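{- Let $n\geq 1$ be an integer and let $\mathrm{Ch}_n$ be the Jack character defined in the context. Define $F_n\colon \mathbb{Y}\to\mathbb{Q}[A,A^{ -1}]$ by $$F_n(\lambda) := (-1)\sum_{M} \gamma^{\,n+1-|\mathcal{V}(M)|}\,\mathfrak{N}_M(\lambda),$$ where the sum runs over all oriented (bicolored, connected, rooted, unlabeled) maps $M$ with $n$ edges and an arbitrary number of faces, and $|\mathcal{V}(M)|$ is the total number of vertices of $M$. Then $F_n$ is a top-degree part of $\mathrm{Ch}_n$, i.e. $\mathrm{Ch}_n - F_n$ is a polynomial function of degree at most $n$. In the notation of the paper: $\mathrm{Ch}_n^{\mathrm{top}} = (-1)\sum_M \gamma^{n+1-|\mathcal{V}|}\mathfrak{N}_M$.
   Context: $\mathbb{Y}$ is the set of Young diagrams; a box $\square=(x,y)\in\mathbb{N}^2$ of $\lambda$ lies in column $x$ and row $y$ (indices start at $1$). Its $A$-deformed content is $c(\square)=Ax-A^{ -1}y$, and $\gamma:=-A+A^{ -1}$. A function $F\colon\mathbb{Y}\to\mathbb{Q}[A,A^{ -1}]$ is a polynomial function of degree at most $d\in\{0,1,\dots\}$ if there exist polynomials $p_0,\dots,p_{\lfloor d/2\rfloor}$ with $p_k\in\mathbb{Q}[\gamma,c_1,\dots,c_k]$ of degree at most $d-2k$ and symmetric in $c_1,\dots,c_k$ (as a polynomial with coefficients in $\mathbb{Q}[\gamma]$), such that for every $\lambda\in\mathbb{Y}$, $F(\lambda)=\sum_{0\le k\le\lfloor d/2\rfloor}\sum_{\square_1,\dots,\square_k\in\lambda}p_k(\gamma,c_1,\dots,c_k)$,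 where $c_i=c(\square_i)$ and $\gamma=-A+A^{ -1}$ are substituted. The Jack character $\mathrm{Ch}_n$ is the unique polynomial function of degree at most $n+1$ such that $\mathrm{Ch}_n(\lambda)=0$ for every $\lambda$ with $|\lambda|<n$, and the coefficient of $c_1^{n-1}$ in $p_1$ equals $n$. A function $G$ is called a top-degree part $\mathrm{Ch}_n^{\mathrm{top}}$ of $\mathrm{Ch}_n$ if $\mathrm{Ch}_n-G$ is a polynomial function of degree at most $n$ (so $\mathrm{Ch}_n^{\mathrm{top}}$ is defined up to such terms). A map is a graph drawn on a surface (so that the faces are discs). All maps considered are bicolored (bipartite with a specified partition of the vertex set $\mathcal{V}=\mathcal{V}_\circ\sqcup\mathcal{V}_\bullet$ into white and black vertices), connected, rooted (one edge is distinguished) and unlabeled (counted up to isomorphism). A map is oriented if the surface is orientable and equipped with a chosen orientation. An embedding of a map $M$ into $\lambda$ is a pair $(f_1,f_2)$ with $f_1$ mapping white vertices to columns of $\lambda$ and $f_2$ mapping black vertices to rows of $\lambda$, such that for every edge joining a white vertex $w$ and a black vertex $b$, the box $(f_1(w),f_2(b))$ belongs to $\lambda$. Set $\mathfrak{N}_M(\lambda):=A^{|\mathcal{V}_\circ|}(-A)^{ -|\mathcal{V}_\bullet|}\times(\text{number of embeddings of } M \text{ into }\lambda)$. -}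

module Defs where

open import Data.Bool using (Bool; true; false; _∧_; _∨_; not; if_then_else_)
open import Data.Nat as ℕ using (ℕ; zero; suc; _∸_; _≤ᵇ_; _≡ᵇ_; ⌊_/2⌋)
open import Data.Integer using (+_)
open import Data.Fin as Fin using (Fin; toℕ)
open import Data.Fin.Permutation using (Permutation′; _⟨$⟩ʳ_)
open import Data.List as List using (List; []; _∷_; _++_; map; foldr; filterᵇ; concatMap; upTo; length; cartesianProduct; allFin)
open import Data.List.Relation.Unary.All using (All)
open import Data.List.Relation.Unary.Linked using (Linked)
open import Data.Vec as Vec using (Vec; []; _∷_; lookup; tabulate)
open import Data.Product using (Σ; _×_; _,_)
open import Data.Rational as ℚ using (ℚ; 0ℚ; 1ℚ; NonZero; 1/_)
open import Relation.Binary.PropositionalEquality using (_≡_)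
open import Data.Nat.ListAction using () renaming (sum to ListSum)
open import Data.Bool.ListAction using (and; or)

infixr 8 _^_
_^_ : ℚ → ℕ → ℚ
x ^ zero  = 1ℚ
x ^ suc k = x ℚ.* (x ^ k)

fromℕ : ℕ → ℚ
fromℕ n = + n ℚ./ 1

sumℚ : List ℚ → ℚ
sumℚ = foldr ℚ._+_ 0ℚ

sumUpTo : ℕ → (ℕ → ℚ) → ℚ
sumUpTo K f = sumℚ (map f (upTo (suc K)))

count : {X : Set} → (X → Bool) → List X → ℕ
count p xs = length (filterᵇ p xs)

-- Young diagrams: list of row lengths λ_1 ≥ λ_2 ≥ … ≥ λ_ℓ ≥ 1.
-- Box (x , y) : column x, row y (1-based); (x,y) ∈ λ iff 1 ≤ x ≤ λ_y.

record YD : Set where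
  field
    rows : List ℕ
    decr : Linked ℕ._≥_ rows
    pos  : All (λ r → 1 ℕ.≤ r) rows
open YD public

range1 : ℕ → List ℕ
range1 r = map suc (upTo r)

boxesFrom : ℕ → List ℕ → List (ℕ × ℕ)
boxesFrom y []       = []
boxesFrom y (r ∷ rs) = map (λ x → (x , y)) (range1 r) ++ boxesFrom (suc y) rs

boxes : YD → List (ℕ × ℕ)
boxes λ' = boxesFrom 1 (rows λ')

size : YD → ℕ
size λ' = ListSum (rows λ')

rowLen : List ℕ → ℕ → ℕ
rowLen []       _             = 0
rowLen (r ∷ rs) zero          = 0
rowLen (r ∷ rs) (suc zero)    = r
rowLen (r ∷ rs) (suc (suc y)) = rowLen rs (suc y)

inYDᵇ : YD → ℕ → ℕ → Bool
inYDᵇ λ' x y = (1 ≤ᵇ x) ∧ (x ≤ᵇ rowLen (rows λ') y)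

columnsOf : YD → List ℕ
columnsOf λ' = range1 (rowLen (rows λ') 1)

rowsOf : YD → List ℕ
rowsOf λ' = range1 (length (rows λ'))

tuples : {X : Set} → (k : ℕ) → List X → List (Vec X k)
tuples zero    xs = [] ∷ []
tuples (suc k) xs = concatMap (λ x → map (x ∷_) (tuples k xs)) xs

-- Functions 𝕐 → ℚ[A,A⁻¹], represented by their evaluations at all
-- nonzero rationals A (a Laurent polynomial over ℚ is determined by them).

LFun : Set
LFun = (A : ℚ) → NonZero A → YD → ℚ

γ : (A : ℚ) → NonZero A → ℚ
γ A nz = ℚ.- A ℚ.+ (1/_ A {{nz}})

content : (A : ℚ) → NonZero A → ℕ × ℕ → ℚ
content A nz (x , y) = A ℚ.* fromℕ x ℚ.- (1/_ A {{nz}}) ℚ.* fromℕ y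

-- Polynomials in ℚ[γ, c_1, …, c_k]: finite lists of monomials
-- coeff · γ^gexp · c_1^{e_1} ⋯ c_k^{e_k}.

record Mono (k : ℕ) : Set where
  field
    coeff : ℚ
    gexp  : ℕ
    cexp  : Vec ℕ k
open Mono public

Poly : ℕ → Set
Poly k = List (Mono k)

evalMono : {k : ℕ} → ℚ → Vec ℚ k → Mono k → ℚ
evalMono g cs m =
  coeff m ℚ.* (g ^ gexp m) ℚ.* Vec.foldr _ ℚ._*_ 1ℚ (Vec.zipWith _^_ cs (cexp m))

evalPoly : {k : ℕ} → Poly k → ℚ → Vec ℚ k → ℚ
evalPoly p g cs = sumℚ (map (evalMono g cs) p)

degMono : {k : ℕ} → Mono k → ℕ
degMono m = gexp m ℕ.+ Vec.sum (cexp m)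

DegLe : {k : ℕ} → ℕ → Poly k → Set
DegLe D p = All (λ m → degMono m ℕ.≤ D) p

-- symmetric in c_1..c_k (as a polynomial over ℚ[γ]; tested by evaluation,
-- which is equivalent over the infinite field ℚ)
Symmetric : {k : ℕ} → Poly k → Set
Symmetric {k} p = (π : Permutation′ k) (g : ℚ) (cs : Vec ℚ k) →
  evalPoly p g (tabulate (λ i → lookup cs (π ⟨$⟩ʳ i))) ≡ evalPoly p g cs

polyFunValue : ℕ → ((k : ℕ) → Poly k) → LFun
polyFunValue d p A nz λ' =
  sumUpTo ⌊ d /2⌋ (λ k →
    sumℚ (map (λ bs → evalPoly (p k) (γ A nz) (Vec.map (content A nz) bs))
              (tuples k (boxes λ'))))

Admissible : ℕ → ((k : ℕ) → Poly k) → Set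
Admissible d p = (k : ℕ) → k ℕ.≤ ⌊ d /2⌋ →
  DegLe (d ∸ (2 ℕ.* k)) (p k) × Symmetric (p k)

IsPolyFun : ℕ → LFun → Set
IsPolyFun d F = Σ ((k : ℕ) → Poly k) λ p →
  Admissible d p × ((A : ℚ) (nz : NonZero A) (λ' : YD) → F A nz λ' ≡ polyFunValue d p A nz λ')

coeffC1 : Poly 1 → ℕ → ℚ → ℚ
coeffC1 p e g = sumℚ (map (λ m → coeff m ℚ.* (g ^ gexp m))
                          (filterᵇ (λ m → lookup (cexp m) Fin.zero ≡ᵇ e) p))

IsJackChar : ℕ → LFun → Set
IsJackChar n Ch = Σ ((k : ℕ) → Poly k) λ p →
  Admissible (suc n) p
  × ((A : ℚ) (nz : NonZero A) (λ' : YD) → Ch A nz λ' ≡ polyFunValue (suc n) p A nz λ')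
  × ((g : ℚ) → coeffC1 (p 1) (n ∸ 1) g ≡ fromℕ n)
  × ((A : ℚ) (nz : NonZero A) (λ' : YD) → size λ' ℕ.< n → Ch A nz λ' ≡ 0ℚ)

-- Oriented bicolored maps with N edges, edges labelled by Fin N:
-- a pair (σ∘ , σ•) of permutations of the edges (rotation around white,
-- resp. black vertices).  Permutations are stored as vectors.

PermV : ℕ → Set
PermV N = Vec (Fin N) N

_==ᶠ_ : {N : ℕ} → Fin N → Fin N → Bool
i ==ᶠ j = toℕ i ≡ᵇ toℕ j

allᶠ : {N : ℕ} → (Fin N → Bool) → Bool
allᶠ {N} p = and (map p (allFin N))

anyᶠ : {N : ℕ} → (Fin N → Bool) → Bool
anyᶠ {N} p = or (map p (allFin N))

allVecs : {X : Set} → (k : ℕ) → List X → List (Vec X k)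
allVecs = tuples

isPerm : {N : ℕ} → PermV N → Bool
isPerm s = allᶠ (λ i → allᶠ (λ j → (i ==ᶠ j) ∨ not (lookup s i ==ᶠ lookup s j)))

perms : (N : ℕ) → List (PermV N)
perms N = filterᵇ isPerm (allVecs N (allFin N))

invV : {N : ℕ} → PermV N → PermV N
invV {N} s = tabulate (λ j → firstPre j (allFin N) j)
  where
  firstPre : Fin N → List (Fin N) → Fin N → Fin N
  firstPre j []       d = d
  firstPre j (i ∷ is) d = if lookup s i ==ᶠ j then i else firstPre j is d

iter : {N : ℕ} → PermV N → ℕ → Fin N → Fin N
iter s zero    i = i
iter s (suc k) i = lookup s (iter s k i)

-- connectedness: the group ⟨σ∘, σ•⟩ acts transitively
reachStep : {N : ℕ} → PermV N → PermV N → Vec Bool N → Vec Bool N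
reachStep s t S = tabulate (λ j → lookup S j ∨
  anyᶠ (λ i → lookup S i ∧ ((lookup s i ==ᶠ j) ∨ (lookup t i ==ᶠ j))))

reachIter : {N : ℕ} → ℕ → PermV N → PermV N → Vec Bool N → Vec Bool N
reachIter zero    s t S = S
reachIter (suc k) s t S = reachIter k s t (reachStep s t S)

transitiveᵇ : {N : ℕ} → PermV (suc N) → PermV (suc N) → Bool
transitiveᵇ {N} s t =
  Vec.foldr _ _∧_ true (reachIter (suc N) s t (tabulate (λ j → j ==ᶠ Fin.zero)))

isCycleMin : {N : ℕ} → PermV N → Fin N → Bool
isCycleMin {N} s i = and (map (λ k → toℕ i ≤ᵇ toℕ (iter s k i)) (upTo N))

cycles : {N : ℕ} → PermV N → ℕ
cycles {N} s = count (isCycleMin s) (allFin N)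

conj : {N : ℕ} → PermV N → PermV N → PermV N
conj τ s = tabulate (λ j → lookup τ (lookup s (lookup (invV τ) j)))

lexLeq : {N k : ℕ} → Vec (Fin N) k → Vec (Fin N) k → Bool
lexLeq []       []       = true
lexLeq (a ∷ as) (b ∷ bs) =
  if a ==ᶠ b then lexLeq as bs else (toℕ a ≤ᵇ toℕ b)

-- rooted maps (root = edge 0) up to isomorphism, i.e. up to relabellings τ
-- with τ(0) = 0: each class represented by its lexicographically least member
isCanonical : {N : ℕ} → PermV (suc N) → PermV (suc N) → Bool
isCanonical {N} s t = and (map
  (λ τ → not (lookup τ Fin.zero ==ᶠ Fin.zero) ∨
         lexLeq (s Vec.++ t) (conj τ s Vec.++ conj τ t))
  (perms (suc N)))

rootedMaps : (N : ℕ) → List (PermV (suc N) × PermV (suc N))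
rootedMaps N = filterᵇ (λ { (s , t) → transitiveᵇ s t ∧ isCanonical s t })
                       (cartesianProduct (perms (suc N)) (perms (suc N)))

-- number of embeddings of M = (σ∘, σ•) into λ: a map from white vertices to
-- columns is a map on edges constant on the cycles of σ∘ (each vertex is
-- the cycle of its incident edges); likewise black vertices → rows.
embeddings : {N : ℕ} → PermV N → PermV N → YD → ℕ
embeddings {N} s t λ' =
  count (λ { (f₁ , f₂) → allᶠ (λ i →
            (lookup f₁ (lookup s i) ≡ᵇ lookup f₁ i)
          ∧ (lookup f₂ (lookup t i) ≡ᵇ lookup f₂ i)
          ∧ inYDᵇ λ' (lookup f₁ i) (lookup f₂ i)) })
        (cartesianProduct (allVecs N (columnsOf λ')) (allVecs N (rowsOf λ')))

-- 𝔑_M(λ) = A^{|V∘|} (−A)^{−|V•|} · #embeddings,  with (−A)^{−b} = (−1)^b (A⁻¹)^b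
𝔑 : {N : ℕ} → PermV N → PermV N → LFun
𝔑 s t A nz λ' =
  (A ^ cycles s) ℚ.* ((ℚ.- 1ℚ) ^ cycles t) ℚ.* ((1/_ A {{nz}}) ^ cycles t)
  ℚ.* fromℕ (embeddings s t λ')

-- F_n(λ) = (−1) Σ_M γ^{n+1−|V(M)|} 𝔑_M(λ)   (n ≥ 1; F_0 := 0 is unused)
Fn : ℕ → LFun
Fn zero    A nz λ' = 0ℚ
Fn (suc N) A nz λ' = ℚ.- sumℚ (map
  (λ { (s , t) → (γ A nz ^ (suc (suc N) ∸ (cycles s ℕ.+ cycles t))) ℚ.* 𝔑 s t A nz λ' })
  (rootedMaps N))

{-# OPTIONS --safe #-}
-- Labelling the edges turns F_n into a sum over pairs of permutations generating a transitive group. By the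
-- exponential formula it is the logarithmic derivative of the series Z in which all pairs, connected or not, are
-- counted. Adding a first column to the diagram acts on Z by an explicit operator C; commuting C past the shift L
-- gives Π (1 − ω G_c G_{c−γ}) L Z = Z, the product being over the boxes, with c the content and ω = 1. Solving for
-- F_n expresses it by one universal polynomial, homogeneous of degree n + 1 in γ and the power sums Σ ω^{m+1} c^e
-- of degree e + 2(m + 1).
--
-- The difference of Ch_n and F_n thus has degree n + 1, and its monomials of top degree must cancel. Give the rows
-- independent infinitesimal heights w_1, …, w_k with w_i² = 0: this is a limit of rescaled diagrams which keeps only
-- the top degree. The coefficient of w_1⋯w_k is a permanent in the row lengths; it vanishes for fewer than n boxes,
-- for Ch_n by hypothesis and for F_n because Z terminates. A polynomial of the degree in question vanishing at all
-- these points is zero, except that for k = 1 one point is missing; there both coefficients equal n!.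
module Submission where

open import Defs hiding (γ)
open import Algebra.Bundles using (CommutativeRing; RawRing)
open import Algebra.Structures using (IsCommutativeRing)
import Algebra.Solver.Ring as RingSolver
import Algebra.Solver.Ring.AlmostCommutativeRing as ACR
open import Data.Bool using (Bool; true; false; _∧_; _∨_; not; if_then_else_)
open import Data.Bool.ListAction using (and; or)
import Data.Bool.Properties as Boolₚ
open import Data.Empty using (⊥; ⊥-elim)
open import Data.Fin as Fin using (Fin; toℕ)
open import Data.Fin.Permutation as FinPerm using (Permutation′)
import Data.Fin.Properties as Finₚ
open import Data.Integer as ℤ using (ℤ)
import Data.Integer.Properties as ℤₚ
open import Data.List as List using (List; []; _∷_; _++_; map; foldr; filterᵇ; upTo; length; allFin; concatMap; null; cartesianProduct)
import Data.List.Extrema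
import Data.List.Membership.DecPropositional as DecMem
open import Data.List.Membership.Propositional using (_∈_; _∉_)
import Data.List.Membership.Propositional.Properties as ∈ₚ
open import Data.List.Membership.Propositional.Properties.WithK using (unique∧set⇒bag)
import Data.List.Properties as Listₚ
open import Data.List.Relation.Binary.BagAndSetEquality using (∼bag⇒↭)
open import Data.List.Relation.Binary.Permutation.Propositional as ↭ using (_↭_)
import Data.List.Relation.Binary.Permutation.Propositional.Properties as ↭ₚ
open import Data.List.Relation.Unary.All as All using (All; []; _∷_)
import Data.List.Relation.Unary.All.Properties as Allₚ
open import Data.List.Relation.Unary.AllPairs using ([]; _∷_)
open import Data.List.Relation.Unary.Any using (Any; here; there)
open import Data.List.Relation.Unary.Linked as Linked using (Linked; []; [-]; _∷_)
open import Data.List.Relation.Unary.Unique.Propositional using (Unique)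
import Data.List.Relation.Unary.Unique.Propositional.Properties as Uniqueₚ
import Data.List.Sort
open import Data.Maybe using (Maybe; just; nothing)
open import Data.Nat as ℕ using (ℕ; zero; suc; z≤n; s≤s; _≤_; _≤ᵇ_; _≡ᵇ_; _∸_; ⌊_/2⌋)
open import Data.Nat.ListAction using () renaming (sum to ListSum)
open import Data.Nat.ListAction.Properties using (sum-↭)
open import Data.Nat.Properties as ℕₚ using (0∸n≡0; <-trans; <⇒≢; <⇒≱; m+n∸m≡n; m+n≤o⇒m≤o∸n; m∸n+n≡m; m≤m+n; m≤n+m; m≤n+m∸n; m≤n+o⇒m∸n≤o; m≤n⇒m≤1+n; m≤n⇒∃[o]m+o≡n; n<1+n; n∸n≡0; n≤1+n; suc-injective; ∸-monoˡ-≤; ≤-<-trans; ≤-pred; ≤-refl; ≤-reflexive; ≤-total; ≤-trans; ≤∧≢⇒<)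
open import Data.Nat.Tactic.RingSolver using (solve-∀)
open import Data.Product using (Σ; ∃; _×_; _,_; proj₁; proj₂)
open import Data.Rational as ℚ using (ℚ; 0ℚ; 1ℚ; NonZero; 1/_; _-_)
import Data.Rational.Properties as ℚₚ
import Data.Rational.Unnormalised as ℚᵘ
import Data.Rational.Unnormalised.Properties as ℚᵘₚ
open import Data.Sum using (_⊎_; inj₁; inj₂)
open import Data.Unit using (⊤; tt)
open import Data.Vec as Vec using (Vec; []; _∷_; lookup; tabulate)
import Data.Vec.Properties as Vecₚ
open import Function using (id; _∘_; mk⇔)
open import Level using (0ℓ)
import Relation.Binary.Construct.Flip.EqAndOrd as Flip
open import Relation.Binary.PropositionalEquality
open import Relation.Nullary using (yes; no)

-- With ζⁿ read as 1/((κ+g)⋯(κ+ng)), Gauss's summation of the hypergeometric series at 1 says that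
-- adding a column is the substitution κ ↦ κ - A followed by multiplication by a quotient Φ of Gamma
-- functions. Only Φ(κ)/Φ(κ+g) is ever used, and it is rational; this is why the shift by g enters,
-- and why the factors of the boxes can multiply up to it. The obstacle is that F_n need not vanish
-- on diagrams with fewer than n boxes (for n = 3 its value at a single box is -1), so the
-- characterisation of Ch_n does not apply to it; only its top degree can be tested, in a
-- degeneration where F_n has no combinatorial meaning. The recursion is therefore proved over any
-- ℚ-algebra, for row heights B with B(A+B+g) = 0. This relation holds for B = -1/A and g = γ, and,
-- with A = 1 and g = -1, for every B of square zero. The weights ω = -AB, equal to 1 for true
-- diagrams, stay variables of degree 2: they make the universal polynomial homogeneous, so that one
-- polynomial serves both situations.

infixr 8 _∙_
_∙_ : {X : Set} {x y z : X} → x ≡ y → y ≡ z → x ≡ z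
_∙_ = trans

-- Algebras over the rationals and a ring solver for them

opaque
  ratℕ : ℕ → ℚ
  ratℕ = fromℕ

  ratℕ-def : ∀ n → ratℕ n ≡ fromℕ n
  ratℕ-def n = refl

record Alg : Set₁ where
  infixl 6 _+_
  infixl 7 _*_
  infix 8 -_
  field
    Carrier : Set
    _+_ _*_ : Carrier → Carrier → Carrier
    -_ : Carrier → Carrier
    0# 1# : Carrier
    isCommutativeRing : IsCommutativeRing _≡_ _+_ _*_ -_ 0# 1#
    ι : ℚ → Carrier
    ι-+ : ∀ p q → ι (p ℚ.+ q) ≡ ι p + ι q
    ι-* : ∀ p q → ι (p ℚ.* q) ≡ ι p * ι q
    ι-neg : ∀ p → ι (ℚ.- p) ≡ - ι p
    ι-0 : ι 0ℚ ≡ 0#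
    ι-1 : ι 1ℚ ≡ 1#
  open IsCommutativeRing isCommutativeRing public
    using (+-assoc; +-comm; *-assoc; *-comm; +-identityˡ; +-identityʳ;
           *-identityˡ; *-identityʳ; zeroˡ; zeroʳ; distribˡ; distribʳ; -‿inverseˡ; -‿inverseʳ)
  commutativeRing : CommutativeRing 0ℓ 0ℓ
  commutativeRing = record { isCommutativeRing = isCommutativeRing }
  nat : ℕ → Carrier
  nat n = ι (ratℕ n)
  infixr 8 _^#_
  _^#_ : Carrier → ℕ → Carrier
  x ^# zero = 1#
  x ^# suc n = x * (x ^# n)

fromℤ : ℤ → ℚ
fromℤ i = i ℚ./ 1

toℚᵘ-fromℤ : ∀ i → ℚ.toℚᵘ (fromℤ i) ℚᵘ.≃ ℚᵘ.mkℚᵘ i 0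
toℚᵘ-fromℤ i = ℚₚ.toℚᵘ-fromℚᵘ (ℚᵘ.mkℚᵘ i 0)

fromℤ-+ : ∀ i j → fromℤ (i ℤ.+ j) ≡ fromℤ i ℚ.+ fromℤ j
fromℤ-+ i j = ℚₚ.toℚᵘ-injective (begin
  ℚ.toℚᵘ (fromℤ (i ℤ.+ j)) ≈⟨ toℚᵘ-fromℤ (i ℤ.+ j) ⟩
  ℚᵘ.mkℚᵘ (i ℤ.+ j) 0 ≈⟨ ℚᵘ.*≡* (cong (ℤ._* (ℤ.+ 1)) (cong₂ ℤ._+_ (sym (ℤₚ.*-identityʳ i)) (sym (ℤₚ.*-identityʳ j)))) ⟩
  ℚᵘ.mkℚᵘ i 0 ℚᵘ.+ ℚᵘ.mkℚᵘ j 0 ≈⟨ ℚᵘₚ.+-cong (ℚᵘₚ.≃-sym (toℚᵘ-fromℤ i)) (ℚᵘₚ.≃-sym (toℚᵘ-fromℤ j)) ⟩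
  ℚ.toℚᵘ (fromℤ i) ℚᵘ.+ ℚ.toℚᵘ (fromℤ j) ≈⟨ ℚᵘₚ.≃-sym (ℚₚ.toℚᵘ-homo-+ (fromℤ i) (fromℤ j)) ⟩
  ℚ.toℚᵘ (fromℤ i ℚ.+ fromℤ j) ∎)
  where open ℚᵘₚ.≃-Reasoning

fromℤ-* : ∀ i j → fromℤ (i ℤ.* j) ≡ fromℤ i ℚ.* fromℤ j
fromℤ-* i j = ℚₚ.toℚᵘ-injective (begin
  ℚ.toℚᵘ (fromℤ (i ℤ.* j)) ≈⟨ toℚᵘ-fromℤ (i ℤ.* j) ⟩
  ℚᵘ.mkℚᵘ i 0 ℚᵘ.* ℚᵘ.mkℚᵘ j 0 ≈⟨ ℚᵘₚ.*-cong (ℚᵘₚ.≃-sym (toℚᵘ-fromℤ i)) (ℚᵘₚ.≃-sym (toℚᵘ-fromℤ j)) ⟩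
  ℚ.toℚᵘ (fromℤ i) ℚᵘ.* ℚ.toℚᵘ (fromℤ j) ≈⟨ ℚᵘₚ.≃-sym (ℚₚ.toℚᵘ-homo-* (fromℤ i) (fromℤ j)) ⟩
  ℚ.toℚᵘ (fromℤ i ℚ.* fromℤ j) ∎)
  where open ℚᵘₚ.≃-Reasoning

fromℤ-neg : ∀ i → fromℤ (ℤ.- i) ≡ ℚ.- fromℤ i
fromℤ-neg i = ℚₚ.toℚᵘ-injective (begin
  ℚ.toℚᵘ (fromℤ (ℤ.- i)) ≈⟨ toℚᵘ-fromℤ (ℤ.- i) ⟩
  ℚᵘ.- (ℚᵘ.mkℚᵘ i 0) ≈⟨ ℚᵘₚ.-‿cong (ℚᵘₚ.≃-sym (toℚᵘ-fromℤ i)) ⟩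
  ℚᵘ.- ℚ.toℚᵘ (fromℤ i) ≈⟨ ℚᵘₚ.≃-sym (ℚₚ.toℚᵘ-homo‿- (fromℤ i)) ⟩
  ℚ.toℚᵘ (ℚ.- fromℤ i) ∎)
  where open ℚᵘₚ.≃-Reasoning

opaque
  unfolding ratℕ

  ratℕ-0 : ratℕ 0 ≡ 0ℚ
  ratℕ-0 = refl

  ratℕ-suc : ∀ n → ratℕ (suc n) ≡ 1ℚ ℚ.+ ratℕ n
  ratℕ-suc n = fromℤ-+ (ℤ.+ 1) (ℤ.+ n)

  ratℕ-+ : ∀ m n → ratℕ (m ℕ.+ n) ≡ ratℕ m ℚ.+ ratℕ n
  ratℕ-+ m n = fromℤ-+ (ℤ.+ m) (ℤ.+ n)

  ratℕ-* : ∀ m n → ratℕ (m ℕ.* n) ≡ ratℕ m ℚ.* ratℕ n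
  ratℕ-* m n = cong fromℤ (ℤₚ.pos-* m n) ∙ fromℤ-* (ℤ.+ m) (ℤ.+ n)

  ratℕ-suc≢0 : ∀ n → ratℕ (suc n) ≢ 0ℚ
  ratℕ-suc≢0 n e with ℚᵘₚ.≃-trans (ℚᵘₚ.≃-sym (toℚᵘ-fromℤ (ℤ.+ suc n))) (ℚᵘₚ.≃-reflexive (cong ℚ.toℚᵘ e))
  ... | ℚᵘ.*≡* ()

-- The index is shifted to stay away from zero: `1/ℕ n` is the inverse of n + 1.
1/ℕ : ℕ → ℚ
1/ℕ n = 1/_ (ratℕ (suc n)) {{ℚ.≢-nonZero (ratℕ-suc≢0 n)}}

1/ℕ-inverse : ∀ n → 1/ℕ n ℚ.* ratℕ (suc n) ≡ 1ℚ
1/ℕ-inverse n = ℚₚ.*-inverseˡ (ratℕ (suc n)) {{ℚ.≢-nonZero (ratℕ-suc≢0 n)}}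

module Solver (R : Alg) where
  open Alg R
  private
    acr : ACR.AlmostCommutativeRing 0ℓ 0ℓ
    acr = ACR.fromCommutativeRing commutativeRing
    ℤraw : RawRing 0ℓ 0ℓ
    ℤraw = CommutativeRing.rawRing ℤₚ.+-*-commutativeRing
    -- 0 and 1 go to the ring's own constants and not through `ι`, so that solved identities mention
    -- `0#` and `1#` literally.
    ⟦_⟧ℤ : ℤ → Carrier
    ⟦ ℤ.+ zero ⟧ℤ = 0#
    ⟦ ℤ.+ suc zero ⟧ℤ = 1#
    ⟦ i ⟧ℤ = ι (fromℤ i)
    ⟦⟧ℤ≡ : ∀ i → ⟦ i ⟧ℤ ≡ ι (fromℤ i)
    ⟦⟧ℤ≡ (ℤ.+ zero) = sym ι-0
    ⟦⟧ℤ≡ (ℤ.+ suc zero) = sym ι-1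
    ⟦⟧ℤ≡ (ℤ.+ suc (suc n)) = refl
    ⟦⟧ℤ≡ (ℤ.-[1+ n ]) = refl
    morphism : ℤraw ACR.-Raw-AlmostCommutative⟶ acr
    morphism = record
      { ⟦_⟧ = ⟦_⟧ℤ
      ; +-homo = λ i j → ⟦⟧ℤ≡ (i ℤ.+ j) ∙ cong ι (fromℤ-+ i j) ∙ ι-+ _ _ ∙ cong₂ _+_ (sym (⟦⟧ℤ≡ i)) (sym (⟦⟧ℤ≡ j))
      ; *-homo = λ i j → ⟦⟧ℤ≡ (i ℤ.* j) ∙ cong ι (fromℤ-* i j) ∙ ι-* _ _ ∙ cong₂ _*_ (sym (⟦⟧ℤ≡ i)) (sym (⟦⟧ℤ≡ j))
      ; -‿homo = λ i → ⟦⟧ℤ≡ (ℤ.- i) ∙ cong ι (fromℤ-neg i) ∙ ι-neg _ ∙ (cong -_ (sym (⟦⟧ℤ≡ i)))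
      ; 0-homo = refl
      ; 1-homo = refl }
    dec : ∀ i j → Maybe (⟦ i ⟧ℤ ≡ ⟦ j ⟧ℤ)
    dec i j with i ℤ.≟ j
    ... | yes p = just (cong ⟦_⟧ℤ p)
    ... | no _ = nothing
  open RingSolver ℤraw acr morphism dec public
    using (solve; _:=_; _:+_; _:*_; :-_; con; Polynomial)
  :0 :1 : ∀ {n} → Polynomial n
  :0 = con (ℤ.+ 0)
  :1 = con (ℤ.+ 1)

module Ring (R : Alg) where
  open Alg R public
  open Solver R public

ℚAlg : Alg
ℚAlg = record
  { Carrier = ℚ ; _+_ = ℚ._+_ ; _*_ = ℚ._*_ ; -_ = ℚ.-_ ; 0# = 0ℚ ; 1# = 1ℚ
  ; isCommutativeRing = ℚₚ.+-*-isCommutativeRing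
  ; ι = λ q → q ; ι-+ = λ _ _ → refl ; ι-* = λ _ _ → refl ; ι-neg = λ _ → refl ; ι-0 = refl ; ι-1 = refl }

-- Adjoining variables w with w² = ηw

module Dual (R : Alg) (η : ℚ) where
  open Alg R
  open Solver R
  -- The pair (u , v) stands for u + vw in R[w]/(w² - ηw). For η ≠ 0 this ring splits into two
  -- copies of R by w ↦ 0 and w ↦ η; for η = 0 it is the ring of dual numbers. One family thus joins
  -- a choice between presence and absence to its infinitesimal limit.
  DC : Set
  DC = Carrier × Carrier
  _+ᵈ_ _*ᵈ_ : DC → DC → DC
  (u , v) +ᵈ (u' , v') = (u + u' , v + v')
  (u , v) *ᵈ (u' , v') = (u * u' , u * v' + v * u' + ι η * (v * v'))
  -ᵈ_ : DC → DC
  -ᵈ (u , v) = (- u , - v)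
  ιᵈ : Carrier → DC
  ιᵈ x = (x , 0#)

  isCR : IsCommutativeRing _≡_ _+ᵈ_ _*ᵈ_ -ᵈ_ (0# , 0#) (1# , 0#)
  isCR = record { isRing = record
    { +-isAbelianGroup = record
      { isGroup = record
        { isMonoid = record
          { isSemigroup = record
            { isMagma = record { isEquivalence = isEquivalence ; ∙-cong = cong₂ _+ᵈ_ }
            ; assoc = λ a b c → cong₂ _,_ (+-assoc _ _ _) (+-assoc _ _ _) }
          ; identity = (λ a → cong₂ _,_ (+-identityˡ _) (+-identityˡ _)) , (λ a → cong₂ _,_ (+-identityʳ _) (+-identityʳ _)) }
        ; inverse = (λ a → cong₂ _,_ (-‿inverseˡ _) (-‿inverseˡ _)) , (λ a → cong₂ _,_ (-‿inverseʳ _) (-‿inverseʳ _))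
        ; ⁻¹-cong = cong -ᵈ_ }
      ; comm = λ a b → cong₂ _,_ (+-comm _ _) (+-comm _ _) }
    ; *-cong = cong₂ _*ᵈ_
    ; *-assoc = λ { (a , a') (b , b') (c , c') → cong₂ _,_ (*-assoc _ _ _)
        (solve 7 (λ e a a' b b' c c' → (a :* b) :* c' :+ (a :* b' :+ a' :* b :+ e :* (a' :* b')) :* c :+ e :* ((a :* b' :+ a' :* b :+ e :* (a' :* b')) :* c')
            := a :* (b :* c' :+ b' :* c :+ e :* (b' :* c')) :+ a' :* (b :* c) :+ e :* (a' :* (b :* c' :+ b' :* c :+ e :* (b' :* c')))) refl (ι η) a a' b b' c c') }
    ; *-identity = (λ { (a , a') → cong₂ _,_ (*-identityˡ _)
        (solve 3 (λ e a a' → :1 :* a' :+ :0 :* a :+ e :* (:0 :* a') := a') refl (ι η) a a') })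
      , (λ { (a , a') → cong₂ _,_ (*-identityʳ _)
        (solve 3 (λ e a a' → a :* :0 :+ a' :* :1 :+ e :* (a' :* :0) := a') refl (ι η) a a') })
    ; distrib = (λ { (a , a') (b , b') (c , c') → cong₂ _,_ (distribˡ _ _ _)
        (solve 7 (λ e a a' b b' c c' → a :* (b' :+ c') :+ a' :* (b :+ c) :+ e :* (a' :* (b' :+ c')) := a :* b' :+ a' :* b :+ e :* (a' :* b') :+ (a :* c' :+ a' :* c :+ e :* (a' :* c'))) refl (ι η) a a' b b' c c') })
      , (λ { (a , a') (b , b') (c , c') → cong₂ _,_ (distribʳ _ _ _)
        (solve 7 (λ e a a' b b' c c' → (b :+ c) :* a' :+ (b' :+ c') :* a :+ e :* ((b' :+ c') :* a') := b :* a' :+ b' :* a :+ e :* (b' :* a') :+ (c :* a' :+ c' :* a :+ e :* (c' :* a'))) refl (ι η) a a' b b' c c') }) }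
    ; *-comm = λ { (a , a') (b , b') → cong₂ _,_ (*-comm _ _)
        (solve 5 (λ e a a' b b' → a :* b' :+ a' :* b :+ e :* (a' :* b') := b :* a' :+ b' :* a :+ e :* (b' :* a')) refl (ι η) a a' b b') } }

  dual : Alg
  dual = record
    { Carrier = DC ; _+_ = _+ᵈ_ ; _*_ = _*ᵈ_ ; -_ = -ᵈ_ ; 0# = (0# , 0#) ; 1# = (1# , 0#)
    ; isCommutativeRing = isCR
    ; ι = λ q → ιᵈ (ι q)
    ; ι-+ = λ p q → cong₂ _,_ (ι-+ p q) (sym (+-identityʳ _))
    ; ι-* = λ p q → cong₂ _,_ (ι-* p q) (solve 3 (λ e a b → :0 := a :* :0 :+ :0 :* b :+ e :* (:0 :* :0)) refl (ι η) (ι p) (ι q))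
    ; ι-neg = λ p → cong₂ _,_ (ι-neg p) (solve 0 (:0 := :- :0) refl)
    ; ι-0 = cong₂ _,_ ι-0 refl
    ; ι-1 = cong₂ _,_ ι-1 refl }

Λ : ℚ → ℕ → Alg
Λ η zero = ℚAlg
Λ η (suc k) = Dual.dual (Λ η k) η

-- Formal power series as coefficient sequences

module Series (R : Alg) where
  open Ring R

  nat-suc : ∀ n → nat (suc n) ≡ 1# + nat n
  nat-suc n = cong ι (ratℕ-suc n) ∙ ι-+ _ _ ∙ cong (_+ nat n) ι-1

  nat-0 : nat 0 ≡ 0#
  nat-0 = cong ι ratℕ-0 ∙ ι-0

  nat-+ : ∀ m n → nat (m ℕ.+ n) ≡ nat m + nat n
  nat-+ m n = cong ι (ratℕ-+ m n) ∙ ι-+ _ _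

  Seq : Set
  Seq = ℕ → Carrier

  tail sh deriv : Seq → Seq
  tail f n = f (suc n)
  sh f zero = 0#
  sh f (suc n) = f n
  deriv f n = nat n * f n

  δ : Seq
  δ zero = 1#
  δ (suc n) = 0#

  -- Antidiagonal sums of an arbitrary t and not only of products, because the column operator is
  -- not a convolution.
  dsum : (ℕ → ℕ → Carrier) → Seq
  dsum t zero = t 0 0
  dsum t (suc n) = t 0 (suc n) + dsum (λ i j → t (suc i) j) n

  dsum-cong′ : ∀ {t t'} n → (∀ i j → i ℕ.+ j ≡ n → t i j ≡ t' i j) → dsum t n ≡ dsum t' n
  dsum-cong′ zero h = h 0 0 refl
  dsum-cong′ (suc n) h = cong₂ _+_ (h 0 (suc n) refl) (dsum-cong′ n (λ i j e → h (suc i) j (cong suc e)))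

  dsum-cong : ∀ {t t'} → (∀ i j → t i j ≡ t' i j) → ∀ n → dsum t n ≡ dsum t' n
  dsum-cong h n = dsum-cong′ n (λ i j _ → h i j)

  dsum-+ : ∀ t t' n → dsum (λ i j → t i j + t' i j) n ≡ dsum t n + dsum t' n
  dsum-+ t t' zero = refl
  dsum-+ t t' (suc n) = cong (t 0 (suc n) + t' 0 (suc n) +_) (dsum-+ _ _ n) ∙
    solve 4 (λ a b c d → (a :+ b) :+ (c :+ d) := (a :+ c) :+ (b :+ d)) refl _ _ _ _

  dsum-* : ∀ c t n → dsum (λ i j → c * t i j) n ≡ c * dsum t n
  dsum-* c t zero = refl
  dsum-* c t (suc n) = cong (c * t 0 (suc n) +_) (dsum-* c _ n) ∙ sym (distribˡ c _ _)

  dsum-weight : ∀ (w : Seq) t n → dsum (λ i j → w (i ℕ.+ j) * t i j) n ≡ w n * dsum t n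
  dsum-weight w t zero = refl
  dsum-weight w t (suc n) = cong (w (suc n) * t 0 (suc n) +_) (dsum-weight (tail w) _ n) ∙ sym (distribˡ _ _ _)

  dsum-last : ∀ t n → dsum t (suc n) ≡ dsum (λ i j → t i (suc j)) n + t (suc n) 0
  dsum-last t zero = refl
  dsum-last t (suc n) = cong (t 0 _ +_) (dsum-last (λ i j → t (suc i) j) n) ∙ sym (+-assoc _ _ _)

  dsum-0 : ∀ n → dsum (λ _ _ → 0#) n ≡ 0#
  dsum-0 zero = refl
  dsum-0 (suc n) = +-identityˡ _ ∙ dsum-0 n

  conv : Seq → Seq → Seq
  conv f h = dsum (λ i j → f i * h j)

  conv-cong : ∀ {f f' h h'} → (∀ n → f n ≡ f' n) → (∀ n → h n ≡ h' n) → ∀ n → conv f h n ≡ conv f' h' n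
  conv-cong p q = dsum-cong (λ i j → cong₂ _*_ (p i) (q j))

  conv-+ˡ : ∀ f f' h n → conv (λ m → f m + f' m) h n ≡ conv f h n + conv f' h n
  conv-+ˡ f f' h n = dsum-cong (λ i j → distribʳ _ _ _) n ∙ dsum-+ _ _ n

  conv-+ʳ : ∀ f h h' n → conv f (λ m → h m + h' m) n ≡ conv f h n + conv f h' n
  conv-+ʳ f h h' n = dsum-cong (λ i j → distribˡ _ _ _) n ∙ dsum-+ _ _ n

  conv-*ˡ : ∀ c f h n → conv (λ m → c * f m) h n ≡ c * conv f h n
  conv-*ˡ c f h n = dsum-cong (λ i j → *-assoc _ _ _) n ∙ dsum-* _ _ n

  conv-*ʳ : ∀ c f h n → conv f (λ m → c * h m) n ≡ c * conv f h n
  conv-*ʳ c f h n = dsum-cong (λ i j → solve 3 (λ a b c → a :* (c :* b) := c :* (a :* b)) refl _ _ _) n ∙ dsum-* _ _ n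

  conv-0ˡ : ∀ h n → conv (λ _ → 0#) h n ≡ 0#
  conv-0ˡ h n = dsum-cong (λ _ _ → zeroˡ _) n ∙ dsum-0 n

  conv-shˡ : ∀ f h n → conv (sh f) h n ≡ sh (conv f h) n
  conv-shˡ f h zero = zeroˡ _
  conv-shˡ f h (suc n) = cong (_+ conv f h n) (zeroˡ _) ∙ +-identityˡ _

  conv-comm : ∀ f h n → conv f h n ≡ conv h f n
  conv-comm f h zero = *-comm _ _
  conv-comm f h (suc n) = cong₂ _+_ (*-comm _ _) (conv-comm (tail f) h n) ∙ +-comm _ _ ∙ sym (dsum-last (λ i j → h i * f j) n)

  conv-shʳ : ∀ f h n → conv f (sh h) n ≡ sh (conv f h) n
  conv-shʳ f h n = conv-comm f (sh h) n ∙ conv-shˡ h f n ∙ aux n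
    where aux : ∀ n → sh (conv h f) n ≡ sh (conv f h) n
          aux zero = refl
          aux (suc n) = conv-comm h f n

  conv-δˡ : ∀ h n → conv δ h n ≡ h n
  conv-δˡ h zero = *-identityˡ _
  conv-δˡ h (suc n) = cong₂ _+_ (*-identityˡ _) (conv-0ˡ h n) ∙ +-identityʳ _

  conv-assoc : ∀ f h k n → conv (conv f h) k n ≡ conv f (conv h k) n
  conv-assoc f h k zero = *-assoc _ _ _
  conv-assoc f h k (suc n) = cong (f 0 * h 0 * k (suc n) +_) (conv-+ˡ _ _ k n ∙ cong₂ _+_ (conv-*ˡ (f 0) (tail h) k n) (conv-assoc (tail f) h k n)) ∙ solve 5 (λ a b c d e → a :* b :* c :+ (a :* d :+ e) := a :* (b :* c :+ d) :+ e) refl _ _ _ _ _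

  deriv-dsum : ∀ t n → nat n * dsum t n ≡ dsum (λ i j → nat i * t i j) n + dsum (λ i j → nat j * t i j) n
  deriv-dsum t n = sym (dsum-weight nat t n) ∙ dsum-cong (λ i j → cong (_* t i j) (nat-+ i j) ∙ distribʳ _ _ _) n ∙ dsum-+ _ _ n

  deriv-conv : ∀ f h n → deriv (conv f h) n ≡ conv (deriv f) h n + conv f (deriv h) n
  deriv-conv f h n = deriv-dsum _ n ∙ cong₂ _+_
    (dsum-cong (λ i j → sym (*-assoc _ _ _)) n)
    (dsum-cong (λ i j → solve 3 (λ a b c → c :* (a :* b) := a :* (c :* b)) refl _ _ _) n)

  -- Long division by Z as if `Z 0` were 1: the first coefficient is split off and the remainder is
  -- divided further. No inverse is taken, so it is available over every algebra.
  quot : Seq → Seq → Seq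
  quot P Z zero = P 0
  quot P Z (suc n) = quot (λ m → P (suc m) + - (P 0 * Z (suc m))) Z n

  quot-cong : ∀ {P P'} Z → (∀ n → P n ≡ P' n) → ∀ n → quot P Z n ≡ quot P' Z n
  quot-cong Z h zero = h 0
  quot-cong Z h (suc n) = quot-cong Z (λ m → cong₂ _+_ (h (suc m)) (cong (λ x → - (x * Z (suc m))) (h 0))) n

  quot-correct : ∀ P Z → Z 0 ≡ 1# → ∀ n → conv (quot P Z) Z n ≡ P n
  quot-correct P Z z zero = cong (P 0 *_) z ∙ *-identityʳ _
  quot-correct P Z z (suc n) = cong (P 0 * Z (suc n) +_) (quot-correct _ Z z n) ∙
    solve 2 (λ a b → a :+ (b :+ :- a) := b) refl _ _

  quot-conv : ∀ X Z → Z 0 ≡ 1# → ∀ n → quot (conv X Z) Z n ≡ X n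
  quot-conv X Z z zero = cong (X 0 *_) z ∙ *-identityʳ _
  quot-conv X Z z (suc n) = quot-cong Z (λ m → cong (λ x → X 0 * Z (suc m) + conv (tail X) Z m + - (X 0 * x * Z (suc m))) z ∙
      solve 3 (λ a b c → a :* b :+ c :+ :- (a :* :1 :* b) := c) refl _ _ _) n ∙
    quot-conv (tail X) Z z n

  conv-cancel : ∀ X X' Z → Z 0 ≡ 1# → (∀ n → conv X Z n ≡ conv X' Z n) → ∀ n → X n ≡ X' n
  conv-cancel X X' Z z h n = sym (quot-conv X Z z n) ∙ quot-cong Z h n ∙ quot-conv X' Z z n

  quot-vanish : ∀ P Z n → (∀ i → i ℕ.≤ n → P i ≡ 0#) → quot P Z n ≡ 0#
  quot-vanish P Z zero h = h 0 z≤n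
  quot-vanish P Z (suc n) h = quot-vanish _ Z n (λ i i≤n → cong₂ (λ x y → x + - (y * Z (suc i))) (h (suc i) (s≤s i≤n)) (h 0 z≤n) ∙
    solve 1 (λ z → :0 :+ :- (:0 :* z) := :0) refl _)

  sumTo : Seq → Seq
  sumTo f zero = f 0
  sumTo f (suc n) = sumTo f n + f (suc n)

  sumTo-cong : ∀ {f h} n → (∀ i → i ℕ.≤ n → f i ≡ h i) → sumTo f n ≡ sumTo h n
  sumTo-cong zero e = e 0 z≤n
  sumTo-cong (suc n) e = cong₂ _+_ (sumTo-cong n (λ i p → e i (m≤n⇒m≤1+n p))) (e (suc n) ≤-refl)

  sumTo-+ : ∀ f h n → sumTo (λ i → f i + h i) n ≡ sumTo f n + sumTo h n
  sumTo-+ f h zero = refl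
  sumTo-+ f h (suc n) = cong (_+ (f (suc n) + h (suc n))) (sumTo-+ f h n) ∙
    solve 4 (λ a b c d → (a :+ b) :+ (c :+ d) := (a :+ c) :+ (b :+ d)) refl _ _ _ _

  sumTo-* : ∀ c f n → sumTo (λ i → c * f i) n ≡ c * sumTo f n
  sumTo-* c f zero = refl
  sumTo-* c f (suc n) = cong (_+ c * f (suc n)) (sumTo-* c f n) ∙ sym (distribˡ _ _ _)

  sumTo-first : ∀ f n → sumTo f (suc n) ≡ f 0 + sumTo (tail f) n
  sumTo-first f zero = refl
  sumTo-first f (suc n) = cong (_+ f _) (sumTo-first f n) ∙ +-assoc _ _ _

  sumTo-0 : ∀ f n → (∀ i → i ℕ.≤ n → f i ≡ 0#) → sumTo f n ≡ 0#
  sumTo-0 f zero h = h 0 z≤n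
  sumTo-0 f (suc n) h = cong₂ _+_ (sumTo-0 f n (λ i p → h i (m≤n⇒m≤1+n p))) (h (suc n) ≤-refl) ∙ +-identityˡ _

  sumTo-extend : ∀ f n k → (∀ i → n ℕ.< i → f i ≡ 0#) → sumTo f (k ℕ.+ n) ≡ sumTo f n
  sumTo-extend f n zero h = refl
  sumTo-extend f n (suc k) h = cong₂ _+_ (sumTo-extend f n k h) (h _ (s≤s (m≤n+m n k))) ∙ +-identityʳ _

  conv-sumTo : ∀ (c : ℕ → Carrier) (F : ℕ → Seq) h n m →
    conv (λ i → sumTo (λ j → c j * F j i) m) h n ≡ sumTo (λ j → c j * conv (F j) h n) m
  conv-sumTo c F h n zero = conv-*ˡ _ _ _ n
  conv-sumTo c F h n (suc m) = conv-+ˡ _ _ h n ∙ cong₂ _+_ (conv-sumTo c F h n m) (conv-*ˡ _ _ _ n)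

-- Multiplication operators on series in ζ

-- κ acts on series in ζ as multiplication by the variable of which
-- ζⁿ stands for 1/((κ+g)⋯(κ+ng)); accordingly G c is 1/(κ - c) and L is the shift κ ↦ κ + g.
module Operators (R : Alg) (g : Alg.Carrier R) where
  open Ring R
  open Series R public

  κ L : Seq → Seq
  κ f m = f (suc m) + - (g * nat m * f m)
  L f zero = f 0
  L f (suc n) = f (suc n) + - (g * nat n * f n)

  G : Carrier → Seq → Seq
  G c Y zero = 0#
  G c Y (suc m) = (g * nat m + c) * G c Y m + Y m

  -- A series without constant term is determined by its image under κ - c. Identities between
  -- resolvents can thus be checked after clearing the denominator.
  G-unique : ∀ c Y U → U 0 ≡ 0# → (∀ m → κ U m ≡ c * U m + Y m) → ∀ n → U n ≡ G c Y n
  G-unique c Y U u h zero = u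
  G-unique c Y U u h (suc m) = solve 3 (λ a b c → a := (a :+ :- (b :* c)) :+ b :* c) refl (U (suc m)) (g * nat m) (U m) ∙ cong (_+ g * nat m * U m) (h m) ∙ solve 4 (λ c u y k → c :* u :+ y :+ k :* u := (k :+ c) :* u :+ y) refl c (U m) (Y m) (g * nat m) ∙ cong (λ x → _ * x + Y m) (G-unique c Y U u h m)

  G-cong : ∀ c {Y Y'} → (∀ n → Y n ≡ Y' n) → ∀ n → G c Y n ≡ G c Y' n
  G-cong c h zero = refl
  G-cong c h (suc m) = cong₂ (λ x y → _ * x + y) (G-cong c h m) (h m)

  G-linear : ∀ c a Y b Y' n → G c (λ m → a * Y m + b * Y' m) n ≡ a * G c Y n + b * G c Y' n
  G-linear c a Y b Y' zero = solve 2 (λ a b → :0 := a :* :0 :+ b :* :0) refl a b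
  G-linear c a Y b Y' (suc m) = cong (λ x → _ * x + _) (G-linear c a Y b Y' m) ∙
    solve 7 (λ k a u y b u' y' → k :* (a :* u :+ b :* u') :+ (a :* y :+ b :* y') := a :* (k :* u :+ y) :+ b :* (k :* u' :+ y')) refl
      (g * nat m + c) a (G c Y m) (Y m) b (G c Y' m) (Y' m)

  G-* : ∀ c a Y n → G c (λ m → a * Y m) n ≡ a * G c Y n
  G-* c a Y zero = sym (zeroʳ a)
  G-* c a Y (suc m) = cong (λ x → _ * x + a * Y m) (G-* c a Y m) ∙
    solve 4 (λ k a u y → k :* (a :* u) :+ a :* y := a :* (k :* u :+ y)) refl _ _ _ _

  -- Partial fractions for the product of 1/(κ-c) and 1/(κ-d).
  resolvent : ∀ c d Y n → G c Y n + - G d Y n ≡ (c + - d) * G c (G d Y) n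
  resolvent c d Y zero = solve 2 (λ c d → :0 :+ :- :0 := (c :+ :- d) :* :0) refl c d
  resolvent c d Y (suc m) = solve 6 (λ k c d a b y → (k :+ c) :* b :+ y :+ :- ((k :+ d) :* a :+ y) := (k :+ c) :* (b :+ :- a) :+ (c :+ :- d) :* a) refl (g * nat m) c d a b (Y m) ∙ cong (λ x → (g * nat m + c) * x + _ * a) (resolvent c d Y m) ∙ solve 4 (λ k e u a → k :* (e :* u) :+ e :* a := e :* (k :* u :+ a)) refl (g * nat m + c) (c + - d) u a
    where a = G d Y m
          b = G c Y m
          u = G c (G d Y) m

  G-comm : ∀ c d Y n → G c (G d Y) n ≡ G d (G c Y) n
  G-comm c d Y zero = refl
  G-comm c d Y (suc m) = solve 5 (λ k c d u a → (k :+ c) :* u :+ a := (k :+ d) :* u :+ ((c :+ :- d) :* u :+ a)) refl (g * nat m) c d u a ∙ cong₂ (λ x y → (g * nat m + d) * x + (y + a)) (G-comm c d Y m) (sym (resolvent c d Y m)) ∙ cong ((g * nat m + d) * G d (G c Y) m +_) (solve 2 (λ a b → b :+ :- a :+ a := b) refl a b)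
    where a = G d Y m
          b = G c Y m
          u = G c (G d Y) m

  resolvent′ : ∀ c e Y n → e * G (c + e) (G c Y) n ≡ G (c + e) Y n + - G c Y n
  resolvent′ c e Y n = cong (_* G (c + e) (G c Y) n) (solve 2 (λ c e → e := c :+ e :+ :- c) refl c e) ∙ sym (resolvent (c + e) c Y n)

  -- The shift sends ζⁿ to 1/((κ+2g)⋯(κ+(n+1)g)), and the missing factor 1/(κ+g) completes it to
  -- ζⁿ⁺¹.
  G-L : ∀ U n → G (- g) (L U) n ≡ sh U n
  G-L U n = sym (G-unique (- g) (L U) (sh U) refl h n)
    where h : ∀ m → κ (sh U) m ≡ - g * sh U m + L U m
          h zero = cong (λ x → U 0 + - (g * x * 0#)) nat-0 ∙ solve 2 (λ g u → u :+ :- (g :* :0 :* :0) := :- g :* :0 :+ u) refl g (U 0)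
          h (suc k) = cong (λ x → U (suc k) + - (g * x * U k)) (nat-suc k) ∙
            solve 4 (λ g n u v → v :+ :- (g :* (:1 :+ n) :* u) := :- g :* u :+ (v :+ :- (g :* n :* u))) refl g (nat k) (U k) (U (suc k))

  -- Multiplication by 1 - ω/((κ-c)(κ-c+g)), the factor of a box of weight ω and content c.
  Ω : Carrier → Carrier → Seq → Seq
  Ω ω c Y n = Y n + - (ω * G (c + - g) (G c Y) n)

  Ω-cong : ∀ ω c {Y Y'} → (∀ n → Y n ≡ Y' n) → ∀ n → Ω ω c Y n ≡ Ω ω c Y' n
  Ω-cong ω c h n = cong₂ (λ x y → x + - (ω * y)) (h n) (G-cong _ (G-cong c h) n)

  Ωs : List (Carrier × Carrier) → Seq → Seq
  Ωs [] Y = Y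
  Ωs ((ω , c) ∷ bs) Y = Ωs bs (Ω ω c Y)

  Ωs-cong : ∀ bs {Y Y'} → (∀ n → Y n ≡ Y' n) → ∀ n → Ωs bs Y n ≡ Ωs bs Y' n
  Ωs-cong [] h = h
  Ωs-cong ((ω , c) ∷ bs) h = Ωs-cong bs (Ω-cong ω c h)

  Ωs-++ : ∀ bs bs' Y → Ωs (bs ++ bs') Y ≡ Ωs bs' (Ωs bs Y)
  Ωs-++ [] bs' Y = refl
  Ωs-++ (b ∷ bs) bs' Y = Ωs-++ bs bs' _

  -- In the variable z = 1/κ this is multiplication by z/(1-cz), the expansion of 1/(κ-c).
  geo : Carrier → Seq → Seq
  geo c φ zero = 0#
  geo c φ (suc n) = φ n + c * geo c φ n

  pw : ℕ → Seq → Seq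
  pw zero Y = Y
  pw (suc j) Y = G 0# (pw j Y)

  pw-low : ∀ j Y n → n ℕ.< j → pw j Y n ≡ 0#
  pw-low (suc j) Y zero p = refl
  pw-low (suc j) Y (suc n) (s≤s p) = cong₂ (λ x y → _ * x + y) (pw-low (suc j) Y n (m≤n⇒m≤1+n p)) (pw-low j Y n p) ∙
    solve 1 (λ k → k :* :0 :+ :0 := :0) refl _

  κ-pw : ∀ j Y m → κ (pw (suc j) Y) m ≡ pw j Y m
  κ-pw j Y m = solve 3 (λ k u y → (k :+ :0) :* u :+ y :+ :- (k :* u) := y) refl (g * nat m) (pw (suc j) Y m) (pw j Y m)

  -- The operator φ(1/κ) applied to Y. By `pw-low` the terms with j > n do not reach the coefficient
  -- at n, so the sum is finite.
  act : Seq → Seq → Seq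
  act φ Y n = sumTo (λ j → φ j * pw j Y n) n

  act-δ : ∀ Y n → act δ Y n ≡ Y n
  act-δ Y zero = *-identityˡ _
  act-δ Y (suc n) = sumTo-first _ n ∙ cong₂ _+_ (*-identityˡ _) (sumTo-0 _ n (λ i _ → zeroˡ _)) ∙ +-identityʳ _

  κ-act : ∀ ψ Y → ψ 0 ≡ 0# → ∀ m → κ (act ψ Y) m ≡ act (tail ψ) Y m
  κ-act ψ Y e m = cong (λ x → sumTo (λ j → ψ j * pw j Y (suc m)) (suc m) + - (g * nat m * x)) ext ∙ solve 3 (λ s k t → s :+ :- (k :* t) := s :+ (:- k) :* t) refl _ (g * nat m) _ ∙ cong (sumTo (λ j → ψ j * pw j Y (suc m)) (suc m) +_) (sym (sumTo-* _ _ (suc m))) ∙ sym (sumTo-+ _ _ (suc m)) ∙ sumTo-first _ m ∙ cong (λ x → x * Y (suc m) + - (g * nat m) * (x * Y m) + rest) e ∙ solve 4 (λ a k b r → :0 :* a :+ :- k :* (:0 :* b) :+ r := r) refl _ _ _ _ ∙ sumTo-cong m (λ i _ → solve 4 (λ p a k b → p :* a :+ :- k :* (p :* b) := p :* (a :+ :- (k :* b))) refl _ _ _ _ ∙ cong (ψ (suc i) *_) (κ-pw i Y m))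
    where
    rest = sumTo (λ j → ψ (suc j) * pw (suc j) Y (suc m) + - _ * _) m
    -- A vanishing last term is added so that the two sums in the definition of κ run over the same
    -- range.
    ext : sumTo (λ j → ψ j * pw j Y m) m ≡ sumTo (λ j → ψ j * pw j Y m) (suc m)
    ext = sym (cong (λ x → sumTo (λ j → ψ j * pw j Y m) m + ψ (suc m) * x) (pw-low (suc m) Y m ≤-refl) ∙
      solve 2 (λ a b → a :+ b :* :0 := a) refl _ _)

  act-linear : ∀ a φ b ψ Y n → act (λ m → a * φ m + b * ψ m) Y n ≡ a * act φ Y n + b * act ψ Y n
  act-linear a φ b ψ Y n = sumTo-cong n (λ i _ → solve 5 (λ a f b h p → (a :* f :+ b :* h) :* p := a :* (f :* p) :+ b :* (h :* p)) refl a (φ i) b (ψ i) _) ∙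
    sumTo-+ _ _ n ∙ cong₂ _+_ (sumTo-* _ _ n) (sumTo-* _ _ n)

  act-cong : ∀ {φ ψ} Y → (∀ n → φ n ≡ ψ n) → ∀ n → act φ Y n ≡ act ψ Y n
  act-cong Y h n = sumTo-cong n (λ i _ → cong (_* pw i Y n) (h i))

  G-act : ∀ c φ Y n → G c (act φ Y) n ≡ act (geo c φ) Y n
  G-act c φ Y n = sym (G-unique c _ _ (zeroˡ _) h n)
    where h : ∀ m → κ (act (geo c φ) Y) m ≡ c * act (geo c φ) Y m + act φ Y m
          h m = κ-act (geo c φ) Y refl m ∙ act-cong Y (λ n → solve 3 (λ f c h → f :+ c :* h := c :* h :+ :1 :* f) refl (φ n) c (geo c φ n)) m ∙
            act-linear c (geo c φ) 1# φ Y m ∙ cong (c * act (geo c φ) Y m +_) (*-identityˡ _)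

  Ωz : Carrier → Carrier → Seq → Seq
  Ωz ω c φ n = φ n + - (ω * geo (c + - g) (geo c φ) n)

  Ωzs : List (Carrier × Carrier) → Seq → Seq
  Ωzs [] φ = φ
  Ωzs ((ω , c) ∷ bs) φ = Ωzs bs (Ωz ω c φ)

  Ω-act : ∀ ω c φ Y n → Ω ω c (act φ Y) n ≡ act (Ωz ω c φ) Y n
  Ω-act ω c φ Y n = sym (act-cong Y (λ m → solve 3 (λ f w x → f :+ :- (w :* x) := :1 :* f :+ :- w :* x) refl (φ m) ω _) n ∙ act-linear 1# φ (- ω) _ Y n ∙ solve 3 (λ f w x → :1 :* f :+ :- w :* x := f :+ :- (w :* x)) refl _ ω _ ∙ cong (λ x → act φ Y n + - (ω * x)) (sym (G-cong _ (G-act c φ Y) n ∙ G-act (c + - g) (geo c φ) Y n)))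

  Ωs-act : ∀ bs φ Y n → Ωs bs (act φ Y) n ≡ act (Ωzs bs φ) Y n
  Ωs-act [] φ Y n = refl
  Ωs-act ((ω , c) ∷ bs) φ Y n = Ωs-cong bs (Ω-act ω c φ Y) n ∙ Ωs-act bs (Ωz ω c φ) Y n

-- The operator that adds a first column

module Columns (R : Alg) (g A : Alg.Carrier R) (α : ℕ → Alg.Carrier R)
  (α-zero : α 0 ≡ Alg.1# R)
  (α-suc : ∀ i → Alg._*_ R (Alg._*_ R (Alg.nat R (suc i)) g) (α (suc i)) ≡ Alg._*_ R (Alg._+_ R A (Alg._*_ R (Alg.nat R i) g)) (α i)) where
  open Ring R
  open Operators R g public
  open ≡-Reasoning

  -- The rising factorial x(x+g)⋯(x+(i-1)g). The hypotheses on α let `α i` play the part of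
  -- `rise A i` divided by i! gⁱ without a division by g.
  rise : Carrier → ℕ → Carrier
  rise x zero = 1#
  rise x (suc i) = x * rise (x + g) i

  rise-last : ∀ x i → rise x (suc i) ≡ rise x i * (x + nat i * g)
  rise-last x zero = solve 2 (λ x g → x :* :1 := :1 :* (x :+ :0 :* g)) refl x g ∙ cong (λ y → 1# * (x + y * g)) (sym nat-0)
  rise-last x (suc i) = cong (x *_) (rise-last (x + g) i) ∙ solve 4 (λ x r g n → x :* (r :* (x :+ g :+ n :* g)) := x :* r :* (x :+ (:1 :+ n) :* g)) refl x _ g (nat i) ∙ cong (λ y → x * rise (x + g) i * (x + y * g)) (sym (nat-suc i))

  module _ (β : Carrier) where

    r : ℕ → ℕ → Carrier
    r j i = rise (β + nat j * g) i

    r-suc : ∀ j i → r j (suc i) ≡ (β + nat j * g) * r (suc j) i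
    r-suc j i = cong (λ y → (β + nat j * g) * rise y i) (solve 3 (λ b n g → b :+ n :* g :+ g := b :+ (:1 :+ n) :* g) refl β (nat j) g ∙
      cong (λ y → β + y * g) (sym (nat-suc j)))

    r-last : ∀ j i → r j (suc i) ≡ r j i * (β + nat j * g + nat i * g)
    r-last j i = rise-last (β + nat j * g) i

    -- ζʲ is sent to ζʲ times the Gauss series with parameters A/g and β/g + j over κ/g + j + 1, at
    -- argument 1. By Gauss's summation this is Φ(κ) times the value of ζʲ at κ - A, with Φ
    -- independent of j. The lemmas below verify the algebraic consequences of this coefficientwise.
    C : Seq → Seq
    C q = dsum (λ j i → q j * (r j i * α i))

    C-cong : ∀ {q q'} → (∀ n → q n ≡ q' n) → ∀ n → C q n ≡ C q' n
    C-cong h = dsum-cong (λ j i → cong (_* (r j i * α i)) (h j))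

    C-linear : ∀ a q b q' n → C (λ m → a * q m + b * q' m) n ≡ a * C q n + b * C q' n
    C-linear a q b q' n = dsum-cong (λ j i → solve 5 (λ a q b p x → (a :* q :+ b :* p) :* x := a :* (q :* x) :+ b :* (p :* x)) refl a (q j) b (q' j) _) n ∙
      dsum-+ _ _ n ∙ cong₂ _+_ (dsum-* a _ n) (dsum-* b _ n)

    private
      e : ℕ → ℕ → Carrier
      e j zero = 0#
      e j (suc i) = nat (suc i) * g * r (suc j) i

      r-e : ∀ j i → r (suc j) i ≡ r j i + e j i
      r-e j zero = sym (+-identityʳ _)
      r-e j (suc i) = r-last (suc j) i ∙ cong (λ y → r (suc j) i * (β + y * g + nat i * g)) (nat-suc j) ∙ solve 5 (λ x b j g i → x :* (b :+ (:1 :+ j) :* g :+ i :* g) := (b :+ j :* g) :* x :+ (:1 :+ i) :* g :* x) refl _ β (nat j) g (nat i) ∙ cong₂ _+_ (sym (r-suc j i)) (cong (λ y → y * g * r (suc j) i) (sym (nat-suc i)))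

      shifted : ∀ (q : Seq) → q 0 ≡ 0# → ∀ m →
        dsum (λ j i → q (suc j) * (e j i * α i)) m ≡ dsum (λ j i → q j * (r j i * ((A + nat i * g) * α i))) m
      shifted q q0 zero = solve 2 (λ a b → a :* (:0 :* b) := :0) refl _ _ ∙
        sym (cong (_* (r 0 0 * ((A + nat 0 * g) * α 0))) q0 ∙ zeroˡ _)
      shifted q q0 (suc m) = dsum-last (λ j i → q (suc j) * (e j i * α i)) m ∙ cong₂ _+_ (dsum-cong (λ j i → solve 5 (λ q n g r a → q :* (n :* g :* r :* a) := q :* (r :* (n :* g :* a))) refl _ (nat (suc i)) g _ _ ∙ cong (λ y → q (suc j) * (r (suc j) i * y)) (α-suc i)) m) (solve 2 (λ a b → a :* (:0 :* b) := :0) refl _ _) ∙ solve 2 (λ a b → a :+ :0 := :0 :* b :+ a) refl rest _ ∙ cong (λ y → y * (r 0 (suc m) * ((A + nat (suc m) * g) * α (suc m))) + rest) (sym q0)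
        where rest = dsum (λ j i → q (suc j) * (r (suc j) i * ((A + nat i * g) * α i))) m

    -- In terms of operators κC = C(κ + A) on series without constant term, as for a substitution κ
    -- ↦ κ - A. The two sources are the difference of `r (suc j) i` and `r j i` and the recursion of
    -- α.
    C-step : ∀ q → q 0 ≡ 0# → ∀ m → C q (suc m) ≡ C (κ q) m + (A + g * nat m) * C q m
    C-step q q0 m = cong₂ _+_ (cong (_* (r 0 (suc m) * α (suc m))) q0 ∙ zeroˡ _) (dsum-cong (λ j i → cong (λ y → q (suc j) * (y * α i)) (r-e j i) ∙ solve 4 (λ q r e a → q :* ((r :+ e) :* a) := q :* (r :* a) :+ q :* (e :* a)) refl _ _ _ _) m) ∙ +-identityˡ _ ∙ dsum-+ _ _ m ∙ cong (dsum (λ j i → q (suc j) * (r j i * α i)) m +_) (shifted q q0 m) ∙ sym (dsum-+ _ _ m) ∙ dsum-cong (λ j i → solve 8 (λ p q r a A i g j → p :* (r :* a) :+ q :* (r :* ((A :+ i :* g) :* a)) := (p :+ :- (g :* j :* q)) :* (r :* a) :+ (A :+ g :* (j :+ i)) :* (q :* (r :* a))) refl (q (suc j)) (q j) (r j i) (α i) A (nat i) g (nat j) ∙ cong (λ y → κ q j * (r j i * α i) + (A + g * y) * (q j * (r j i * α i))) (sym (nat-+ j i))) m ∙ dsum-+ _ _ m ∙ cong (C (κ q) m +_) (dsum-weight (λ n → A + g * nat n) _ m)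

    C-G : ∀ c Y n → C (G c Y) n ≡ G (c + A) (C Y) n
    C-G c Y n = G-unique (c + A) (C Y) (C (G c Y)) (zeroˡ _) h n
      where
      h : ∀ m → κ (C (G c Y)) m ≡ (c + A) * C (G c Y) m + C Y m
      h m = cong (_+ - (g * nat m * C (G c Y) m)) (C-step (G c Y) refl m) ∙ cong (λ y → y + (A + g * nat m) * C (G c Y) m + - (g * nat m * C (G c Y) m)) (C-cong (λ j → solve 4 (λ k c u y → (k :+ c) :* u :+ y :+ :- (k :* u) := c :* u :+ :1 :* y) refl (g * nat j) c (G c Y j) (Y j)) m ∙ C-linear c (G c Y) 1# Y m) ∙ solve 5 (λ c u y A k → c :* u :+ :1 :* y :+ (A :+ k) :* u :+ :- (k :* u) := (c :+ A) :* u :+ y) refl c _ _ A (g * nat m)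

    -- β times this is the failure of `C` to commute with the shift `L`.
    H : Seq → Seq
    H q zero = 0#
    H q (suc zero) = 0#
    H q (suc (suc n)) = dsum (λ j i → q j * (r (suc j) i * ((A + nat i * g) * α i))) n

    private
      e' : ℕ → ℕ → Carrier
      e' j zero = 0#
      e' j (suc i) = β * (r (suc j) i * ((A + nat i * g) * α i))

      -- The products `r j (suc i)` and `r (suc j) (suc i)` share all factors except β + jg and β +
      -- (j+i+1)g. Weighted by j + i + 1 and j, these differ by (i+1)β, because the terms in g
      -- cancel.
      bracket : ∀ j i → g * α i * ((nat j + nat i) * r j i + - (nat j * r (suc j) i)) ≡ e' j i
      bracket j zero = cong (λ y → g * α 0 * ((nat j + y) * 1# + - (nat j * 1#))) nat-0 ∙
        solve 3 (λ g a j → g :* a :* ((j :+ :0) :* :1 :+ :- (j :* :1)) := :0) refl g (α 0) (nat j)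
      bracket j (suc i) = cong₂ (λ x y → g * α (suc i) * ((nat j + nat (suc i)) * x + - (nat j * y))) (r-suc j i) (r-last (suc j) i) ∙ cong₂ (λ x y → g * α (suc i) * ((nat j + x) * ((β + nat j * g) * ρ) + - (nat j * (ρ * (β + y * g + nat i * g))))) (nat-suc i) (nat-suc j) ∙ solve 6 (λ g a j i b ρ → g :* a :* ((j :+ (:1 :+ i)) :* ((b :+ j :* g) :* ρ) :+ :- (j :* (ρ :* (b :+ (:1 :+ j) :* g :+ i :* g)))) := b :* (ρ :* ((:1 :+ i) :* g :* a))) refl g (α (suc i)) (nat j) (nat i) β ρ ∙ cong (λ y → β * (ρ * y)) (cong (λ y → y * g * α (suc i)) (sym (nat-suc i)) ∙ α-suc i)
        where ρ = r (suc j) i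

    C-L : ∀ q n → C (L q) n ≡ L (C q) n + β * H q n
    C-L q zero = sym (cong (C q 0 +_) (zeroʳ β) ∙ +-identityʳ _)
    C-L q (suc m) = cong (q 0 * (r 0 (suc m) * α (suc m)) +_) (dsum-cong (λ j i → solve 3 (λ p x y → (p :+ :- x) :* y := p :* y :+ :- (x :* y)) refl _ _ _) m ∙ dsum-+ _ _ m) ∙ sym (+-assoc _ _ _) ∙ cong (C q (suc m) +_) Xeq ∙ sym (+-assoc _ _ _)
      where
      X = dsum (λ j i → - (g * nat j * q j * (r (suc j) i * α i))) m
      bH : ∀ m → dsum (λ j i → q j * e' j i) m ≡ β * H q (suc m)
      bH zero = zeroʳ _ ∙ sym (zeroʳ β)
      bH (suc m) = dsum-last (λ j i → q j * e' j i) m ∙ cong₂ _+_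
          (dsum-cong (λ j i → solve 3 (λ q b x → q :* (b :* x) := b :* (q :* x)) refl _ _ _) m ∙ dsum-* β _ m) (zeroʳ _) ∙ +-identityʳ _
      Xeq : X ≡ - (g * nat m * C q m) + β * H q (suc m)
      Xeq = dsum-cong (λ j i → solve 6 (λ g j q s t a → :- (g :* j :* q :* (s :* a)) := :- g :* (j :* (q :* (t :* a))) :+ q :* (g :* a :* (j :* t :+ :- (j :* s)))) refl g (nat j) (q j) (r (suc j) i) (r j i) (α i) ∙ solve 7 (λ g j i q s t a → :- g :* (j :* (q :* (t :* a))) :+ q :* (g :* a :* (j :* t :+ :- (j :* s))) := :- g :* ((j :+ i) :* (q :* (t :* a))) :+ q :* (g :* a :* ((j :+ i) :* t :+ :- (j :* s)))) refl g (nat j) (nat i) (q j) (r (suc j) i) (r j i) (α i)) m ∙ dsum-cong (λ j i → cong₂ (λ x y → - g * (x * (q j * (r j i * α i))) + q j * y) (sym (nat-+ j i)) (bracket j i)) m ∙ dsum-+ _ _ m ∙ cong₂ _+_ (dsum-* (- g) _ m ∙ cong (- g *_) (dsum-weight nat _ m)) (bH m) ∙ cong (_+ β * H q (suc m)) (solve 3 (λ g n c → :- g :* (n :* c) := :- (g :* n :* c)) refl g (nat m) (C q m))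

    -- The sum obeys the first-order recursion that defines `G` at A + β - g: α's own recursion
    -- trades the last factor of a term for the next coefficient.
    H-G : ∀ q n → H q n ≡ A * G (A + β + - g) (sh (C q)) n
    H-G q n = H-unique n ∙ G-* (A + β + - g) A (sh (C q)) n
      where
      c = A + β + - g
      step : ∀ m → H q (suc m) ≡ (g * nat m + c) * H q m + A * sh (C q) m
      step zero = solve 2 (λ k a → :0 := k :* :0 :+ a :* :0) refl _ A
      step (suc zero) = cong (λ y → q 0 * (1# * ((A + y * g) * α 0))) nat-0 ∙ solve 5 (λ q A g a k → q :* (:1 :* ((A :+ :0 :* g) :* a)) := k :* :0 :+ A :* (q :* (:1 :* a))) refl (q 0) A g (α 0) _
      step (suc (suc k)) = dsum-last T k ∙ cong₂ _+_ (dsum-cong term k) last ∙ cong (_+ A * t (suc k) 0) (dsum-+ _ _ k ∙ cong₂ _+_ (dsum-weight w T k) (dsum-* A _ k)) ∙ solve 4 (λ x A y z → x :+ A :* y :+ A :* z := x :+ A :* (y :+ z)) refl _ A _ _ ∙ cong (λ y → w k * dsum T k + A * y) (sym (dsum-last t k))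
        where
        w = λ n → g * nat (suc (suc n)) + c
        T = λ j i → q j * (r (suc j) i * ((A + nat i * g) * α i))
        t = λ j i → q j * (r j i * α i)
        last : T (suc k) 0 ≡ A * t (suc k) 0
        last = cong (λ y → q (suc k) * (1# * ((A + y * g) * α 0))) nat-0 ∙
          solve 4 (λ q A g a → q :* (:1 :* ((A :+ :0 :* g) :* a)) := A :* (q :* (:1 :* a))) refl _ A g _
        term : ∀ j i → T j (suc i) ≡ w (j ℕ.+ i) * T j i + A * t j (suc i)
        term j i = cong₂ (λ x y → q j * (x * ((A + y * g) * a))) (r-last (suc j) i ∙ cong (λ y → ρ * (β + y * g + nat i * g)) (nat-suc j)) (nat-suc i) ∙ solve 8 (λ q ρ b j g i A a → q :* (ρ :* (b :+ (:1 :+ j) :* g :+ i :* g) :* ((A :+ (:1 :+ i) :* g) :* a)) := (g :* (:1 :+ (:1 :+ (j :+ i))) :+ (A :+ b :+ :- g)) :* (q :* (ρ :* ((:1 :+ i) :* g :* a))) :+ A :* (q :* ((b :+ j :* g) :* ρ :* a))) refl (q j) ρ β (nat j) g (nat i) A a ∙ cong₂ (λ x y → (g * x + c) * (q j * (ρ * y)) + A * (q j * ((β + nat j * g) * ρ * a))) (cong (λ y → 1# + (1# + y)) (sym (nat-+ j i)) ∙ cong (1# +_) (sym (nat-suc _)) ∙ sym (nat-suc _)) (cong (λ y → y * g * a) (sym (nat-suc i)) ∙ α-suc i) ∙ cong (λ y → w (j ℕ.+ i) * T j i + A * (q j * (y * a))) (sym (r-suc j i))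
          where ρ = r (suc j) i
                a = α (suc i)
      H-unique : ∀ n → H q n ≡ G c (λ m → A * sh (C q) m) n
      H-unique zero = refl
      H-unique (suc m) = step m ∙ cong (λ y → (g * nat m + c) * y + A * sh (C q) m) (H-unique m)

    -- Multiplication by 1 + Aβ/((κ+g)(κ+g-A-β)) = (κ+g-A)(κ+g-β)/((κ+g)(κ+g-A-β)), which is
    -- Φ(κ)/Φ(κ+g).
    V : Seq → Seq
    V Y n = Y n + A * β * G (A + β + - g) (G (- g) Y) n

    C-V : ∀ q n → C (L q) n ≡ V (L (C q)) n
    C-V q n = C-L q n ∙ cong (L (C q) n +_) (cong (β *_) (H-G q n ∙
      cong (A *_) (G-cong (A + β + - g) (λ m → sym (G-L (C q) m)) n)) ∙ solve 3 (λ b A x → b :* (A :* x) := A :* b :* x) refl β A _)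

    C-Ω : ∀ ω c Y n → C (Ω ω c Y) n ≡ Ω ω (c + A) (C Y) n
    C-Ω ω c Y n = begin C (Ω ω c Y) n ≡⟨ C-cong (λ m → solve 3 (λ y w x → y :+ :- (w :* x) := :1 :* y :+ :- w :* x) refl (Y m) ω _) n ∙ C-linear 1# Y (- ω) _ n ∙ solve 3 (λ y w x → :1 :* y :+ :- w :* x := y :+ :- (w :* x)) refl _ ω _ ∙ cong (λ y → C Y n + - (ω * y)) (C-G (c + - g) (G c Y) n ∙ cong (λ y → G y (C (G c Y)) n) (solve 3 (λ c g A → c :+ :- g :+ A := c :+ A :+ :- g) refl c g A) ∙ G-cong (c + A + - g) (C-G c Y) n) ⟩ Ω ω (c + A) (C Y) n ∎

    C-Ωs : ∀ bs Y n → C (Ωs bs Y) n ≡ Ωs (map (λ { (ω , c) → (ω , c + A) }) bs) (C Y) n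
    C-Ωs [] Y n = refl
    C-Ωs ((ω , c) ∷ bs) Y n = C-Ωs bs (Ω ω c Y) n ∙ Ωs-cong (map _ bs) (C-Ω ω c Y) n

  shiftBox : Carrier × Carrier → Carrier × Carrier
  shiftBox (ω , c) = (ω , c + A)

  -- With u = κ + g - β, the quotient of the functions V at β + B and at β is (u-A)(u-B)/(u(u-A-B)).
  -- If A + B = -g, this is 1 + AB/(u(u+g)), the factor of one box; if B = 0, both are 1. The
  -- factors of the boxes in a column therefore telescope.
  Ω-V : ∀ β B → B * (A + B + g) ≡ 0# → ∀ Y n → Ω (- (A * B)) (β + - g) (V β Y) n ≡ V (β + B) Y n
  Ω-V β B cond Y n = begin V β Y n + - (- (A * B) * G (c + - g) (G c (V β Y)) n) ≡⟨ cong (λ y → V β Y n + - y) (solve 3 (λ A B x → :- (A :* B) :* x := :- A :* (B :* x)) refl A B _ ∙ cong (- A *_) change ∙ cong (λ y → - A * (B * y)) (G-cong (d + B) pV n ∙ G-linear (d + B) 1# W (- A) (G a W) n)) ∙ solve 5 (λ v A B x y → v :+ :- (:- A :* (B :* (:1 :* x :+ :- A :* y))) := v :+ A :* (B :* x) :+ :- (A :* A :* (B :* y))) refl _ A B _ _ ∙ cong₂ (λ x y → V β Y n + A * x + - (A * A * y)) (resolvent′ d B Y n) (cong (B *_) (G-cong (d + B) (G-comm a d Y) n ∙ refl) ∙ resolvent′ d B (G a Y) n) ∙ solve 8 (λ Y A b yx r y rx B → Y :+ A :* b :* yx :+ A :* (r :+ :- y) :+ :- (A :* A :* (rx :+ :-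 yx)) := Y :+ A :* ((b :+ A) :* yx) :+ A :* (r :+ :- y) :+ :- (A :* A :* rx)) refl (Y n) A β yx r' (G d Y n) rx B ∙ cong (λ x → Y n + A * x + A * (r' + - G d Y n) + - (A * A * rx)) (cong (λ z → (β + A) * G z (G a Y) n) (solve 3 (λ A b g → A :+ b :+ :- g := :- g :+ (b :+ A)) refl A β g) ∙ resolvent′ a (β + A) Y n ∙ cong (λ z → G z Y n + - G a Y n) (solve 3 (λ A b g → :- g :+ (b :+ A) := A :+ b :+ :- g) refl A β g)) ∙ solve 6 (λ Y A y x r rx → Y :+ A :* (y :+ :- x) :+ A :* (r :+ :- y) :+ :- (A :* A :* rx) := Y :+ A :* (r :+ :- x) :+ :- (A :* A :* rx)) refl (Y n) A (G d Y n) (G a Y n) r' rx ∙ cong₂ (λ x y → Y n + A * x + - (A * A * y)) (sym (cong (λ z → (A + (β + B)) * G z (G a Y) n) e₁ ∙ resolvent′ a (A + (β + B)) Y n ∙ cong (λ z → G z Y n + - G a Y n) (sym e₂))) (cong (λ z → G z (G a Y) n) e₃) ∙ solve 5 (λ Y A b B x → Y :+ A :* ((A :+ (b :+ B)) :* x) :+ :- (A :* A :* x) := Y :+ A :* (b :+ B) :* x) refl (Y n) A β B _ ⟩ V (β + B) Y n ∎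
    where
    a = - g
    c = β + - g
    d = A + β + - g
    W = G d Y
    P = G c (V β Y)
    yx = G d (G a Y) n
    r' = G (d + B) Y n
    rx = G (d + B) (G a Y) n
    e₁ : A + (β + B) + - g ≡ a + (A + (β + B))
    e₁ = solve 4 (λ A b B g → A :+ (b :+ B) :+ :- g := :- g :+ (A :+ (b :+ B))) refl A β B g
    e₂ : d + B ≡ a + (A + (β + B))
    e₂ = solve 4 (λ A b B g → A :+ b :+ :- g :+ B := :- g :+ (A :+ (b :+ B))) refl A β B g
    e₃ : d + B ≡ A + (β + B) + - g
    e₃ = solve 4 (λ A b B g → A :+ b :+ :- g :+ B := A :+ (b :+ B) :+ :- g) refl A β B g
    -- `cond` enters here: the parameters of the two resolvents differ by A + B + g, and this
    -- difference is multiplied by B.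
    change : B * G (c + - g) P n ≡ B * G (d + B) P n
    change = solve 3 (λ B x y → B :* x := B :* y :+ :- (B :* (y :+ :- x))) refl B _ _ ∙ cong (λ y → B * G (d + B) P n + - (B * y)) (resolvent (d + B) (c + - g) P n) ∙ solve 6 (λ B x A b g y → B :* x :+ :- (B :* ((A :+ b :+ :- g :+ B :+ :- (b :+ :- g :+ :- g)) :* y)) := B :* x :+ :- (B :* (A :+ B :+ g) :* y)) refl B _ A β g _ ∙ cong (λ z → B * G (d + B) P n + - (z * G (d + B) (G (c + - g) P) n)) cond ∙ solve 2 (λ x y → x :+ :- (:0 :* y) := x) refl _ _
    pV : ∀ m → P m ≡ 1# * W m + - A * G a W m
    pV m = G-cong c (λ k → cong (_+ A * β * G d (G a Y) k) (sym (*-identityˡ (Y k)))) m ∙ G-linear c 1# Y (A * β) (G d (G a Y)) m ∙ solve 4 (λ p A b x → :1 :* p :+ A :* b :* x := p :+ A :* (b :* x)) refl _ A β _ ∙ cong (λ x → G c Y m + A * x) (cong (β *_) (G-cong c (λ k → G-comm d a Y k) m) ∙ cong (λ z → β * G z (G a W) m) ce ∙ resolvent′ a β W m ∙ cong (λ z → G z W m + - G a W m) (sym ce)) ∙ solve 4 (λ p A x y → p :+ A :* (x :+ :- y) := p :+ A :* x :+ :- A :* y) refl _ A _ _ ∙ cong (λ x → G c Y m + x + - A * G a W m) (cong (A *_) (G-comm c d Y m) ∙ cong (λ z → A * G z (G c Y) m) de ∙ resolvent′ c A Y m ∙ cong (λ z → G z Y m + - G c Y m) (sym de)) ∙ solve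 3 (λ p w x → p :+ (w :+ :- p) :+ x := :1 :* w :+ x) refl _ _ _
      where
      ce : c ≡ a + β
      ce = +-comm β (- g)
      de : d ≡ c + A
      de = solve 3 (λ A b g → A :+ b :+ :- g := b :+ :- g :+ A) refl A β g

sumL : (R : Alg) → List (Alg.Carrier R) → Alg.Carrier R
sumL R = foldr (Alg._+_ R) (Alg.0# R)

-- cols lists the columns of a diagram whose rows have (anisotropic) heights B.
record World : Set₁ where
  field
    alg : Alg
  open Alg alg public
  field
    g A : Carrier
    α : ℕ → Carrier
    α-zero : α 0 ≡ 1#
    α-suc : ∀ i → nat (suc i) * g * α (suc i) ≡ (A + nat i * g) * α i
    cols : List (List Carrier)
    cond : All (All (λ B → B * (A + B + g) ≡ 0#)) cols

-- Newton's identities for the product over the boxes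

module Newton (R : Alg) (g : Alg.Carrier R) where
  open Ring R
  open Operators R g

  qmul : Carrier → Carrier → Seq → Seq
  qmul a b φ n = φ n + - (a * sh φ n) + b * sh (sh φ) n

  -- Power sums of the two roots of t² - at + b, with constant term 0 in place of 2. As a series it
  -- is (az - 2bz²)/(1 - az + bz²), the logarithmic derivative z d/dz of 1/(1 - az + bz²).
  lucas : Carrier → Carrier → Seq
  lucas a b 0 = 0#
  lucas a b 1 = a
  lucas a b 2 = a * a + - (b + b)
  lucas a b (suc (suc (suc n))) = a * lucas a b (suc (suc n)) + - (b * lucas a b (suc n))

  qmul-lucas : ∀ a b n → qmul a b (lucas a b) n ≡ a * sh δ n + - ((b + b) * sh (sh δ) n)
  qmul-lucas a b 0 = solve 2 (λ a b → :0 :+ :- (a :* :0) :+ b :* :0 := a :* :0 :+ :- ((b :+ b) :* :0)) refl a b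
  qmul-lucas a b 1 = solve 2 (λ a b → a :+ :- (a :* :0) :+ b :* :0 := a :* :1 :+ :- ((b :+ b) :* :0)) refl a b
  qmul-lucas a b 2 = solve 2 (λ a b → a :* a :+ :- (b :+ b) :+ :- (a :* a) :+ b :* :0 := a :* :0 :+ :- ((b :+ b) :* :1)) refl a b
  qmul-lucas a b (suc (suc (suc n))) = solve 4 (λ a b x y → a :* x :+ :- (b :* y) :+ :- (a :* x) :+ b :* y := a :* :0 :+ :- ((b :+ b) :* :0)) refl a b _ _

  sh-cong : ∀ {f h : Seq} → (∀ n → f n ≡ h n) → ∀ n → sh f n ≡ sh h n
  sh-cong e zero = refl
  sh-cong e (suc n) = e n

  qmul-cong : ∀ a b {f h} → (∀ n → f n ≡ h n) → ∀ n → qmul a b f n ≡ qmul a b h n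
  qmul-cong a b e n = cong₂ _+_ (cong₂ (λ x y → x + - (a * y)) (e n) (sh-cong e n)) (cong (b *_) (sh-cong (sh-cong e) n))

  qmul-deriv : ∀ a b φ n → deriv (qmul a b φ) n ≡ qmul a b (deriv φ) n + - (a * sh φ n + - ((b + b) * sh (sh φ) n))
  qmul-deriv a b φ 0 = cong (λ k → k * (φ 0 + - (a * 0#) + b * 0#)) nat-0 ∙
    solve 3 (λ a b f → :0 :* (f :+ :- (a :* :0) :+ b :* :0) := :0 :* f :+ :- (a :* :0) :+ b :* :0 :+ :- (a :* :0 :+ :- ((b :+ b) :* :0))) refl a b (φ 0) ∙
      cong (λ k → k * φ 0 + - (a * 0#) + b * 0# + - (a * 0# + - ((b + b) * 0#))) (sym nat-0)
  qmul-deriv a b φ 1 = cong (λ k → k * (φ 1 + - (a * φ 0) + b * 0#)) e ∙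
    solve 4 (λ a b f h → :1 :* (f :+ :- (a :* h) :+ b :* :0) := :1 :* f :+ :- (a :* (:0 :* h)) :+ b :* :0 :+ :- (a :* h :+ :- ((b :+ b) :* :0))) refl a b (φ 1) (φ 0) ∙
      cong₂ (λ k z → k * φ 1 + - (a * (z * φ 0)) + b * 0# + - (a * φ 0 + - ((b + b) * 0#))) (sym e) (sym nat-0)
    where e : nat 1 ≡ 1#
          e = nat-suc 0 ∙ cong (1# +_) nat-0 ∙ +-identityʳ _
  qmul-deriv a b φ (suc (suc n)) = cong (λ k → k * (φ (suc (suc n)) + - (a * φ (suc n)) + b * φ n)) (nat-suc (suc n) ∙ cong (1# +_) (nat-suc n)) ∙
    solve 6 (λ a b f h k n → (:1 :+ (:1 :+ n)) :* (f :+ :- (a :* h) :+ b :* k)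
         := (:1 :+ (:1 :+ n)) :* f :+ :- (a :* ((:1 :+ n) :* h)) :+ b :* (n :* k) :+ :- (a :* h :+ :- ((b :+ b) :* k))) refl a b _ _ _ (nat n) ∙
      cong₂ (λ x y → x * φ (suc (suc n)) + - (a * (y * φ (suc n))) + b * (nat n * φ n) + - (a * φ (suc n) + - ((b + b) * φ n)))
         (sym (nat-suc (suc n) ∙ cong (1# +_) (nat-suc n))) (sym (nat-suc n))

  qmul-conv : ∀ a b σ φ n → conv σ (qmul a b φ) n ≡ qmul a b (conv σ φ) n
  qmul-conv a b σ φ n = conv-+ʳ σ _ _ n ∙ cong₂ _+_ (conv-cong (λ _ → refl) (λ m → solve 3 (λ f a x → f :+ :- (a :* x) := f :+ :- a :* x) refl _ a _) n ∙ conv-+ʳ σ φ _ n ∙ cong (conv σ φ n +_) (conv-*ʳ (- a) σ (sh φ) n)) (conv-*ʳ b σ _ n) ∙ cong₂ (λ x y → conv σ φ n + - a * x + b * y) (conv-shʳ σ φ n) (conv-shʳ σ (sh φ) n ∙ sh-cong (conv-shʳ σ φ) n) ∙ solve 5 (λ f a x b y → f :+ :- a :* x :+ b :* y := f :+ :- (a :* x) :+ b :* y) refl _ a _ b _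

  lucas-conv : ∀ a b φ n → conv (lucas a b) (qmul a b φ) n ≡ a * sh φ n + - ((b + b) * sh (sh φ) n)
  lucas-conv a b φ n = qmul-conv a b _ φ n ∙ qmul-cong a b (conv-comm _ φ) n ∙ sym (qmul-conv a b φ _ n) ∙ conv-comm φ _ n ∙ conv-cong (λ m → qmul-lucas a b m ∙ solve 4 (λ a x c y → a :* x :+ :- (c :* y) := a :* x :+ :- c :* y) refl a _ (b + b) _) (λ _ → refl) n ∙ conv-+ˡ _ _ φ n ∙ cong₂ _+_ (conv-*ˡ a _ φ n) (conv-*ˡ (- (b + b)) _ φ n) ∙ cong₂ (λ x y → a * x + - (b + b) * y) (conv-shˡ δ φ n ∙ sh-cong (conv-δˡ φ) n) (conv-shˡ (sh δ) φ n ∙ sh-cong (λ m → conv-shˡ δ φ m ∙ sh-cong (conv-δˡ φ) m) n) ∙ solve 4 (λ a x c y → a :* x :+ :- c :* y := a :* x :+ :- (c :* y)) refl a _ (b + b) _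

  LogDeriv : Seq → Seq → Set
  LogDeriv σ φ = ∀ n → deriv φ n ≡ conv σ φ n

  logDeriv-mul : ∀ a b σ φ → LogDeriv σ φ → LogDeriv (λ n → σ n + - lucas a b n) (qmul a b φ)
  logDeriv-mul a b σ φ h n = qmul-deriv a b φ n ∙ cong₂ (λ x y → x + - y) (qmul-cong a b h n ∙ sym (qmul-conv a b σ φ n)) (sym (lucas-conv a b φ n)) ∙ cong (conv σ (qmul a b φ) n +_) (solve 1 (λ x → :- x := :- :1 :* x) refl _ ∙ sym (conv-*ˡ (- 1#) (lucas a b) _ n)) ∙ sym (conv-+ˡ _ _ _ n) ∙ conv-cong (λ m → solve 2 (λ s l → s :+ :- :1 :* l := s :+ :- l) refl (σ m) _) (λ _ → refl) n

  qmul-cancel : ∀ a b f h → (∀ n → qmul a b f n ≡ qmul a b h n) → ∀ n → f n ≡ h n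
  qmul-cancel a b f h e 0 = solve 3 (λ f a b → f := f :+ :- (a :* :0) :+ b :* :0) refl (f 0) a b ∙ e 0 ∙ solve 3 (λ f a b → f :+ :- (a :* :0) :+ b :* :0 := f) refl (h 0) a b
  qmul-cancel a b f h e 1 = solve 4 (λ x y a b → x := (x :+ :- (a :* y) :+ b :* :0) :+ a :* y) refl (f 1) (f 0) a b ∙ cong₂ (λ x y → x + a * y) (e 1) (qmul-cancel a b f h e 0) ∙ solve 4 (λ x y a b → (x :+ :- (a :* y) :+ b :* :0) :+ a :* y := x) refl (h 1) (h 0) a b
  qmul-cancel a b f h e (suc (suc n)) = solve 5 (λ x y z a b → x := (x :+ :- (a :* y) :+ b :* z) :+ a :* y :+ :- (b :* z)) refl _ (f (suc n)) (f n) a b ∙ cong₂ _+_ (cong₂ (λ x y → x + a * y) (e (suc (suc n))) (qmul-cancel a b f h e (suc n))) (cong (λ z → - (b * z)) (qmul-cancel a b f h e n)) ∙ solve 5 (λ x y z a b → (x :+ :- (a :* y) :+ b :* z) :+ a :* y :+ :- (b :* z) := x) refl _ (h (suc n)) (h n) a b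

  logDeriv-div : ∀ a b σ φ χ → (∀ n → qmul a b φ n ≡ χ n) → LogDeriv σ χ → LogDeriv (λ n → σ n + lucas a b n) φ
  logDeriv-div a b σ φ χ e h = qmul-cancel a b _ _ λ n → (solve 2 (λ x y → x := (x :+ :- y) :+ y) refl _ _ ∙ cong₂ _+_ (sym (qmul-deriv a b φ n)) (sym (lucas-conv a b φ n)) ∙ cong (_+ conv (lucas a b) (qmul a b φ) n) (cong (nat n *_) (e n) ∙ h n ∙ conv-cong (λ _ → refl) (λ m → sym (e m)) n) ∙ sym (conv-+ˡ σ _ _ n) ∙ qmul-conv a b _ φ n)

  -- Clearing denominators: multiplied by (1-cz)(1-(c-g)z), the factor of a box becomes
  -- (1-cz)(1-(c-g)z) - ωz². A box is thus a quotient of two quadratics, and both have logarithmic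
  -- derivatives of the Lucas type.
  Ωz-qmul : ∀ ω c φ n → qmul (c + (c + - g)) (c * (c + - g)) (Ωz ω c φ) n ≡ qmul (c + (c + - g)) (c * (c + - g) + - ω) φ n
  Ωz-qmul ω c φ 0 = solve 5 (λ f w p a b → f :+ :- (w :* :0) :+ :- (p :* :0) :+ a :* :0 := f :+ :- (p :* :0) :+ b :* :0) refl (φ 0) ω (c + (c + - g)) _ _
  Ωz-qmul ω c φ 1 = solve 5 (λ f h w c d → f :+ :- (w :* (:0 :+ d :* :0)) :+ :- ((c :+ d) :* (h :+ :- (w :* :0))) :+ c :* d :* :0
      := f :+ :- ((c :+ d) :* h) :+ (c :* d :+ :- w) :* :0) refl (φ 1) (φ 0) ω c (c + - g)
  Ωz-qmul ω c φ (suc (suc n)) = solve 8 (λ p q r x y w c d →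
      p :+ :- (w :* (r :+ c :* x :+ d :* (x :+ d :* y))) :+ :- ((c :+ d) :* (q :+ :- (w :* (x :+ d :* y)))) :+ c :* d :* (r :+ :- (w :* y))
      := p :+ :- ((c :+ d) :* q) :+ (c :* d :+ :- w) :* r) refl (φ (suc (suc n))) (φ (suc n)) (φ n) (geo c φ n) (geo (c + - g) (geo c φ) n) ω c (c + - g)

  boxSeries : Carrier → Carrier → Seq
  boxSeries ω c n = lucas (c + (c + - g)) (c * (c + - g)) n + - lucas (c + (c + - g)) (c * (c + - g) + - ω) n

  totalSeries : List (Carrier × Carrier) → Seq
  totalSeries bs n = sumL R (map (λ { (ω , c) → boxSeries ω c n }) bs)

  logDeriv-Ωzs : ∀ bs σ φ → LogDeriv σ φ → LogDeriv (λ n → σ n + totalSeries bs n) (Ωzs bs φ)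
  logDeriv-Ωzs [] σ φ h n = h n ∙ conv-cong (λ m → sym (+-identityʳ _)) (λ _ → refl) n
  logDeriv-Ωzs ((ω , c) ∷ bs) σ φ h n = logDeriv-Ωzs bs _ (Ωz ω c φ) (logDeriv-div _ _ _ _ _ (Ωz-qmul ω c φ) (logDeriv-mul _ (c * (c + - g) + - ω) σ φ h)) n ∙
    conv-cong (λ m → solve 4 (λ s x y t → s :+ :- x :+ y :+ t := s :+ (y :+ :- x :+ t)) refl (σ m) _ _ _) (λ _ → refl) n

  -- The product starts at δ, whose logarithmic derivative is 0, and every box adds its own
  -- `boxSeries`. The coefficients of a product over boxes are so reduced to sums over boxes.
  newton : ∀ bs n → nat n * Ωzs bs δ n ≡ conv (totalSeries bs) (Ωzs bs δ) n
  newton bs n = logDeriv-Ωzs bs (λ _ → 0#) δ δ-deriv n ∙ conv-cong (λ _ → +-identityˡ _) (λ _ → refl) n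
    where
    δ-deriv : LogDeriv (λ _ → 0#) δ
    δ-deriv zero = cong (_* 1#) nat-0 ∙ refl
    δ-deriv (suc n) = zeroʳ _ ∙ sym (conv-0ˡ δ (suc n))

-- The logarithmic derivative of the partition series

module Recursion (W : World) where
  open World W
  open Solver alg
  open Columns alg g A α α-zero α-suc public
  open Newton alg g public

  -- A box in a row of height B, with preceding rows of total height β, has weight -AB and, in the
  -- first column, content β - g; each further column adds A. For B = -1/A and g = γ these are
  -- weight 1 and the content Ax - y/A.
  colBoxes : List Carrier → Carrier → List (Carrier × Carrier)
  colBoxes [] β = []
  colBoxes (B ∷ Bs) β = (- (A * B) , β + - g) ∷ colBoxes Bs (β + B)

  boxesOf : List (List Carrier) → List (Carrier × Carrier)
  boxesOf [] = []
  boxesOf (Bs ∷ cs) = colBoxes Bs 0# ++ map shiftBox (boxesOf cs)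

  partition : List (List Carrier) → Seq
  partition [] = δ
  partition (Bs ∷ cs) = C (sumL alg Bs) (partition cs)

  Z : Seq
  Z = partition cols

  bxs : List (Carrier × Carrier)
  bxs = boxesOf cols

  Z-zero : Z 0 ≡ 1#
  Z-zero = go cols
    where
    go : ∀ cs → partition cs 0 ≡ 1#
    go [] = refl
    go (Bs ∷ cs) = cong₂ (λ x y → x * (1# * y)) (go cs) α-zero ∙ solve 0 (:1 :* (:1 :* :1) := :1) refl

  Ωs-colBoxes : ∀ Bs β Y → All (λ B → B * (A + B + g) ≡ 0#) Bs → ∀ n → Ωs (colBoxes Bs β) (V β Y) n ≡ V (β + sumL alg Bs) Y n
  Ωs-colBoxes [] β Y [] n = cong (λ z → V z Y n) (sym (+-identityʳ β))
  Ωs-colBoxes (B ∷ Bs) β Y (c ∷ cs) n = Ωs-cong (colBoxes Bs (β + B)) (Ω-V β B c Y) n ∙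
    Ωs-colBoxes Bs (β + B) Y cs n ∙ cong (λ z → V z Y n) (+-assoc β B _)

  V-0 : ∀ Y n → V 0# Y n ≡ Y n
  V-0 Y n = solve 3 (λ y A x → y :+ A :* :0 :* x := y) refl (Y n) A _

  -- Column by column: the boxes of the first column multiply up to `V`, which turns `L` after `C`
  -- into `C` after `L`; the boxes of the other columns then pass under `C` and lose their shift by
  -- A, and induction applies.
  hypergeometric : ∀ n → Ωs bxs (L Z) n ≡ Z n
  hypergeometric = go cols cond
    where
    go : ∀ cs → All (All (λ B → B * (A + B + g) ≡ 0#)) cs → ∀ n → Ωs (boxesOf cs) (L (partition cs)) n ≡ partition cs n
    go [] [] zero = refl
    go [] [] (suc zero) = cong (λ x → 0# + - (g * x * 1#)) nat-0 ∙ solve 1 (λ g → :0 :+ :- (g :* :0 :* :1) := :0) refl g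
    go [] [] (suc (suc n)) = solve 2 (λ g k → :0 :+ :- (g :* k :* :0) := :0) refl g _
    go (Bs ∷ cs) (p ∷ ps) n = cong (λ f → f n) (Ωs-++ (colBoxes Bs 0#) _ (L Z')) ∙ Ωs-cong (map shiftBox (boxesOf cs)) (λ m → Ωs-cong (colBoxes Bs 0#) (λ k → sym (V-0 (L Z') k)) m ∙ Ωs-colBoxes Bs 0# (L Z') p m ∙ cong (λ z → V z (L Z') m) (+-identityˡ _) ∙ sym (C-V (sumL alg Bs) (partition cs) m)) n ∙ sym (C-Ωs (sumL alg Bs) (boxesOf cs) (L (partition cs)) n) ∙ C-cong (sumL alg Bs) (go cs ps) n
      where Z' = C (sumL alg Bs) (partition cs)

  -- For the world of a diagram, `f̂ n` will turn out to be F_n for n ≥ 1.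
  ê f̂ : Seq
  ê = Ωzs bxs δ
  f̂ = quot (λ n → - (g * deriv Z n)) Z

  -- The series κ⁻ʲLZ divided by Z. `hypergeometric` is linear in Z, whereas `f̂` is a quotient;
  -- after this division the powers of 1/κ obey a recursion in which Z occurs through `f̂` alone.
  π : ℕ → Seq
  π j = quot (pw j (L Z)) Z

  f̂-Z : ∀ n → conv f̂ Z n ≡ - (g * deriv Z n)
  f̂-Z = quot-correct _ Z Z-zero

  f̂-zero : f̂ 0 ≡ 0#
  f̂-zero = cong (λ x → - (g * (x * Z 0))) nat-0 ∙ solve 2 (λ g z → :- (g :* (:0 :* z)) := :0) refl g (Z 0)

  π-Z : ∀ j n → conv (π j) Z n ≡ pw j (L Z) n
  π-Z j = quot-correct _ Z Z-zero

  π-zero : ∀ n → π 0 n ≡ δ n + sh f̂ n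
  π-zero = conv-cancel _ _ Z Z-zero λ n → π-Z 0 n ∙ sym (conv-+ˡ δ (sh f̂) Z n ∙ cong₂ _+_ (conv-δˡ Z n) (conv-shˡ f̂ Z n ∙ sh-cong f̂-Z n) ∙ h n)
    where
    h : ∀ n → Z n + sh (λ n → - (g * deriv Z n)) n ≡ L Z n
    h zero = +-identityʳ _
    h (suc n) = cong (λ x → Z (suc n) + - x) (sym (*-assoc g (nat n) (Z n)))

  π-low : ∀ j n → n ℕ.< j → π j n ≡ 0#
  π-low j n p = quot-vanish (pw j (L Z)) Z n (λ i i≤n → pw-low j (L Z) i (≤-<-trans i≤n p))

  -- The relation κ · κ⁻ʲ⁻¹LZ = κ⁻ʲLZ divided by Z. The derivative contained in κ acts on the
  -- product of `π (suc j)` and Z by Leibniz's rule, and -g times the derivative of Z is the product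
  -- of `f̂` and Z.
  π-step : ∀ j m → π (suc j) (suc m) ≡ g * nat m * π (suc j) m + - conv f̂ (π (suc j)) m + π j m
  π-step j m = solve 3 (λ x y z → x := y :+ :- z :+ (x :+ (:- y) :+ z)) refl (P (suc m)) (g * nat m * P m) (conv f̂ P m) ∙ cong (g * nat m * P m + - conv f̂ P m +_) (conv-cancel X (π j) Z Z-zero h m)
    where
    P = π (suc j)
    X : Seq
    X m = P (suc m) + - (g * nat m * P m) + conv f̂ P m
    P0 : P 0 ≡ 0#
    P0 = refl
    h : ∀ m → conv X Z m ≡ conv (π j) Z m
    h m = conv-+ˡ _ _ Z m ∙ cong₂ _+_ (conv-cong (λ k → solve 4 (λ p g n q → p :+ :- (g :* n :* q) := p :+ :- g :* (n :* q)) refl _ g (nat k) _) (λ _ → refl) m ∙ conv-+ˡ _ _ Z m ∙ cong (conv (tail P) Z m +_) (conv-*ˡ (- g) (deriv P) Z m)) (conv-cong (conv-comm f̂ P) (λ _ → refl) m ∙ conv-assoc P f̂ Z m ∙ conv-cong (λ _ → refl) (λ k → f̂-Z k ∙ solve 2 (λ g x → :- (g :* x) := :- g :* x) refl g _) m ∙ conv-*ʳ (- g) P (deriv Z) m) ∙ solve 4 (λ t g x y → t :+ :- g :* x :+ :- g :* y := t :+ :- (g :* (x :+ y))) refl _ g _ _ ∙ cong₂ (λ x y → x + - (g * y)) (sym (cong (λ x → x * Z (suc m) + conv (tail P) Z m) P0 ∙ solve 2 (λ z x → :0 :* z :+ x := x) refl _ _)) (sym (deriv-conv P Z m)) ∙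 cong₂ (λ x y → x + - (g * (nat m * y))) (π-Z (suc j) (suc m)) (π-Z (suc j) m) ∙ cong (λ x → pw (suc j) (L Z) (suc m) + - x) (sym (*-assoc _ _ _)) ∙ κ-pw j (L Z) m ∙ sym (π-Z j m)

  ê-zero : ê 0 ≡ 1#
  ê-zero = go bxs δ refl
    where
    go : ∀ bs φ → φ 0 ≡ 1# → Ωzs bs φ 0 ≡ 1#
    go [] φ h = h
    go ((ω , c) ∷ bs) φ h = go bs _ (cong (_+ - (ω * 0#)) h ∙ solve 1 (λ w → :1 :+ :- (w :* :0) := :1) refl ω)

  -- `hypergeometric` with the box factors expanded in powers of 1/κ, divided by Z. Terms with j > n
  -- vanish by `π-low`, which allows a common range of summation for all coefficients of the
  -- convolution.
  ê-π : ∀ n → sumTo (λ j → ê j * π j n) n ≡ δ n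
  ê-π = conv-cancel χ δ Z Z-zero λ n → (dsum-cong′ n (λ i k e → cong (_* Z k) (sym (cong (sumTo (λ j → ê j * π j i)) (sym e ∙ ℕₚ.+-comm i k) ∙ sumTo-extend _ i k (λ j i<j → cong (ê j *_) (π-low j i i<j) ∙ zeroʳ _)))) ∙ conv-sumTo ê π Z n n ∙ sumTo-cong n (λ j _ → cong (ê j *_) (π-Z j n)) ∙ sym (Ωs-act bxs δ (L Z) n) ∙ Ωs-cong bxs (act-δ (L Z)) n ∙ hypergeometric n ∙ sym (conv-δˡ Z n))
    where
    χ : Seq
    χ n = sumTo (λ j → ê j * π j n) n

  -- The coefficient of `ê-π` at m + 1. Its term j = 0 is `f̂ m`, because `ê 0` is 1 and `π 0` is 1
  -- plus the shifted `f̂`.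
  f̂-recursion : ∀ m → f̂ m ≡ - sumTo (λ j → ê (suc j) * π (suc j) (suc m)) m
  f̂-recursion m = solve 2 (λ f s → f := (:1 :* (:0 :+ f) :+ s) :+ :- s) refl (f̂ m) S ∙ cong₂ (λ x y → x * y + S + - S) (sym ê-zero) (sym (π-zero (suc m))) ∙ cong (_+ - S) (sym (sumTo-first (λ j → ê j * π j (suc m)) m) ∙ ê-π (suc m)) ∙ +-identityˡ _
    where S = sumTo (λ j → ê (suc j) * π (suc j) (suc m)) m

-- Finite sums and weighted polynomials

module Sums (R : Alg) where
  open Ring R

  Σ# : List Carrier → Carrier
  Σ# = sumL R

  ΣL : {X : Set} → (X → Carrier) → List X → Carrier
  ΣL f xs = Σ# (map f xs)

  ΣL-cong : ∀ {X : Set} {f h : X → Carrier} → (∀ x → f x ≡ h x) → ∀ xs → ΣL f xs ≡ ΣL h xs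
  ΣL-cong e [] = refl
  ΣL-cong e (x ∷ xs) = cong₂ _+_ (e x) (ΣL-cong e xs)

  ΣL-congAll : ∀ {X : Set} {f h : X → Carrier} {P : X → Set} → (∀ x → P x → f x ≡ h x) → ∀ {xs} → All P xs → ΣL f xs ≡ ΣL h xs
  ΣL-congAll e [] = refl
  ΣL-congAll e (p ∷ ps) = cong₂ _+_ (e _ p) (ΣL-congAll e ps)

  ΣL-++ : ∀ {X : Set} (f : X → Carrier) xs ys → ΣL f (xs ++ ys) ≡ ΣL f xs + ΣL f ys
  ΣL-++ f [] ys = sym (+-identityˡ _)
  ΣL-++ f (x ∷ xs) ys = cong (f x +_) (ΣL-++ f xs ys) ∙ sym (+-assoc _ _ _)

  ΣL-+ : ∀ {X : Set} (f h : X → Carrier) xs → ΣL (λ x → f x + h x) xs ≡ ΣL f xs + ΣL h xs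
  ΣL-+ f h [] = sym (+-identityˡ _)
  ΣL-+ f h (x ∷ xs) = cong (f x + h x +_) (ΣL-+ f h xs) ∙
    solve 4 (λ a b c d → (a :+ b) :+ (c :+ d) := (a :+ c) :+ (b :+ d)) refl _ _ _ _

  ΣL-* : ∀ {X : Set} c (f : X → Carrier) xs → ΣL (λ x → c * f x) xs ≡ c * ΣL f xs
  ΣL-* c f [] = sym (zeroʳ c)
  ΣL-* c f (x ∷ xs) = cong (c * f x +_) (ΣL-* c f xs) ∙ sym (distribˡ _ _ _)

  ΣL-*ʳ : ∀ {X : Set} c (f : X → Carrier) xs → ΣL (λ x → f x * c) xs ≡ ΣL f xs * c
  ΣL-*ʳ c f xs = ΣL-cong (λ x → *-comm _ _) xs ∙ ΣL-* c f xs ∙ *-comm _ _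

  ΣL-0 : ∀ {X : Set} (xs : List X) → ΣL (λ _ → 0#) xs ≡ 0#
  ΣL-0 [] = refl
  ΣL-0 (x ∷ xs) = +-identityˡ _ ∙ ΣL-0 xs

  ΣL-map : ∀ {X Y : Set} (f : Y → Carrier) (k : X → Y) xs → ΣL f (map k xs) ≡ ΣL (λ x → f (k x)) xs
  ΣL-map f k [] = refl
  ΣL-map f k (x ∷ xs) = cong (f (k x) +_) (ΣL-map f k xs)

  ΣL-concatMap : ∀ {X Y : Set} (f : Y → Carrier) (k : X → List Y) xs → ΣL f (List.concatMap k xs) ≡ ΣL (λ x → ΣL f (k x)) xs
  ΣL-concatMap f k [] = refl
  ΣL-concatMap f k (x ∷ xs) = ΣL-++ f (k x) _ ∙ cong (ΣL f (k x) +_) (ΣL-concatMap f k xs)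

  ΣL-swap : ∀ {X Y : Set} (f : X → Y → Carrier) xs ys → ΣL (λ x → ΣL (f x) ys) xs ≡ ΣL (λ y → ΣL (λ x → f x y) xs) ys
  ΣL-swap f [] ys = sym (ΣL-0 ys)
  ΣL-swap f (x ∷ xs) ys = cong (ΣL (f x) ys +_) (ΣL-swap f xs ys) ∙ sym (ΣL-+ _ _ ys)

  Π# : {X : Set} → (X → Carrier) → List X → Carrier
  Π# f [] = 1#
  Π# f (x ∷ xs) = f x * Π# f xs

  Π#-++ : ∀ {X : Set} (f : X → Carrier) xs ys → Π# f (xs ++ ys) ≡ Π# f xs * Π# f ys
  Π#-++ f [] ys = sym (*-identityˡ _)
  Π#-++ f (x ∷ xs) ys = cong (f x *_) (Π#-++ f xs ys) ∙ sym (*-assoc _ _ _)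

  ^#-+ : ∀ x m n → x ^# (m ℕ.+ n) ≡ (x ^# m) * (x ^# n)
  ^#-+ x zero n = sym (*-identityˡ _)
  ^#-+ x (suc m) n = cong (x *_) (^#-+ x m n) ∙ sym (*-assoc _ _ _)

record Monomial (X : Set) : Set where
  constructor mono
  field
    coef : ℚ
    gpow : ℕ
    fac : List X
open Monomial public

weight : {X : Set} → (X → ℕ) → List X → ℕ
weight w = foldr (λ x n → w x ℕ.+ n) 0

weight-++ : ∀ {X : Set} (w : X → ℕ) xs ys → weight w (xs ++ ys) ≡ weight w xs ℕ.+ weight w ys
weight-++ w [] ys = refl
weight-++ w (x ∷ xs) ys = cong (w x ℕ.+_) (weight-++ w xs ys) ∙ sym (ℕₚ.+-assoc (w x) _ _)

degree : {X : Set} → (X → ℕ) → Monomial X → ℕ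
degree w m = gpow m ℕ.+ weight w (fac m)

module Evaluation (R : Alg) where
  open Ring R
  open Sums R

  evalM : {X : Set} → Carrier → (X → Carrier) → Monomial X → Carrier
  evalM g T m = ι (coef m) * ((g ^# gpow m) * Π# T (fac m))

  evalP : {X : Set} → Carrier → (X → Carrier) → List (Monomial X) → Carrier
  evalP g T = ΣL (evalM g T)

mulM : {X : Set} → Monomial X → Monomial X → Monomial X
mulM m m' = mono (coef m ℚ.* coef m') (gpow m ℕ.+ gpow m') (fac m ++ fac m')

mulP : {X : Set} → List (Monomial X) → List (Monomial X) → List (Monomial X)
mulP U V = List.concatMap (λ m → map (mulM m) V) U

module EvaluationProperties (R : Alg) {X : Set} (g : Alg.Carrier R) (T : X → Alg.Carrier R) where
  open Ring R
  open Sums R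
  open Evaluation R

  evalM-mul : ∀ m m' → evalM g T (mulM m m') ≡ evalM g T m * evalM g T m'
  evalM-mul m m' = cong₂ _*_ (ι-* _ _) (cong₂ _*_ (^#-+ g (gpow m) (gpow m')) (Π#-++ T (fac m) (fac m'))) ∙
    solve 6 (λ a b c d e f → (a :* b) :* ((c :* d) :* (e :* f)) := (a :* (c :* e)) :* (b :* (d :* f))) refl _ _ _ _ _ _

  evalP-mul : ∀ U V → evalP g T (mulP U V) ≡ evalP g T U * evalP g T V
  evalP-mul U V = ΣL-concatMap _ _ U ∙ ΣL-cong (λ m → ΣL-map _ _ V ∙ ΣL-cong (evalM-mul m) V ∙ ΣL-* _ _ V) U ∙ ΣL-*ʳ _ _ U

degree-mul : ∀ {X : Set} (w : X → ℕ) m m' → degree w (mulM m m') ≡ degree w m ℕ.+ degree w m'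
degree-mul w m m' = cong (gpow m ℕ.+ gpow m' ℕ.+_) (weight-++ w (fac m) (fac m')) ∙ lem (gpow m) (gpow m') _ _
  where
  open import Data.Nat.Tactic.RingSolver
  lem : ∀ a b c d → a ℕ.+ b ℕ.+ (c ℕ.+ d) ≡ a ℕ.+ c ℕ.+ (b ℕ.+ d)
  lem = solve-∀

module Representation {X : Set} (w : X → ℕ) (I : Set₁) (alg : I → Alg)
  (g : ∀ i → Alg.Carrier (alg i)) (T : ∀ i → X → Alg.Carrier (alg i)) where

  private module A i = Alg (alg i)

  -- φ is given, uniformly in i, by a polynomial all of whose monomials have degree b - a.
  Rep : ℕ → ℕ → (∀ i → A.Carrier i) → Set₁
  Rep a b φ = Σ (List (Monomial X)) λ U → All (λ m → degree w m ℕ.+ a ≡ b) U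
    × (∀ i → φ i ≡ Evaluation.evalP (alg i) (g i) (T i) U)

  rep-cong : ∀ {a b φ ψ} → (∀ i → φ i ≡ ψ i) → Rep a b ψ → Rep a b φ
  rep-cong e (U , d , h) = U , d , λ i → e i ∙ h i

  rep-resp : ∀ {a b a' b' φ} → (∀ d → d ℕ.+ a ≡ b → d ℕ.+ a' ≡ b') → Rep a b φ → Rep a' b' φ
  rep-resp e (U , d , h) = U , All.map (e _) d , h

  rep-0 : ∀ {a b} → Rep a b (λ i → A.0# i)
  rep-0 = [] , [] , λ i → refl

  rep-const : ∀ {a} q → Rep a a (λ i → A.ι i q)
  rep-const q = mono q 0 [] ∷ [] , refl ∷ [] , λ i → let open Ring (alg i) in
    solve 1 (λ q → q := q :* (:1 :* :1) :+ :0) refl (ι q)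

  rep-g : ∀ {a} → Rep a (suc a) g
  rep-g = mono 1ℚ 1 [] ∷ [] , refl ∷ [] , λ i → let open Ring (alg i) in
    solve 1 (λ x → x := :1 :* (x :* :1 :* :1) :+ :0) refl (g i) ∙ cong (λ z → z * (g i * 1# * 1#) + 0#) (sym ι-1)

  rep-T : ∀ {a} x → Rep a (w x ℕ.+ a) (λ i → T i x)
  rep-T {a} x = mono 1ℚ 0 (x ∷ []) ∷ [] , cong (ℕ._+ a) (ℕₚ.+-identityʳ (w x)) ∷ [] , λ i → let open Ring (alg i) in
    solve 1 (λ x → x := :1 :* (:1 :* (x :* :1)) :+ :0) refl (T i x) ∙ cong (λ z → z * (1# * (T i x * 1#)) + 0#) (sym ι-1)

  rep-+ : ∀ {a b φ ψ} → Rep a b φ → Rep a b ψ → Rep a b (λ i → A._+_ i (φ i) (ψ i))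
  rep-+ (U , d , h) (U' , d' , h') = U ++ U' , Allₚ.++⁺ d d' , λ i →
    cong₂ (A._+_ i) (h i) (h' i) ∙ sym (Sums.ΣL-++ (alg i) _ U U')

  rep-* : ∀ {a b a' b' φ ψ} → Rep a b φ → Rep a' b' ψ → Rep (a ℕ.+ a') (b ℕ.+ b') (λ i → A._*_ i (φ i) (ψ i))
  rep-* {a} {b} {a'} {b'} (U , d , h) (U' , d' , h') = mulP U U' ,
    Allₚ.concat⁺ (Allₚ.map⁺ (All.map (λ {m} e → Allₚ.map⁺ (All.map (λ {m'} e' → cong (ℕ._+ (a ℕ.+ a')) (degree-mul w m m') ∙
      lem (degree w m) (degree w m') a a' ∙ cong₂ ℕ._+_ e e') d')) d)) ,
    λ i → cong₂ (A._*_ i) (h i) (h' i) ∙ sym (EvaluationProperties.evalP-mul (alg i) (g i) (T i) U U')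
    where
    open import Data.Nat.Tactic.RingSolver
    lem : ∀ m m' a a' → m ℕ.+ m' ℕ.+ (a ℕ.+ a') ≡ m ℕ.+ a ℕ.+ (m' ℕ.+ a')
    lem = solve-∀

  rep-scale : ∀ {a b φ} q → Rep a b φ → Rep a b (λ i → A._*_ i (A.ι i q) (φ i))
  rep-scale q r = rep-* (rep-const {0} q) r

  rep-neg : ∀ {a b φ} → Rep a b φ → Rep a b (λ i → A.-_ i (φ i))
  rep-neg {φ = φ} r = rep-cong (λ i → let open Ring (alg i) in
    solve 1 (λ x → :- x := :- :1 :* x) refl (φ i) ∙ cong (_* φ i) ((cong -_ (sym ι-1)) ∙ sym (ι-neg 1ℚ))) (rep-scale (ℚ.- 1ℚ) r)

  rep-dsum : ∀ {a b} n (t : ∀ i → ℕ → ℕ → A.Carrier i) → (∀ j k → j ℕ.+ k ≡ n → Rep a b (λ i → t i j k)) → Rep a b (λ i → Series.dsum (alg i) (t i) n)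
  rep-dsum zero t h = h 0 0 refl
  rep-dsum (suc n) t h = rep-+ (h 0 (suc n) refl) (rep-dsum n (λ i j k → t i (suc j) k) (λ j k e → h (suc j) k (cong suc e)))

  rep-sumTo : ∀ {a b} n (t : ∀ i → ℕ → A.Carrier i) → (∀ j → j ℕ.≤ n → Rep a b (λ i → t i j)) → Rep a b (λ i → Series.sumTo (alg i) (t i) n)
  rep-sumTo zero t h = h 0 z≤n
  rep-sumTo (suc n) t h = rep-+ (rep-sumTo n t (λ j p → h j (m≤n⇒m≤1+n p))) (h (suc n) ≤-refl)

record BoxCtx : Set₁ where
  field
    ring : Alg
    g ω c : Alg.Carrier ring

data Var : Set where
  ω′ c′ : Var

varWeight : Var → ℕ
varWeight ω′ = 2
varWeight c′ = 1

varValue : (i : BoxCtx) → Var → Alg.Carrier (BoxCtx.ring i)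
varValue i ω′ = BoxCtx.ω i
varValue i c′ = BoxCtx.c i

module BoxPolynomials where
  open Representation varWeight BoxCtx BoxCtx.ring BoxCtx.g varValue public

  private
    module N (i : BoxCtx) = Newton (BoxCtx.ring i) (BoxCtx.g i)
    module A (i : BoxCtx) where
      open Ring (BoxCtx.ring i) public
      open BoxCtx i public
      e₁ e₂ : Carrier
      e₁ = c + (c + - g)
      e₂ = c * (c + - g)

  rep-e₁ : ∀ {a} → Rep a (suc a) A.e₁
  rep-e₁ = rep-+ (rep-T c′) (rep-+ (rep-T c′) (rep-neg rep-g))

  rep-e₂ : Rep 0 2 A.e₂
  rep-e₂ = rep-* (rep-T {0} c′) (rep-+ (rep-T {0} c′) (rep-neg rep-g))

  rep-lucas : ∀ n → Rep 0 n (λ i → let open A i in N.lucas i e₁ (e₂ + - ω) n)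
  rep-lucas 0 = rep-0
  rep-lucas 1 = rep-e₁
  rep-lucas 2 = rep-+ (rep-* (rep-e₁ {0}) (rep-e₁ {0})) (rep-neg (rep-+ r r))
    where r = rep-+ rep-e₂ (rep-neg (rep-T {0} ω′))
  rep-lucas (suc (suc (suc n))) = rep-+ (rep-* (rep-e₁ {0}) (rep-lucas (suc (suc n))))
    (rep-neg (rep-* (rep-+ rep-e₂ (rep-neg (rep-T {0} ω′))) (rep-lucas (suc n))))

  -- `boxSeries` is a difference of Lucas series whose parameters agree at ω = 0, hence a multiple
  -- of ω; this is the quotient. Thanks to the extracted ω every power sum carries at least one
  -- factor ω, so that rows of height 0 contribute nothing.
  reduced : (i : BoxCtx) → ℕ → A.Carrier i
  reduced i 0 = A.0# i
  reduced i 1 = A.0# i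
  reduced i 2 = let open A i in - (1# + 1#)
  reduced i (suc (suc (suc n))) = let open A i in
    e₁ * reduced i (suc (suc n)) + - (e₂ * reduced i (suc n)) + - N.lucas i e₁ (e₂ + - ω) (suc n)

  rep-1 : ∀ {a} → Rep a a (λ i → A.1# i)
  rep-1 = rep-cong (λ i → sym (A.ι-1 i)) (rep-const 1ℚ)

  rep-reduced : ∀ n → Rep 2 n (λ i → reduced i n)
  rep-reduced 0 = rep-0
  rep-reduced 1 = rep-0
  rep-reduced 2 = rep-neg (rep-+ rep-1 rep-1)
  rep-reduced (suc (suc (suc n))) = rep-+ (rep-+ (rep-* (rep-e₁ {0}) (rep-reduced (suc (suc n))))
    (rep-neg (rep-* rep-e₂ (rep-reduced (suc n)))))
    (rep-neg (rep-resp {0} {suc n} (λ d e → ℕₚ.+-comm d 2 ∙ cong (λ x → suc (suc x)) (sym (ℕₚ.+-identityʳ d) ∙ e)) (rep-lucas (suc n))))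

  boxSeries-reduced : ∀ i n → let open A i in N.boxSeries i ω c n ≡ ω * reduced i n
  boxSeries-reduced i 0 = let open A i in solve 1 (λ w → :0 :+ :- :0 := w :* :0) refl ω
  boxSeries-reduced i 1 = let open A i in solve 2 (λ e w → e :+ :- e := w :* :0) refl e₁ ω
  boxSeries-reduced i 2 = let open A i in
    solve 3 (λ e f w → e :* e :+ :- (f :+ f) :+ :- (e :* e :+ :- (f :+ :- w :+ (f :+ :- w))) := w :* :- (:1 :+ :1)) refl e₁ e₂ ω
  boxSeries-reduced i (suc (suc (suc n))) = let open A i in (solve 7 (λ e f w a b x y → e :* a :+ :- (f :* b) :+ :- (e :* x :+ :- ((f :+ :- w) :* y)) := e :* (a :+ :- x) :+ :- (f :* (b :+ :- y)) :+ :- (w :* y)) refl e₁ e₂ ω _ _ _ _ ∙ cong₂ (λ x y → e₁ * x + - (e₂ * y) + - (ω * N.lucas i e₁ (e₂ + - ω) (suc n))) (boxSeries-reduced i (suc (suc n))) (boxSeries-reduced i (suc n)) ∙ solve 6 (λ e f w a b y → e :* (w :* a) :+ :- (f :* (w :* b)) :+ :- (w :* y) := w :* (e :* a :+ :- (f :* b) :+ :- y)) refl e₁ e₂ ω _ _ _)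

-- The label (e , m) stands for the power sum Σ ω^{m+1} c^e over the boxes.
powerWeight : ℕ × ℕ → ℕ
powerWeight (e , m) = e ℕ.+ 2 ℕ.* suc m

powerSum : (R : Alg) → List (Alg.Carrier R × Alg.Carrier R) → ℕ × ℕ → Alg.Carrier R
powerSum R bs (e , m) = Sums.ΣL R (λ { (ω , c) → Alg._*_ R (Alg._^#_ R ω (suc m)) (Alg._^#_ R c e) }) bs

-- The universal polynomial for the coefficients of f̂

module Universal where
  private module W (W : World) where
    open World W public hiding (alg)
    open Solver (World.alg W) public
    open Recursion W public using (bxs; ê; f̂; π; δ; sh; conv; sumTo; π-zero; π-low; π-step; ê-zero; f̂-recursion; totalSeries; newton; f̂-zero)
  open Representation powerWeight World World.alg World.g (λ W → powerSum (World.alg W) (W.bxs W)) public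

  count′ : List Var → ℕ × ℕ
  count′ [] = 0 , 0
  count′ (ω′ ∷ vs) = let (e , m) = count′ vs in e , suc m
  count′ (c′ ∷ vs) = let (e , m) = count′ vs in suc e , m

  promote : Monomial Var → Monomial (ℕ × ℕ)
  promote m = mono (coef m) (gpow m) (count′ (fac m) ∷ [])

  count-weight : ∀ vs → powerWeight (count′ vs) ≡ weight varWeight vs ℕ.+ 2
  count-weight [] = refl
  count-weight (ω′ ∷ vs) = lem _ _ ∙ cong (2 ℕ.+_) (count-weight vs)
    where
    open import Data.Nat.Tactic.RingSolver
    lem : ∀ e m → e ℕ.+ 2 ℕ.* suc (suc m) ≡ 2 ℕ.+ (e ℕ.+ 2 ℕ.* suc m)
    lem = solve-∀
  count-weight (c′ ∷ vs) = cong suc (count-weight vs)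

  module _ (R : Alg) (g : Alg.Carrier R) where
    open Ring R
    open Sums R
    open Evaluation R

    ctx : Carrier × Carrier → BoxCtx
    ctx (ω , c) = record { ring = R ; g = g ; ω = ω ; c = c }

    Π-count : ∀ ω c vs → ω * Π# (varValue (ctx (ω , c))) vs ≡ (ω ^# suc (proj₂ (count′ vs))) * (c ^# proj₁ (count′ vs))
    Π-count ω c [] = solve 1 (λ w → w :* :1 := w :* :1 :* :1) refl ω
    Π-count ω c (ω′ ∷ vs) = cong (ω *_) (Π-count ω c vs) ∙ sym (*-assoc _ _ _)
    Π-count ω c (c′ ∷ vs) = solve 3 (λ w c p → w :* (c :* p) := c :* (w :* p)) refl ω c _ ∙ cong (c *_) (Π-count ω c vs) ∙
      solve 3 (λ c w p → c :* (w :* p) := w :* (c :* p)) refl c _ _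

    evalP-promote : ∀ bs U → ΣL (λ b → proj₁ b * evalP g (varValue (ctx b)) U) bs ≡ evalP g (powerSum R bs) (map promote U)
    evalP-promote bs U = ΣL-cong (λ b → sym (ΣL-* (proj₁ b) _ U)) bs ∙ ΣL-swap _ bs U ∙ ΣL-cong one U ∙ sym (ΣL-map _ promote U)
      where
      one : ∀ m → ΣL (λ b → proj₁ b * evalM g (varValue (ctx b)) m) bs ≡ evalM g (powerSum R bs) (promote m)
      one m = ΣL-cong (λ b → solve 4 (λ w k p x → w :* (k :* (p :* x)) := k :* p :* (w :* x)) refl (proj₁ b) _ _ _ ∙ cong (ι (coef m) * (g ^# gpow m) *_) (Π-count (proj₁ b) (proj₂ b) (fac m))) bs ∙ ΣL-* _ _ bs ∙ solve 3 (λ k p x → k :* p :* x := k :* (p :* (x :* :1))) refl _ _ _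

  rep-totalSeries : ∀ n → Rep 0 n (λ W → W.totalSeries W (W.bxs W) n)
  rep-totalSeries n with BoxPolynomials.rep-reduced n
  ... | U , d , h = map promote U ,
    Allₚ.map⁺ (All.map (λ {m} e → ℕₚ.+-identityʳ _ ∙ cong (gpow m ℕ.+_) (ℕₚ.+-identityʳ _ ∙ count-weight (fac m)) ∙ sym (ℕₚ.+-assoc (gpow m) _ 2) ∙ e) d) ,
    λ W → Sums.ΣL-cong (World.alg W) (λ b → BoxPolynomials.boxSeries-reduced (ctx (World.alg W) (World.g W) b) n ∙ cong (World._*_ W _) (h _)) (W.bxs W) ∙
      evalP-promote (World.alg W) (World.g W) (W.bxs W) U

  totalSeries-0 : ∀ W → W.totalSeries W (W.bxs W) 0 ≡ World.0# W
  totalSeries-0 W = Sums.ΣL-cong (World.alg W) (λ _ → World.-‿inverseʳ W _) (W.bxs W) ∙ Sums.ΣL-0 (World.alg W) (W.bxs W)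

  rep-ê : ∀ n k → k ℕ.≤ n → Rep 0 k (λ W → W.ê W k)
  rep-ê n zero p = rep-cong (λ W → W.ê-zero W ∙ sym (World.ι-1 W)) (rep-const 1ℚ)
  rep-ê (suc n) (suc k) (s≤s p) = rep-cong
    (λ W → let open W W in solve 1 (λ x → x := :1 :* x) refl (ê (suc k)) ∙
      cong (_* ê (suc k)) (sym (sym (ι-* _ _) ∙ cong ι (1/ℕ-inverse k) ∙ ι-1)) ∙
        *-assoc _ _ _ ∙ cong (ι (1/ℕ k) *_) (newton bxs (suc k)))
    (rep-scale (1/ℕ k) (rep-dsum (suc k) (λ W i j → World._*_ W _ _) term))
    where
    term : ∀ i j → i ℕ.+ j ≡ suc k → Rep 0 (suc k) (λ W → World._*_ W (W.totalSeries W (W.bxs W) i) (W.ê W j))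
    -- This term contains `ê (suc k)` itself, but its other factor is 0.
    term zero j e = rep-cong (λ W → cong (λ x → World._*_ W x (W.ê W j)) (totalSeries-0 W) ∙ World.zeroˡ W _) rep-0
    term (suc i) j e = rep-resp (λ d q → q ∙ e) (rep-* (rep-totalSeries (suc i)) (rep-ê n j (≤-trans (ℕₚ.m+n≤o⇒n≤o i (≤-reflexive (suc-injective e))) p)))

  private
    -- Induction on the index for `f̂` and all `π j` together. The system is triangular: `f̂ n`
    -- needs `π (suc j) (suc n)`, which needs `f̂ i` for i < n.
    Known : ℕ → Set₁
    Known n = (∀ i → i ℕ.< n → Rep 0 (suc i) (λ W → W.f̂ W i)) × (∀ k → k ℕ.≤ n → ∀ j → Rep j k (λ W → W.π W j k))

    step : ∀ n → Known n → ∀ j → Rep (suc j) (suc n) (λ W → W.π W (suc j) (suc n))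
    step n (F , P) j = rep-cong (λ W → W.π-step W j n)
      (rep-+ (rep-+ (rep-cong (λ W → let open W W in solve 3 (λ g n p → g :* n :* p := n :* (g :* p)) refl g (nat n) _)
                (rep-scale (ratℕ n) (rep-* (rep-g {0}) (P n ≤-refl (suc j)))))
              (rep-neg (rep-dsum n (λ W i k → World._*_ W _ _) term)))
        (rep-resp (λ d e → ℕₚ.+-suc d j ∙ cong suc e) (P n ≤-refl j)))
      where
      term : ∀ i k → i ℕ.+ k ≡ n → Rep (suc j) (suc n) (λ W → World._*_ W (W.f̂ W i) (W.π W (suc j) k))
      -- Here i = n, and `f̂ n` is not yet known; the term vanishes because `π (suc j)` has no
      -- constant coefficient.
      term i zero e = rep-cong (λ W → World.zeroʳ W _) rep-0
      term i (suc k) e = rep-resp (λ d q → q ∙ cong suc e)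
        (rep-* (F i (subst (suc i ℕ.≤_) e (subst (ℕ._≤ i ℕ.+ suc k) (ℕₚ.+-comm i 1) (ℕₚ.+-monoʳ-≤ i (s≤s z≤n)))))
               (P (suc k) (subst (suc k ℕ.≤_) e (m≤n+m (suc k) i)) (suc j)))

    known : ∀ n → Known n
    known zero = (λ _ ()) , λ { .zero z≤n zero → rep-cong (λ W → W.π-zero W 0 ∙ World.+-identityʳ W _ ∙ sym (World.ι-1 W)) (rep-const 1ℚ)
                              ; .zero z≤n (suc j) → rep-0 }
    known (suc n) = F' , P'
      where
      K = known n
      f-n : Rep 0 (suc n) (λ W → W.f̂ W n)
      f-n = rep-cong (λ W → W.f̂-recursion W n) (rep-neg (rep-sumTo n (λ W j → World._*_ W _ _) λ j p →
        rep-resp (λ d e → ℕₚ.+-cancelʳ-≡ (suc j) _ _ (cong (ℕ._+ suc j) (ℕₚ.+-identityʳ d) ∙ e ∙ ℕₚ.+-comm (suc j) (suc n)))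
          (rep-* (rep-ê (suc j) (suc j) ≤-refl) (step n K j))))
      F' : ∀ i → i ℕ.< suc n → Rep 0 (suc i) (λ W → W.f̂ W i)
      F' i (s≤s p) with i ℕ.≟ n
      ... | yes refl = f-n
      ... | no i≢n = proj₁ K i (≤∧≢⇒< p i≢n)
      P' : ∀ k → k ℕ.≤ suc n → ∀ j → Rep j k (λ W → W.π W j k)
      P' k p j with k ℕ.≟ suc n
      ... | no k≢ = proj₂ K k (≤-pred (≤∧≢⇒< p k≢)) j
      P' k p (suc j) | yes refl = step n K j
      P' k p zero | yes refl = rep-cong (λ W → W.π-zero W (suc n) ∙ World.+-identityˡ W _) f-n

  rep-f̂ : ∀ n → Rep 0 (suc n) (λ W → W.f̂ W n)
  rep-f̂ n = proj₁ (known (suc n)) n ≤-refl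

-- Boolean tests, cycles of permutations and their number

true≢false : true ≢ false
true≢false ()

bool-ext : ∀ {a b} → (a ≡ true → b ≡ true) → (b ≡ true → a ≡ true) → a ≡ b
bool-ext {true} f g = sym (f refl)
bool-ext {false} {true} f g = g refl
bool-ext {false} {false} f g = refl

∧-split : ∀ {a b} → a ∧ b ≡ true → a ≡ true × b ≡ true
∧-split {true} {true} _ = refl , refl

∧-intro : ∀ {a b} → a ≡ true → b ≡ true → a ∧ b ≡ true
∧-intro refl refl = refl

and-elim : ∀ {X : Set} (p : X → Bool) xs → and (map p xs) ≡ true → ∀ {x} → x ∈ xs → p x ≡ true
and-elim p (x ∷ xs) h (here refl) = proj₁ (∧-split h)
and-elim p (x ∷ xs) h (there m) = and-elim p xs (proj₂ (∧-split {p x} h)) m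

and-intro : ∀ {X : Set} (p : X → Bool) xs → (∀ {x} → x ∈ xs → p x ≡ true) → and (map p xs) ≡ true
and-intro p [] h = refl
and-intro p (x ∷ xs) h = ∧-intro (h (here refl)) (and-intro p xs (h ∘ there))

or-elim : ∀ {X : Set} (p : X → Bool) xs → or (map p xs) ≡ true → ∃ λ x → x ∈ xs × p x ≡ true
or-elim p (x ∷ xs) h with p x in e
... | true = x , here refl , e
... | false = let (y , m , q) = or-elim p xs h in y , there m , q

or-intro : ∀ {X : Set} (p : X → Bool) xs {x} → x ∈ xs → p x ≡ true → or (map p xs) ≡ true
or-intro p (x ∷ xs) (here refl) h rewrite h = refl
or-intro p (x ∷ xs) (there m) h rewrite or-intro p xs m h = Boolₚ.∨-zeroʳ (p x)

∨-elim : ∀ {a b} → a ∨ b ≡ true → a ≡ true ⊎ b ≡ true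
∨-elim {true} h = inj₁ refl
∨-elim {false} h = inj₂ h

≡ᵇ-sound : ∀ {m n} → (m ≡ᵇ n) ≡ true → m ≡ n
≡ᵇ-sound {m} {n} h = ℕₚ.≡ᵇ⇒≡ m n (subst Data.Bool.T (sym h) tt)

≡ᵇ-refl : ∀ n → (n ≡ᵇ n) ≡ true
≡ᵇ-refl zero = refl
≡ᵇ-refl (suc n) = ≡ᵇ-refl n

≤ᵇ-sound : ∀ {m n} → (m ≤ᵇ n) ≡ true → m ℕ.≤ n
≤ᵇ-sound {m} {n} h = ℕₚ.≤ᵇ⇒≤ m n (subst Data.Bool.T (sym h) tt)

≤ᵇ-complete : ∀ {m n} → m ℕ.≤ n → (m ≤ᵇ n) ≡ true
≤ᵇ-complete {m} {n} p with m ≤ᵇ n | ℕₚ.≤⇒≤ᵇ p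
... | true | _ = refl

==-sound : ∀ {N} {i j : Fin N} → (i ==ᶠ j) ≡ true → i ≡ j
==-sound h = Finₚ.toℕ-injective (≡ᵇ-sound h)

==-refl : ∀ {N} (i : Fin N) → (i ==ᶠ i) ≡ true
==-refl i = ≡ᵇ-refl (toℕ i)

==-complete : ∀ {N} {i j : Fin N} → i ≡ j → (i ==ᶠ j) ≡ true
==-complete {i = i} refl = ==-refl i

==-≢ : ∀ {N} {i j : Fin N} → i ≢ j → (i ==ᶠ j) ≡ false
==-≢ {i = i} {j} h with i ==ᶠ j in e
... | true = ⊥-elim (h (==-sound e))
... | false = refl

vec-ext : ∀ {X : Set} {n} {v w : Vec X n} → (∀ i → lookup v i ≡ lookup w i) → v ≡ w
vec-ext {v = v} {w} h = sym (Vecₚ.tabulate∘lookup v) ∙ Vecₚ.tabulate-cong h ∙ Vecₚ.tabulate∘lookup w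

b2n : Bool → ℕ
b2n true = 1
b2n false = 0

sumN : {X : Set} → (X → ℕ) → List X → ℕ
sumN f [] = 0
sumN f (x ∷ xs) = f x ℕ.+ sumN f xs

count-sumN : ∀ {X : Set} (p : X → Bool) xs → count p xs ≡ sumN (b2n ∘ p) xs
count-sumN p [] = refl
count-sumN p (x ∷ xs) with p x
... | true = cong suc (count-sumN p xs)
... | false = count-sumN p xs

sumN-cong : ∀ {X : Set} {f h : X → ℕ} → (∀ x → f x ≡ h x) → ∀ xs → sumN f xs ≡ sumN h xs
sumN-cong e [] = refl
sumN-cong e (x ∷ xs) = cong₂ ℕ._+_ (e x) (sumN-cong e xs)

sumN-mono : ∀ {X : Set} {f h : X → ℕ} → (∀ x → f x ℕ.≤ h x) → ∀ xs → sumN f xs ℕ.≤ sumN h xs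
sumN-mono e [] = z≤n
sumN-mono e (x ∷ xs) = ℕₚ.+-mono-≤ (e x) (sumN-mono e xs)

sumN-+ : ∀ {X : Set} (f h : X → ℕ) xs → sumN (λ x → f x ℕ.+ h x) xs ≡ sumN f xs ℕ.+ sumN h xs
sumN-+ f h [] = refl
sumN-+ f h (x ∷ xs) = cong (f x ℕ.+ h x ℕ.+_) (sumN-+ f h xs) ∙ lem (f x) (h x) _ _
  where
  open import Data.Nat.Tactic.RingSolver
  lem : ∀ a b c d → a ℕ.+ b ℕ.+ (c ℕ.+ d) ≡ a ℕ.+ c ℕ.+ (b ℕ.+ d)
  lem = solve-∀

sumN-0 : ∀ {X : Set} (xs : List X) → sumN (λ _ → 0) xs ≡ 0
sumN-0 [] = refl
sumN-0 (x ∷ xs) = sumN-0 xs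

sumN-swap : ∀ {X Y : Set} (f : X → Y → ℕ) xs ys → sumN (λ x → sumN (f x) ys) xs ≡ sumN (λ y → sumN (λ x → f x y) xs) ys
sumN-swap f [] ys = sym (sumN-0 ys)
sumN-swap f (x ∷ xs) ys = cong (sumN (f x) ys ℕ.+_) (sumN-swap f xs ys) ∙ sym (sumN-+ _ _ ys)

sumN-map : ∀ {X Y : Set} (f : Y → ℕ) (k : X → Y) xs → sumN f (map k xs) ≡ sumN (f ∘ k) xs
sumN-map f k [] = refl
sumN-map f k (x ∷ xs) = cong (f (k x) ℕ.+_) (sumN-map f k xs)

sumN-single : ∀ {N} (a : Fin N) → sumN (λ i → b2n (i ==ᶠ a)) (allFin N) ≡ 1
sumN-single {suc N} a = cong (λ l → b2n (Fin.zero ==ᶠ a) ℕ.+ sumN f l) (sym (Listₚ.map-tabulate id Fin.suc)) ∙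
  cong (b2n (Fin.zero ==ᶠ a) ℕ.+_) (sumN-map f Fin.suc (allFin N)) ∙ rest a
  where
  f : Fin (suc N) → ℕ
  f i = b2n (i ==ᶠ a)
  rest : ∀ a → b2n (Fin.zero ==ᶠ a) ℕ.+ sumN (λ i → b2n (Fin.suc i ==ᶠ a)) (allFin N) ≡ 1
  rest Fin.zero = cong suc (sumN-0 (allFin N))
  rest (Fin.suc a) = sumN-single a

allᶠ-elim : ∀ {N} (p : Fin N → Bool) → allᶠ p ≡ true → ∀ i → p i ≡ true
allᶠ-elim {N} p h i = and-elim p _ h (∈ₚ.∈-allFin i)

allᶠ-intro : ∀ {N} (p : Fin N → Bool) → (∀ i → p i ≡ true) → allᶠ p ≡ true
allᶠ-intro {N} p h = and-intro p (allFin N) (λ {i} _ → h i)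

Inj : ∀ {N} → PermV N → Set
Inj s = ∀ i j → lookup s i ≡ lookup s j → i ≡ j

isPerm-sound : ∀ {N} (s : PermV N) → isPerm s ≡ true → Inj s
isPerm-sound s h i j e with i Fin.≟ j
... | yes p = p
... | no i≢j with allᶠ-elim (λ j → (i ==ᶠ j) ∨ not (lookup s i ==ᶠ lookup s j)) (allᶠ-elim (λ i → allᶠ (λ j → (i ==ᶠ j) ∨ not (lookup s i ==ᶠ lookup s j))) h i) j
...   | q rewrite ==-≢ i≢j | ==-complete e = ⊥-elim (true≢false (sym q))

isPerm-complete : ∀ {N} (s : PermV N) → Inj s → isPerm s ≡ true
isPerm-complete s inj = allᶠ-intro _ (λ i → allᶠ-intro _ (aux i))
  where
  aux : ∀ i j → (i ==ᶠ j) ∨ not (lookup s i ==ᶠ lookup s j) ≡ true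
  aux i j with i ==ᶠ j in e | lookup s i ==ᶠ lookup s j in e'
  ... | true | _ = refl
  ... | false | false = refl
  ... | false | true = ⊥-elim (true≢false (sym (==-complete (inj i j (==-sound e'))) ∙ e))

==-swap : ∀ {N} (a b c d : Fin N) → (a ==ᶠ b) ∧ (c ==ᶠ d) ≡ true → (d ==ᶠ c) ∧ (b ==ᶠ a) ≡ true
==-swap a b c d h = let (p , q) = ∧-split {a ==ᶠ b} h in
  ∧-intro (==-complete (sym (==-sound {i = c} {d} q))) (==-complete (sym (==-sound {i = a} {b} p)))

module Orbits {N : ℕ} (s : PermV N) (inj : Inj s) where
  open Data.List.Extrema (Finₚ.≤-totalOrder N) using (min; min≤⊤; min≤xs; argmin-sel)

  iter-+ : ∀ a b i → iter s (a ℕ.+ b) i ≡ iter s a (iter s b i)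
  iter-+ zero b i = refl
  iter-+ (suc a) b i = cong (lookup s) (iter-+ a b i)

  iter-suc : ∀ a i → iter s a (lookup s i) ≡ iter s (suc a) i
  iter-suc zero i = refl
  iter-suc (suc a) i = cong (lookup s) (iter-suc a i)

  iter-inj : ∀ a {i j} → iter s a i ≡ iter s a j → i ≡ j
  iter-inj zero e = e
  iter-inj (suc a) e = iter-inj a (inj _ _ e)

  -- Pigeonhole among the N + 1 iterates of exponent 0, ..., N; injectivity strips the common
  -- prefix.
  return : ∀ i → ∃ λ p → iter s (suc p) i ≡ i × suc p ℕ.≤ N
  return i with Finₚ.pigeonhole (n<1+n N) (λ (k : Fin (suc N)) → iter s (toℕ k) i)
  ... | a , b , a<b , e with m≤n⇒∃[o]m+o≡n a<b
  ...   | d , eq = d , iter-inj (toℕ a) (sym (iter-+ (toℕ a) (suc d) i) ∙ cong (λ k → iter s k i) (ℕₚ.+-suc (toℕ a) d ∙ eq) ∙ sym e) ,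
          ≤-trans (m≤n+m (suc d) (toℕ a)) (subst (ℕ._≤ N) (sym (ℕₚ.+-suc _ d ∙ eq)) (≤-pred (Finₚ.toℕ<n b)))

  -- Whole periods can be removed from the exponent, so the first N iterates, which are all that
  -- `isCycleMin` inspects, exhaust the cycle.
  reduce : ∀ i m k → k ℕ.≤ m → ∃ λ k' → k' ℕ.< N × iter s k' i ≡ iter s k i
  reduce i m k k≤m with k ℕ.<? N
  ... | yes p = k , p , refl
  reduce i zero zero z≤n | no k≮N = ⊥-elim (k≮N (≤-trans (s≤s z≤n) (Finₚ.toℕ<n i)))
  reduce i (suc m) k k≤m | no k≮N with return i
  ... | p , e , p≤N with reduce i m (k ∸ suc p) (≤-trans (∸-monoˡ-≤ (suc p) k≤m) (ℕₚ.m∸n≤m m p))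
  ...   | k' , lt , e' = k' , lt , e' ∙ cong (iter s (k ∸ suc p)) (sym e) ∙ sym (iter-+ (k ∸ suc p) (suc p) i) ∙
            cong (λ m → iter s m i) (m∸n+n≡m (≤-trans p≤N (ℕₚ.≮⇒≥ k≮N)))

  orbit : Fin N → List (Fin N)
  orbit i = map (λ k → iter s k i) (upTo N)

  minOrbit : Fin N → Fin N
  minOrbit i = min i (orbit i)

  minOrbit-reach : ∀ i → ∃ λ k → iter s k i ≡ minOrbit i
  minOrbit-reach i with argmin-sel id i (orbit i)
  ... | inj₁ e = 0 , sym e
  ... | inj₂ m with ∈ₚ.∈-map⁻ (λ k → iter s k i) m
  ...   | k , _ , e = k , sym e

  minOrbit-≤ : ∀ i k → minOrbit i Fin.≤ iter s k i
  minOrbit-≤ i k with reduce i k k ≤-refl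
  ... | k' , lt , e = subst (minOrbit i Fin.≤_) e (All.lookup (min≤xs i _) (∈ₚ.∈-map⁺ _ (∈ₚ.∈-upTo⁺ lt)))

  minOrbit-invariant : ∀ i → minOrbit (lookup s i) ≡ minOrbit i
  minOrbit-invariant i = Finₚ.≤-antisym le ge
    where
    ge : minOrbit i Fin.≤ minOrbit (lookup s i)
    ge with minOrbit-reach (lookup s i)
    ... | k , e = subst (minOrbit i Fin.≤_) (sym (iter-suc k i) ∙ e) (minOrbit-≤ i (suc k))
    le : minOrbit (lookup s i) Fin.≤ minOrbit i
    le with minOrbit-reach i
    ... | suc k , e = subst (minOrbit (lookup s i) Fin.≤_) (iter-suc k i ∙ e) (minOrbit-≤ _ k)
    ... | zero , e with return i
    ...   | p , e' , _ = subst (minOrbit (lookup s i) Fin.≤_) (iter-suc p i ∙ e' ∙ e) (minOrbit-≤ _ p)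

  isCycleMin≡ : ∀ i → isCycleMin s i ≡ (minOrbit i ==ᶠ i)
  isCycleMin≡ i = bool-ext to from
    where
    to : isCycleMin s i ≡ true → (minOrbit i ==ᶠ i) ≡ true
    to h = ==-complete (Finₚ.≤-antisym (min≤⊤ i (orbit i)) ge)
      where
      ge : i Fin.≤ minOrbit i
      ge with argmin-sel id i (orbit i)
      ... | inj₁ e = subst (i Fin.≤_) (sym e) ≤-refl
      ... | inj₂ m with ∈ₚ.∈-map⁻ (λ k → iter s k i) m
      ...   | k , k∈ , e = subst (i Fin.≤_) (sym e) (≤ᵇ-sound (and-elim _ (upTo N) h k∈))
    from : (minOrbit i ==ᶠ i) ≡ true → isCycleMin s i ≡ true
    from h = and-intro _ (upTo N) (λ {k} _ → ≤ᵇ-complete (subst (Fin._≤ iter s k i) (==-sound h) (minOrbit-≤ i k)))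

fixCount : ∀ {N} → (Fin N → Fin N) → ℕ
fixCount {N} e = sumN (λ i → b2n (e i ==ᶠ i)) (allFin N)

-- A choice of one representative in each cycle. Its fixed points count the cycles whatever the
-- choice, which frees the later arguments from minimal elements.
ClassFn : ∀ {N} → PermV N → (Fin N → Fin N) → Set
ClassFn s e = (∀ i → e (lookup s i) ≡ e i) × (∀ i → ∃ λ k → iter s k i ≡ e i)

invariant-iter : ∀ {N} (s : PermV N) (e : Fin N → Fin N) → (∀ i → e (lookup s i) ≡ e i) → ∀ k i → e (iter s k i) ≡ e i
invariant-iter s e h zero i = refl
invariant-iter s e h (suc k) i = h _ ∙ invariant-iter s e h k i

classFn-min : ∀ {N} (s : PermV N) (inj : Inj s) → ClassFn s (Orbits.minOrbit s inj)
classFn-min s inj = Orbits.minOrbit-invariant s inj , Orbits.minOrbit-reach s inj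

-- Both counts equal the number of pairs (i , k) of representatives of one class.
fixCount-unique : ∀ {N} (s : PermV N) (e e' : Fin N → Fin N) → ClassFn s e → ClassFn s e' → fixCount e ≡ fixCount e'
fixCount-unique {N} s e e' (h , r) (h' , r') = half e e' ee' ∙ sumN-swap _ (allFin N) (allFin N) ∙
  sumN-cong (λ k → sumN-cong (λ i → sym (pair-comm k i)) (allFin N)) (allFin N) ∙ sym (half e' e e'e)
  where
  ee' : ∀ i → e (e' i) ≡ e i
  ee' i with r' i
  ... | k , q = cong e (sym q) ∙ invariant-iter s e h k i
  e'e : ∀ i → e' (e i) ≡ e' i
  e'e i with r i
  ... | k , q = cong e' (sym q) ∙ invariant-iter s e' h' k i
  pair : (Fin N → Fin N) → (Fin N → Fin N) → Fin N → Fin N → ℕ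
  pair f f' i k = b2n ((k ==ᶠ f' i) ∧ (f k ==ᶠ i))
  idem : ∀ f f' → (∀ i → f (f' i) ≡ f i) → ∀ i → sumN (pair f f' i) (allFin N) ≡ b2n (f i ==ᶠ i)
  idem f f' ff' i = sumN-cong (λ k → aux k) (allFin N) ∙ lin (f i ==ᶠ i) ∙ ℕₚ.*-identityʳ _
    where
    aux : ∀ k → pair f f' i k ≡ b2n (f i ==ᶠ i) ℕ.* b2n (k ==ᶠ f' i)
    aux k with k ==ᶠ f' i in q
    ... | false = sym (ℕₚ.*-zeroʳ (b2n (f i ==ᶠ i)))
    ... | true = cong (λ z → b2n (z ==ᶠ i)) (cong f (==-sound q) ∙ ff' i) ∙ sym (ℕₚ.*-identityʳ _)
    lin : ∀ b → sumN (λ k → b2n b ℕ.* b2n (k ==ᶠ f' i)) (allFin N) ≡ b2n b ℕ.* 1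
    lin true = sumN-cong (λ k → ℕₚ.*-identityˡ _) (allFin N) ∙ sumN-single (f' i)
    lin false = sumN-0 (allFin N)
  half : ∀ f f' → (∀ i → f (f' i) ≡ f i) → fixCount f ≡ sumN (λ i → sumN (pair f f' i) (allFin N)) (allFin N)
  half f f' ff' = sumN-cong (λ i → sym (idem f f' ff' i)) (allFin N)
  pair-comm : ∀ k i → pair e' e k i ≡ pair e e' i k
  pair-comm k i = cong b2n (bool-ext (==-swap i (e k) (e' i) k) (==-swap k (e' i) (e k) i))

cycles-classFn : ∀ {N} (s : PermV N) → Inj s → ∀ e → ClassFn s e → cycles s ≡ fixCount e
cycles-classFn {N} s inj e c = count-sumN (isCycleMin s) (allFin N) ∙
  sumN-cong (λ i → cong b2n (Orbits.isCycleMin≡ s inj i)) (allFin N) ∙ fixCount-unique s _ e (classFn-min s inj) c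

cycles-≤ : ∀ {N} (s : PermV N) → cycles s ℕ.≤ N
cycles-≤ {N} s = subst (cycles s ℕ.≤_) (Listₚ.length-tabulate id) (Listₚ.length-filter _ (allFin N))

-- Permutations built by insertion into cycles

idV : ∀ {N} → PermV N
idV = tabulate id

lookup-idV : ∀ {N} (i : Fin N) → lookup idV i ≡ i
lookup-idV = Vecₚ.lookup∘tabulate id

Inj-idV : ∀ {N} → Inj (idV {N})
Inj-idV i j e = sym (lookup-idV i) ∙ e ∙ lookup-idV j

-- The element u is inserted after j into the cycle of j.
insF : ∀ {N} → Fin N → Fin N → PermV N → Fin N → Fin N
insF u j s i with i Fin.≟ u | i Fin.≟ j
... | yes _ | _ = lookup s j
... | no _ | yes _ = u
... | no _ | no _ = lookup s i

ins : ∀ {N} → Fin N → Fin N → PermV N → PermV N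
ins u j s = tabulate (insF u j s)

module _ {N : ℕ} (u j : Fin N) (s : PermV N) where

  ins-new : lookup (ins u j s) u ≡ lookup s j
  ins-new rewrite Vecₚ.lookup∘tabulate (insF u j s) u with u Fin.≟ u | u Fin.≟ j
  ... | yes _ | _ = refl
  ... | no q | _ = ⊥-elim (q refl)

  ins-at : j ≢ u → lookup (ins u j s) j ≡ u
  ins-at j≢u rewrite Vecₚ.lookup∘tabulate (insF u j s) j with j Fin.≟ u | j Fin.≟ j
  ... | yes q | _ = ⊥-elim (j≢u q)
  ... | no _ | yes _ = refl
  ... | no _ | no q = ⊥-elim (q refl)

  ins-other : ∀ i → i ≢ u → i ≢ j → lookup (ins u j s) i ≡ lookup s i
  ins-other i i≢u i≢j rewrite Vecₚ.lookup∘tabulate (insF u j s) i with i Fin.≟ u | i Fin.≟ j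
  ... | yes q | _ = ⊥-elim (i≢u q)
  ... | no _ | yes q = ⊥-elim (i≢j q)
  ... | no _ | no _ = refl

  module _ (inj : Inj s) (fix : lookup s u ≡ u) (j≢u : j ≢ u) where

    s≢u : ∀ i → i ≢ u → lookup s i ≢ u
    s≢u i i≢u e = i≢u (inj i u (e ∙ sym fix))

    data InsView (i : Fin N) : Set where
      new : i ≡ u → lookup (ins u j s) i ≡ lookup s j → InsView i
      at : i ≡ j → i ≢ u → lookup (ins u j s) i ≡ u → InsView i
      other : i ≢ u → i ≢ j → lookup (ins u j s) i ≡ lookup s i → InsView i

    insView : ∀ i → InsView i
    insView i with i Fin.≟ u | i Fin.≟ j
    ... | yes refl | _ = new refl ins-new
    ... | no p | yes refl = at refl p (ins-at j≢u)
    ... | no p | no q = other p q (ins-other i p q)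

    Inj-ins : Inj (ins u j s)
    Inj-ins a b e with insView a | insView b
    ... | new refl p | new refl q = refl
    ... | new refl p | at refl _ q = ⊥-elim (s≢u j j≢u (sym p ∙ e ∙ q))
    ... | new refl p | other b≢u b≢j q = ⊥-elim (b≢j (sym (inj j b (sym p ∙ e ∙ q))))
    ... | at refl _ p | new refl q = ⊥-elim (s≢u j j≢u (sym q ∙ sym e ∙ p))
    ... | at refl _ p | at refl _ q = refl
    ... | at refl _ p | other b≢u b≢j q = ⊥-elim (s≢u b b≢u (sym q ∙ sym e ∙ p))
    ... | other a≢u a≢j p | new refl q = ⊥-elim (a≢j (inj a j (sym p ∙ e ∙ q)))
    ... | other a≢u a≢j p | at refl _ q = ⊥-elim (s≢u a a≢u (sym p ∙ e ∙ q))
    ... | other _ _ p | other _ _ q = inj a b (sym p ∙ e ∙ q)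

    -- Away from u the old cycle is still traversed; the new permutation only makes one more step
    -- whenever it passes through u.
    ins-path : ∀ k i → i ≢ u → ∃ λ k' → iter (ins u j s) k' i ≡ iter s k i
    ins-path zero i _ = 0 , refl
    ins-path (suc k) i i≢u with ins-path k (lookup s i) (s≢u i i≢u)
    ... | k' , e with insView i
    ...   | new q _ = ⊥-elim (i≢u q)
    ...   | other _ _ q = suc k' , sym (shift k' i) ∙ cong (iter _ k') q ∙ e ∙ Orbits.iter-suc s inj k i
      where
      shift : ∀ a i → iter (ins u j s) a (lookup (ins u j s) i) ≡ iter (ins u j s) (suc a) i
      shift zero i = refl
      shift (suc a) i = cong (lookup (ins u j s)) (shift a i)
    ...   | at refl _ q = suc (suc k') , sym (shift² k' i) ∙ cong (iter _ k') (cong (lookup (ins u j s)) q ∙ ins-new) ∙ e ∙ Orbits.iter-suc s inj k i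
      where
      shift² : ∀ a i → iter (ins u j s) a (lookup (ins u j s) (lookup (ins u j s) i)) ≡ iter (ins u j s) (suc (suc a)) i
      shift² zero i = refl
      shift² (suc a) i = cong (lookup (ins u j s)) (shift² a i)

    cycles-ins : suc (cycles (ins u j s)) ≡ cycles s
    cycles-ins = cong suc (cycles-classFn _ Inj-ins e' class') ∙ ℕₚ.+-comm 1 _ ∙ cong (fixCount e' ℕ.+_) (sym (sumN-single u)) ∙ sym (sumN-+ _ _ (allFin N)) ∙ sumN-cong point (allFin N) ∙ sym (cycles-classFn s inj e (classFn-min s inj))
      where
      e = Orbits.minOrbit s inj
      e-inv = Orbits.minOrbit-invariant s inj
      -- u adopts the representative of j and all other elements keep theirs; so exactly one fixed
      -- point, u itself, is lost.
      e' : Fin N → Fin N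
      e' i with i Fin.≟ u
      ... | yes _ = e j
      ... | no _ = e i
      e'-u : e' u ≡ e j
      e'-u with u Fin.≟ u
      ... | yes _ = refl
      ... | no q = ⊥-elim (q refl)
      e'-o : ∀ i → i ≢ u → e' i ≡ e i
      e'-o i i≢u with i Fin.≟ u
      ... | yes q = ⊥-elim (i≢u q)
      ... | no _ = refl
      inv' : ∀ i → e' (lookup (ins u j s) i) ≡ e' i
      inv' i with insView i
      ... | new refl q = cong e' q ∙ e'-o _ (s≢u j j≢u) ∙ e-inv j ∙ sym e'-u
      ... | at refl i≢u q = cong e' q ∙ e'-u ∙ sym (e'-o j j≢u)
      ... | other i≢u _ q = cong e' q ∙ e'-o _ (s≢u i i≢u) ∙ e-inv i ∙ sym (e'-o i i≢u)
      class' : ClassFn (ins u j s) e'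
      class' = inv' , reach
        where
        reach : ∀ i → ∃ λ k → iter (ins u j s) k i ≡ e' i
        reach i with i Fin.≟ u
        ... | no i≢u with Orbits.minOrbit-reach s inj i
        ...   | k , q = let (k' , q') = ins-path k i i≢u in k' , q' ∙ q
        reach i | yes refl with Orbits.minOrbit-reach s inj (lookup s j)
        ...   | k , q = let (k' , q') = ins-path k (lookup s j) (s≢u j j≢u) in
                  suc k' , sym (shift k' u) ∙ cong (iter _ k') ins-new ∙ q' ∙ q ∙ e-inv j
          where
          shift : ∀ a i → iter (ins u j s) a (lookup (ins u j s) i) ≡ iter (ins u j s) (suc a) i
          shift zero i = refl
          shift (suc a) i = cong (lookup (ins u j s)) (shift a i)
      fixed-iter : ∀ k → iter s k u ≡ u
      fixed-iter zero = refl
      fixed-iter (suc k) = cong (lookup s) (fixed-iter k) ∙ fix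
      e-u : e u ≡ u
      e-u with Orbits.minOrbit-reach s inj u
      ... | k , q = sym q ∙ fixed-iter k
      e-j : e j ≢ u
      e-j q with Orbits.minOrbit-reach s inj j
      ... | k , r = j≢u (Orbits.iter-inj s inj k (r ∙ q ∙ sym (fixed-iter k)))
      point : ∀ i → b2n (e' i ==ᶠ i) ℕ.+ b2n (i ==ᶠ u) ≡ b2n (e i ==ᶠ i)
      point i with i Fin.≟ u
      ... | yes refl rewrite ==-≢ e-j | ==-refl u | ==-complete e-u = refl
      ... | no i≢u rewrite ==-≢ i≢u = ℕₚ.+-identityʳ _

-- Every permutation supported on u ∷ us arises exactly once: u is fixed, or it follows some j of us
-- in its cycle. Weights that are multiplicative under insertion therefore sum to products.
permsOn : ∀ {N} → List (Fin N) → List (PermV N)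
permsOn [] = idV ∷ []
permsOn (u ∷ us) = concatMap (λ s → s ∷ map (λ j → ins u j s) us) (permsOn us)

Good : ∀ {N} → List (Fin N) → PermV N → Set
Good us s = Inj s × (∀ i → i ∉ us → lookup s i ≡ i)

unique-head : ∀ {X : Set} {u : X} {us} → Unique (u ∷ us) → u ∉ us
unique-head (p ∷ _) m = All.lookup p m refl

unique-tail : ∀ {X : Set} {u : X} {us} → Unique (u ∷ us) → Unique us
unique-tail (_ ∷ p) = p

∈-≢ : ∀ {X : Set} {u j : X} {us} → u ∉ us → j ∈ us → j ≢ u
∈-≢ u∉ j∈ refl = u∉ j∈

-- The induction principle that goes with insertion; the support condition is carried along because
-- an insertion requires u to be fixed beforehand.
permsOn-All : ∀ {N} (Q : List (Fin N) → PermV N → Set) → Q [] idV →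
  (∀ u us s → Unique (u ∷ us) → Good us s → Q us s → Q (u ∷ us) s) →
  (∀ u us s j → Unique (u ∷ us) → Good us s → j ∈ us → Q us s → Q (u ∷ us) (ins u j s)) →
  ∀ us → Unique us → All (Good us) (permsOn us) × All (Q us) (permsOn us)
permsOn-All {N} Q q₀ q₁ q₂ us un = (All.map proj₁ (go us un)) , All.map proj₂ (go us un)
  where
  go : ∀ us → Unique us → All (λ s → Good us s × Q us s) (permsOn us)
  go [] _ = ((Inj-idV , λ i _ → lookup-idV i) , q₀) ∷ []
  go (u ∷ us) un = Allₚ.concat⁺ (Allₚ.map⁺ (All.map (λ {s} (g , q) →
      ((proj₁ g , λ i i∉ → proj₂ g i (i∉ ∘ there)) , q₁ u us s un g q) ∷
      Allₚ.map⁺ (All.tabulate (λ {j} j∈ →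
        (Inj-ins u j s (proj₁ g) (proj₂ g u u∉) (∈-≢ u∉ j∈) ,
          λ i i∉ → ins-other u j s i (λ { refl → i∉ (here refl) }) (λ { refl → i∉ (there j∈) }) ∙ proj₂ g i (i∉ ∘ there)) ,
        q₂ u us s j un g j∈ q))) (go us (unique-tail un))))
    where u∉ = unique-head un

permsOn-Good : ∀ {N} (us : List (Fin N)) → Unique us → All (Good us) (permsOn us)
permsOn-Good us un = proj₁ (permsOn-All (λ _ _ → Data.Unit.⊤) _ (λ _ _ _ _ _ _ → _) (λ _ _ _ _ _ _ _ _ → _) us un)
  where import Data.Unit

-- Reflection length and Euler's inequality

ρ : ∀ {N} → PermV N → ℕ
ρ {N} s = N ∸ cycles s

sumN-1 : ∀ {X : Set} (xs : List X) → sumN (λ _ → 1) xs ≡ length xs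
sumN-1 [] = refl
sumN-1 (x ∷ xs) = cong suc (sumN-1 xs)

fixCount-id : ∀ {N} → fixCount {N} id ≡ N
fixCount-id {N} = sumN-cong (λ i → cong b2n (==-refl i)) (allFin N) ∙ sumN-1 (allFin N) ∙ Listₚ.length-tabulate id

ρ-id : ∀ {N} → ρ (idV {N}) ≡ 0
ρ-id {N} = cong (N ∸_) (cycles-classFn _ Inj-idV id ((λ i → lookup-idV i) , λ i → 0 , lookup-idV′ i) ∙ fixCount-id {N}) ∙ n∸n≡0 N
  where
  lookup-idV′ : ∀ (i : Fin N) → i ≡ i
  lookup-idV′ i = refl

ρ-ins : ∀ {N} (u j : Fin N) s → Inj s → lookup s u ≡ u → j ≢ u → ρ (ins u j s) ≡ suc (ρ s)
ρ-ins {N} u j s inj fix j≢u = sym (cong (λ c → suc (N ∸ c)) (sym e) ∙ sym (ℕₚ.+-∸-assoc 1 (subst (ℕ._≤ N) (sym e) (cycles-≤ s))))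
  where e = cycles-ins u j s inj fix j≢u

-- Each insertion merges at most two joint classes.
Invariants : ∀ {N} → PermV N → PermV N → Set
Invariants {N} s t = ∃ λ (e : Fin N → Fin N) → (∀ i → e (lookup s i) ≡ e i) × (∀ i → e (lookup t i) ≡ e i) × N ℕ.≤ fixCount e ℕ.+ (ρ s ℕ.+ ρ t)

merge : ∀ {N} → (Fin N → Fin N) → Fin N → Fin N → Fin N → Fin N
merge e u j i = if e i ==ᶠ e u then e j else e i

-- Only the representative of the class of u can cease to be a fixed point.
fixCount-merge : ∀ {N} (e : Fin N → Fin N) u j → fixCount e ℕ.≤ suc (fixCount (merge e u j))
fixCount-merge {N} e u j = ≤-trans (sumN-mono point (allFin N)) (≤-reflexive (sumN-+ _ _ (allFin N) ∙ cong (ℕ._+ fixCount (merge e u j)) (sumN-single (e u))))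
  where
  point : ∀ i → b2n (e i ==ᶠ i) ℕ.≤ b2n (i ==ᶠ e u) ℕ.+ b2n (merge e u j i ==ᶠ i)
  point i with e i ==ᶠ i in p
  ... | false = z≤n
  ... | true with e i ==ᶠ e u in q
  ...   | true rewrite ==-complete (sym (==-sound {i = e i} {i} p) ∙ ==-sound {i = e i} {e u} q) = s≤s z≤n
  ...   | false rewrite p = m≤n+m 1 _

merge-cong : ∀ {N} (e : Fin N → Fin N) u j {a b} → e a ≡ e b → merge e u j a ≡ merge e u j b
merge-cong e u j h rewrite h = refl

merge-at : ∀ {N} (e : Fin N → Fin N) u j → merge e u j u ≡ merge e u j j
merge-at e u j with e u ==ᶠ e u in q | e j ==ᶠ e u
... | true | true = refl
... | true | false = refl
... | false | _ = ⊥-elim (true≢false (sym (==-refl (e u)) ∙ q))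

invariants-ins : ∀ {N} (u j : Fin N) s t → Inj s → lookup s u ≡ u → j ≢ u → Invariants s t → Invariants (ins u j s) t
invariants-ins {N} u j s t inj fix j≢u (e , hs , ht , le) = merge e u j , hs' , (λ i → merge-cong e u j (ht i)) ,
  ≤-trans le (≤-trans (ℕₚ.+-monoˡ-≤ _ (fixCount-merge e u j)) (≤-reflexive (sym (ℕₚ.+-suc _ _) ∙ cong (λ r → fixCount (merge e u j) ℕ.+ (r ℕ.+ ρ t)) (sym (ρ-ins u j s inj fix j≢u)))))
  where
  hs' : ∀ i → merge e u j (lookup (ins u j s) i) ≡ merge e u j i
  hs' i with insView u j s inj fix j≢u i
  ... | new refl q = cong (merge e u j) q ∙ merge-cong e u j (hs j) ∙ sym (merge-at e u j)
  ... | at refl _ q = cong (merge e u j) q ∙ merge-at e u j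
  ... | other _ _ q = cong (merge e u j) q ∙ merge-cong e u j (hs i)

invariants-swap : ∀ {N} {s t : PermV N} → Invariants s t → Invariants t s
invariants-swap {N} {s} {t} (e , hs , ht , le) = e , ht , hs , subst (λ r → N ℕ.≤ fixCount e ℕ.+ r) (ℕₚ.+-comm (ρ s) (ρ t)) le

-- One permutation at a time: s is built up beside the identity, and then t beside s.
permsOn-invariants : ∀ {N} (us : List (Fin N)) → Unique us → All (λ s → All (λ t → Invariants s t) (permsOn us)) (permsOn us)
permsOn-invariants {N} us un = All.map (λ {s} p → both s p) left
  where
  extend : ∀ t → Invariants idV t → All (λ s → Invariants s t) (permsOn us)
  extend t h = proj₂ (permsOn-All _ h (λ _ _ _ _ _ p → p)
    (λ u us s j un g j∈ p → invariants-ins u j s t (proj₁ g) (proj₂ g u (unique-head un)) (∈-≢ (unique-head un) j∈) p) us un)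
  left : All (λ s → Invariants s idV) (permsOn us)
  left = extend idV (id , lookup-idV , lookup-idV , ≤-trans (≤-reflexive (sym fixCount-id)) (m≤m+n _ _))
  both : ∀ s → Invariants s idV → All (λ t → Invariants s t) (permsOn us)
  both s p = All.map invariants-swap (extend s (invariants-swap p))

data Reach {N} (s t : PermV N) (u : Fin N) : Fin N → Set where
  start : Reach s t u u
  bySˢ : ∀ {i} → Reach s t u i → Reach s t u (lookup s i)
  bySᵗ : ∀ {i} → Reach s t u i → Reach s t u (lookup t i)

-- Transitivity leaves e a single value, hence at most one fixed point. In terms of maps this says
-- that the number of vertices is at most n + 1.
euler : ∀ {N} (s t : PermV N) (u : Fin N) → Invariants s t → (∀ i → Reach s t u i) → N ℕ.≤ suc (ρ s ℕ.+ ρ t)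
euler {N} s t u (e , hs , ht , le) reach = ≤-trans le (ℕₚ.+-monoˡ-≤ _ (subst (fixCount e ℕ.≤_) (sumN-single (e u)) (sumN-mono point (allFin N))))
  where
  const : ∀ {i} → Reach s t u i → e i ≡ e u
  const start = refl
  const (bySˢ r) = hs _ ∙ const r
  const (bySᵗ r) = ht _ ∙ const r
  point : ∀ i → b2n (e i ==ᶠ i) ℕ.≤ b2n (i ==ᶠ e u)
  point i with e i ==ᶠ i in p
  ... | false = z≤n
  ... | true rewrite ==-complete (sym (==-sound {i = e i} {i} p) ∙ const (reach i)) = s≤s z≤n

-- Joint orbits by breadth-first search

module BFS {N : ℕ} (s t : PermV N) where

  startSet : Fin N → Vec Bool N
  startSet u = tabulate (λ j → j ==ᶠ u)

  orbV : Fin N → Vec Bool N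
  orbV u = reachIter N s t (startSet u)

  private
    hit : Vec Bool N → Fin N → Fin N → Bool
    hit S j i = lookup S i ∧ ((lookup s i ==ᶠ j) ∨ (lookup t i ==ᶠ j))

    lookup-step : ∀ S j → lookup (reachStep s t S) j ≡ lookup S j ∨ anyᶠ (hit S j)
    lookup-step S j = Vecₚ.lookup∘tabulate _ j

    Sound : Fin N → Vec Bool N → Set
    Sound u S = ∀ j → lookup S j ≡ true → Reach s t u j

    sound-step : ∀ u S → Sound u S → Sound u (reachStep s t S)
    sound-step u S h j e with ∨-elim (sym (lookup-step S j) ∙ e)
    ... | inj₁ p = h j p
    ... | inj₂ p with or-elim (hit S j) (allFin N) p
    ...   | i , _ , q with ∧-split {lookup S i} q
    ...     | a , b with ∨-elim {lookup s i ==ᶠ j} b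
    ...       | inj₁ c = subst (Reach s t u) (==-sound c) (bySˢ (h i a))
    ...       | inj₂ c = subst (Reach s t u) (==-sound c) (bySᵗ (h i a))

    sound-iter : ∀ u k S → Sound u S → Sound u (reachIter k s t S)
    sound-iter u zero S h = h
    sound-iter u (suc k) S h = sound-iter u k _ (sound-step u S h)

    Closed : Vec Bool N → Set
    Closed S = ∀ i → lookup S i ≡ true → lookup S (lookup s i) ≡ true × lookup S (lookup t i) ≡ true

    size′ : Vec Bool N → ℕ
    size′ S = sumN (λ i → b2n (lookup S i)) (allFin N)

    step-mono : ∀ S j → lookup S j ≡ true → lookup (reachStep s t S) j ≡ true
    step-mono S j e = lookup-step S j ∙ cong (_∨ anyᶠ (hit S j)) e

    step-hits : ∀ S i → lookup S i ≡ true → lookup (reachStep s t S) (lookup s i) ≡ true × lookup (reachStep s t S) (lookup t i) ≡ true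
    step-hits S i e = h _ (cong (_∨ (lookup t i ==ᶠ lookup s i)) (==-refl (lookup s i))) ,
                      h _ (cong ((lookup s i ==ᶠ lookup t i) ∨_) (==-refl (lookup t i)) ∙ Boolₚ.∨-zeroʳ _)
      where
      h : ∀ j → (lookup s i ==ᶠ j) ∨ (lookup t i ==ᶠ j) ≡ true → lookup (reachStep s t S) j ≡ true
      h j q = lookup-step S j ∙ cong (lookup S j ∨_) (or-intro _ _ (∈ₚ.∈-allFin i) (∧-intro e q)) ∙ Boolₚ.∨-zeroʳ _

    iter-fixed : ∀ k S → reachStep s t S ≡ S → reachIter k s t S ≡ S
    iter-fixed zero S e = refl
    iter-fixed (suc k) S e = cong (reachIter k s t) e ∙ iter-fixed k S e

    sumN-strict : ∀ {X : Set} {f h : X → ℕ} (xs : List X) → (∀ x → f x ℕ.≤ h x) → ∀ {y} → y ∈ xs → f y ℕ.< h y → sumN f xs ℕ.< sumN h xs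
    sumN-strict (x ∷ xs) le (here refl) lt = ℕₚ.+-mono-<-≤ lt (sumN-mono le xs)
    sumN-strict (x ∷ xs) le (there m) lt = ℕₚ.+-mono-≤-< (le x) (sumN-strict xs le m lt)

    grow : ∀ S → reachStep s t S ≡ S ⊎ size′ S ℕ.< size′ (reachStep s t S)
    grow S with Finₚ.any? (λ j → lookup (reachStep s t S) j ∧ not (lookup S j) Data.Bool.≟ true)
    ... | yes (j , q) = inj₂ (sumN-strict _ le (∈ₚ.∈-allFin j) lt)
      where
      le : ∀ i → b2n (lookup S i) ℕ.≤ b2n (lookup (reachStep s t S) i)
      le i with lookup S i in e
      ... | false = z≤n
      ... | true rewrite step-mono S i e = ≤-refl
      lt : b2n (lookup S j) ℕ.< b2n (lookup (reachStep s t S) j)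
      lt with lookup S j | ∧-split {lookup (reachStep s t S) j} q
      ... | false | (a , _) rewrite a = ≤-refl
      ... | true | (_ , ())
    ... | no none = inj₁ (vec-ext λ j → bool-ext (λ a → back j a) (step-mono S j))
      where
      back : ∀ j → lookup (reachStep s t S) j ≡ true → lookup S j ≡ true
      back j a with lookup S j in e
      ... | true = refl
      ... | false = ⊥-elim (none (j , ∧-intro a (cong not e)))

    -- A step that changes the set enlarges it. Starting from one element, N enlargements would
    -- exceed the N elements available, so the set is closed after the N rounds that `transitiveᵇ`
    -- performs.
    progress : ∀ k S → Closed (reachIter k s t S) ⊎ k ℕ.+ size′ S ℕ.≤ size′ (reachIter k s t S)
    progress zero S = inj₂ ≤-refl
    progress (suc k) S with grow S
    ... | inj₁ e = inj₁ (subst Closed (sym (cong (reachIter k s t) e ∙ iter-fixed k S e))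
                     (λ i p → let (a , b) = step-hits S i p in subst (λ V → lookup V _ ≡ true) e a , subst (λ V → lookup V _ ≡ true) e b))
    ... | inj₂ lt with progress k (reachStep s t S)
    ...   | inj₁ c = inj₁ c
    ...   | inj₂ le = inj₂ (≤-trans (subst (ℕ._≤ k ℕ.+ size′ (reachStep s t S)) (ℕₚ.+-suc k (size′ S)) (ℕₚ.+-monoʳ-≤ k lt)) le)

    iter-mono : ∀ k S j → lookup S j ≡ true → lookup (reachIter k s t S) j ≡ true
    iter-mono zero S j e = e
    iter-mono (suc k) S j e = iter-mono k _ j (step-mono S j e)

    startSet-u : ∀ u → lookup (startSet u) u ≡ true
    startSet-u u = Vecₚ.lookup∘tabulate _ u ∙ ==-refl u

    orb-closed : ∀ u → Closed (orbV u)
    orb-closed u with progress N (startSet u)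
    ... | inj₁ c = c
    ... | inj₂ le = ⊥-elim (<⇒≱ {N} (subst (N ℕ.<_) (cong (N ℕ.+_) (sym size-start)) (subst (N ℕ.<_) (ℕₚ.+-comm 1 N) ≤-refl))
                       (≤-trans le (subst (size′ (orbV u) ℕ.≤_) (sumN-1 (allFin N) ∙ Listₚ.length-tabulate id) (sumN-mono (λ i → b2n-≤ (lookup (orbV u) i)) (allFin N)))))
      where
      b2n-≤ : ∀ b → b2n b ℕ.≤ 1
      b2n-≤ true = ≤-refl
      b2n-≤ false = z≤n
      size-start : size′ (startSet u) ≡ 1
      size-start = sumN-cong (λ i → cong b2n (Vecₚ.lookup∘tabulate _ i)) (allFin N) ∙ sumN-single u

  orb-sound : ∀ u j → lookup (orbV u) j ≡ true → Reach s t u j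
  orb-sound u = sound-iter u N _ (λ j e → subst (Reach s t u) (sym (==-sound (sym (Vecₚ.lookup∘tabulate _ j) ∙ e))) start)

  orb-complete : ∀ u {j} → Reach s t u j → lookup (orbV u) j ≡ true
  orb-complete u start = iter-mono N _ u (startSet-u u)
  orb-complete u (bySˢ r) = proj₁ (orb-closed u _ (orb-complete u r))
  orb-complete u (bySᵗ r) = proj₂ (orb-closed u _ (orb-complete u r))

open BFS public using (orbV; orb-sound; orb-complete)

-- Factoring permutations along a joint orbit

comp : ∀ {N} → PermV N → PermV N → PermV N
comp s t = tabulate (λ i → lookup s (lookup t i))

lookup-comp : ∀ {N} (s t : PermV N) i → lookup (comp s t) i ≡ lookup s (lookup t i)
lookup-comp s t = Vecₚ.lookup∘tabulate _

ins-cong : ∀ {N} (u j : Fin N) (s s' : PermV N) → j ≢ u → lookup s' u ≡ lookup s j → lookup s' j ≡ u →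
  (∀ i → i ≢ u → i ≢ j → lookup s' i ≡ lookup s i) → s' ≡ ins u j s
ins-cong u j s s' j≢u a b c = vec-ext h
  where
  h : ∀ i → lookup s' i ≡ lookup (ins u j s) i
  h i with i Fin.≟ u
  ... | yes refl = a ∙ sym (ins-new i j s)
  ... | no p with i Fin.≟ j
  ...   | yes refl = b ∙ sym (ins-at u i s j≢u)
  ...   | no q = c i p q ∙ sym (ins-other u j s i p q)

comp-insˡ : ∀ {N} (u j : Fin N) (s t : PermV N) → Inj t → lookup t u ≡ u → lookup t j ≡ j → j ≢ u → comp (ins u j s) t ≡ ins u j (comp s t)
comp-insˡ u j s t inj tu tj j≢u = ins-cong u j _ _ j≢u
  (lookup-comp (ins u j s) t u ∙ cong (lookup (ins u j s)) tu ∙ ins-new u j s ∙ sym (lookup-comp s t j ∙ cong (lookup s) tj))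
  (lookup-comp (ins u j s) t j ∙ cong (lookup (ins u j s)) tj ∙ ins-at u j s j≢u)
  (λ i p q → lookup-comp (ins u j s) t i ∙ ins-other u j s _ (λ e → p (inj i u (e ∙ sym tu))) (λ e → q (inj i j (e ∙ sym tj))) ∙ sym (lookup-comp s t i))

comp-insʳ : ∀ {N} (u j : Fin N) (s t : PermV N) → lookup s u ≡ u → j ≢ u → comp s (ins u j t) ≡ ins u j (comp s t)
comp-insʳ u j s t su j≢u = ins-cong u j _ _ j≢u
  (lookup-comp s (ins u j t) u ∙ cong (lookup s) (ins-new u j t) ∙ sym (lookup-comp s t j))
  (lookup-comp s (ins u j t) j ∙ cong (lookup s) (ins-at u j t j≢u) ∙ su)
  (λ i p q → lookup-comp s (ins u j t) i ∙ cong (lookup s) (ins-other u j t i p q) ∙ sym (lookup-comp s t i))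

comp-idˡ : ∀ {N} (t : PermV N) → comp idV t ≡ t
comp-idˡ t = vec-ext (λ i → lookup-comp idV t i ∙ lookup-idV _)

compat : ∀ {N} → (Fin N → ℕ) → PermV N → Bool
compat f s = allᶠ (λ i → f (lookup s i) ≡ᵇ f i)

compat-elim : ∀ {N} (f : Fin N → ℕ) s → compat f s ≡ true → ∀ i → f (lookup s i) ≡ f i
compat-elim f s h i = ≡ᵇ-sound (allᶠ-elim _ h i)

compat-intro : ∀ {N} (f : Fin N → ℕ) s → (∀ i → f (lookup s i) ≡ f i) → compat f s ≡ true
compat-intro f s h = allᶠ-intro _ (λ i → cong (_≡ᵇ f i) (h i) ∙ ≡ᵇ-refl (f i))

compat-ins : ∀ {N} (f : Fin N → ℕ) (u j : Fin N) s → Inj s → lookup s u ≡ u → j ≢ u → compat f (ins u j s) ≡ (f u ≡ᵇ f j) ∧ compat f s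
compat-ins f u j s inj fix j≢u = bool-ext to from
  where
  to : compat f (ins u j s) ≡ true → (f u ≡ᵇ f j) ∧ compat f s ≡ true
  to h = ∧-intro (cong (_≡ᵇ f j) fu ∙ ≡ᵇ-refl (f j)) (compat-intro f s k)
    where
    h' = compat-elim f (ins u j s) h
    fu : f u ≡ f j
    fu = cong f (sym (ins-at u j s j≢u)) ∙ h' j
    k : ∀ i → f (lookup s i) ≡ f i
    k i with insView u j s inj fix j≢u i
    ... | new refl _ = cong f fix
    ... | at refl _ _ = cong f (sym (ins-new u i s)) ∙ h' u ∙ fu
    ... | other _ _ q = cong f (sym q) ∙ h' i
  from : (f u ≡ᵇ f j) ∧ compat f s ≡ true → compat f (ins u j s) ≡ true
  from h = compat-intro f (ins u j s) k
    where
    fu : f u ≡ f j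
    fu = ≡ᵇ-sound (proj₁ (∧-split h))
    h' = compat-elim f s (proj₂ (∧-split {f u ≡ᵇ f j} h))
    k : ∀ i → f (lookup (ins u j s) i) ≡ f i
    k i with insView u j s inj fix j≢u i
    ... | new refl q = cong f q ∙ h' j ∙ sym fu
    ... | at refl _ q = cong f q ∙ fu
    ... | other _ _ q = cong f q ∙ h' i

preserves : ∀ {N} → (Fin N → Bool) → PermV N → Bool
preserves o s = allᶠ (λ i → not (o (lookup s i) Data.Bool.xor o i))

xor-sound : ∀ {a b} → not (a Data.Bool.xor b) ≡ true → a ≡ b
xor-sound {true} {true} h = refl
xor-sound {false} {false} h = refl

xor-refl : ∀ a → not (a Data.Bool.xor a) ≡ true
xor-refl true = refl
xor-refl false = refl

preserves-elim : ∀ {N} (o : Fin N → Bool) s → preserves o s ≡ true → ∀ i → o (lookup s i) ≡ o i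
preserves-elim o s h i = xor-sound (allᶠ-elim _ h i)

preserves-intro : ∀ {N} (o : Fin N → Bool) s → (∀ i → o (lookup s i) ≡ o i) → preserves o s ≡ true
preserves-intro o s h = allᶠ-intro _ (λ i → cong (λ b → not (b Data.Bool.xor o i)) (h i) ∙ xor-refl (o i))

preserves-ins : ∀ {N} (o : Fin N → Bool) (u j : Fin N) s → Inj s → lookup s u ≡ u → j ≢ u →
  preserves o (ins u j s) ≡ not (o u Data.Bool.xor o j) ∧ preserves o s
preserves-ins o u j s inj fix j≢u = bool-ext to from
  where
  to : preserves o (ins u j s) ≡ true → not (o u Data.Bool.xor o j) ∧ preserves o s ≡ true
  to h = ∧-intro (cong (λ b → not (b Data.Bool.xor o j)) fu ∙ xor-refl (o j)) (preserves-intro o s k)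
    where
    h' = preserves-elim o (ins u j s) h
    fu : o u ≡ o j
    fu = cong o (sym (ins-at u j s j≢u)) ∙ h' j
    k : ∀ i → o (lookup s i) ≡ o i
    k i with insView u j s inj fix j≢u i
    ... | new refl _ = cong o fix
    ... | at refl _ _ = cong o (sym (ins-new u i s)) ∙ h' u ∙ fu
    ... | other _ _ q = cong o (sym q) ∙ h' i
  from : not (o u Data.Bool.xor o j) ∧ preserves o s ≡ true → preserves o (ins u j s) ≡ true
  from h = preserves-intro o (ins u j s) k
    where
    fu : o u ≡ o j
    fu = xor-sound (proj₁ (∧-split {not (o u Data.Bool.xor o j)} h))
    h' = preserves-elim o s (proj₂ (∧-split {not (o u Data.Bool.xor o j)} h))
    k : ∀ i → o (lookup (ins u j s) i) ≡ o i
    k i with insView u j s inj fix j≢u i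
    ... | new refl q = cong o q ∙ h' j ∙ sym fu
    ... | at refl _ q = cong o q ∙ fu
    ... | other _ _ q = cong o q ∙ h' i

data Split {X : Set} : List X → List X → List X → Set where
  none : Split [] [] []
  left : ∀ {v us O O'} → Split us O O' → Split (v ∷ us) (v ∷ O) O'
  right : ∀ {v us O O'} → Split us O O' → Split (v ∷ us) O (v ∷ O')

splits : {X : Set} → List X → List (List X × List X)
splits [] = ([] , []) ∷ []
splits (v ∷ vs) = concatMap (λ { (O , O') → (v ∷ O , O') ∷ (O , v ∷ O') ∷ [] }) (splits vs)

splits-Split : ∀ {X : Set} (us : List X) → All (λ { (O , O') → Split us O O' }) (splits us)
splits-Split [] = none ∷ []
splits-Split (v ∷ us) = Allₚ.concat⁺ (Allₚ.map⁺ (All.map (λ p → left p ∷ right p ∷ []) (splits-Split us)))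

Split-∈ˡ : ∀ {X : Set} {us O O' : List X} → Split us O O' → ∀ {x} → x ∈ O → x ∈ us
Split-∈ˡ (left p) (here e) = here e
Split-∈ˡ (left p) (there m) = there (Split-∈ˡ p m)
Split-∈ˡ (right p) m = there (Split-∈ˡ p m)

Split-∈ʳ : ∀ {X : Set} {us O O' : List X} → Split us O O' → ∀ {x} → x ∈ O' → x ∈ us
Split-∈ʳ (left p) m = there (Split-∈ʳ p m)
Split-∈ʳ (right p) (here e) = here e
Split-∈ʳ (right p) (there m) = there (Split-∈ʳ p m)

Split-∈ : ∀ {X : Set} {us O O' : List X} → Split us O O' → ∀ {x} → x ∈ us → x ∈ O ⊎ x ∈ O'
Split-∈ (left p) (here e) = inj₁ (here e)
Split-∈ (left p) (there m) with Split-∈ p m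
... | inj₁ q = inj₁ (there q)
... | inj₂ q = inj₂ q
Split-∈ (right p) (here e) = inj₂ (here e)
Split-∈ (right p) (there m) with Split-∈ p m
... | inj₁ q = inj₁ q
... | inj₂ q = inj₂ (there q)

Split-disjoint : ∀ {X : Set} {us O O' : List X} → Unique us → Split us O O' → ∀ {x} → x ∈ O → x ∉ O'
Split-disjoint un (left p) (here refl) m' = unique-head un (Split-∈ʳ p m')
Split-disjoint un (left p) (there m) m' = Split-disjoint (unique-tail un) p m m'
Split-disjoint un (right p) m (here refl) = unique-head un (Split-∈ˡ p m)
Split-disjoint un (right p) m (there m') = Split-disjoint (unique-tail un) p m m'

Split-uniqueˡ : ∀ {X : Set} {us O O' : List X} → Unique us → Split us O O' → Unique O
Split-uniqueˡ un none = []
Split-uniqueˡ un (left p) = All.tabulate (λ m e → unique-head un (subst (_∈ _) (sym e) (Split-∈ˡ p m))) ∷ Split-uniqueˡ (unique-tail un) p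
Split-uniqueˡ un (right p) = Split-uniqueˡ (unique-tail un) p

Split-swap : ∀ {X : Set} {us O O' : List X} → Split us O O' → Split us O' O
Split-swap none = none
Split-swap (left p) = right (Split-swap p)
Split-swap (right p) = left (Split-swap p)

Split-length : ∀ {X : Set} {us O O' : List X} → Split us O O' → length O ℕ.+ length O' ≡ length us
Split-length none = refl
Split-length (left p) = cong suc (Split-length p)
Split-length (right p) = ℕₚ.+-suc _ _ ∙ cong suc (Split-length p)

data Part {X : Set} (o : X → Bool) : List X → List X → List X → Set where
  none : Part o [] [] []
  left : ∀ {v us O O'} → o v ≡ true → Part o us O O' → Part o (v ∷ us) (v ∷ O) O'
  right : ∀ {v us O O'} → o v ≡ false → Part o us O O' → Part o (v ∷ us) O (v ∷ O')

Part-Split : ∀ {X : Set} {o : X → Bool} {us O O'} → Part o us O O' → Split us O O'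
Part-Split none = none
Part-Split (left _ p) = left (Part-Split p)
Part-Split (right _ p) = right (Part-Split p)

Split-Part : ∀ {X : Set} {o : X → Bool} {us O O'} → Split us O O' → (∀ {i} → i ∈ O → o i ≡ true) → (∀ {i} → i ∈ O' → o i ≡ false) → Part o us O O'
Split-Part none a b = none
Split-Part (left p) a b = left (a (here refl)) (Split-Part p (a ∘ there) b)
Split-Part (right p) a b = right (b (here refl)) (Split-Part p a (b ∘ there))

module Indicator (R : Alg) where
  open Ring R
  open Sums R

  ind : Bool → Carrier
  ind true = 1#
  ind false = 0#

  ind-∧ : ∀ a b → ind (a ∧ b) ≡ ind a * ind b
  ind-∧ true b = sym (*-identityˡ _)
  ind-∧ false b = sym (zeroˡ _)

  ΣL-permsOn : ∀ {N} (f : PermV N → Carrier) u us → ΣL f (permsOn (u ∷ us)) ≡ ΣL (λ s → f s + ΣL (λ j → f (ins u j s)) us) (permsOn us)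
  ΣL-permsOn f u us = ΣL-concatMap f _ (permsOn us) ∙ ΣL-cong (λ s → cong (f s +_) (ΣL-map f (λ j → ins u j s) us)) (permsOn us)

  module _ {N : ℕ} (o : Fin N → Bool) where

    Σ-part : ∀ (g : Fin N → Carrier) {us O O'} b → Part o us O O' →
      ΣL (λ j → ind (not (b Data.Bool.xor o j)) * g j) us ≡ ΣL g (if b then O else O')
    Σ-part g true none = refl
    Σ-part g false none = refl
    Σ-part g true (left e p) rewrite e = cong₂ _+_ (*-identityˡ _) (Σ-part g true p)
    Σ-part g false (left e p) rewrite e = cong₂ _+_ (zeroˡ _) (Σ-part g false p) ∙ +-identityˡ _
    Σ-part g true (right e p) rewrite e = cong₂ _+_ (zeroˡ _) (Σ-part g true p) ∙ +-identityˡ _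
    Σ-part g false (right e p) rewrite e = cong₂ _+_ (*-identityˡ _) (Σ-part g false p)

    -- A permutation preserving o is a product of permutations of O and O'.
    Σ-preserves : ∀ {us O O'} → Unique us → Part o us O O' → ∀ (f : PermV N → Carrier) →
      ΣL (λ s → ind (preserves o s) * f s) (permsOn us) ≡ ΣL (λ s₁ → ΣL (λ s₂ → f (comp s₁ s₂)) (permsOn O')) (permsOn O)
    Σ-preserves un none f = cong (λ b → ind b * f idV + 0#) (preserves-intro o idV (λ i → cong o (lookup-idV i))) ∙
      solve 1 (λ x → :1 :* x :+ :0 := x :+ :0 :+ :0) refl _ ∙ cong (λ s → f s + 0# + 0#) (sym (comp-idˡ idV))
    Σ-preserves {u ∷ us} {O} {O'} un pt f = ΣL-permsOn _ u us ∙ ΣL-congAll (λ s g → cong (ind (preserves o s) * f s +_) (ΣL-congAll (λ j j≢u → cong (λ b → ind b * f _) (preserves-ins o u j s (proj₁ g) (proj₂ g u u∉) j≢u) ∙ cong (_* f (ins u j s)) (ind-∧ (not (o u Data.Bool.xor o j)) (preserves o s)) ∙ solve 3 (λ a b c → a :* b :* c := b :* (a :* c)) refl _ _ _) js≢u ∙ ΣL-* _ _ us)) (permsOn-Good us (unique-tail un)) ∙ ΣL-cong (λ s → sym (distribˡ _ _ _)) (permsOn us) ∙ finish pt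
      where
      u∉ = unique-head un
      js≢u : All (_≢ u) us
      js≢u = All.tabulate (∈-≢ u∉)
      finish : ∀ {O O'} → Part o (u ∷ us) O O' →
        ΣL (λ s → ind (preserves o s) * (f s + ΣL (λ j → ind (not (o u Data.Bool.xor o j)) * f (ins u j s)) us)) (permsOn us)
        ≡ ΣL (λ s₁ → ΣL (λ s₂ → f (comp s₁ s₂)) (permsOn O')) (permsOn O)
      finish {u ∷ O} {O'} (left e p) = ΣL-cong (λ s → cong (λ x → ind (preserves o s) * (f s + x)) (cong (λ b → ΣL (λ j → ind (not (b Data.Bool.xor o j)) * f _) us) e ∙ Σ-part _ true p)) (permsOn us) ∙ Σ-preserves (unique-tail un) p _ ∙ ΣL-cong (λ s₁ → ΣL-+ _ _ (permsOn O') ∙ cong (ΣL (λ s₂ → f (comp s₁ s₂)) (permsOn O') +_) (ΣL-congAll (λ s₂ g → ΣL-congAll (λ j q → cong f (sym (comp-insˡ u j s₁ s₂ (proj₁ g) (proj₂ g u (λ m → u∉ (Split-∈ʳ sp m))) (proj₂ g j (proj₂ q)) (proj₁ q)))) O-ok) (permsOn-Good O' (Split-uniqueˡ (unique-tail un) (Split-swap sp))) ∙ ΣL-swap _ (permsOn O') O)) (permsOn O) ∙ sym (ΣL-permsOn _ u O)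
        where
        sp = Part-Split p
        O-ok : All (λ j → j ≢ u × j ∉ O') O
        O-ok = All.tabulate (λ m → ∈-≢ u∉ (Split-∈ˡ sp m) , Split-disjoint (unique-tail un) sp m)
      finish {O} {u ∷ O'} (right e p) = ΣL-cong (λ s → cong (λ x → ind (preserves o s) * (f s + x)) (cong (λ b → ΣL (λ j → ind (not (b Data.Bool.xor o j)) * f _) us) e ∙ Σ-part _ false p)) (permsOn us) ∙ Σ-preserves (unique-tail un) p _ ∙ ΣL-congAll (λ s₁ g → ΣL-cong (λ s₂ → cong (f (comp s₁ s₂) +_) (ΣL-congAll (λ j q → cong f (sym (comp-insʳ u j s₁ s₂ (proj₂ g u (λ m → u∉ (Split-∈ˡ sp m))) q))) O'-ok)) (permsOn O') ∙ sym (ΣL-permsOn _ u O')) (permsOn-Good O (Split-uniqueˡ (unique-tail un) sp))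
        where
        sp = Part-Split p
        O'-ok : All (_≢ u) O'
        O'-ok = All.tabulate (λ m → ∈-≢ u∉ (Split-∈ʳ sp m))

  module Weight (x : Carrier) where

    wt : ∀ {N} → (Fin N → ℕ) → PermV N → Carrier
    wt f s = ind (compat f s) * (x ^# ρ s)

    wt-id : ∀ {N} (f : Fin N → ℕ) → wt f idV ≡ 1#
    wt-id {N} f = cong₂ (λ b r → ind b * (x ^# r)) (compat-intro f idV (λ i → cong f (lookup-idV i))) (ρ-id {N}) ∙ *-identityˡ _

    wt-ins : ∀ {N} (f : Fin N → ℕ) (u j : Fin N) s → Inj s → lookup s u ≡ u → j ≢ u → wt f (ins u j s) ≡ ind (f u ≡ᵇ f j) * x * wt f s
    wt-ins f u j s inj fix j≢u = cong₂ (λ b r → ind b * (x ^# r)) (compat-ins f u j s inj fix j≢u) (ρ-ins u j s inj fix j≢u) ∙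
      cong (_* (x * _)) (ind-∧ (f u ≡ᵇ f j) (compat f s)) ∙ solve 4 (λ a b c d → a :* b :* (c :* d) := a :* c :* (b :* d)) refl _ _ x _

    -- the weight of a colour word: Π (1 + x · number of later occurrences of the colour)
    word : List ℕ → Carrier
    word [] = 1#
    word (c ∷ cs) = (1# + x * ΣL (λ d → ind (c ≡ᵇ d)) cs) * word cs

    -- Inserting u behind j multiplies the weight by x if the colours agree and gives 0 otherwise.
    -- Hence u contributes the factor 1 + x times the number of elements of its colour in us.
    Σ-wt : ∀ {N} (f : Fin N → ℕ) us → Unique us → ΣL (wt f) (permsOn us) ≡ word (map f us)
    Σ-wt f [] _ = +-identityʳ _ ∙ wt-id f
    Σ-wt f (u ∷ us) un = ΣL-permsOn _ u us ∙ ΣL-congAll (λ s g → cong (wt f s +_) (ΣL-congAll (λ j m → wt-ins f u j s (proj₁ g) (proj₂ g u (unique-head un)) m ∙ solve 3 (λ a x w → a :* x :* w := x :* w :* a) refl _ x _) (All.tabulate (∈-≢ (unique-head un))) ∙ ΣL-* _ _ us) ∙ solve 3 (λ w x k → w :+ x :* w :* k := (:1 :+ x :* k) :* w) refl _ x _) (permsOn-Good us (unique-tail un)) ∙ ΣL-* _ _ (permsOn us) ∙ cong₂ (λ a b → (1# + x * a) * b) (sym (ΣL-map (λ d → ind (f u ≡ᵇ d)) f us)) (Σ-wt f us (unique-tail un))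

    -- s₁ is built by insertions outside the support of s₂, so each of them changes the weight of
    -- the composite as it changes the weight of s₁.
    wt-comp : ∀ {N} (f : Fin N → ℕ) O O' → Unique O → (∀ {i} → i ∈ O → i ∉ O') →
      All (λ s₁ → ∀ s₂ → Good O' s₂ → wt f (comp s₁ s₂) ≡ wt f s₁ * wt f s₂) (permsOn O)
    wt-comp f O O' un dis = All.map (λ h s₂ g₂ → h s₂ g₂ dis) (proj₂ (permsOn-All
        (λ O s₁ → ∀ s₂ → Good O' s₂ → (∀ {i} → i ∈ O → i ∉ O') → wt f (comp s₁ s₂) ≡ wt f s₁ * wt f s₂)
        (λ s₂ _ _ → cong (wt f) (comp-idˡ s₂) ∙ sym (cong (_* wt f s₂) (wt-id f) ∙ *-identityˡ _))
        (λ u us s _ _ h s₂ g₂ dis → h s₂ g₂ (dis ∘ there))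
        (λ u us s j un g j∈ h s₂ g₂ dis → step u us s j s₂ g₂ un g j∈ (h s₂ g₂) dis) O un))
      where
      step : ∀ u us s j s₂ → Good O' s₂ → Unique (u ∷ us) → Good us s → j ∈ us →
        ((∀ {i} → i ∈ us → i ∉ O') → wt f (comp s s₂) ≡ wt f s * wt f s₂) →
        (∀ {i} → i ∈ u ∷ us → i ∉ O') → wt f (comp (ins u j s) s₂) ≡ wt f (ins u j s) * wt f s₂
      step u us s j s₂ g₂ un g j∈ h dis = cong (wt f) (comp-insˡ u j s s₂ (proj₁ g₂) (proj₂ g₂ u (dis (here refl))) (proj₂ g₂ j (dis (there j∈))) j≢u) ∙ wt-ins f u j (comp s s₂) (λ a b e → proj₁ g₂ a b (proj₁ g _ _ (sym (lookup-comp s s₂ a) ∙ e ∙ lookup-comp s s₂ b))) (lookup-comp s s₂ u ∙ cong (lookup s) (proj₂ g₂ u (dis (here refl))) ∙ s-u) j≢u ∙ cong (ind (f u ≡ᵇ f j) * x *_) (h (dis ∘ there)) ∙ sym (*-assoc _ _ _) ∙ cong (_* wt f s₂) (sym (wt-ins f u j s (proj₁ g) s-u j≢u))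
        where
        j≢u = ∈-≢ (unique-head un) j∈
        s-u = proj₂ g u (unique-head un)

memᵇ : ∀ {N} → List (Fin N) → Fin N → Bool
memᵇ l i = or (map (i ==ᶠ_) l)

memᵇ-sound : ∀ {N} (l : List (Fin N)) i → memᵇ l i ≡ true → i ∈ l
memᵇ-sound l i h with or-elim (i ==ᶠ_) l h
... | k , k∈ , e = subst (_∈ l) (sym (==-sound e)) k∈

memᵇ-complete : ∀ {N} (l : List (Fin N)) {i} → i ∈ l → memᵇ l i ≡ true
memᵇ-complete l {i} m = or-intro (i ==ᶠ_) l m (==-refl i)

memᵇ-∉ : ∀ {N} (l : List (Fin N)) {i} → i ∉ l → memᵇ l i ≡ false
memᵇ-∉ l {i} m with memᵇ l i in e
... | true = ⊥-elim (m (memᵇ-sound l i e))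
... | false = refl

not-true : ∀ {b} → not b ≡ true → b ≡ false
not-true {false} _ = refl

connects : ∀ {N} → Fin N → List (Fin N) → PermV N → PermV N → Bool
connects u O s t = and (map (lookup (orbV s t u)) O)

matches : ∀ {X : Set} → (X → Bool) → List X × List X → Bool
matches o (O , O') = and (map o O) ∧ and (map (not ∘ o) O')

Good-∈ : ∀ {N} {us : List (Fin N)} s → Good us s → ∀ {i} → i ∈ us → lookup s i ∈ us
Good-∈ {us = us} s (inj , fix) {i} m with lookup s i ∈? us
  where open DecMem Fin._≟_
... | yes p = p
... | no p = ⊥-elim (p (subst (_∈ us) (sym (inj _ _ (fix _ p))) m))

orb-inv : ∀ {N} (s t : PermV N) u → Inj s → ∀ i → lookup (orbV s t u) (lookup s i) ≡ lookup (orbV s t u) i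
orb-inv s t u inj i = bool-ext back (λ h → orb-complete s t u (bySˢ (orb-sound s t u i h)))
  where
  along : ∀ k {j} → Reach s t u j → Reach s t u (iter s k j)
  along zero r = r
  along (suc k) r = bySˢ (along k r)
  back : lookup (orbV s t u) (lookup s i) ≡ true → lookup (orbV s t u) i ≡ true
  back h with Orbits.return s inj i
  ... | p , e , _ = orb-complete s t u (subst (Reach s t u) (Orbits.iter-suc s inj p i ∙ e) (along p (orb-sound s t u _ h)))

Reach-swap : ∀ {N} {s t : PermV N} {u i} → Reach s t u i → Reach t s u i
Reach-swap start = start
Reach-swap (bySˢ r) = bySᵗ (Reach-swap r)
Reach-swap (bySᵗ r) = bySˢ (Reach-swap r)

orb-invᵗ : ∀ {N} (s t : PermV N) u → Inj t → ∀ i → lookup (orbV s t u) (lookup t i) ≡ lookup (orbV s t u) i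
orb-invᵗ s t u inj i = flip (lookup t i) ∙ orb-inv t s u inj i ∙ sym (flip i)
  where
  flip : ∀ i → lookup (orbV s t u) i ≡ lookup (orbV t s u) i
  flip i = bool-ext (λ h → orb-complete t s u (Reach-swap (orb-sound s t u i h))) (λ h → orb-complete s t u (Reach-swap (orb-sound t s u i h)))

module _ {N : ℕ} {u : Fin N} {us O O' : List (Fin N)} (un : Unique (u ∷ us)) (sp : Split us O O') where

  private
    o = memᵇ (u ∷ O)
    o-O' : ∀ {i} → i ∈ O' → o i ≡ false
    o-O' {i} m = memᵇ-∉ (u ∷ O) {i} λ { (here refl) → unique-head un (Split-∈ʳ sp m) ; (there m') → Split-disjoint (unique-tail un) sp m' m }

  split-Part : Part o (u ∷ us) (u ∷ O) O'
  split-Part = Split-Part (left sp) (memᵇ-complete (u ∷ O)) o-O'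

  -- Trades a condition on the joint orbit for three separate ones. The first two factor the sums
  -- over s and t through `Σ-preserves`; the third concerns only the restrictions to u ∷ O, by
  -- `connects-comp`.
  matches-preserves : ∀ s t → Good (u ∷ us) s → Good (u ∷ us) t →
    matches (lookup (orbV s t u)) (O , O') ≡ preserves o s ∧ (preserves o t ∧ connects u O s t)
  matches-preserves s t gs gt = bool-ext to from
    where
    orb = lookup (orbV s t u)
    to : matches orb (O , O') ≡ true → preserves o s ∧ (preserves o t ∧ connects u O s t) ≡ true
    to h = ∧-intro (preserves-intro o s (pres s gs (orb-inv s t u (proj₁ gs)))) (∧-intro (preserves-intro o t (pres t gt (orb-invᵗ s t u (proj₁ gt)))) (proj₁ (∧-split h)))
      where
      same : ∀ {i} → i ∈ u ∷ us → o i ≡ orb i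
      same (here refl) = memᵇ-complete (u ∷ O) (here refl) ∙ sym (orb-complete s t u start)
      same (there m) with Split-∈ sp m
      ... | inj₁ q = memᵇ-complete (u ∷ O) (there q) ∙ sym (and-elim orb O (proj₁ (∧-split h)) q)
      ... | inj₂ q = o-O' q ∙ sym (not-true (and-elim (not ∘ orb) O' (proj₂ (∧-split {and (map orb O)} h)) q))
      pres : ∀ (r : PermV N) → Good (u ∷ us) r → (∀ i → orb (lookup r i) ≡ orb i) → ∀ i → o (lookup r i) ≡ o i
      pres r g inv i with i ∈? (u ∷ us)
        where open DecMem Fin._≟_
      ... | yes m = same (Good-∈ r g m) ∙ inv i ∙ sym (same m)
      ... | no m = cong o (proj₂ g i m)
    from : preserves o s ∧ (preserves o t ∧ connects u O s t) ≡ true → matches orb (O , O') ≡ true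
    from h = ∧-intro (proj₂ (∧-split {preserves o t} (proj₂ (∧-split {preserves o s} h)))) (and-intro _ O' (λ {i} m → cong not (out i m)))
      where
      ps = preserves-elim o s (proj₁ (∧-split h))
      pt = preserves-elim o t (proj₁ (∧-split {preserves o t} (proj₂ (∧-split {preserves o s} h))))
      stay : ∀ {i} → Reach s t u i → o i ≡ true
      stay start = memᵇ-complete (u ∷ O) (here refl)
      stay (bySˢ r) = ps _ ∙ stay r
      stay (bySᵗ r) = pt _ ∙ stay r
      out : ∀ i → i ∈ O' → orb i ≡ false
      out i m with orb i in e
      ... | false = refl
      ... | true = ⊥-elim (true≢false (sym (stay (orb-sound s t u i e)) ∙ o-O' m))

  connects-comp : ∀ s₁ s₂ t₁ t₂ → Good (u ∷ O) s₁ → Good O' s₂ → Good (u ∷ O) t₁ → Good O' t₂ →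
    connects u O (comp s₁ s₂) (comp t₁ t₂) ≡ connects u O s₁ t₁
  connects-comp s₁ s₂ t₁ t₂ gs₁ gs₂ gt₁ gt₂ = cong and (Listₚ.map-cong same O)
    where
    avoid : ∀ {i} → i ∈ u ∷ O → i ∉ O'
    avoid m m' = true≢false (sym (memᵇ-complete _ m) ∙ o-O' m')
    to : ∀ {i} → Reach (comp s₁ s₂) (comp t₁ t₂) u i → Reach s₁ t₁ u i × i ∈ u ∷ O
    to start = start , here refl
    to (bySˢ {i} r) with to r
    ... | r' , m = subst (λ j → Reach s₁ t₁ u j × j ∈ u ∷ O) (sym (lookup-comp s₁ s₂ i ∙ cong (lookup s₁) (proj₂ gs₂ i (avoid m)))) (bySˢ r' , Good-∈ s₁ gs₁ m)
    to (bySᵗ {i} r) with to r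
    ... | r' , m = subst (λ j → Reach s₁ t₁ u j × j ∈ u ∷ O) (sym (lookup-comp t₁ t₂ i ∙ cong (lookup t₁) (proj₂ gt₂ i (avoid m)))) (bySᵗ r' , Good-∈ t₁ gt₁ m)
    from : ∀ {i} → Reach s₁ t₁ u i → Reach (comp s₁ s₂) (comp t₁ t₂) u i × i ∈ u ∷ O
    from start = start , here refl
    from (bySˢ {i} r) with from r
    ... | r' , m = subst (Reach _ _ u) (lookup-comp s₁ s₂ i ∙ cong (lookup s₁) (proj₂ gs₂ i (avoid m))) (bySˢ r') , Good-∈ s₁ gs₁ m
    from (bySᵗ {i} r) with from r
    ... | r' , m = subst (Reach _ _ u) (lookup-comp t₁ t₂ i ∙ cong (lookup t₁) (proj₂ gt₂ i (avoid m))) (bySᵗ r') , Good-∈ t₁ gt₁ m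
    same : ∀ i → lookup (orbV (comp s₁ s₂) (comp t₁ t₂) u) i ≡ lookup (orbV s₁ t₁ u) i
    same i = bool-ext (λ h → orb-complete s₁ t₁ u (proj₁ (to (orb-sound _ _ u i h)))) (λ h → orb-complete _ _ u (proj₁ (from (orb-sound s₁ t₁ u i h))))

-- The exponential formula in terms of coloured words

module Connected (R : Alg) (x y : Alg.Carrier R) where
  open Ring R
  open Series R
  open Sums R
  open Indicator R public
  private
    module X = Weight x
    module Y = Weight y

  matches-sum : ∀ {X : Set} (o : X → Bool) us → ΣL (λ p → ind (matches o p)) (splits us) ≡ 1#
  matches-sum o [] = +-identityʳ _
  matches-sum o (v ∷ us) = ΣL-concatMap _ _ (splits us) ∙ ΣL-cong point (splits us) ∙ matches-sum o us
    where
    point : ∀ p → ΣL (λ p → ind (matches o p)) ((v ∷ proj₁ p , proj₂ p) ∷ (proj₁ p , v ∷ proj₂ p) ∷ []) ≡ ind (matches o p)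
    point (O , O') with o v
    ... | true = cong (λ b → ind (and (map o O) ∧ and (map (not ∘ o) O')) + (ind b + 0#)) (Boolₚ.∧-zeroʳ (and (map o O))) ∙ solve 1 (λ a → a :+ (:0 :+ :0) := a) refl _
    ... | false = solve 1 (λ a → :0 :+ (a :+ :0) := a) refl _

  module _ {N : ℕ} (f₁ f₂ : Fin N → ℕ) where

    pairSum : List (Fin N) → (PermV N → PermV N → Carrier) → Carrier
    pairSum us h = ΣL (λ s → ΣL (h s) (permsOn us)) (permsOn us)

    weight₂ : PermV N → PermV N → Carrier
    weight₂ s t = X.wt f₁ s * Y.wt f₂ t

    allSum : List (Fin N) → Carrier
    allSum us = pairSum us weight₂

    connSum : Fin N → List (Fin N) → Carrier
    connSum u O = pairSum (u ∷ O) (λ s t → ind (connects u O s t) * weight₂ s t)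

    private
      -- Both permutations are factored along the orbit of u. The weights multiply and connectedness
      -- depends on the first factors alone, so the fourfold sum separates.
      part : ∀ {u us O O'} → Unique (u ∷ us) → Split us O O' →
        pairSum (u ∷ us) (λ s t → ind (matches (lookup (orbV s t u)) (O , O')) * weight₂ s t) ≡ connSum u O * allSum O'
      part {u} {us} {O} {O'} un sp = ΣL-congAll (λ s gs → ΣL-congAll (λ t gt → cong (λ b → ind b * weight₂ s t) (matches-preserves un sp s t gs gt) ∙ cong (_* weight₂ s t) (ind-∧ (preserves o s) _ ∙ cong (ind (preserves o s) *_) (ind-∧ (preserves o t) _)) ∙ solve 4 (λ a b c d → a :* (b :* c) :* d := a :* (b :* (c :* d))) refl _ _ _ _) goodP ∙ ΣL-* _ _ P) goodP ∙ ΣL-cong (λ s → cong (ind (preserves o s) *_) (Σ-preserves o un pt (λ t → ind (connects u O s t) * weight₂ s t))) P ∙ Σ-preserves o un pt _ ∙ ΣL-congAll (λ s₁ gs₁ → ΣL-congAll (λ s₂ gs₂ → ΣL-congAll (λ t₁ gt₁ → ΣL-congAll (λ t₂ gt₂ → term s₁ s₂ t₁ t₂ gs₁ gs₂ gt₁ gt₂) good₂) goodY) good₂) goodX ∙ ΣL-cong (λ s₁ → ΣL-swap (λ s₂ t₁ → ΣL (λ t₂ → ind (connects u O s₁ t₁) * weight₂ s₁ t₁ * weight₂ s₂ t₂) P₂) P₂ P₁ ∙ ΣL-cong (λ t₁ → ΣL-cong (λ s₂ → ΣL-* _ _ P₂) P₂ ∙ ΣL-* _ _ P₂) P₁ ∙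 ΣL-*ʳ _ _ P₁) P₁ ∙ ΣL-*ʳ _ _ P₁
        where
        o = memᵇ (u ∷ O)
        pt = split-Part un sp
        P = permsOn (u ∷ us)
        P₁ = permsOn (u ∷ O)
        P₂ = permsOn O'
        goodP = permsOn-Good (u ∷ us) un
        un₁ = Split-uniqueˡ un (left sp)
        un₂ = Split-uniqueˡ un (Split-swap (left sp))
        good₁ = permsOn-Good (u ∷ O) un₁
        goodX = All.zip (good₁ , X.wt-comp f₁ (u ∷ O) O' un₁ (λ {i} → Split-disjoint un (left sp)))
        goodY = All.zip (good₁ , Y.wt-comp f₂ (u ∷ O) O' un₁ (λ {i} → Split-disjoint un (left sp)))
        good₂ = permsOn-Good O' un₂
        term : ∀ s₁ s₂ t₁ t₂ → Good (u ∷ O) s₁ × (∀ s₂ → Good O' s₂ → X.wt f₁ (comp s₁ s₂) ≡ X.wt f₁ s₁ * X.wt f₁ s₂) → Good O' s₂ →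
          Good (u ∷ O) t₁ × (∀ t₂ → Good O' t₂ → Y.wt f₂ (comp t₁ t₂) ≡ Y.wt f₂ t₁ * Y.wt f₂ t₂) → Good O' t₂ →
          ind (connects u O (comp s₁ s₂) (comp t₁ t₂)) * weight₂ (comp s₁ s₂) (comp t₁ t₂) ≡ ind (connects u O s₁ t₁) * weight₂ s₁ t₁ * weight₂ s₂ t₂
        term s₁ s₂ t₁ t₂ gs₁ gs₂ gt₁ gt₂ = cong₂ (λ b w → ind b * w) (connects-comp un sp s₁ s₂ t₁ t₂ (proj₁ gs₁) gs₂ (proj₁ gt₁) gt₂) (cong₂ _*_ (proj₂ gs₁ s₂ gs₂) (proj₂ gt₁ t₂ gt₂)) ∙
          solve 5 (λ b a c d e → b :* (a :* c :* (d :* e)) := b :* (a :* d) :* (c :* e)) refl _ _ _ _ _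

    -- Each pair selects one split of us, namely by the joint orbit of u; `matches-sum` inserts this
    -- choice as a sum equal to 1.
    exponential : ∀ u us → Unique (u ∷ us) → allSum (u ∷ us) ≡ ΣL (λ p → connSum u (proj₁ p) * allSum (proj₂ p)) (splits us)
    exponential u us un = ΣL-cong (λ s → ΣL-cong (λ t → sym (*-identityˡ _) ∙ cong (_* weight₂ s t) (sym (matches-sum (lookup (orbV s t u)) us)) ∙ sym (ΣL-*ʳ _ _ (splits us))) P) P ∙ ΣL-cong (λ s → ΣL-swap _ P (splits us)) P ∙ ΣL-swap _ P (splits us) ∙ ΣL-congAll (λ { (O , O') sp → part un sp }) (splits-Split us)
      where P = permsOn (u ∷ us)

  -- A coloured edge is a pair (column , row).
  word₂ : List (ℕ × ℕ) → Carrier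
  word₂ bs = X.word (map proj₁ bs) * Y.word (map proj₂ bs)

  -- The exponential formula solved for its connected part. It depends on the word of colours alone,
  -- which is why permutations disappear from here on. The first argument bounds the recursion; the
  -- length of the word suffices.
  connWord : ℕ → List (ℕ × ℕ) → Carrier
  connWord zero bs = 0#
  connWord (suc n) [] = 0#
  connWord (suc n) (b ∷ bs) = word₂ (b ∷ bs) +
    - ΣL (λ p → ind (not (null (proj₂ p))) * (connWord n (b ∷ proj₁ p) * word₂ (proj₂ p))) (splits bs)

  Σ-null : ∀ {X : Set} (F : List X × List X → Carrier) us → ΣL (λ p → ind (null (proj₂ p)) * F p) (splits us) ≡ F (us , [])
  Σ-null F [] = +-identityʳ _ ∙ *-identityˡ _
  Σ-null F (v ∷ us) = ΣL-concatMap _ _ (splits us) ∙ ΣL-cong (λ { (O , O') →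
      solve 3 (λ a b c → a :* b :+ (:0 :* c :+ :0) := a :* b) refl (ind (null O')) (F (v ∷ O , O')) (F (O , v ∷ O')) }) (splits us) ∙ Σ-null (λ { (O , O') → F (v ∷ O , O') }) us

  Σ-null-split : ∀ {X : Set} (F : List X × List X → Carrier) us →
    ΣL F (splits us) ≡ F (us , []) + ΣL (λ p → ind (not (null (proj₂ p))) * F p) (splits us)
  Σ-null-split F us = ΣL-cong (λ p → point (null (proj₂ p)) (F p)) (splits us) ∙ ΣL-+ _ _ (splits us) ∙ cong (_+ ΣL (λ p → ind (not (null (proj₂ p))) * F p) (splits us)) (Σ-null F us)
    where
    point : ∀ b f → f ≡ ind b * f + ind (not b) * f
    point true f = solve 1 (λ f → f := :1 :* f :+ :0 :* f) refl f
    point false f = solve 1 (λ f → f := :0 :* f :+ :1 :* f) refl f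

  nonempty-shorter : ∀ {X : Set} {us O O' : List X} → Split us O O' → not (null O') ≡ true → length O ℕ.< length us
  nonempty-shorter {O = O} {O' = v ∷ O'} sp _ = subst (suc (length O) ℕ.≤_) (sym (ℕₚ.+-suc (length O) (length O')) ∙ Split-length sp) (s≤s (m≤m+n (length O) (length O')))

  Σ-nonempty-cong : ∀ {X : Set} (us : List X) {F F' : List X × List X → Carrier} →
    (∀ O O' → Split us O O' → length O ℕ.< length us → F (O , O') ≡ F' (O , O')) →
    ΣL (λ p → ind (not (null (proj₂ p))) * F p) (splits us) ≡ ΣL (λ p → ind (not (null (proj₂ p))) * F' p) (splits us)
  Σ-nonempty-cong us {F} {F'} h = ΣL-congAll (λ { (O , O') sp → aux O O' sp }) (splits-Split us)
    where
    aux : ∀ O O' → Split us O O' → ind (not (null O')) * F (O , O') ≡ ind (not (null O')) * F' (O , O')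
    aux O O' sp with not (null O') in e
    ... | false = zeroˡ _ ∙ sym (zeroˡ _)
    ... | true = cong (1# *_) (h O O' sp (nonempty-shorter sp e))

  connWord-stable : ∀ n m bs → length bs ℕ.≤ n → length bs ℕ.≤ m → connWord n bs ≡ connWord m bs
  connWord-stable zero zero [] p q = refl
  connWord-stable zero (suc m) [] p q = refl
  connWord-stable (suc n) zero [] p q = refl
  connWord-stable (suc n) (suc m) [] p q = refl
  connWord-stable (suc n) (suc m) (b ∷ bs) (s≤s p) (s≤s q) = cong (λ z → word₂ (b ∷ bs) + - z) (Σ-nonempty-cong bs (λ O O' sp lt →
    cong (_* word₂ O') (connWord-stable n m (b ∷ O) (≤-trans lt p) (≤-trans lt q))))

  connW : List (ℕ × ℕ) → Carrier
  connW bs = connWord (length bs) bs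

  word₂-splits : ∀ b bs → word₂ (b ∷ bs) ≡ ΣL (λ p → connW (b ∷ proj₁ p) * word₂ (proj₂ p)) (splits bs)
  word₂-splits b bs = sym (Σ-null-split (λ p → connW (b ∷ proj₁ p) * word₂ (proj₂ p)) bs ∙
    cong₂ _+_ (cong (connW (b ∷ bs) *_) (*-identityʳ 1#) ∙ *-identityʳ _)
        (Σ-nonempty-cong bs (λ O O' sp lt → cong (_* word₂ O') (connWord-stable (suc (length O)) (length bs) (b ∷ O) ≤-refl lt))) ∙
      solve 2 (λ w z → (w :+ :- z) :+ z := w) refl (word₂ (b ∷ bs)) _)

  splits-map : ∀ {X Y : Set} (k : X → Y) us → splits (map k us) ≡ map (λ p → map k (proj₁ p) , map k (proj₂ p)) (splits us)
  splits-map k [] = refl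
  splits-map k (v ∷ us) = cong (concatMap _) (splits-map k us) ∙ go (splits us)
    where
    go : ∀ ps → concatMap (λ { (O , O') → (k v ∷ O , O') ∷ (O , k v ∷ O') ∷ [] }) (map (λ p → map k (proj₁ p) , map k (proj₂ p)) ps)
       ≡ map (λ p → map k (proj₁ p) , map k (proj₂ p)) (concatMap (λ { (O , O') → (v ∷ O , O') ∷ (O , v ∷ O') ∷ [] }) ps)
    go [] = refl
    go (p ∷ ps) = cong (λ z → _ ∷ _ ∷ z) (go ps)

  module _ {N : ℕ} (f₁ f₂ : Fin N → ℕ) where

    colour : Fin N → ℕ × ℕ
    colour i = f₁ i , f₂ i

    allSum-word : ∀ us → Unique us → allSum f₁ f₂ us ≡ word₂ (map colour us)
    allSum-word us un = ΣL-cong (λ s → ΣL-* _ _ (permsOn us)) (permsOn us) ∙ ΣL-*ʳ _ _ (permsOn us) ∙ cong₂ _*_ (X.Σ-wt f₁ us un) (Y.Σ-wt f₂ us un) ∙ cong₂ (λ a b → X.word a * Y.word b) (Listₚ.map-∘ us) (Listₚ.map-∘ us)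

    connSum-word′ : ∀ n u us → length us ℕ.≤ n → Unique (u ∷ us) → connSum f₁ f₂ u us ≡ connWord (suc n) (map colour (u ∷ us))
    connSum-word : ∀ n u us → length us ℕ.≤ n → Unique (u ∷ us) →
      connSum f₁ f₂ u us ≡ word₂ (map colour (u ∷ us)) + - ΣL (λ p → ind (not (null (proj₂ p))) * (connWord n (colour u ∷ map colour (proj₁ p)) * word₂ (map colour (proj₂ p)))) (splits us)
    connSum-word′ n u us le un = connSum-word n u us le un ∙
      cong (λ z → word₂ (map colour (u ∷ us)) + - z) (sym (cong (ΣL (λ p → ind (not (null (proj₂ p))) * _)) (splits-map colour us) ∙
        ΣL-map _ _ (splits us) ∙ ΣL-cong (λ { (O , []) → refl ; (O , v ∷ O') → refl }) (splits us)))
    connSum-word n u us le un = solve 2 (λ w z → w := (w :+ z) :+ :- z) refl _ rest ∙ cong (λ w → w + rest + - rest) (sym (cong (connSum f₁ f₂ u us *_) (allSum-word [] []) ∙ cong (connSum f₁ f₂ u us *_) (*-identityʳ 1#) ∙ *-identityʳ _)) ∙ cong (_+ - rest) (sym (exponential f₁ f₂ u us un ∙ Σ-null-split _ us)) ∙ cong₂ (λ w z → w + - z) (allSum-word (u ∷ us) un) (Σ-nonempty-cong us (λ O O' sp lt → term n le O O' sp lt))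
      where
      rest = ΣL (λ p → ind (not (null (proj₂ p))) * (connSum f₁ f₂ u (proj₁ p) * allSum f₁ f₂ (proj₂ p))) (splits us)
      term : ∀ n → length us ℕ.≤ n → ∀ O O' → Split us O O' → length O ℕ.< length us →
        connSum f₁ f₂ u O * allSum f₁ f₂ O' ≡ connWord n (colour u ∷ map colour O) * word₂ (map colour O')
      term zero le O O' sp lt = ⊥-elim (ℕₚ.n≮0 (≤-trans lt le))
      term (suc n) le O O' sp lt = cong₂ _*_ (connSum-word′ n u O (≤-pred (≤-trans lt le)) (Split-uniqueˡ un (left sp)))
        (allSum-word O' (Split-uniqueˡ (unique-tail un) (Split-swap sp)))

    connSum-connW : ∀ u us → Unique (u ∷ us) → connSum f₁ f₂ u us ≡ connW (map colour (u ∷ us))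
    connSum-connW u us un = connSum-word′ (length us) u us ≤-refl un ∙
      cong (λ k → connWord (suc k) (map colour (u ∷ us))) (sym (Listₚ.length-map colour us))

  -- Sums over words, normalised as in an exponential generating function.
  module Words (Bx : List (ℕ × ℕ)) where

    Σw : ℕ → (List (ℕ × ℕ) → Carrier) → Carrier
    Σw n h = ΣL (λ v → h (Vec.toList v)) (tuples n Bx)

    Σw-suc : ∀ n h → Σw (suc n) h ≡ ΣL (λ b → Σw n (λ l → h (b ∷ l))) Bx
    Σw-suc n h = ΣL-concatMap _ _ Bx ∙ ΣL-cong (λ b → ΣL-map _ _ (tuples n Bx)) Bx

  1/! : ℕ → Carrier
  1/! zero = 1#
  1/! (suc n) = ι (1/ℕ n) * 1/! n

  1/!-suc : ∀ n → nat (suc n) * 1/! (suc n) ≡ 1/! n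
  1/!-suc n = solve 3 (λ a b c → a :* (b :* c) := b :* a :* c) refl _ _ _ ∙ cong (_* 1/! n) (sym (ι-* _ _) ∙ cong ι (1/ℕ-inverse n) ∙ ι-1) ∙ *-identityˡ _

  nat-cancel : ∀ n a b → nat (suc n) * a ≡ nat (suc n) * b → a ≡ b
  nat-cancel n a b e = sym (inv a) ∙ cong (ι (1/ℕ n) *_) e ∙ inv b
    where
    inv : ∀ a → ι (1/ℕ n) * (nat (suc n) * a) ≡ a
    inv a = sym (*-assoc _ _ _) ∙ cong (_* a) (sym (ι-* _ _) ∙ cong ι (1/ℕ-inverse n) ∙ ι-1) ∙ *-identityˡ _

  module WordSeries (Bx : List (ℕ × ℕ)) where
    open Words Bx

    -- An exponential generating function over words in Bx. By `Σb-egf`, prefixing a letter and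
    -- summing over it is differentiation.
    egf : (List (ℕ × ℕ) → Carrier) → Seq
    egf h n = 1/! n * Σw n h

    splitSum : (List (ℕ × ℕ) → Carrier) → (List (ℕ × ℕ) → Carrier) → List (ℕ × ℕ) → Carrier
    splitSum h k l = ΣL (λ p → h (proj₁ p) * k (proj₂ p)) (splits l)

    Σb-egf : ∀ h n → ΣL (λ b → egf (λ l → h (b ∷ l)) n) Bx ≡ nat (suc n) * egf h (suc n)
    Σb-egf h n = ΣL-* _ _ Bx ∙ cong (1/! n *_) (sym (Σw-suc n h)) ∙
      cong (_* Σw (suc n) h) (sym (1/!-suc n)) ∙ *-assoc _ _ _

    -- Both sides have the same derivative: a prefixed letter goes to one of the two subwords, which
    -- is Leibniz's rule.
    egf-split : ∀ n h k → egf (splitSum h k) n ≡ conv (egf h) (egf k) n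
    egf-split zero h k = solve 2 (λ a b → :1 :* (a :* b :+ :0 :+ :0) := :1 :* (a :+ :0) :* (:1 :* (b :+ :0))) refl (h []) (k [])
    egf-split (suc n) h k = nat-cancel n _ _ (sym (Σb-egf (splitSum h k) n) ∙ ΣL-cong (λ b → cong (1/! n *_) (ΣL-cong (λ v → cons b (Vec.toList v)) (tuples n Bx) ∙ ΣL-+ _ _ (tuples n Bx)) ∙ distribˡ _ _ _) Bx ∙ ΣL-cong (λ b → cong₂ _+_ (egf-split n _ k) (egf-split n h _)) Bx ∙ ΣL-+ _ _ Bx ∙ cong₂ _+_ (conv-Σˡ Bx ∙ conv-cong (Σb-egf h) (λ _ → refl) n) (conv-Σʳ Bx ∙ conv-cong (λ _ → refl) (Σb-egf k) n) ∙ cong₂ _+_ (sym (cong (_+ conv (tail (deriv (egf h))) (egf k) n) (d0 _ _) ∙ +-identityˡ _)) (sym (dsum-last (λ i j → egf h i * deriv (egf k) j) n ∙ cong (conv (egf h) (tail (deriv (egf k))) n +_) (*-comm _ _ ∙ d0 _ _) ∙ +-identityʳ _)) ∙ sym (deriv-conv (egf h) (egf k) (suc n)))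
      where
      d0 : ∀ a b → nat 0 * a * b ≡ 0#
      d0 a b = cong (λ z → z * a * b) nat-0 ∙ solve 2 (λ a b → :0 :* a :* b := :0) refl a b
      cons : ∀ b l → splitSum h k (b ∷ l) ≡ splitSum (λ l → h (b ∷ l)) k l + splitSum h (λ l → k (b ∷ l)) l
      cons b l = ΣL-concatMap _ _ (splits l) ∙ ΣL-cong (λ p → cong (h (b ∷ proj₁ p) * k (proj₂ p) +_) (+-identityʳ _)) (splits l) ∙ ΣL-+ _ _ (splits l)
      conv-Σˡ : ∀ bs → ΣL (λ b → conv (egf (λ l → h (b ∷ l))) (egf k) n) bs ≡ conv (λ m → ΣL (λ b → egf (λ l → h (b ∷ l)) m) bs) (egf k) n
      conv-Σˡ [] = sym (conv-0ˡ _ n)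
      conv-Σˡ (b ∷ bs) = cong (conv (egf (λ l → h (b ∷ l))) (egf k) n +_) (conv-Σˡ bs) ∙ sym (conv-+ˡ _ _ _ n)
      conv-Σʳ : ∀ bs → ΣL (λ b → conv (egf h) (egf (λ l → k (b ∷ l))) n) bs ≡ conv (egf h) (λ m → ΣL (λ b → egf (λ l → k (b ∷ l)) m) bs) n
      conv-Σʳ [] = sym (conv-comm _ _ n ∙ conv-0ˡ _ n)
      conv-Σʳ (b ∷ bs) = cong (conv (egf h) (egf (λ l → k (b ∷ l))) n +_) (conv-Σʳ bs) ∙ sym (conv-+ʳ _ _ _ n)

    ẑ ŵ : Seq
    ẑ = egf word₂
    ŵ n = 1/! n * Σw (suc n) connW

    -- The first letter plays the part of the root edge. Summing `word₂-splits` over it yields the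
    -- differential equation ẑ' = ŵẑ.
    word-series : ∀ n → nat (suc n) * ẑ (suc n) ≡ conv ŵ ẑ n
    word-series n = sym (Σb-egf word₂ n) ∙ ΣL-cong (λ b → cong (1/! n *_) (ΣL-cong (λ v → word₂-splits b (Vec.toList v)) (tuples n Bx)) ∙ egf-split n _ _) Bx ∙ conv-Σ Bx ∙ conv-cong (λ m → ΣL-* _ _ Bx ∙ cong (1/! m *_) (sym (Σw-suc m connW))) (λ _ → refl) n
      where
      conv-Σ : ∀ bs → ΣL (λ b → conv (egf (λ l → connW (b ∷ l))) ẑ n) bs ≡ conv (λ m → ΣL (λ b → egf (λ l → connW (b ∷ l)) m) bs) ẑ n
      conv-Σ [] = sym (conv-0ˡ _ n)
      conv-Σ (b ∷ bs) = cong (conv (egf (λ l → connW (b ∷ l))) ẑ n +_) (conv-Σ bs) ∙ sym (conv-+ˡ _ _ _ n)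

-- From words in the boxes to the column operator

tuples-All : ∀ {X : Set} k (xs : List X) → All (λ v → All (_∈ xs) (Vec.toList v)) (tuples k xs)
tuples-All zero xs = [] ∷ []
tuples-All (suc k) xs = Allₚ.concat⁺ (Allₚ.map⁺ (All.tabulate (λ {x} m → Allₚ.map⁺ (All.map (λ p → m ∷ p) (tuples-All k xs)))))

colBoxesℕ : List (ℕ × List ℕ) → List (ℕ × ℕ)
colBoxesℕ [] = []
colBoxesℕ ((c , ys) ∷ cs) = map (c ,_) ys ++ colBoxesℕ cs

-- Later columns meet only rows that the first column meets, and differ from it in name. This is the
-- form in which the shape of a Young diagram enters the count of words.
data Nested : List (ℕ × List ℕ) → Set where
  [] : Nested []
  add : ∀ {c ys cs} → Unique ys → All (λ b → proj₁ b ≢ c × proj₂ b ∈ ys) (colBoxesℕ cs) → Nested cs → Nested ((c , ys) ∷ cs)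

-- x = g/A and y = g/B are the parameters for which the word weights of one column become the rising
-- factorials of the column operator.
module ColumnWords (R : Alg) (A B g gi x y : Alg.Carrier R)
  (xA : Alg._*_ R x A ≡ g) (yB : Alg._*_ R y B ≡ g) (ggi : Alg._*_ R g gi ≡ Alg.1# R) where
  open Ring R
  open Sums R
  open Connected R x y
  open Series R
  private
    module X = Weight x
    module Y = Weight y

  ris₁ : ℕ → Carrier
  ris₁ zero = 1#
  ris₁ (suc i) = ris₁ i * (1# + x * nat i)

  α : ℕ → Carrier
  α i = (A ^# i) * (ris₁ i * (1/! i * (gi ^# i)))

  α-zero : α 0 ≡ 1#
  α-zero = solve 0 (:1 :* (:1 :* (:1 :* :1)) := :1) refl

  α-suc : ∀ i → nat (suc i) * g * α (suc i) ≡ (A + nat i * g) * α i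
  α-suc i = solve 9 (λ n g A a r k f gi p → n :* g :* (A :* a :* (r :* k :* (f :* (gi :* p)))) := (n :* f) :* (g :* gi) :* (A :* k) :* (a :* (r :* p))) refl (nat (suc i)) g A (A ^# i) (ris₁ i) (1# + x * nat i) (1/! (suc i)) gi (gi ^# i) ∙ cong₂ (λ a b → a * (A * (1# + x * nat i)) * ((A ^# i) * (ris₁ i * b))) (cong₂ _*_ (1/!-suc i) ggi) refl ∙ solve 7 (λ f A x n a r p → f :* :1 :* (A :* (:1 :+ x :* n)) :* (a :* (r :* p)) := (A :+ n :* (x :* A)) :* (a :* (r :* (f :* p)))) refl (1/! i) A x (nat i) (A ^# i) (ris₁ i) (gi ^# i) ∙ cong (λ z → (A + nat i * z) * α i) xA

  open Columns R g A α α-zero α-suc using (C; r; r-last; rise)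

  occ : ℕ → List ℕ → Carrier
  occ c cs = ΣL (λ d → ind (c ≡ᵇ d)) cs

  Symmetricʷ : (List (ℕ × ℕ) → Carrier) → Set
  Symmetricʷ h = ∀ as xs b ys → h (as ++ xs ++ b ∷ ys) ≡ h (as ++ b ∷ xs ++ ys)

  module _ (z : Carrier) where
    open Weight z using (word)

    -- Equality of weights alone is not stable under prefixing a letter; the letter counts have to
    -- be carried along.
    record Equi (cs ds : List ℕ) : Set where
      constructor equi
      field
        same-word : word cs ≡ word ds
        same-occ : ∀ c → occ c cs ≡ occ c ds
    open Equi

    private
      equi-cons : ∀ c {cs ds} → Equi cs ds → Equi (c ∷ cs) (c ∷ ds)
      equi-cons c (equi p q) = equi (cong₂ (λ a b → (1# + z * a) * b) (q c) p) λ d → cong (ind (d ≡ᵇ c) +_) (q d)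

      equi-trans : ∀ {cs ds es} → Equi cs ds → Equi ds es → Equi cs es
      equi-trans (equi p q) (equi p' q') = equi (p ∙ p') λ c → q c ∙ q' c

      ind-sym : ∀ c d → ind (c ≡ᵇ d) ≡ ind (d ≡ᵇ c)
      ind-sym zero zero = refl
      ind-sym zero (suc d) = refl
      ind-sym (suc c) zero = refl
      ind-sym (suc c) (suc d) = ind-sym c d

      equi-swap : ∀ c d cs → Equi (c ∷ d ∷ cs) (d ∷ c ∷ cs)
      equi-swap c d cs = equi (cong (λ i → (1# + z * (i + occ c cs)) * ((1# + z * occ d cs) * word cs)) (ind-sym c d) ∙ swap′ (ind (d ≡ᵇ c)) refl)
        λ e → solve 3 (λ a b k → a :+ (b :+ k) := b :+ (a :+ k)) refl _ _ _
        where
        swap′ : ∀ i → i ≡ ind (d ≡ᵇ c) → (1# + z * (i + occ c cs)) * ((1# + z * occ d cs) * word cs) ≡ (1# + z * (i + occ d cs)) * ((1# + z * occ c cs) * word cs)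
        swap′ i e with d ≡ᵇ c in eq
        ... | true rewrite ≡ᵇ-sound {d} {c} eq = refl
        ... | false rewrite e = solve 4 (λ z a b w → (:1 :+ z :* (:0 :+ a)) :* ((:1 :+ z :* b) :* w) := (:1 :+ z :* (:0 :+ b)) :* ((:1 :+ z :* a) :* w)) refl z (occ c cs) (occ d cs) (word cs)

      equi-move : ∀ xs b ys → Equi (xs ++ b ∷ ys) (b ∷ xs ++ ys)
      equi-move [] b ys = equi refl λ _ → refl
      equi-move (c ∷ xs) b ys = equi-trans (equi-cons c (equi-move xs b ys)) (equi-swap c b (xs ++ ys))

      equi-prefix : ∀ as {cs ds} → Equi cs ds → Equi (as ++ cs) (as ++ ds)
      equi-prefix [] e = e
      equi-prefix (a ∷ as) e = equi-cons a (equi-prefix as e)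

    word-move : ∀ as xs b ys → word (as ++ xs ++ b ∷ ys) ≡ word (as ++ b ∷ xs ++ ys)
    word-move as xs b ys = same-word (equi-prefix as (equi-move xs b ys))

  word₂-symmetric : Symmetricʷ word₂
  word₂-symmetric as xs b ys = cong₂ _*_ (step x proj₁) (step y proj₂)
    where
    step : ∀ z (p : ℕ × ℕ → ℕ) → Weight.word z (map p (as ++ xs ++ b ∷ ys)) ≡ Weight.word z (map p (as ++ b ∷ xs ++ ys))
    step z p = cong (Weight.word z) (Listₚ.map-++ p as _ ∙ cong (map p as ++_) (Listₚ.map-++ p xs _)) ∙
      word-move z (map p as) (map p xs) (p b) (map p ys) ∙
        cong (Weight.word z) (sym (Listₚ.map-++ p as _ ∙ cong (λ w → map p as ++ p b ∷ w) (Listₚ.map-++ p xs ys)))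

  module TwoAlphabets (Xs Ys : List (ℕ × ℕ)) where

    S : ℕ → ℕ → (List (ℕ × ℕ) → Carrier) → Carrier
    S j i h = ΣL (λ ys → ΣL (λ xs → h (Vec.toList xs ++ Vec.toList ys)) (tuples i Xs)) (tuples j Ys)

    egf₂ : (List (ℕ × ℕ) → Carrier) → ℕ → ℕ → Carrier
    egf₂ h j i = 1/! j * (1/! i * S j i h)

    open WordSeries (Xs ++ Ys) using (egf; Σb-egf)

    S-X : ∀ j i h → ΣL (λ b → S j i (h ∘ (b ∷_))) Xs ≡ S j (suc i) h
    S-X j i h = ΣL-swap _ Xs (tuples j Ys) ∙ ΣL-cong (λ ys → sym (ΣL-concatMap _ _ Xs ∙ ΣL-cong (λ b → ΣL-map _ _ (tuples i Xs)) Xs)) (tuples j Ys)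

    S-Y : ∀ j i h → Symmetricʷ h → ΣL (λ b → S j i (h ∘ (b ∷_))) Ys ≡ S (suc j) i h
    S-Y j i h sy = sym (ΣL-concatMap _ _ Ys ∙ ΣL-cong (λ b → ΣL-map _ _ (tuples j Ys) ∙
      ΣL-cong (λ ys → ΣL-cong (λ xs → sy [] (Vec.toList xs) b (Vec.toList ys)) (tuples i Xs)) (tuples j Ys)) Ys)

    nat0* : ∀ a → nat 0 * a ≡ 0#
    nat0* a = cong (_* a) nat-0 ∙ zeroˡ a

    -- By symmetry the letters from Xs can be moved to the front. The number of interleavings is a
    -- binomial coefficient, which the factorials absorb; the proof compares derivatives instead of
    -- counting.
    egf-two : ∀ n h → Symmetricʷ h → egf h n ≡ dsum (egf₂ h) n
    egf-two zero h sy = solve 1 (λ a → :1 :* (a :+ :0) := :1 :* (:1 :* (a :+ :0 :+ :0))) refl (h [])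
    egf-two (suc n) h sy = nat-cancel n _ _ (sym (Σb-egf h n) ∙ ΣL-cong (λ b → egf-two n (h ∘ (b ∷_)) (λ as → sy (b ∷ as))) (Xs ++ Ys) ∙ ΣL-++ _ Xs Ys ∙ cong₂ _+_ (dsum-ΣL Xs ∙ dsum-cong (λ j i → ΣL-* _ _ Xs ∙ cong (1/! j *_) (ΣL-* _ _ Xs ∙ cong (1/! i *_) (S-X j i h)) ∙ raiseX j i) n) (dsum-ΣL Ys ∙ dsum-cong (λ j i → ΣL-* _ _ Ys ∙ cong (1/! j *_) (ΣL-* _ _ Ys ∙ cong (1/! i *_) (S-Y j i h sy)) ∙ raiseY j i) n) ∙ cong₂ _+_ (sym (dsum-last (λ j i → nat i * egf₂ h j i) n ∙ cong (dsum (λ j i → nat (suc i) * egf₂ h j (suc i)) n +_) (nat0* _) ∙ +-identityʳ _)) (sym (cong (_+ dsum (λ j i → nat (suc j) * egf₂ h (suc j) i) n) (nat0* _) ∙ +-identityˡ _)) ∙ +-comm _ _ ∙ sym (deriv-dsum (egf₂ h) (suc n)))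
      where
      dsum-ΣL : ∀ bs → ΣL (λ b → dsum (egf₂ (h ∘ (b ∷_))) n) bs ≡ dsum (λ j i → ΣL (λ b → egf₂ (h ∘ (b ∷_)) j i) bs) n
      dsum-ΣL [] = sym (dsum-0 n)
      dsum-ΣL (b ∷ bs) = cong (dsum (egf₂ (h ∘ (b ∷_))) n +_) (dsum-ΣL bs) ∙ sym (dsum-+ _ _ n)
      raiseX : ∀ j i → 1/! j * (1/! i * S j (suc i) h) ≡ nat (suc i) * egf₂ h j (suc i)
      raiseX j i = cong (λ f → 1/! j * (f * S j (suc i) h)) (sym (1/!-suc i)) ∙ solve 4 (λ a n f s → a :* (n :* f :* s) := n :* (a :* (f :* s))) refl _ _ _ _
      raiseY : ∀ j i → 1/! j * (1/! i * S (suc j) i h) ≡ nat (suc j) * egf₂ h (suc j) i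
      raiseY j i = cong (λ f → f * (1/! i * S (suc j) i h)) (sym (1/!-suc j)) ∙ *-assoc _ _ _

  module Column (c : ℕ) (ys : List ℕ) (un : Unique ys) where

    h : Carrier
    h = nat (length ys)

    Xs : List (ℕ × ℕ)
    Xs = map (c ,_) ys

    ris₂ : ℕ → ℕ → Carrier
    ris₂ j zero = 1#
    ris₂ j (suc i) = ris₂ j i * (h + y * nat (i ℕ.+ j))

    occ-in : ∀ {d} zs → Unique zs → d ∈ zs → ΣL (λ e → ind (e ≡ᵇ d)) zs ≡ 1#
    occ-in {d} (e ∷ zs) (p ∷ _) (here refl) = cong₂ _+_ (cong ind (≡ᵇ-refl d)) (ΣL-congAll (λ e q → cong ind (neq q)) p ∙ ΣL-0 zs) ∙ +-identityʳ _
      where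
      neq : ∀ {e} → d ≢ e → (e ≡ᵇ d) ≡ false
      neq {e} q with e ≡ᵇ d in eq
      ... | false = refl
      ... | true = ⊥-elim (q (sym (≡ᵇ-sound eq)))
    occ-in {d} (e ∷ zs) (p ∷ un) (there m) with e ≡ᵇ d in eq
    ... | true = ⊥-elim (All.lookup p m (≡ᵇ-sound eq))
    ... | false = +-identityˡ _ ∙ occ-in zs un m

    occ-total : ∀ {l} → All (_∈ ys) l → ΣL (λ e → occ e l) ys ≡ nat (length l)
    occ-total {[]} [] = ΣL-0 ys ∙ sym nat-0
    occ-total {d ∷ l} (m ∷ ms) = ΣL-+ _ _ ys ∙ cong₂ _+_ (occ-in ys un m) (occ-total ms) ∙ sym (nat-suc (length l))

    occ-c : ∀ {xs l : List (ℕ × ℕ)} → All (_∈ Xs) xs → All (λ b → proj₁ b ≢ c) l → occ c (map proj₁ (xs ++ l)) ≡ nat (length xs)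
    occ-c {[]} {[]} [] [] = sym nat-0
    occ-c {[]} {b ∷ l} [] (p ∷ ps) with c ≡ᵇ proj₁ b in eq
    ... | true = ⊥-elim (p (sym (≡ᵇ-sound eq)))
    ... | false = +-identityˡ _ ∙ occ-c [] ps
    occ-c {b ∷ xs} (m ∷ ms) ps with ∈ₚ.∈-map⁻ (c ,_) m
    ... | _ , _ , refl = cong₂ _+_ (cong ind (≡ᵇ-refl c)) (occ-c ms ps) ∙ sym (nat-suc (length xs))

    word₂-cons : ∀ d m → word₂ ((c , d) ∷ m) ≡ (1# + x * occ c (map proj₁ m)) * ((1# + y * occ d (map proj₂ m)) * word₂ m)
    word₂-cons d m = solve 4 (λ a p b q → (a :* p) :* (b :* q) := a :* (b :* (p :* q))) refl _ _ _ _

    Outside : List (ℕ × ℕ) → Set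
    Outside l = All (λ b → proj₁ b ≢ c × proj₂ b ∈ ys) l

    -- A letter of column c prefixed to i others of that column and to l has column factor 1 + xi.
    -- Summed over its row, its row factor gives h + y(i + length l), since each letter behind it
    -- lies in exactly one of the rows ys.
    ΣX-word : ∀ i l → Outside l → ΣL (λ xs → word₂ (Vec.toList xs ++ l)) (tuples i Xs) ≡ ris₁ i * ris₂ (length l) i * word₂ l
    ΣX-word zero l out = solve 1 (λ w → w :+ :0 := :1 :* :1 :* w) refl (word₂ l)
    ΣX-word (suc i) l out = ΣL-concatMap _ _ Xs ∙ ΣL-cong (λ b → ΣL-map _ _ (tuples i Xs)) Xs ∙ ΣL-swap _ Xs (tuples i Xs) ∙ ΣL-congAll (λ xs p → head xs p) (tuples-All i Xs) ∙ ΣL-* _ _ (tuples i Xs) ∙ cong ((1# + x * nat i) * (h + y * nat (i ℕ.+ length l)) *_) (ΣX-word i l out) ∙ solve 5 (λ a b p q w → a :* b :* (p :* q :* w) := p :* a :* (q :* b) :* w) refl _ _ _ _ _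
      where
      rows-in : ∀ {xs} → All (_∈ Xs) xs → All (_∈ ys) (map proj₂ (xs ++ l))
      rows-in ms = Allₚ.map⁺ (Allₚ.++⁺ (All.map (λ m → let (d , d∈ , e) = ∈ₚ.∈-map⁻ (c ,_) m in subst (_∈ ys) (sym (cong proj₂ e)) d∈) ms) (All.map proj₂ out))
      head : ∀ (xs : Vec (ℕ × ℕ) i) → All (_∈ Xs) (Vec.toList xs) → ΣL (λ b → word₂ (b ∷ Vec.toList xs ++ l)) Xs ≡ (1# + x * nat i) * (h + y * nat (i ℕ.+ length l)) * word₂ (Vec.toList xs ++ l)
      head xs p = ΣL-map _ _ ys ∙ ΣL-cong (λ d → word₂-cons d m) ys ∙ ΣL-* _ _ ys ∙ cong ((1# + x * occ c (map proj₁ m)) *_) (ΣL-*ʳ _ _ ys) ∙ cong₂ (λ a b → (1# + x * a) * (b * word₂ m)) (occ-c p (All.map proj₁ out) ∙ cong nat (len xs)) (ΣL-+ _ _ ys ∙ cong₂ _+_ (ones ys) (ΣL-* _ _ ys ∙ cong (y *_) (occ-total (rows-in p) ∙ cong nat lenm))) ∙ sym (*-assoc _ _ _)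
        where
        m = Vec.toList xs ++ l
        len : ∀ {k} (v : Vec (ℕ × ℕ) k) → length (Vec.toList v) ≡ k
        len [] = refl
        len (_ ∷ v) = cong suc (len v)
        lenm : length (map proj₂ m) ≡ i ℕ.+ length l
        lenm = Listₚ.length-map proj₂ m ∙ Listₚ.length-++ (Vec.toList xs) ∙ cong (ℕ._+ length l) (len xs)
        ones : ∀ (zs : List ℕ) → ΣL (λ _ → 1#) zs ≡ nat (length zs)
        ones [] = sym nat-0
        ones (z ∷ zs) = cong (1# +_) (ones zs) ∙ sym (nat-suc (length zs))

  K : Carrier
  K = A * (B * gi)

  *-^# : ∀ a b n → (a * b) ^# n ≡ (a ^# n) * (b ^# n)
  *-^# a b zero = sym (*-identityˡ _)
  *-^# a b (suc n) = cong (a * b *_) (*-^# a b n) ∙ solve 4 (λ a b p q → a :* b :* (p :* q) := a :* p :* (b :* q)) refl a b _ _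

  heights : List (ℕ × List ℕ) → List (List Carrier)
  heights = map (λ cy → map (λ _ → B) (proj₂ cy))

  sum-B : ∀ (zs : List ℕ) → sumL R (map (λ _ → B) zs) ≡ nat (length zs) * B
  sum-B [] = sym (zeroˡ B) ∙ cong (_* B) (sym nat-0)
  sum-B (z ∷ zs) = cong (B +_) (sum-B zs) ∙ solve 2 (λ b n → b :+ n :* b := (:1 :+ n) :* b) refl B _ ∙ cong (_* B) (sym (nat-suc (length zs)))

  open WordSeries using (ẑ; ŵ; egf; word-series)

  partition′ : List (List Carrier) → Seq
  partition′ [] = δ
  partition′ (Bs ∷ cs) = C (sumL R Bs) (partition′ cs)

  -- A(1 + xi) = A + ig and B(h + ym) = hB + mg: up to the powers of K, the sums over the letters of
  -- the first column are the coefficients of `C` at β = hB.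
  partition-words : ∀ cs → Nested cs → ∀ n → partition′ (heights cs) n ≡ (K ^# n) * ẑ (colBoxesℕ cs) n
  partition-words [] [] zero = solve 0 (:1 := :1 :* (:1 :* (:1 :* :1 :+ :0))) refl
  partition-words [] [] (suc n) = solve 2 (λ k f → :0 := k :* (f :* :0)) refl _ _
  partition-words ((c , ys) ∷ cs) (add un out nest) n = dsum-cong (λ j i → cong₂ (λ p q → p * (q * α i)) (partition-words cs nest j) (rise-ris j i)) n ∙ dsum-cong term n ∙ dsum-weight (K ^#_) _ n ∙ cong ((K ^# n) *_) (sym (egf-two n word₂ word₂-symmetric))
    where
    open Column c ys un
    Ys = colBoxesℕ cs
    open TwoAlphabets Xs Ys
    open Words Ys using (Σw)
    rise-ris : ∀ j i → r (sumL R (map (λ _ → B) ys)) j i ≡ (B ^# i) * ris₂ j i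
    rise-ris j zero = sym (*-identityˡ _)
    rise-ris j (suc i) = r-last β j i ∙ cong₂ (λ a b → a * (b + nat j * g + nat i * g)) (rise-ris j i) (sum-B ys) ∙ cong (λ z → (B ^# i) * ris₂ j i * (h * B + nat j * z + nat i * z)) (sym yB) ∙ solve 7 (λ b p B h y j i → b :* p :* (h :* B :+ j :* (y :* B) :+ i :* (y :* B)) := B :* b :* (p :* (h :+ y :* (i :+ j)))) refl (B ^# i) (ris₂ j i) B h y (nat j) (nat i) ∙ cong (λ z → B * (B ^# i) * (ris₂ j i * (h + y * z))) (sym (nat-+ i j))
      where β = sumL R (map (λ _ → B) ys)
    S-value : ∀ j i → S j i word₂ ≡ ris₁ i * ris₂ j i * Σw j word₂
    S-value j i = ΣL-congAll (λ zs p → ΣX-word i (Vec.toList zs) (All.map (λ m → All.lookup out m) p) ∙ cong (λ k → ris₁ i * ris₂ k i * word₂ (Vec.toList zs)) (len zs)) (tuples-All j Ys) ∙ ΣL-* _ _ (tuples j Ys)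
      where
      len : ∀ {k} (v : Vec (ℕ × ℕ) k) → length (Vec.toList v) ≡ k
      len [] = refl
      len (_ ∷ v) = cong suc (len v)
    term : ∀ j i → (K ^# j) * ẑ Ys j * ((B ^# i) * ris₂ j i * α i) ≡ (K ^# (j ℕ.+ i)) * egf₂ word₂ j i
    term j i = solve 9 (λ k f s b p a q e t → k :* (f :* s) :* (b :* p :* (a :* (q :* (e :* t)))) := k :* (a :* (b :* t)) :* (f :* (e :* (q :* p :* s)))) refl (K ^# j) (1/! j) (Σw j word₂) (B ^# i) (ris₂ j i) (A ^# i) (ris₁ i) (1/! i) (gi ^# i) ∙ cong₂ (λ a b → (K ^# j) * a * (1/! j * (1/! i * b))) (sym ((*-^# A (B * gi) i) ∙ cong ((A ^# i) *_) (*-^# B gi i))) (sym (S-value j i)) ∙ cong (_* egf₂ word₂ j i) (sym (^#-+ K j i))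

  module _ (cond : B * (A + B + g) ≡ 0#) where

    world : List (ℕ × List ℕ) → World
    world cs = record { alg = R ; g = g ; A = A ; α = α ; α-zero = α-zero ; α-suc = α-suc ; cols = heights cs
                      ; cond = Allₚ.map⁺ (All.tabulate (λ _ → Allₚ.map⁺ (All.tabulate (λ _ → cond)))) }

    partition≡ : ∀ cs cs' n → Recursion.partition (world cs') (heights cs) n ≡ partition′ (heights cs) n
    partition≡ [] cs' n = refl
    partition≡ (c ∷ cs) cs' n = dsum-cong (λ j i → cong (_* _) (partition≡ cs cs' j)) n

    -- Z is the generating function ẑ up to the substitution ζ ↦ Kζ, and ŵ is the logarithmic
    -- derivative of ẑ. Both sides times Z give -g times the derivative of Z.
    f̂-words : ∀ cs → Nested cs → ∀ n → Recursion.f̂ (world cs) (suc n) ≡ - (g * ((K ^# suc n) * ŵ (colBoxesℕ cs) n))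
    f̂-words cs nest n = conv-cancel (Recursion.f̂ (world cs)) F′ Z (Recursion.Z-zero (world cs)) same (suc n)
      where
      Z = Recursion.Z (world cs)
      Bx = colBoxesℕ cs
      F′ : Seq
      F′ zero = 0#
      F′ (suc n) = - (g * ((K ^# suc n) * ŵ Bx n))
      Z-words : ∀ n → Z n ≡ (K ^# n) * ẑ Bx n
      Z-words n = partition≡ cs cs n ∙ partition-words cs nest n
      same : ∀ n → conv (Recursion.f̂ (world cs)) Z n ≡ conv F′ Z n
      same n = Recursion.f̂-Z (world cs) n ∙ sym (rhs n)
        where
        rhs : ∀ n → conv F′ Z n ≡ - (g * (nat n * Z n))
        rhs zero = zeroˡ _ ∙ sym (cong (λ z → - (g * (z * Z 0))) nat-0 ∙ solve 2 (λ g z → :- (g :* (:0 :* z)) := :0) refl g (Z 0))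
        rhs (suc n) = cong (_+ conv (tail F′) Z n) (zeroˡ _) ∙ +-identityˡ _ ∙ dsum-cong (λ i j → cong (tail F′ i *_) (Z-words j) ∙ solve 6 (λ g k p w q z → :- (g :* (k :* p :* w)) :* (q :* z) := (:- (g :* k) :* (p :* q)) :* (w :* z)) refl g K (K ^# i) (ŵ Bx i) (K ^# j) (ẑ Bx j) ∙ cong (λ p → - (g * K) * p * (ŵ Bx i * ẑ Bx j)) (sym (^#-+ K i j))) n ∙ dsum-weight (λ m → - (g * K) * (K ^# m)) _ n ∙ cong (- (g * K) * (K ^# n) *_) (sym (word-series Bx n)) ∙ solve 5 (λ g k p m z → :- (g :* k) :* p :* (m :* z) := :- (g :* (m :* (k :* p :* z)))) refl g K (K ^# n) (nat (suc n)) (ẑ Bx (suc n)) ∙ cong (λ z → - (g * (nat (suc n) * z))) (sym (Z-words (suc n)))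

-- Conjugation of permutations and rooted maps

-- The underscores stand for the local search function of invV, which has no name outside Defs.
mutual
  lookup-search : ∀ {N} (s : PermV N) (j : Fin N) (l : List (Fin N)) → (∃ λ i → i ∈ l × lookup s i ≡ j) → lookup s _ ≡ j
  lookup-searchAll : ∀ {N} (s : PermV N) (j : Fin N) → (∃ λ i → lookup s i ≡ j) → lookup s _ ≡ j

  lookup-invV : ∀ {N} (s : PermV N) (j : Fin N) → (∃ λ i → lookup s i ≡ j) → lookup s (lookup (invV s) j) ≡ j
  lookup-invV s j p = cong (lookup s) (Vecₚ.lookup∘tabulate _ j) ∙ lookup-searchAll s j p

  lookup-searchAll {N} s j (i , e) with allFin N | ∈ₚ.∈-allFin i
  ... | l | m = lookup-search s j l (i , m , e)

  lookup-search s j (k ∷ l) (i , m , e) with lookup s k ==ᶠ j in q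
  ... | true = ==-sound q
  lookup-search s j (k ∷ l) (i , there m , e) | false = lookup-search s j l (i , m , e)
  lookup-search s j (k ∷ l) (i , here refl , e) | false = ⊥-elim (true≢false (sym (==-complete e) ∙ q))

module Inverse {N : ℕ} (τ : PermV N) (inj : Inj τ) where

  τ⁻ : PermV N
  τ⁻ = invV τ

  inv-right : ∀ j → lookup τ (lookup τ⁻ j) ≡ j
  inv-right j with Orbits.return τ inj j
  ... | p , e , _ = lookup-invV τ j (iter τ p j , e)

  inv-left : ∀ i → lookup τ⁻ (lookup τ i) ≡ i
  inv-left i = inj _ _ (inv-right _)

  inv-Inj : Inj τ⁻
  inv-Inj i j e = sym (inv-right i) ∙ cong (lookup τ) e ∙ inv-right j

  lookup-conj : ∀ s j → lookup (conj τ s) j ≡ lookup τ (lookup s (lookup τ⁻ j))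
  lookup-conj s j = Vecₚ.lookup∘tabulate _ j

  conj-at : ∀ s i → lookup (conj τ s) (lookup τ i) ≡ lookup τ (lookup s i)
  conj-at s i = lookup-conj s _ ∙ cong (λ k → lookup τ (lookup s k)) (inv-left i)

  conj-unique : ∀ s s' → (∀ i → lookup s' (lookup τ i) ≡ lookup τ (lookup s i)) → s' ≡ conj τ s
  conj-unique s s' h = vec-ext (λ j → cong (lookup s') (sym (inv-right j)) ∙ h _ ∙ sym (lookup-conj s j))

  conj-Inj : ∀ s → Inj s → Inj (conj τ s)
  conj-Inj s is i j e = inv-Inj i j (is _ _ (inj _ _ (sym (lookup-conj s i) ∙ e ∙ lookup-conj s j)))

  Reach-conj : ∀ {s t u i} → Reach s t u i → Reach (conj τ s) (conj τ t) (lookup τ u) (lookup τ i)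
  Reach-conj start = start
  Reach-conj {s} {t} {u} (bySˢ {i} r) = subst (Reach _ _ (lookup τ u)) (conj-at s i) (bySˢ (Reach-conj r))
  Reach-conj {s} {t} {u} (bySᵗ {i} r) = subst (Reach _ _ (lookup τ u)) (conj-at t i) (bySᵗ (Reach-conj r))

Inj-comp : ∀ {N} (s t : PermV N) → Inj s → Inj t → Inj (comp s t)
Inj-comp s t is it i j e = it i j (is _ _ (sym (lookup-comp s t i) ∙ e ∙ lookup-comp s t j))

conj-comp : ∀ {N} (τ σ s : PermV N) → Inj τ → Inj σ → conj τ (conj σ s) ≡ conj (comp τ σ) s
conj-comp τ σ s it is = Inverse.conj-unique (comp τ σ) (Inj-comp τ σ it is) s _ (λ i →
  cong (lookup (conj τ (conj σ s))) (lookup-comp τ σ i) ∙ Inverse.conj-at τ it (conj σ s) _ ∙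
    cong (lookup τ) (Inverse.conj-at σ is s i) ∙ sym (lookup-comp τ σ _))

conj-id : ∀ {N} (τ s : PermV N) → Inj τ → (∀ i → lookup τ i ≡ i) → conj τ s ≡ s
conj-id τ s it h = sym (Inverse.conj-unique τ it s s (λ i → cong (lookup s) (h i) ∙ sym (h (lookup s i))))

conj-inverse : ∀ {N} (τ s : PermV N) → Inj τ → conj (invV τ) (conj τ s) ≡ s
conj-inverse τ s it = conj-comp (invV τ) τ s (Inverse.inv-Inj τ it) it ∙
  conj-id (comp (invV τ) τ) s (Inj-comp (invV τ) τ (Inverse.inv-Inj τ it) it) (λ i → lookup-comp (invV τ) τ i ∙ Inverse.inv-left τ it i)

conj-inverseʳ : ∀ {N} (τ s : PermV N) → Inj τ → conj τ (conj (invV τ) s) ≡ s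
conj-inverseʳ τ s it = conj-comp τ (invV τ) s it (Inverse.inv-Inj τ it) ∙
  conj-id (comp τ (invV τ)) s (Inj-comp τ (invV τ) it (Inverse.inv-Inj τ it)) (λ i → lookup-comp τ (invV τ) i ∙ Inverse.inv-right τ it i)

sumN-* : ∀ {X : Set} c (f : X → ℕ) xs → sumN (λ x → c ℕ.* f x) xs ≡ c ℕ.* sumN f xs
sumN-* c f [] = sym (ℕₚ.*-zeroʳ c)
sumN-* c f (x ∷ xs) = cong (c ℕ.* f x ℕ.+_) (sumN-* c f xs) ∙ sym (ℕₚ.*-distribˡ-+ c _ _)

sumN-reindex : ∀ {N} (f : Fin N → ℕ) (σ σ⁻ : Fin N → Fin N) → (∀ i → σ⁻ (σ i) ≡ i) → (∀ i → σ (σ⁻ i) ≡ i) → sumN (f ∘ σ) (allFin N) ≡ sumN f (allFin N)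
sumN-reindex {N} f σ σ⁻ l r = sumN-cong (λ j → sym (pick (σ j))) (allFin N) ∙ sumN-swap _ (allFin N) (allFin N) ∙ sumN-cong (λ k → sumN-* (f k) _ (allFin N) ∙ cong (f k ℕ.*_) (sumN-cong (λ j → cong b2n (flip k j)) (allFin N) ∙ sumN-single (σ⁻ k)) ∙ ℕₚ.*-identityʳ _) (allFin N)
  where
  flip : ∀ k j → (k ==ᶠ σ j) ≡ (j ==ᶠ σ⁻ k)
  flip k j = bool-ext (λ h → ==-complete (sym (l j) ∙ cong σ⁻ (sym (==-sound h)))) (λ h → ==-complete (sym (r k) ∙ cong σ (sym (==-sound h))))
  pick : ∀ a → sumN (λ k → f k ℕ.* b2n (k ==ᶠ a)) (allFin N) ≡ f a
  pick a = sumN-cong (λ k → point k) (allFin N) ∙ sumN-* (f a) _ (allFin N) ∙ cong (f a ℕ.*_) (sumN-single a) ∙ ℕₚ.*-identityʳ _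
    where
    point : ∀ k → f k ℕ.* b2n (k ==ᶠ a) ≡ f a ℕ.* b2n (k ==ᶠ a)
    point k with k ==ᶠ a in e
    ... | true = cong (λ z → f z ℕ.* 1) (==-sound e)
    ... | false = ℕₚ.*-zeroʳ (f k) ∙ sym (ℕₚ.*-zeroʳ (f a))

cycles-conj : ∀ {N} (τ s : PermV N) → Inj τ → Inj s → cycles (conj τ s) ≡ cycles s
cycles-conj {N} τ s it is = cycles-classFn (conj τ s) (conj-Inj s is) e' (inv' , reach') ∙
  sumN-cong (λ j → cong b2n (point j)) (allFin N) ∙ sumN-reindex _ _ (lookup τ) inv-right inv-left ∙
    sym (cycles-classFn s is e (classFn-min s is))
  where
  open Inverse τ it
  e = Orbits.minOrbit s is
  e' : Fin N → Fin N
  e' j = lookup τ _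
  inv' : ∀ j → e' (lookup (conj τ s) j) ≡ e' j
  inv' j = cong (lookup τ) (cong e (cong (lookup τ⁻) (lookup-conj s j) ∙ inv-left _) ∙ Orbits.minOrbit-invariant s is _)
  iter-conj : ∀ k j → iter (conj τ s) k j ≡ lookup τ (iter s k (lookup τ⁻ j))
  iter-conj zero j = sym (inv-right j)
  iter-conj (suc k) j = cong (lookup (conj τ s)) (iter-conj k j) ∙ conj-at s _
  reach' : ∀ j → ∃ λ k → iter (conj τ s) k j ≡ e' j
  reach' j with Orbits.minOrbit-reach s is (lookup τ⁻ j)
  ... | k , q = k , iter-conj k j ∙ cong (lookup τ) q
  point : ∀ j → (e' j ==ᶠ j) ≡ (e (lookup τ⁻ j) ==ᶠ lookup τ⁻ j)
  point j = bool-ext (λ h → ==-complete (it _ _ (==-sound h ∙ sym (inv-right j)))) (λ h → ==-complete (cong (lookup τ) (==-sound h) ∙ inv-right j))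

foldr-∧ : ∀ {n} (v : Vec Bool n) → Vec.foldr _ _∧_ true v ≡ true → ∀ i → lookup v i ≡ true
foldr-∧ (x ∷ v) h Fin.zero = proj₁ (∧-split h)
foldr-∧ (x ∷ v) h (Fin.suc i) = foldr-∧ v (proj₂ (∧-split {x} h)) i

foldr-∧-intro : ∀ {n} (v : Vec Bool n) → (∀ i → lookup v i ≡ true) → Vec.foldr _ _∧_ true v ≡ true
foldr-∧-intro [] h = refl
foldr-∧-intro (x ∷ v) h = ∧-intro (h Fin.zero) (foldr-∧-intro v (h ∘ Fin.suc))

transitive-Reach : ∀ {N} (s t : PermV (suc N)) → transitiveᵇ s t ≡ true → ∀ i → Reach s t Fin.zero i
transitive-Reach s t h i = orb-sound s t Fin.zero i (foldr-∧ (orbV s t Fin.zero) h i)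

Reach-transitive : ∀ {N} (s t : PermV (suc N)) → (∀ i → Reach s t Fin.zero i) → transitiveᵇ s t ≡ true
Reach-transitive s t h = foldr-∧-intro (orbV s t Fin.zero) (λ i → orb-complete s t Fin.zero (h i))

transitive-conj : ∀ {N} (τ s t : PermV (suc N)) → Inj τ → lookup τ Fin.zero ≡ Fin.zero → transitiveᵇ (conj τ s) (conj τ t) ≡ transitiveᵇ s t
transitive-conj τ s t it t0 = bool-ext back fwd
  where
  open Inverse τ it
  fwd : transitiveᵇ s t ≡ true → transitiveᵇ (conj τ s) (conj τ t) ≡ true
  fwd h = Reach-transitive _ _ (λ j → subst₂ (Reach (conj τ s) (conj τ t)) t0 (inv-right j) (Reach-conj (transitive-Reach s t h (lookup τ⁻ j))))
  back : transitiveᵇ (conj τ s) (conj τ t) ≡ true → transitiveᵇ s t ≡ true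
  back h = Reach-transitive s t (λ i → subst₃ (cong (lookup τ⁻) (sym t0) ∙ inv-left Fin.zero) (inv-left i)
      (Inverse.Reach-conj τ⁻ inv-Inj (transitive-Reach _ _ h (lookup τ i))))
    where
    subst₃ : ∀ {a b c} → a ≡ Fin.zero → b ≡ c → Reach (conj τ⁻ (conj τ s)) (conj τ⁻ (conj τ t)) a b → Reach s t Fin.zero c
    subst₃ refl refl r = subst₂ (λ x y → Reach x y _ _) (conj-inverse τ s it) (conj-inverse τ t it) r

lexLeq-total : ∀ {N k} (a b : Vec (Fin N) k) → lexLeq a b ≡ true ⊎ lexLeq b a ≡ true
lexLeq-total [] [] = inj₁ refl
lexLeq-total (a ∷ as) (b ∷ bs) with a Fin.≟ b
... | yes refl rewrite ==-refl a = lexLeq-total as bs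
... | no a≢b rewrite ==-≢ a≢b | ==-≢ (λ e → a≢b (sym e)) with ≤-total (toℕ a) (toℕ b)
...   | inj₁ p = inj₁ (≤ᵇ-complete p)
...   | inj₂ p = inj₂ (≤ᵇ-complete p)

lexLeq-antisym : ∀ {N k} (a b : Vec (Fin N) k) → lexLeq a b ≡ true → lexLeq b a ≡ true → a ≡ b
lexLeq-antisym [] [] _ _ = refl
lexLeq-antisym (a ∷ as) (b ∷ bs) p q with a Fin.≟ b
... | yes refl rewrite ==-refl a = cong (a ∷_) (lexLeq-antisym as bs p q)
... | no a≢b rewrite ==-≢ a≢b | ==-≢ (λ e → a≢b (sym e)) = ⊥-elim (a≢b (Finₚ.≤-antisym (≤ᵇ-sound p) (≤ᵇ-sound q)))

lexLeq-trans : ∀ {N k} (a b c : Vec (Fin N) k) → lexLeq a b ≡ true → lexLeq b c ≡ true → lexLeq a c ≡ true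
lexLeq-trans [] [] [] _ _ = refl
lexLeq-trans (a ∷ as) (b ∷ bs) (c ∷ cs) p q with a Fin.≟ b | b Fin.≟ c
... | yes refl | yes refl rewrite ==-refl a = lexLeq-trans as bs cs p q
... | yes refl | no b≢c rewrite ==-≢ b≢c = q
... | no a≢b | yes refl rewrite ==-≢ a≢b = p
... | no a≢b | no b≢c rewrite ==-≢ a≢b | ==-≢ b≢c with a Fin.≟ c
...   | yes refl = ⊥-elim (a≢b (Finₚ.≤-antisym (≤ᵇ-sound p) (≤ᵇ-sound q)))
...   | no a≢c rewrite ==-≢ a≢c = ≤ᵇ-complete (≤-trans {toℕ a} {toℕ b} {toℕ c} (≤ᵇ-sound p) (≤ᵇ-sound q))

lexLeq-refl : ∀ {N k} (a : Vec (Fin N) k) → lexLeq a a ≡ true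
lexLeq-refl a with lexLeq-total a a
... | inj₁ p = p
... | inj₂ p = p

minimiser : ∀ {X : Set} {N k} (key : X → Vec (Fin N) k) x xs → ∃ λ m → m ∈ x ∷ xs × (∀ {y} → y ∈ x ∷ xs → lexLeq (key m) (key y) ≡ true)
minimiser key x [] = x , here refl , λ { (here refl) → lexLeq-refl (key x) }
minimiser key x (y ∷ ys) with minimiser key y ys
... | m , m∈ , h with lexLeq-total (key x) (key m)
...   | inj₁ p = x , here refl , λ { (here refl) → lexLeq-refl (key x) ; (there q) → lexLeq-trans (key x) (key m) (key _) p (h q) }
...   | inj₂ p = m , there m∈ , λ { (here refl) → p ; (there q) → h q }

eqV : ∀ {N k} → Vec (Fin N) k → Vec (Fin N) k → Bool
eqV [] [] = true
eqV (x ∷ v) (y ∷ w) = (x ==ᶠ y) ∧ eqV v w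

eqV-sound : ∀ {N k} (v w : Vec (Fin N) k) → eqV v w ≡ true → v ≡ w
eqV-sound [] [] _ = refl
eqV-sound (x ∷ v) (y ∷ w) h = cong₂ _∷_ (==-sound (proj₁ (∧-split h))) (eqV-sound v w (proj₂ (∧-split {x ==ᶠ y} h)))

eqV-complete : ∀ {N k} (v w : Vec (Fin N) k) → v ≡ w → eqV v w ≡ true
eqV-complete [] _ refl = refl
eqV-complete (x ∷ v) _ refl = ∧-intro (==-refl x) (eqV-complete v v refl)

eqV-≢ : ∀ {N k} (v w : Vec (Fin N) k) → v ≢ w → eqV v w ≡ false
eqV-≢ v w h with eqV v w in e
... | true = ⊥-elim (h (eqV-sound v w e))
... | false = refl

-- `ins u j idV` is the transposition of u and its preimage j; composing with it takes u out of its
-- cycle.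
unins : ∀ {N} → Fin N → PermV N → PermV N
unins u a = comp a (ins u (lookup (invV a) u) idV)

module _ {N : ℕ} (u : Fin N) (us : List (Fin N)) (un : Unique (u ∷ us)) (a : PermV N) (g : Good (u ∷ us) a) (moved : lookup a u ≢ u) where

  private
    inj = proj₁ g
    j = lookup (invV a) u
    aj : lookup a j ≡ u
    aj = Inverse.inv-right a inj u
    j≢u : j ≢ u
    j≢u e = moved (cong (lookup a) (sym e) ∙ aj)
    T = ins u j idV

  unins-j : j ∈ us
  unins-j with j ∈? (u ∷ us)
    where open DecMem Fin._≟_
  ... | yes (here e) = ⊥-elim (j≢u e)
  ... | yes (there m) = m
  ... | no q = ⊥-elim (j≢u (sym (proj₂ g j q) ∙ aj))

  unins-new : lookup (unins u a) u ≡ u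
  unins-new = lookup-comp a T u ∙ cong (lookup a) (ins-new u j idV ∙ lookup-idV j) ∙ aj

  unins-at : lookup (unins u a) j ≡ lookup a u
  unins-at = lookup-comp a T j ∙ cong (lookup a) (ins-at u j idV j≢u)

  unins-other : ∀ i → i ≢ u → i ≢ j → lookup (unins u a) i ≡ lookup a i
  unins-other i p q = lookup-comp a T i ∙ cong (lookup a) (ins-other u j idV i p q ∙ lookup-idV i)

  unins-Good : Good us (unins u a)
  unins-Good = Inj-comp a T inj (Inj-ins u j idV Inj-idV (lookup-idV u) j≢u) , fix
    where
    fix : ∀ i → i ∉ us → lookup (unins u a) i ≡ i
    fix i i∉ with i Fin.≟ u
    ... | yes refl = unins-new
    ... | no p with i Fin.≟ j
    ...   | yes refl = ⊥-elim (i∉ unins-j)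
    ...   | no q = unins-other i p q ∙ (proj₂ g i λ { (here e) → p e ; (there m) → i∉ m })

  ins-unins : ins u j (unins u a) ≡ a
  ins-unins = sym (ins-cong u j (unins u a) a j≢u (sym unins-at) aj (λ i p q → sym (unins-other i p q)))

  ins-inverse : ∀ k s → k ∈ us → Good us s → ins u k s ≡ a → k ≡ j × s ≡ unins u a
  ins-inverse k s k∈ gs refl = k≡j , vec-ext same
    where
    k≢u = ∈-≢ (unique-head un) k∈
    k≡j : k ≡ j
    k≡j = inj k j (ins-at u k s k≢u ∙ sym aj)
    same : ∀ i → lookup s i ≡ lookup (unins u a) i
    same i with i Fin.≟ u
    ... | yes refl = proj₂ gs u (unique-head un) ∙ sym unins-new
    ... | no p with i Fin.≟ j
    ...   | yes refl = cong (lookup s) (sym k≡j) ∙ sym (ins-new u k s) ∙ sym unins-at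
    ...   | no q = sym (ins-other u k s i p (λ e → q (e ∙ k≡j))) ∙ sym (unins-other i p q)

Any-intro : ∀ {X Y : Set} {a : Y} {x : X} {l : List X} {f : X → List Y} → x ∈ l → a ∈ f x → Any (λ x → a ∈ f x) l
Any-intro (here refl) q = here q
Any-intro (there m) q = there (Any-intro m q)

permsOn-complete : ∀ {N} (us : List (Fin N)) → Unique us → ∀ a → Good us a → a ∈ permsOn us
permsOn-complete [] un a g = here (vec-ext (λ i → (proj₂ g i λ ()) ∙ sym (lookup-idV i)))
permsOn-complete (u ∷ us) un a g with lookup a u Fin.≟ u
... | yes e = ∈ₚ.∈-concatMap⁺ _ (Any-intro (permsOn-complete us (unique-tail un) a (proj₁ g , fix)) (here refl))
  where
  fix : ∀ i → i ∉ us → lookup a i ≡ i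
  fix i i∉ with i Fin.≟ u
  ... | yes refl = e
  ... | no p = proj₂ g i λ { (here q) → p q ; (there m) → i∉ m }
... | no e = ∈ₚ.∈-concatMap⁺ _ (Any-intro (permsOn-complete us (unique-tail un) (unins u a) (unins-Good u us un a g e))
    (there (subst (_∈ map (λ j → ins u j (unins u a)) us) (ins-unins u us un a g e) (∈ₚ.∈-map⁺ _ (unins-j u us un a g e)))))

restFin : ∀ N → List (Fin (suc N))
restFin N = List.tabulate Fin.suc

zero∉rest : ∀ {N} → Fin.zero {N} ∉ restFin N
zero∉rest m with ∈ₚ.∈-tabulate⁻ m
... | _ , ()

rest-unique : ∀ N → Unique (restFin N)
rest-unique N = unique-tail (Uniqueₚ.allFin⁺ (suc N))

implies-elim : ∀ {a b} → not a ∨ b ≡ true → a ≡ true → b ≡ true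
implies-elim h refl = h

implies-intro : ∀ a {b} → (a ≡ true → b ≡ true) → not a ∨ b ≡ true
implies-intro true h = h refl
implies-intro false h = refl

isCanonical-elim : ∀ {N} (s t : PermV (suc N)) → isCanonical s t ≡ true → ∀ τ → τ ∈ perms (suc N) → lookup τ Fin.zero ≡ Fin.zero →
  lexLeq (s Vec.++ t) (conj τ s Vec.++ conj τ t) ≡ true
isCanonical-elim {N} s t h τ τ∈ t0 = implies-elim {lookup τ Fin.zero ==ᶠ Fin.zero}
  (and-elim (λ τ → not (lookup τ Fin.zero ==ᶠ Fin.zero) ∨ lexLeq (s Vec.++ t) (conj τ s Vec.++ conj τ t)) (perms (suc N)) h τ∈) (==-complete t0)

isCanonical-intro : ∀ {N} (s t : PermV (suc N)) → (∀ τ → τ ∈ perms (suc N) → lookup τ Fin.zero ≡ Fin.zero →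
  lexLeq (s Vec.++ t) (conj τ s Vec.++ conj τ t) ≡ true) → isCanonical s t ≡ true
isCanonical-intro {N} s t h = and-intro (λ τ → not (lookup τ Fin.zero ==ᶠ Fin.zero) ∨ lexLeq (s Vec.++ t) (conj τ s Vec.++ conj τ t)) (perms (suc N))
  (λ {τ} m → implies-intro (lookup τ Fin.zero ==ᶠ Fin.zero) (λ e → h τ m (==-sound e)))

∈-tuples : ∀ {X : Set} k (xs : List X) (v : Vec X k) → (∀ i → lookup v i ∈ xs) → v ∈ tuples k xs
∈-tuples zero xs [] h = here refl
∈-tuples (suc k) xs (a ∷ v) h = ∈ₚ.∈-concatMap⁺ _ (Any-intro (h Fin.zero) (∈ₚ.∈-map⁺ (a ∷_) (∈-tuples k xs v (h ∘ Fin.suc))))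

filterᵇ-∈ : ∀ {X : Set} (p : X → Bool) {xs x} → x ∈ xs → p x ≡ true → x ∈ filterᵇ p xs
filterᵇ-∈ p {x ∷ xs} (here refl) h rewrite h = here refl
filterᵇ-∈ p {y ∷ xs} (there m) h with p y
... | true = there (filterᵇ-∈ p m h)
... | false = filterᵇ-∈ p m h

filterᵇ-All : ∀ {X : Set} (p : X → Bool) xs → All (λ x → p x ≡ true) (filterᵇ p xs)
filterᵇ-All p [] = []
filterᵇ-All p (x ∷ xs) with p x in e
... | true = e ∷ filterᵇ-All p xs
... | false = filterᵇ-All p xs

∈-perms : ∀ {N} (s : PermV N) → Inj s → s ∈ perms N
∈-perms {N} s inj = filterᵇ-∈ isPerm (∈-tuples N _ s (λ i → ∈ₚ.∈-allFin _)) (isPerm-complete s inj)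

perms-Inj : ∀ N → All Inj (perms N)
perms-Inj N = All.map (λ {s} → isPerm-sound s) (filterᵇ-All isPerm (allVecs N _))

++-injective : ∀ {X : Set} {m n} (v v' : Vec X m) {w w' : Vec X n} → v Vec.++ w ≡ v' Vec.++ w' → v ≡ v' × w ≡ w'
++-injective v v' e = Vecₚ.++-injective v v' e

module Rooted (R : Alg) where
  open Ring R
  open Sums R
  open Indicator R
  open Connected R 1# 1# using (1/!; 1/!-suc)
  open Series R using (nat-suc; nat-0)

  module Enumeration {T : Set} (eq : T → T → Bool) (sound : ∀ x y → eq x y ≡ true → x ≡ y) (complete : ∀ x y → x ≡ y → eq x y ≡ true) where

    multiplicity : T → List T → Carrier
    multiplicity a xs = ΣL (λ x → ind (eq x a)) xs

    ind-eq : ∀ (f : T → Carrier) x y → ind (eq y x) * f x ≡ ind (eq x y) * f y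
    ind-eq f x y with eq x y in e | eq y x in e'
    ... | true | true = cong (λ z → 1# * f z) (sound x y e)
    ... | false | false = zeroˡ _ ∙ sym (zeroˡ _)
    ... | true | false = ⊥-elim (true≢false (sym (complete y x (sym (sound x y e))) ∙ e'))
    ... | false | true = ⊥-elim (true≢false (sym (complete x y (sym (sound y x e'))) ∙ e))

    -- Each summand is multiplied by the multiplicity of its index in the other list, written as a
    -- sum of Kronecker deltas, and the two sums are exchanged.
    Σ-enumerate : ∀ (f : T → Carrier) xs ys → All (λ x → multiplicity x ys ≡ 1#) xs → All (λ y → multiplicity y xs ≡ 1#) ys → ΣL f xs ≡ ΣL f ys
    Σ-enumerate f xs ys p q = ΣL-congAll (λ x m → sym (*-identityˡ _) ∙ cong (_* f x) (sym m) ∙ sym (ΣL-*ʳ _ _ ys)) p ∙ ΣL-swap _ xs ys ∙ ΣL-congAll (λ y m → ΣL-cong (λ x → ind-eq f x y) xs ∙ ΣL-*ʳ _ _ xs ∙ cong (_* f y) m ∙ *-identityˡ _) q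

  mult : ∀ {N k} → Vec (Fin N) k → List (Vec (Fin N) k) → Carrier
  mult a xs = ΣL (λ x → ind (eqV x a)) xs

  Σ-enum : ∀ {N k} (f : Vec (Fin N) k → Carrier) xs ys → All (λ x → mult x ys ≡ 1#) xs → All (λ y → mult y xs ≡ 1#) ys → ΣL f xs ≡ ΣL f ys
  Σ-enum = Enumeration.Σ-enumerate eqV eqV-sound eqV-complete

  ΣL-filterᵇ : ∀ {X : Set} (p : X → Bool) (f : X → Carrier) xs → ΣL f (filterᵇ p xs) ≡ ΣL (λ x → ind (p x) * f x) xs
  ΣL-filterᵇ p f [] = refl
  ΣL-filterᵇ p f (x ∷ xs) with p x
  ... | true = cong₂ _+_ (sym (*-identityˡ _)) (ΣL-filterᵇ p f xs)
  ... | false = ΣL-filterᵇ p f xs ∙ sym (+-identityˡ _) ∙ cong (_+ ΣL (λ x → ind (p x) * f x) xs) (sym (zeroˡ _))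

  ΣL-cartesian : ∀ {X Y : Set} (f : X × Y → Carrier) xs ys → ΣL f (cartesianProduct xs ys) ≡ ΣL (λ x → ΣL (λ y → f (x , y)) ys) xs
  ΣL-cartesian f [] ys = refl
  ΣL-cartesian f (x ∷ xs) ys = ΣL-++ f (map (x ,_) ys) _ ∙ cong₂ _+_ (ΣL-map f (x ,_) ys) (ΣL-cartesian f xs ys)

  pick : ∀ {N} (a : Fin N) us → Unique us → a ∈ us → ΣL (λ i → ind (i ==ᶠ a)) us ≡ 1#
  pick a (u ∷ us) (p ∷ _) (here refl) = cong₂ _+_ (cong ind (==-refl a)) (ΣL-congAll (λ i q → cong ind (==-≢ (λ e → q (sym e)))) p ∙ ΣL-0 us) ∙ +-identityʳ _
  pick a (u ∷ us) (p ∷ un) (there m) = cong₂ _+_ (cong ind (==-≢ (All.lookup p m))) (pick a us un m) ∙ +-identityˡ _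

  mult-tuples : ∀ {N} k (v : Vec (Fin N) k) → mult v (tuples k (allFin N)) ≡ 1#
  mult-tuples zero [] = +-identityʳ _
  mult-tuples {N} (suc k) (a ∷ v) = ΣL-concatMap _ _ (allFin N) ∙ ΣL-cong (λ x → ΣL-map _ _ (tuples k _) ∙ ΣL-cong (λ w → ind-∧ (x ==ᶠ a) (eqV w v)) (tuples k _) ∙ ΣL-* _ _ (tuples k _)) (allFin N) ∙ ΣL-*ʳ _ _ (allFin N) ∙ cong₂ _*_ (pick a (allFin N) (Uniqueₚ.allFin⁺ N) (∈ₚ.∈-allFin a)) (mult-tuples k v) ∙ *-identityˡ 1#

  mult-perms : ∀ {N} (s : PermV N) → Inj s → mult s (perms N) ≡ 1#
  mult-perms {N} s inj = ΣL-filterᵇ isPerm _ (allVecs N _) ∙ ΣL-cong aux (allVecs N _) ∙ mult-tuples N s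
    where
    aux : ∀ x → ind (isPerm x) * ind (eqV x s) ≡ ind (eqV x s)
    aux x with eqV x s in e
    ... | false = zeroʳ _
    ... | true = cong (λ z → ind z * 1#) (cong isPerm (eqV-sound x s e) ∙ isPerm-complete s inj) ∙ *-identityˡ _

  mult-permsOn : ∀ {N} (us : List (Fin N)) → Unique us → ∀ a → Good us a → mult a (permsOn us) ≡ 1#
  mult-permsOn [] un a g = +-identityʳ _ ∙ cong ind (eqV-complete idV a (vec-ext (λ i → lookup-idV i ∙ sym (proj₂ g i λ ()))))
  mult-permsOn (u ∷ us) un a g with lookup a u Fin.≟ u
  ... | yes e = ΣL-permsOn _ u us ∙ ΣL-congAll (λ s gs → cong (ind (eqV s a) +_) (ΣL-congAll (λ j j≢u → cong ind (eqV-≢ (ins u j s) a (λ q →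
        s≢u u j s (proj₁ gs) (proj₂ gs u (unique-head un)) j≢u j j≢u (sym (ins-new u j s) ∙ cong (λ v → lookup v u) q ∙ e)))) (All.tabulate (∈-≢ (unique-head un))) ∙ ΣL-0 us) ∙ +-identityʳ _)
        (permsOn-Good us (unique-tail un)) ∙ mult-permsOn us (unique-tail un) a (proj₁ g , fix)
    where
    fix : ∀ i → i ∉ us → lookup a i ≡ i
    fix i i∉ with i Fin.≟ u
    ... | yes refl = e
    ... | no p = proj₂ g i λ { (here q) → p q ; (there m) → i∉ m }
  ... | no e = ΣL-permsOn _ u us ∙ ΣL-congAll (λ s gs → cong₂ _+_ (cong ind (eqV-≢ s a (λ q → e (cong (λ v → lookup v u) (sym q) ∙ proj₂ gs u (unique-head un))))) (ΣL-congAll (λ j j∈ → cong ind (same s gs j j∈) ∙ ind-∧ (eqV s _) _) (All.tabulate id) ∙ ΣL-* _ _ us) ∙ +-identityˡ _) (permsOn-Good us (unique-tail un)) ∙ ΣL-*ʳ _ _ (permsOn us) ∙ cong₂ _*_ (mult-permsOn us (unique-tail un) (unins u a) (unins-Good u us un a g e)) (pick j₀ us (unique-tail un) (unins-j u us un a g e)) ∙ *-identityˡ 1#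
    where
    j₀ = lookup (invV a) u
    same : ∀ s → Good us s → ∀ j → j ∈ us → eqV (ins u j s) a ≡ eqV s (unins u a) ∧ (j ==ᶠ j₀)
    same s gs j j∈ = bool-ext
      (λ h → let (p , q) = ins-inverse u us un a g e j s j∈ gs (eqV-sound (ins u j s) a h) in ∧-intro (eqV-complete s (unins u a) q) (==-complete p))
      (λ h → eqV-complete (ins u j s) a (cong₂ (λ j s → ins u j s) (==-sound (proj₂ (∧-split {eqV s (unins u a)} h))) (eqV-sound s (unins u a) (proj₁ (∧-split h))) ∙ ins-unins u us un a g e))

  all-Good : ∀ {N} (s : PermV N) → Inj s → Good (allFin N) s
  all-Good s inj = inj , λ i i∉ → ⊥-elim (i∉ (∈ₚ.∈-allFin i))

  permsAll : ∀ N → List (PermV N)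
  permsAll N = permsOn (allFin N)

  Σ-perms : ∀ {N} (f : PermV N → Carrier) → ΣL f (perms N) ≡ ΣL f (permsAll N)
  Σ-perms {N} f = Σ-enum f (perms N) (permsAll N)
    (All.map (λ {s} i → mult-permsOn (allFin N) (Uniqueₚ.allFin⁺ N) s (all-Good s i)) (perms-Inj N))
    (All.map (λ {s} g → mult-perms s (proj₁ g)) (permsOn-Good (allFin N) (Uniqueₚ.allFin⁺ N)))

  permsAll-Inj : ∀ N → All Inj (permsAll N)
  permsAll-Inj N = All.map proj₁ (permsOn-Good (allFin N) (Uniqueₚ.allFin⁺ N))

  Σ-conj : ∀ {N} (τ : PermV N) → Inj τ → (f : PermV N → Carrier) → ΣL (λ s → f (conj τ s)) (permsAll N) ≡ ΣL f (permsAll N)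
  Σ-conj {N} τ it f = sym (ΣL-map f (conj τ) (permsAll N)) ∙ Σ-enum f (map _ _) _
    (Allₚ.map⁺ (All.map (λ {s} i → mult-permsOn (allFin N) (Uniqueₚ.allFin⁺ N) (conj τ s) (all-Good (conj τ s) (Inverse.conj-Inj τ it s i))) (permsAll-Inj N)))
    (All.map (λ {a} i → ΣL-map _ (conj τ) (permsAll N) ∙ ΣL-cong (λ s → cong ind (flip s a)) (permsAll N) ∙
       mult-permsOn (allFin N) (Uniqueₚ.allFin⁺ N) (conj (invV τ) a) (all-Good (conj (invV τ) a) (Inverse.conj-Inj (invV τ) (Inverse.inv-Inj τ it) a i))) (permsAll-Inj N))
    where
    flip : ∀ s a → eqV (conj τ s) a ≡ eqV s (conj (invV τ) a)
    flip s a = bool-ext (λ h → eqV-complete s _ (sym (conj-inverse τ s it) ∙ cong (conj (invV τ)) (eqV-sound (conj τ s) a h)))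
      (λ h → eqV-complete (conj τ s) a (cong (conj τ) (eqV-sound s (conj (invV τ) a) h) ∙ conj-inverseʳ τ a it))

  permsOn-count : ∀ {N} (us : List (Fin N)) → Unique us → 1/! (length us) * ΣL (λ _ → 1#) (permsOn us) ≡ 1#
  permsOn-count [] un = solve 0 (:1 :* (:1 :+ :0) := :1) refl
  permsOn-count (u ∷ us) un = cong (1/! (suc _) *_) (ΣL-permsOn _ u us) ∙ cong (1/! (suc _) *_) (ΣL-cong (λ _ → cong (1# +_) (ones us) ∙ sym (nat-suc (length us)) ∙ sym (*-identityʳ _)) (permsOn us) ∙ ΣL-* _ _ (permsOn us)) ∙ solve 3 (λ a b c → a :* (b :* c) := b :* a :* c) refl _ _ _ ∙ cong (_* ΣL (λ _ → 1#) (permsOn us)) (1/!-suc (length us)) ∙ permsOn-count us (unique-tail un)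
    where
    ones : ∀ {X : Set} (zs : List X) → ΣL (λ _ → 1#) zs ≡ nat (length zs)
    ones [] = sym nat-0
    ones (z ∷ zs) = cong (1# +_) (ones zs) ∙ sym (nat-suc (length zs))

  module _ (N : ℕ) where

    relabellings : List (PermV (suc N))
    relabellings = permsOn (restFin N)

    relabelling-zero : ∀ τ → Good (restFin N) τ → lookup τ Fin.zero ≡ Fin.zero
    relabelling-zero τ g = proj₂ g Fin.zero (zero∉rest {N})

    zero-relabelling : ∀ τ → Inj τ → lookup τ Fin.zero ≡ Fin.zero → Good (restFin N) τ
    zero-relabelling τ it t0 = it , fix
      where
      fix : ∀ i → i ∉ restFin N → lookup τ i ≡ i
      fix Fin.zero _ = t0
      fix (Fin.suc i) i∉ = ⊥-elim (i∉ (∈ₚ.∈-tabulate⁺ i))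

    -- A relabelling fixing the root and a connected map is the identity.
    relabelling-free : ∀ (τ σ s t : PermV (suc N)) → Inj τ → Inj σ → lookup τ Fin.zero ≡ Fin.zero → lookup σ Fin.zero ≡ Fin.zero →
      conj τ s ≡ conj σ s → conj τ t ≡ conj σ t → (∀ i → Reach s t Fin.zero i) → τ ≡ σ
    relabelling-free τ σ s t it is t0 s0 es et reach = vec-ext (λ i → go (reach i))
      where
      go : ∀ {i} → Reach s t Fin.zero i → lookup τ i ≡ lookup σ i
      go start = t0 ∙ sym s0
      go (bySˢ {i} r) = sym (Inverse.conj-at τ it s i) ∙ cong₂ lookup es (go r) ∙ Inverse.conj-at σ is s i
      go (bySᵗ {i} r) = sym (Inverse.conj-at τ it t i) ∙ cong₂ lookup et (go r) ∙ Inverse.conj-at σ is t i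

    -- A relabelling m with lexicographically least result exists. Any other canonical result is
    -- also least, hence equal, and then the relabelling itself equals m, because on a connected map
    -- it is determined by the fixed root.
    canonical-once : ∀ s t → transitiveᵇ s t ≡ true → ΣL (λ τ → ind (isCanonical (conj τ s) (conj τ t))) relabellings ≡ 1#
    canonical-once s t h = ΣL-congAll (λ τ g → cong ind (same τ g)) (permsOn-Good (restFin N) (rest-unique N)) ∙
      mult-permsOn (restFin N) (rest-unique N) m (proj₁ m-good , proj₂ m-good)
      where
      key : PermV (suc N) → Vec (Fin (suc N)) (suc N ℕ.+ suc N)
      key τ = conj τ s Vec.++ conj τ t
      best : ∃ λ m → m ∈ relabellings × (∀ {y} → y ∈ relabellings → lexLeq (key m) (key y) ≡ true)
      best with relabellings | permsOn-complete (restFin N) (rest-unique N) idV (Inj-idV , λ i _ → lookup-idV i)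
      ... | x ∷ xs | _ = minimiser key x xs
      m = proj₁ best
      m-good : Good (restFin N) m
      m-good = All.lookup (permsOn-Good (restFin N) (rest-unique N)) (proj₁ (proj₂ best))
      m0 = relabelling-zero m m-good
      least : ∀ τ → Good (restFin N) τ → lexLeq (key m) (key τ) ≡ true
      least τ g = proj₂ (proj₂ best) (permsOn-complete (restFin N) (rest-unique N) τ g)
      compGood : ∀ σ τ → Inj σ → lookup σ Fin.zero ≡ Fin.zero → Good (restFin N) τ → Good (restFin N) (comp σ τ)
      compGood σ τ is s0 g = zero-relabelling (comp σ τ) (Inj-comp σ τ is (proj₁ g)) (lookup-comp σ τ Fin.zero ∙ cong (lookup σ) (relabelling-zero τ g) ∙ s0)
      key-comp : ∀ σ τ → Inj σ → Inj τ → key (comp σ τ) ≡ conj σ (conj τ s) Vec.++ conj σ (conj τ t)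
      key-comp σ τ is it = sym (cong₂ Vec._++_ (conj-comp σ τ s is it) (conj-comp σ τ t is it))
      same : ∀ τ → Good (restFin N) τ → isCanonical (conj τ s) (conj τ t) ≡ eqV τ m
      same τ g = bool-ext to from
        where
        it = proj₁ g
        τ⁻ = invV τ
        i⁻ = Inverse.inv-Inj τ it
        -- σ carries the relabelling τ to the least one; testing the canonicity of τ against it
        -- compares the two keys.
        σ = comp m τ⁻
        σ-Inj = Inj-comp m τ⁻ (proj₁ m-good) i⁻
        τ⁻0 : lookup τ⁻ Fin.zero ≡ Fin.zero
        τ⁻0 = cong (lookup τ⁻) (sym (relabelling-zero τ g)) ∙ Inverse.inv-left τ it Fin.zero
        σ0 : lookup σ Fin.zero ≡ Fin.zero
        σ0 = lookup-comp m τ⁻ Fin.zero ∙ cong (lookup m) τ⁻0 ∙ m0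
        στ : comp σ τ ≡ m
        στ = vec-ext (λ i → lookup-comp σ τ i ∙ lookup-comp m τ⁻ (lookup τ i) ∙ cong (lookup m) (Inverse.inv-left τ it i))
        to : isCanonical (conj τ s) (conj τ t) ≡ true → eqV τ m ≡ true
        to c = eqV-complete τ m (relabelling-free τ m s t it (proj₁ m-good) (relabelling-zero τ g) m0 (proj₁ both) (proj₂ both) (transitive-Reach s t h))
          where
          le : lexLeq (key τ) (key m) ≡ true
          le = subst (λ z → lexLeq (key τ) z ≡ true) (sym (key-comp σ τ σ-Inj it) ∙ cong key στ)
            (isCanonical-elim (conj τ s) (conj τ t) c σ (∈-perms σ σ-Inj) σ0)
          both = ++-injective (conj τ s) (conj m s) (lexLeq-antisym (key τ) (key m) le (least τ g))
        from : eqV τ m ≡ true → isCanonical (conj τ s) (conj τ t) ≡ true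
        from e = isCanonical-intro (conj τ s) (conj τ t) (λ σ σ∈ s0 → let is = All.lookup (perms-Inj (suc N)) σ∈ in
          subst₂ (λ a b → lexLeq a b ≡ true) (cong key (sym (eqV-sound τ m e))) (key-comp σ τ is it) (least (comp σ τ) (compGood σ τ is s0 g)))

    -- The relabellings that fix the root act freely on connected pairs, and each class contains one
    -- canonical pair. Summing over all pairs therefore counts each map N! times, with N + 1 edges
    -- one of which is the root.
    Σ-rootedMaps : (w : PermV (suc N) → PermV (suc N) → Carrier) →
      (∀ τ s t → Good (restFin N) τ → Inj s → Inj t → w (conj τ s) (conj τ t) ≡ w s t) →
      ΣL (λ { (s , t) → w s t }) (rootedMaps N) ≡ 1/! N * ΣL (λ s → ΣL (λ t → ind (transitiveᵇ s t) * w s t) (permsAll (suc N))) (permsAll (suc N))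
    Σ-rootedMaps w inv = ΣL-filterᵇ _ _ (cartesianProduct (perms (suc N)) (perms (suc N))) ∙ ΣL-cartesian _ (perms (suc N)) (perms (suc N)) ∙ ΣL-cong (λ s → Σ-perms (F s)) (perms (suc N)) ∙ Σ-perms (λ s → ΣL (F s) P) ∙ sym (sym (*-assoc _ _ _) ∙ cong (_* base) count₁ ∙ *-identityˡ _) ∙ cong (1/! N *_) (sym total)
      where
      P = permsAll (suc N)
      F : PermV (suc N) → PermV (suc N) → Carrier
      F s t = ind (transitiveᵇ s t ∧ isCanonical s t) * w s t
      base = ΣL _ P
      count₁ : 1/! N * ΣL (λ _ → 1#) relabellings ≡ 1#
      count₁ = cong (λ k → 1/! k * ΣL _ relabellings) (sym (Listₚ.length-tabulate {n = N} Fin.suc)) ∙ permsOn-count (restFin N) (rest-unique N)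
      goodG = permsOn-Good (restFin N) (rest-unique N)
      expand : ∀ s t → ind (transitiveᵇ s t) * w s t ≡ ΣL (λ τ → ind (transitiveᵇ s t) * ind (isCanonical (conj τ s) (conj τ t)) * w s t) relabellings
      expand s t with transitiveᵇ s t in e
      ... | false = zeroˡ _ ∙ sym (ΣL-cong (λ τ → solve 2 (λ a b → :0 :* a :* b := :0) refl _ _) relabellings ∙ ΣL-0 relabellings)
      ... | true = sym (ΣL-*ʳ _ _ relabellings ∙ cong (_* w s t) (ΣL-cong (λ _ → *-identityˡ _) relabellings ∙ canonical-once s t e))
      total : ΣL (λ s → ΣL (λ t → ind (transitiveᵇ s t) * w s t) P) P ≡ ΣL (λ _ → 1#) relabellings * base
      total = ΣL-cong (λ s → ΣL-cong (expand s) P) P ∙ ΣL-cong (λ s → ΣL-swap _ P relabellings) P ∙ ΣL-swap _ P relabellings ∙ ΣL-congAll (λ τ g → ΣL-congAll (λ s is → ΣL-congAll (λ t it → move τ g s t is it) (permsAll-Inj (suc N))) (permsAll-Inj (suc N)) ∙ ΣL-cong (λ s → Σ-conj τ (proj₁ g) _) P ∙ Σ-conj τ (proj₁ g) _) goodG ∙ ΣL-cong (λ _ → sym (*-identityˡ base)) relabellings ∙ ΣL-*ʳ base _ relabellings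
        where
        move : ∀ τ → Good (restFin N) τ → ∀ s t → Inj s → Inj t →
          ind (transitiveᵇ s t) * ind (isCanonical (conj τ s) (conj τ t)) * w s t ≡ ind (transitiveᵇ (conj τ s) (conj τ t) ∧ isCanonical (conj τ s) (conj τ t)) * w (conj τ s) (conj τ t)
        move τ g s t is it = cong₂ _*_ (cong (λ b → ind b * ind (isCanonical (conj τ s) (conj τ t))) (sym (transitive-conj τ s t (proj₁ g) (relabelling-zero τ g))) ∙ sym (ind-∧ (transitiveᵇ (conj τ s) (conj τ t)) _))
          (sym (inv τ s t g is it))

-- Diagrams by columns and by rows

-- Rows carry labels; lead lists the labels of the rows meeting the first column.
lead : {X : Set} → List (X × ℕ) → List X
lead [] = []
lead ((y , zero) ∷ L) = []
lead ((y , suc r) ∷ L) = y ∷ lead L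

strip : {X : Set} → List (X × ℕ) → List (X × ℕ)
strip = map (λ { (y , r) → (y , ℕ.pred r) })

colsOf : {X : Set} → ℕ → ℕ → List (X × ℕ) → List (ℕ × List X)
colsOf zero x L = []
colsOf (suc m) x L = (x , lead L) ∷ colsOf m (suc x) (strip L)

data Decreasing {X : Set} : ℕ → List (X × ℕ) → Set where
  [] : ∀ {m} → Decreasing m []
  _∷_ : ∀ {m y r L} → r ℕ.≤ m → Decreasing r L → Decreasing m ((y , r) ∷ L)

Decreasing-strip : ∀ {X : Set} {m} {L : List (X × ℕ)} → Decreasing m L → Decreasing (ℕ.pred m) (strip L)
Decreasing-strip [] = []
Decreasing-strip (p ∷ d) = ℕₚ.pred-mono-≤ p ∷ Decreasing-strip d

lead-strip : ∀ {X : Set} (L : List (X × ℕ)) {y} → y ∈ lead (strip L) → y ∈ lead L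
lead-strip ((y , suc (suc r)) ∷ L) (here e) = here e
lead-strip ((y , suc (suc r)) ∷ L) (there m) = there (lead-strip L m)

colBoxesℕ-colsOf : ∀ m x (L : List (ℕ × ℕ)) → All (λ b → x ℕ.≤ proj₁ b × proj₂ b ∈ lead L) (colBoxesℕ (colsOf m x L))
colBoxesℕ-colsOf zero x L = []
colBoxesℕ-colsOf (suc m) x L = Allₚ.++⁺ (Allₚ.map⁺ (All.tabulate (λ p → ≤-refl , p)))
  (All.map (λ (p , q) → ≤-trans (n≤1+n x) p , lead-strip L q) (colBoxesℕ-colsOf m (suc x) (strip L)))

lead-∈ : ∀ {X : Set} (L : List (X × ℕ)) {y} → y ∈ lead L → y ∈ map proj₁ L
lead-∈ ((y , suc r) ∷ L) (here e) = here e
lead-∈ ((y , suc r) ∷ L) (there m) = there (lead-∈ L m)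

lead-unique : ∀ {X : Set} (L : List (X × ℕ)) → Unique (map proj₁ L) → Unique (lead L)
lead-unique [] _ = []
lead-unique ((y , zero) ∷ L) _ = []
lead-unique ((y , suc r) ∷ L) (p ∷ un) = All.tabulate (λ m → All.lookup p (lead-∈ L m)) ∷ lead-unique L un

strip-labels : ∀ {X : Set} (L : List (X × ℕ)) → map proj₁ (strip L) ≡ map proj₁ L
strip-labels [] = refl
strip-labels (p ∷ L) = cong (proj₁ p ∷_) (strip-labels L)

colsOf-Nested : ∀ m x (L : List (ℕ × ℕ)) → Unique (map proj₁ L) → Nested (colsOf m x L)
colsOf-Nested zero x L un = []
colsOf-Nested (suc m) x L un = add (lead-unique L un)
  (All.map (λ (p , q) → (λ e → <⇒≢ p (sym e)) , lead-strip L q) (colBoxesℕ-colsOf m (suc x) (strip L)))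
  (colsOf-Nested m (suc x) (strip L) (subst Unique (sym (strip-labels L)) un))

module Fubini (R : Alg) where
  open Ring R
  open Sums R

  rowSum : (ℕ → Carrier) → ℕ → ℕ → Carrier
  rowSum h x zero = 0#
  rowSum h x (suc r) = h x + rowSum h (suc x) r

  Σ-rows : {X : Set} → (ℕ → X → Carrier) → ℕ → List (X × ℕ) → Carrier
  Σ-rows h x L = ΣL (λ { (y , r) → rowSum (λ k → h k y) x r }) L

  Σ-cols : {X : Set} → (ℕ → X → Carrier) → List (ℕ × List X) → Carrier
  Σ-cols h cs = ΣL (λ { (x , ys) → ΣL (h x) ys }) cs

  Σ-rows-zero : ∀ {X : Set} (h : ℕ → X → Carrier) x L → Decreasing 0 L → Σ-rows h x L ≡ 0#
  Σ-rows-zero h x [] [] = refl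
  Σ-rows-zero h x ((y , zero) ∷ L) (z≤n ∷ d) = +-identityˡ _ ∙ Σ-rows-zero h x L d

  Σ-rows-step : ∀ {X : Set} (h : ℕ → X → Carrier) x L {m} → Decreasing m L → Σ-rows h x L ≡ ΣL (h x) (lead L) + Σ-rows h (suc x) (strip L)
  Σ-rows-step h x [] [] = sym (+-identityˡ _)
  Σ-rows-step h x ((y , zero) ∷ L) (p ∷ d) = Σ-rows-zero h x ((y , zero) ∷ L) (z≤n ∷ d) ∙ sym (+-identityˡ _ ∙ Σ-rows-zero h (suc x) (strip ((y , zero) ∷ L)) (Decreasing-strip (z≤n {0} ∷ d)))
  Σ-rows-step h x ((y , suc r) ∷ L) (p ∷ d) = cong (h x y + rowSum (λ k → h k y) (suc x) r +_) (Σ-rows-step h x L d) ∙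
    solve 4 (λ a b c d → a :+ b :+ (c :+ d) := a :+ c :+ (b :+ d)) refl _ _ _ _

  fubini : ∀ {X : Set} (h : ℕ → X → Carrier) m x L → Decreasing m L → Σ-cols h (colsOf m x L) ≡ Σ-rows h x L
  fubini h zero x L d = sym (Σ-rows-zero h x L d)
  fubini h (suc m) x L d = cong (ΣL (h x) (lead L) +_) (fubini h m (suc x) (strip L) (Decreasing-strip d)) ∙ sym (Σ-rows-step h x L d)

  ΣL-colBoxesℕ : ∀ (h : ℕ → ℕ → Carrier) cs → ΣL (λ b → h (proj₁ b) (proj₂ b)) (colBoxesℕ cs) ≡ Σ-cols h cs
  ΣL-colBoxesℕ h [] = refl
  ΣL-colBoxesℕ h ((x , ys) ∷ cs) = ΣL-++ _ (map (x ,_) ys) _ ∙ cong₂ _+_ (ΣL-map _ _ ys) (ΣL-colBoxesℕ h cs)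

module RowForm (R : Alg) (g A : Alg.Carrier R) where
  open Ring R
  open Sums R
  open Fubini R
  open Series R using (nat-suc; nat-0)

  shift : Carrier × Carrier → Carrier × Carrier
  shift (ω , c) = (ω , c + A)

  colB : List Carrier → Carrier → List (Carrier × Carrier)
  colB [] β = []
  colB (B ∷ Bs) β = (- (A * B) , β + - g) ∷ colB Bs (β + B)

  boxesB : List (List Carrier) → List (Carrier × Carrier)
  boxesB [] = []
  boxesB (Bs ∷ cs) = colB Bs 0# ++ map shift (boxesB cs)

  -- rows labelled by their height and the total height of the preceding rows
  labelled : Carrier → List (Carrier × ℕ) → List ((Carrier × Carrier) × ℕ)
  labelled β [] = []
  labelled β ((B , r) ∷ L) = ((B , β) , r) ∷ labelled (β + B) L

  colsB : ℕ → List (Carrier × ℕ) → List (List Carrier)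
  colsB m L = map proj₂ (colsOf m 0 L)

  box : ℕ → Carrier × Carrier → Carrier × Carrier
  box k (B , β) = (- (A * B) , A * nat k + β + - g)

  labelled-strip : ∀ β L → labelled β (strip L) ≡ strip (labelled β L)
  labelled-strip β [] = refl
  labelled-strip β ((B , r) ∷ L) = cong (_ ∷_) (labelled-strip (β + B) L)

  ΣL-colB : ∀ (φ : Carrier × Carrier → Carrier) k β L → ΣL (λ b → φ (proj₁ b , A * nat k + proj₂ b)) (colB (lead L) β) ≡ ΣL (λ y → φ (box k y)) (lead (labelled β L))
  ΣL-colB φ k β [] = refl
  ΣL-colB φ k β ((B , zero) ∷ L) = refl
  ΣL-colB φ k β ((B , suc r) ∷ L) = cong₂ _+_ (cong (λ c → φ (_ , c)) (sym (+-assoc _ _ _))) (ΣL-colB φ k (β + B) L)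

  ΣL-boxesB : ∀ (φ : Carrier × Carrier → Carrier) m k x L → ΣL (λ b → φ (proj₁ b , A * nat k + proj₂ b)) (boxesB (map proj₂ (colsOf m x L))) ≡ Σ-cols (λ k y → φ (box k y)) (colsOf m k (labelled 0# L))
  ΣL-boxesB φ zero k x L = refl
  ΣL-boxesB φ (suc m) k x L = ΣL-++ _ (colB (lead L) 0#) _ ∙ cong₂ _+_ (ΣL-colB φ k 0# L)
    (ΣL-map _ shift (boxesB (map proj₂ (colsOf m (suc x) (strip L)))) ∙
      ΣL-cong (λ b → cong (λ c → φ (proj₁ b , c)) (solve 3 (λ A n c → A :* n :+ (c :+ A) := A :* (:1 :+ n) :+ c) refl A (nat k) (proj₂ b) ∙ cong (λ n → A * n + proj₂ b) (sym (nat-suc k)))) (boxesB (map proj₂ (colsOf m (suc x) (strip L)))) ∙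
        ΣL-boxesB φ m (suc k) (suc x) (strip L) ∙ cong (λ l → Σ-cols (λ k y → φ (box k y)) (colsOf m (suc k) l)) (labelled-strip 0# L))

  labelled-Decreasing : ∀ β {m} {L : List (Carrier × ℕ)} → Decreasing m L → Decreasing m (labelled β L)
  labelled-Decreasing β [] = []
  labelled-Decreasing β (_∷_ {y = B} p d) = p ∷ labelled-Decreasing (β + B) d

  -- Σ over rows (B , r), with running total height β, of Σ_{k<r} φ(box)
  rowForm : (Carrier × Carrier → Carrier) → Carrier → List (Carrier × ℕ) → Carrier
  rowForm φ β [] = 0#
  rowForm φ β ((B , r) ∷ L) = rowSum (λ k → φ (box k (B , β))) 0 r + rowForm φ (β + B) L

  rowForm-labelled : ∀ φ β L → Σ-rows (λ k y → φ (box k y)) 0 (labelled β L) ≡ rowForm φ β L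
  rowForm-labelled φ β [] = refl
  rowForm-labelled φ β ((B , r) ∷ L) = cong (rowSum (λ k → φ (box k (B , β))) 0 r +_) (rowForm-labelled φ (β + B) L)

  ΣL-boxes-rows : ∀ (φ : Carrier × Carrier → Carrier) m L → Decreasing m L → ΣL φ (boxesB (colsB m L)) ≡ rowForm φ 0# L
  ΣL-boxes-rows φ m L d = ΣL-cong (λ b → cong (λ c → φ (proj₁ b , c)) (sym (cong (λ n → A * n + proj₂ b) nat-0 ∙ solve 2 (λ A c → A :* :0 :+ c := c) refl A (proj₂ b)))) (boxesB (colsB m L)) ∙ ΣL-boxesB φ m 0 0 L ∙ fubini _ m 0 (labelled 0# L) (labelled-Decreasing 0# d) ∙ rowForm-labelled φ 0# L

boxesOf-boxesB : ∀ (W : World) cs → Recursion.boxesOf W cs ≡ RowForm.boxesB (World.alg W) (World.g W) (World.A W) cs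
boxesOf-boxesB W [] = refl
boxesOf-boxesB W (Bs ∷ cs) = cong₂ _++_ (col Bs (World.0# W)) (cong (map _) (boxesOf-boxesB W cs) ∙ Listₚ.map-cong (λ _ → refl) _)
  where
  col : ∀ Bs β → Recursion.colBoxes W Bs β ≡ RowForm.colB (World.alg W) (World.g W) (World.A W) Bs β
  col [] β = refl
  col (B ∷ Bs) β = cong (_ ∷_) (col Bs _)

-- Embeddings as colourings of the edges by boxes

allᶠ-∧ : ∀ {N} (p q : Fin N → Bool) → allᶠ (λ i → p i ∧ q i) ≡ allᶠ p ∧ allᶠ q
allᶠ-∧ p q = bool-ext
  (λ h → ∧-intro (allᶠ-intro p (λ i → proj₁ (∧-split (allᶠ-elim (λ i → p i ∧ q i) h i)))) (allᶠ-intro q (λ i → proj₂ (∧-split {p i} (allᶠ-elim (λ i → p i ∧ q i) h i)))))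
  (λ h → allᶠ-intro _ (λ i → ∧-intro (allᶠ-elim p (proj₁ (∧-split h)) i) (allᶠ-elim q (proj₂ (∧-split {allᶠ p} h)) i)))

allᶠ-cong : ∀ {N} {p q : Fin N → Bool} → (∀ i → p i ≡ q i) → allᶠ p ≡ allᶠ q
allᶠ-cong {N} h = cong and (Listₚ.map-cong h (allFin N))

allᶠ-suc : ∀ {N} (p : Fin (suc N) → Bool) → allᶠ p ≡ p Fin.zero ∧ allᶠ (p ∘ Fin.suc)
allᶠ-suc {N} p = cong (λ l → p Fin.zero ∧ and l) (cong (map p) (sym (Listₚ.map-tabulate id Fin.suc)) ∙ sym (Listₚ.map-∘ (allFin N)))

connects-transitive : ∀ {N} (s t : PermV (suc N)) → connects Fin.zero (restFin N) s t ≡ transitiveᵇ s t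
connects-transitive {N} s t = bool-ext
  (λ h → Reach-transitive s t (λ { Fin.zero → start ; (Fin.suc i) → orb-sound s t Fin.zero (Fin.suc i) (and-elim (lookup (orbV s t Fin.zero)) (restFin N) h (∈ₚ.∈-tabulate⁺ i)) }))
  (λ h → and-intro _ (restFin N) (λ {i} _ → orb-complete s t Fin.zero (transitive-Reach s t h i)))

label : ℕ → List ℕ → List (ℕ × ℕ)
label y [] = []
label y (r ∷ rs) = (y , r) ∷ label (suc y) rs

label-Decreasing : ∀ y r rs → Linked ℕ._≥_ (r ∷ rs) → Decreasing r (label y rs)
label-Decreasing y r [] _ = []
label-Decreasing y r (r' ∷ rs) (p ∷ l) = p ∷ label-Decreasing (suc y) r' rs l

label-bound : ∀ y rs → All (λ z → y ℕ.≤ z) (map proj₁ (label y rs))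
label-bound y [] = []
label-bound y (r ∷ rs) = ≤-refl ∷ All.map (≤-trans (n≤1+n y)) (label-bound (suc y) rs)

label-unique : ∀ y rs → Unique (map proj₁ (label y rs))
label-unique y [] = []
label-unique y (r ∷ rs) = All.map <⇒≢ (label-bound (suc y) rs) ∷ label-unique (suc y) rs

labelYD : YD → List (ℕ × ℕ)
labelYD λ' = label 1 (rows λ')

width : YD → ℕ
width λ' = rowLen (rows λ') 1

labelYD-Decreasing : ∀ λ' → Decreasing (width λ') (labelYD λ')
labelYD-Decreasing λ' with rows λ' | decr λ'
... | [] | _ = []
... | r ∷ rs | l = ≤-refl ∷ label-Decreasing 2 r rs l

columns : YD → List (ℕ × List ℕ)
columns λ' = colsOf (width λ') 1 (labelYD λ')

columns-Nested : ∀ λ' → Nested (columns λ')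
columns-Nested λ' = colsOf-Nested (width λ') 1 (labelYD λ') (label-unique 1 (rows λ'))

range1-unique : ∀ r → Unique (range1 r)
range1-unique r = Uniqueₚ.map⁺ suc-injective (Uniqueₚ.upTo⁺ r)

eqVℕ : ∀ {k} → Vec ℕ k → Vec ℕ k → Bool
eqVℕ [] [] = true
eqVℕ (x ∷ v) (y ∷ w) = (x ≡ᵇ y) ∧ eqVℕ v w

eqVℕ-sound : ∀ {k} (v w : Vec ℕ k) → eqVℕ v w ≡ true → v ≡ w
eqVℕ-sound [] [] _ = refl
eqVℕ-sound (x ∷ v) (y ∷ w) h = cong₂ _∷_ (≡ᵇ-sound (proj₁ (∧-split h))) (eqVℕ-sound v w (proj₂ (∧-split {x ≡ᵇ y} h)))

eqVℕ-complete : ∀ {k} (v w : Vec ℕ k) → v ≡ w → eqVℕ v w ≡ true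
eqVℕ-complete [] _ refl = refl
eqVℕ-complete (x ∷ v) _ refl = ∧-intro (≡ᵇ-refl x) (eqVℕ-complete v v refl)

module TupleSums (R : Alg) where
  open Ring R
  open Sums R
  open Indicator R
  open Rooted R
  private
    module E {k : ℕ} = Enumeration (eqVℕ {k}) eqVℕ-sound eqVℕ-complete
  open E

  pickℕ : ∀ (a : ℕ) us → Unique us → a ∈ us → ΣL (λ i → ind (i ≡ᵇ a)) us ≡ 1#
  pickℕ a (u ∷ us) (p ∷ _) (here refl) = cong₂ _+_ (cong ind (≡ᵇ-refl a)) (ΣL-congAll (λ i q → cong ind (≢-false i q)) p ∙ ΣL-0 us) ∙ +-identityʳ _
    where
    ≢-false : ∀ i → a ≢ i → (i ≡ᵇ a) ≡ false
    ≢-false i q with i ≡ᵇ a in e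
    ... | false = refl
    ... | true = ⊥-elim (q (sym (≡ᵇ-sound e)))
  pickℕ a (u ∷ us) (p ∷ un) (there m) with u ≡ᵇ a in e
  ... | true = ⊥-elim (All.lookup p m (≡ᵇ-sound e))
  ... | false = +-identityˡ _ ∙ pickℕ a us un m

  multiplicity-tuples : ∀ k xs → Unique xs → (v : Vec ℕ k) → (∀ i → lookup v i ∈ xs) → multiplicity v (tuples k xs) ≡ 1#
  multiplicity-tuples zero xs un [] h = +-identityʳ _
  multiplicity-tuples (suc k) xs un (a ∷ v) h = ΣL-concatMap _ _ xs ∙ ΣL-cong (λ x → ΣL-map _ _ (tuples k xs) ∙ ΣL-cong (λ w → ind-∧ (x ≡ᵇ a) (eqVℕ w v)) (tuples k xs) ∙ ΣL-* _ _ (tuples k xs)) xs ∙ ΣL-*ʳ _ _ xs ∙ cong₂ _*_ (pickℕ a xs un (h Fin.zero)) (multiplicity-tuples k xs un v (h ∘ Fin.suc)) ∙ *-identityˡ 1#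

  tuples-∈ : ∀ {X : Set} k (xs : List X) → All (λ v → ∀ i → lookup v i ∈ xs) (tuples k xs)
  tuples-∈ zero xs = (λ ()) ∷ []
  tuples-∈ (suc k) xs = Allₚ.concat⁺ (Allₚ.map⁺ (All.tabulate (λ {x} m → Allₚ.map⁺ (All.map (λ p → λ { Fin.zero → m ; (Fin.suc i) → p i }) (tuples-∈ k xs)))))

  reindex : ∀ {n} → PermV n → Vec ℕ n → Vec ℕ n
  reindex τ v = tabulate (λ i → lookup v (lookup τ i))

  lookup-reindex : ∀ {n} (τ : PermV n) v i → lookup (reindex τ v) i ≡ lookup v (lookup τ i)
  lookup-reindex τ v i = Vecₚ.lookup∘tabulate _ i

  Σ-reindex : ∀ {n} (τ : PermV n) → Inj τ → ∀ xs → Unique xs → (f : Vec ℕ n → Carrier) → ΣL (λ v → f (reindex τ v)) (tuples n xs) ≡ ΣL f (tuples n xs)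
  Σ-reindex {n} τ it xs un f = sym (ΣL-map f (reindex τ) (tuples n xs)) ∙ Σ-enumerate f (map (reindex τ) (tuples n xs)) (tuples n xs)
    (Allₚ.map⁺ (All.map (λ {v} h → multiplicity-tuples n xs un (reindex τ v) (λ i → subst (_∈ xs) (sym (lookup-reindex τ v i)) (h _))) (tuples-∈ n xs)))
    (All.map (λ {a} h → ΣL-map _ (reindex τ) (tuples n xs) ∙ ΣL-cong (λ v → cong ind (flip v a)) (tuples n xs) ∙
       multiplicity-tuples n xs un (reindex τ⁻ a) (λ i → subst (_∈ xs) (sym (lookup-reindex τ⁻ a i)) (h _))) (tuples-∈ n xs))
    where
    open Inverse τ it using (τ⁻; inv-left; inv-right)
    to-from : ∀ v → reindex τ⁻ (reindex τ v) ≡ v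
    to-from v = vec-ext (λ i → lookup-reindex τ⁻ (reindex τ v) i ∙ lookup-reindex τ v (lookup τ⁻ i) ∙ cong (lookup v) (inv-right i))
    from-to : ∀ v → reindex τ (reindex τ⁻ v) ≡ v
    from-to v = vec-ext (λ i → lookup-reindex τ (reindex τ⁻ v) i ∙ lookup-reindex τ⁻ v (lookup τ i) ∙ cong (lookup v) (inv-left i))
    flip : ∀ v a → eqVℕ (reindex τ v) a ≡ eqVℕ v (reindex τ⁻ a)
    flip v a = bool-ext (λ h → eqVℕ-complete v (reindex τ⁻ a) (sym (to-from v) ∙ cong (reindex τ⁻) (eqVℕ-sound (reindex τ v) a h)))
      (λ h → eqVℕ-complete (reindex τ v) a (cong (reindex τ) (eqVℕ-sound v (reindex τ⁻ a) h) ∙ from-to a))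

  -- Columns and rows chosen for all edges, with every pair inside the diagram, amount to a box for
  -- each edge; the product of the conditions is split off one edge at a time.
  Σ-pairs : ∀ (P : ℕ → ℕ → Bool) xs ys Bx → (∀ (h : ℕ → ℕ → Carrier) → ΣL (λ x → ΣL (λ y → ind (P x y) * h x y) ys) xs ≡ ΣL (λ b → h (proj₁ b) (proj₂ b)) Bx) →
    ∀ n (H : Vec ℕ n → Vec ℕ n → Carrier) →
    ΣL (λ f₁ → ΣL (λ f₂ → ind (allᶠ (λ i → P (lookup f₁ i) (lookup f₂ i))) * H f₁ f₂) (tuples n ys)) (tuples n xs)
      ≡ ΣL (λ bs → H (Vec.map proj₁ bs) (Vec.map proj₂ bs)) (tuples n Bx)
  Σ-pairs P xs ys Bx base zero H = solve 1 (λ a → :1 :* a :+ :0 :+ :0 := a :+ :0) refl (H [] [])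
  Σ-pairs P xs ys Bx base (suc n) H = ΣL-concatMap _ _ xs ∙ ΣL-cong (λ x → ΣL-map _ _ (tuples n xs) ∙ ΣL-cong (λ f₁ → ΣL-concatMap _ _ ys ∙ ΣL-cong (λ y → ΣL-map _ _ (tuples n ys) ∙ ΣL-cong (λ f₂ → point x f₁ y f₂) (tuples n ys)) ys) (tuples n xs)) xs ∙ ΣL-cong (λ x → ΣL-swap _ (tuples n xs) ys ∙ ΣL-cong (λ y → ΣL-cong (λ f₁ → ΣL-* _ _ (tuples n ys)) (tuples n xs) ∙ ΣL-* _ _ (tuples n xs)) ys) xs ∙ ΣL-cong (λ x → ΣL-cong (λ y → cong (ind (P x y) *_) (Σ-pairs P xs ys Bx base n (λ f₁ f₂ → H (x ∷ f₁) (y ∷ f₂)))) ys) xs ∙ base _ ∙ sym (ΣL-concatMap _ _ Bx ∙ ΣL-cong (λ b → ΣL-map _ _ (tuples n Bx)) Bx)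
    where
    point : ∀ x (f₁ : Vec ℕ n) y (f₂ : Vec ℕ n) → ind (allᶠ (λ i → P (lookup (x ∷ f₁) i) (lookup (y ∷ f₂) i))) * H (x ∷ f₁) (y ∷ f₂)
      ≡ ind (P x y) * (ind (allᶠ (λ i → P (lookup f₁ i) (lookup f₂ i))) * H (x ∷ f₁) (y ∷ f₂))
    point x f₁ y f₂ = cong (λ b → ind b * H (x ∷ f₁) (y ∷ f₂)) (allᶠ-suc (λ i → P (lookup (x ∷ f₁) i) (lookup (y ∷ f₂) i))) ∙
      cong (_* H (x ∷ f₁) (y ∷ f₂)) (ind-∧ (P x y) _) ∙ *-assoc _ _ _

  open Fubini R

  ΣL-upTo-suc : ∀ (f : ℕ → Carrier) m → ΣL f (upTo (suc m)) ≡ f 0 + ΣL (λ i → f (suc i)) (upTo m)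
  ΣL-upTo-suc f m = cong (f 0 +_) (cong (ΣL f) (sym (Listₚ.map-upTo suc m)) ∙ ΣL-map f suc (upTo m))

  Σ-upTo-rowSum : ∀ (h : ℕ → Carrier) x M r → r ℕ.≤ M → ΣL (λ i → ind (suc i ≤ᵇ r) * h (x ℕ.+ i)) (upTo M) ≡ rowSum h x r
  Σ-upTo-rowSum h x zero zero z≤n = refl
  Σ-upTo-rowSum h x (suc M) zero p = ΣL-cong (λ i → zeroˡ _) (upTo (suc M)) ∙ ΣL-0 (upTo (suc M))
  Σ-upTo-rowSum h x (suc M) (suc r) (s≤s p) = ΣL-upTo-suc (λ i → ind (suc i ≤ᵇ suc r) * h (x ℕ.+ i)) M ∙ cong₂ _+_ (*-identityˡ _ ∙ cong h (ℕₚ.+-identityʳ x))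
    (ΣL-cong (λ i → cong (λ k → ind (suc i ≤ᵇ r) * h k) (ℕₚ.+-suc x i)) (upTo M) ∙ Σ-upTo-rowSum h (suc x) M r p)

  Σ-upTo-label : ∀ (Φ : ℕ → ℕ → Carrier) k rs → ΣL (λ i → Φ (k ℕ.+ i) (rowLen rs (suc i))) (upTo (length rs)) ≡ ΣL (λ { (y , r) → Φ y r }) (label k rs)
  Σ-upTo-label Φ k [] = refl
  Σ-upTo-label Φ k (r ∷ rs) = ΣL-upTo-suc (λ i → Φ (k ℕ.+ i) (rowLen (r ∷ rs) (suc i))) (length rs) ∙ cong₂ _+_ (cong (λ j → Φ j r) (ℕₚ.+-identityʳ k))
    (ΣL-cong (λ i → cong (λ j → Φ j (rowLen rs (suc i))) (ℕₚ.+-suc k i)) (upTo (length rs)) ∙ Σ-upTo-label Φ (suc k) rs)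

  label-All : ∀ {m} k rs → Decreasing m (label k rs) → All (λ yr → proj₂ yr ℕ.≤ m) (label k rs)
  label-All k [] [] = []
  label-All k (r ∷ rs) (p ∷ d) = p ∷ All.map (λ q → ≤-trans q p) (label-All (suc k) rs d)

  Σ-inYD : ∀ λ' (h : ℕ → ℕ → Carrier) → ΣL (λ x → ΣL (λ y → ind (inYDᵇ λ' x y) * h x y) (rowsOf λ')) (columnsOf λ') ≡ ΣL (λ b → h (proj₁ b) (proj₂ b)) (colBoxesℕ (columns λ'))
  Σ-inYD λ' h = ΣL-swap _ (columnsOf λ') (rowsOf λ') ∙ ΣL-map _ suc (upTo (length (rows λ'))) ∙ ΣL-cong (λ i → ΣL-map _ suc (upTo (width λ'))) (upTo (length (rows λ'))) ∙ Σ-upTo-label (λ y r → ΣL (λ j → ind (suc j ≤ᵇ r) * h (suc j) y) (upTo (width λ'))) 1 (rows λ') ∙ ΣL-congAll (λ { (y , r) p → Σ-upTo-rowSum (λ k → h k y) 1 (width λ') r p }) (label-All 1 (rows λ') (labelYD-Decreasing λ')) ∙ sym (fubini h (width λ') 1 (labelYD λ') (labelYD-Decreasing λ')) ∙ sym (ΣL-colBoxesℕ h (columns λ'))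

  embSum : ∀ {n} → YD → PermV n → PermV n → Carrier
  embSum {n} λ' s t = ΣL (λ f₁ → ΣL (λ f₂ → ind (allᶠ (λ i → inYDᵇ λ' (lookup f₁ i) (lookup f₂ i))) * (ind (compat (lookup f₁) s) * ind (compat (lookup f₂) t)))
    (tuples n (rowsOf λ'))) (tuples n (columnsOf λ'))

  compat-cong : ∀ {n} {f f' : Fin n → ℕ} s → (∀ i → f i ≡ f' i) → compat f s ≡ compat f' s
  compat-cong s h = allᶠ-cong (λ i → cong₂ _≡ᵇ_ (h (lookup s i)) (h i))

  embSum-boxes : ∀ {n} λ' (s t : PermV n) → embSum λ' s t ≡ ΣL (λ bs → ind (compat (proj₁ ∘ lookup bs) s) * ind (compat (proj₂ ∘ lookup bs) t)) (tuples n (colBoxesℕ (columns λ')))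
  embSum-boxes {n} λ' s t = Σ-pairs (inYDᵇ λ') (columnsOf λ') (rowsOf λ') (colBoxesℕ (columns λ')) (Σ-inYD λ') n _ ∙
    ΣL-cong (λ bs → cong₂ (λ a b → ind a * ind b) (compat-cong s (λ i → Vecₚ.lookup-map i proj₁ bs)) (compat-cong t (λ i → Vecₚ.lookup-map i proj₂ bs))) (tuples n (colBoxesℕ (columns λ')))

  compat-conj : ∀ {n} (τ : PermV n) → Inj τ → (v : Vec ℕ n) (s : PermV n) → compat (lookup v) (conj τ s) ≡ compat (lookup (reindex τ v)) s
  compat-conj τ it v s = bool-ext
    (λ h → compat-intro (lookup (reindex τ v)) s (λ i → look (lookup s i) ∙ cong (lookup v) (sym (Inverse.conj-at τ it s i)) ∙ compat-elim (lookup v) (conj τ s) h (lookup τ i) ∙ sym (look i)))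
    (λ h → compat-intro (lookup v) (conj τ s) (λ j → cong (lookup v) (Inverse.lookup-conj τ it s j) ∙ sym (look _) ∙
       compat-elim (lookup (reindex τ v)) s h (lookup (invV τ) j) ∙ look _ ∙ cong (lookup v) (Inverse.inv-right τ it j)))
    where
    look = lookup-reindex τ v

  embSum-conj : ∀ {n} λ' (τ s t : PermV n) → Inj τ → embSum λ' (conj τ s) (conj τ t) ≡ embSum λ' s t
  embSum-conj {n} λ' τ s t it = ΣL-cong (λ f₁ → ΣL-cong (λ f₂ → cong₂ (λ b c → ind b * c) (inside f₁ f₂) (cong₂ (λ b c → ind b * ind c) (compat-conj τ it f₁ s) (compat-conj τ it f₂ t))) (tuples n (rowsOf λ'))) (tuples n (columnsOf λ')) ∙ ΣL-cong (λ f₁ → Σ-reindex τ it (rowsOf λ') (range1-unique _) (F (reindex τ f₁))) (tuples n (columnsOf λ')) ∙ Σ-reindex τ it (columnsOf λ') (range1-unique _) (λ f₁ → ΣL (F f₁) (tuples n (rowsOf λ')))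
    where
    F : Vec ℕ n → Vec ℕ n → Carrier
    F f₁ f₂ = ind (allᶠ (λ i → inYDᵇ λ' (lookup f₁ i) (lookup f₂ i))) * (ind (compat (lookup f₁) s) * ind (compat (lookup f₂) t))
    inside : ∀ f₁ f₂ → allᶠ (λ i → inYDᵇ λ' (lookup f₁ i) (lookup f₂ i)) ≡ allᶠ (λ i → inYDᵇ λ' (lookup (reindex τ f₁) i) (lookup (reindex τ f₂) i))
    inside f₁ f₂ = bool-ext
      (λ h → allᶠ-intro _ (λ i → cong₂ (inYDᵇ λ') (lookup-reindex τ f₁ i) (lookup-reindex τ f₂ i) ∙ allᶠ-elim (λ i → inYDᵇ λ' (lookup f₁ i) (lookup f₂ i)) h (lookup τ i)))
      (λ h → allᶠ-intro _ (λ j → cong₂ (λ a b → inYDᵇ λ' (lookup f₁ a) (lookup f₂ b)) (sym (Inverse.inv-right τ it j)) (sym (Inverse.inv-right τ it j)) ∙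
        sym (cong₂ (inYDᵇ λ') (lookup-reindex τ f₁ (lookup (invV τ) j)) (lookup-reindex τ f₂ (lookup (invV τ) j))) ∙
          allᶠ-elim (λ i → inYDᵇ λ' (lookup (reindex τ f₁) i) (lookup (reindex τ f₂) i)) h (lookup (invV τ) j)))

  nat-count : ∀ {X : Set} (p : X → Bool) xs → nat (count p xs) ≡ ΣL (λ x → ind (p x)) xs
  nat-count p [] = Series.nat-0 R
  nat-count p (x ∷ xs) with p x
  ... | true = Series.nat-suc R (count p xs) ∙ cong (1# +_) (nat-count p xs)
  ... | false = nat-count p xs ∙ sym (+-identityˡ _)

  nat-embeddings : ∀ {n} λ' (s t : PermV n) → nat (embeddings s t λ') ≡ embSum λ' s t
  nat-embeddings {n} λ' s t = nat-count _ (cartesianProduct (allVecs n (columnsOf λ')) (allVecs n (rowsOf λ'))) ∙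
    ΣL-cartesian _ (allVecs n (columnsOf λ')) (allVecs n (rowsOf λ')) ∙
      ΣL-cong (λ f₁ → ΣL-cong (λ f₂ → cong ind (allᶠ-∧ (λ i → lookup f₁ (lookup s i) ≡ᵇ lookup f₁ i) _ ∙
           cong (compat (lookup f₁) s ∧_) (allᶠ-∧ (λ i → lookup f₂ (lookup t i) ≡ᵇ lookup f₂ i) _)) ∙
         ind-∧ (compat (lookup f₁) s) _ ∙ cong (ind (compat (lookup f₁) s) *_) (ind-∧ (compat (lookup f₂) t) _) ∙
            solve 3 (λ a b c → a :* (b :* c) := c :* (a :* b)) refl _ _ _) (tuples n (rowsOf λ'))) (tuples n (columnsOf λ'))

-- F_n as a coefficient of the logarithmic derivative

module Powers (R : Alg) where
  open Ring R

  one-^# : ∀ n → 1# ^# n ≡ 1#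
  one-^# zero = refl
  one-^# (suc n) = *-identityˡ _ ∙ one-^# n

  *-^# : ∀ a b n → (a * b) ^# n ≡ (a ^# n) * (b ^# n)
  *-^# a b zero = sym (*-identityˡ _)
  *-^# a b (suc n) = cong (a * b *_) (*-^# a b n) ∙ solve 4 (λ a b p q → a :* b :* (p :* q) := a :* p :* (b :* q)) refl a b _ _

  inverse-^# : ∀ a b n → a * b ≡ 1# → (a ^# n) * (b ^# n) ≡ 1#
  inverse-^# a b n h = sym (*-^# a b n) ∙ cong (_^# n) h ∙ one-^# n

^≡^# : ∀ (x : ℚ) n → x ^ n ≡ Alg._^#_ ℚAlg x n
^≡^# x zero = refl
^≡^# x (suc n) = cong (x ℚ.*_) (^≡^# x n)

-- |V| ≤ n + 1 makes the truncated subtraction in the exponent of γ harmless.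
γ-exponent : ∀ N c c' r r' → c ℕ.+ r ≡ suc N → c' ℕ.+ r' ≡ suc N → N ℕ.≤ r ℕ.+ r' → (suc (suc N) ∸ (c ℕ.+ c')) ℕ.+ N ≡ r ℕ.+ r'
γ-exponent N c c' r r' e e' le with m≤n⇒∃[o]m+o≡n le
... | d , q = cong (ℕ._+ N) (cong (_∸ (c ℕ.+ c')) (sym total) ∙ m+n∸m≡n (c ℕ.+ c') d) ∙ ℕₚ.+-comm d N ∙ q
  where
  rearr : ∀ a b d N → a ℕ.+ b ℕ.+ d ℕ.+ N ≡ a ℕ.+ b ℕ.+ (N ℕ.+ d)
  rearr = solve-∀
  rearr′ : ∀ a b c d → a ℕ.+ b ℕ.+ (c ℕ.+ d) ≡ a ℕ.+ c ℕ.+ (b ℕ.+ d)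
  rearr′ = solve-∀
  total : c ℕ.+ c' ℕ.+ d ≡ suc (suc N)
  total = ℕₚ.+-cancelʳ-≡ N _ _ (rearr c c' d N ∙ cong (c ℕ.+ c' ℕ.+_) q ∙ rearr′ c c' r r' ∙ cong₂ ℕ._+_ e e' ∙ cong suc (ℕₚ.+-suc N N))

module MapsToSeries (A : ℚ) (nz : NonZero A) (γ≢0 : Defs.γ A nz ≢ 0ℚ) where
  open Ring ℚAlg
  open Sums ℚAlg
  open Powers ℚAlg

  ai B g gi x y : ℚ
  ai = 1/_ A {{nz}}
  B = - ai
  g = Defs.γ A nz
  gi = 1/_ g {{ℚ.≢-nonZero γ≢0}}
  x = g * ai
  y = g * - A

  Aai : A * ai ≡ 1#
  Aai = ℚₚ.*-inverseʳ A {{nz}}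

  ggi : g * gi ≡ 1#
  ggi = ℚₚ.*-inverseʳ g {{ℚ.≢-nonZero γ≢0}}

  xA : x * A ≡ g
  xA = solve 3 (λ g a A → g :* a :* A := g :* (A :* a)) refl g ai A ∙ cong (g *_) Aai ∙ *-identityʳ g

  yB : y * B ≡ g
  yB = solve 3 (λ g a A → g :* :- A :* :- a := g :* (A :* a)) refl g ai A ∙ cong (g *_) Aai ∙ *-identityʳ g

  cond : B * (A + B + g) ≡ 0#
  cond = solve 2 (λ A a → :- a :* (A :+ :- a :+ (:- A :+ a)) := :0) refl A ai

  open Connected ℚAlg x y
  open Words
  open WordSeries using (ŵ)
  open ColumnWords ℚAlg A B g gi x y xA yB ggi public using (K; world; f̂-words)
  open TupleSums ℚAlg
  open Rooted ℚAlg using (Σ-rootedMaps; permsAll; permsAll-Inj)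

  module _ (N : ℕ) (λ' : YD) where

    private
      n = suc N
      Bx = colBoxesℕ (columns λ')
      P = permsAll n

    mapWeight : PermV n → PermV n → ℚ
    mapWeight s t = (g ^ (suc (suc N) ∸ (cycles s ℕ.+ cycles t))) * 𝔑 s t A nz λ'

    fromℕ-embeddings : ∀ (s t : PermV n) → fromℕ (embeddings s t λ') ≡ embSum λ' s t
    fromℕ-embeddings s t = sym (ratℕ-def _) ∙ nat-embeddings λ' s t

    weightOf : ℕ → ℕ → ℚ → ℚ
    weightOf c c' e = (g ^ (suc (suc N) ∸ (c ℕ.+ c'))) * ((A ^ c) * ((- 1#) ^ c') * (ai ^ c') * e)

    mapWeight-conj : ∀ τ s t → Good (restFin N) τ → Inj s → Inj t → mapWeight (conj τ s) (conj τ t) ≡ mapWeight s t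
    mapWeight-conj τ s t g' is it = cong₂ (λ a b → weightOf a b (fromℕ (embeddings (conj τ s) (conj τ t) λ'))) (cycles-conj τ s (proj₁ g') is) (cycles-conj τ t (proj₁ g') it) ∙
      cong (weightOf (cycles s) (cycles t))
        (fromℕ-embeddings (conj τ s) (conj τ t) ∙ embSum-conj λ' τ s t (proj₁ g') ∙ sym (fromℕ-embeddings s t))

    unit : ℚ
    unit = (gi ^# N) * ((A ^# n) * (B ^# n))

    -- With c = n - r and c' = n - r', the powers of A and B = -1/A are AⁿBⁿ times A⁻ʳB⁻ʳ'.
    -- Replacing 1/A and 1/B by x and y costs the power r + r' of γ, which exceeds the exponent e of
    -- the map by N; this is the origin of the power of `gi` in `unit`.
    monomial : ∀ c c' r r' e → c ℕ.+ r ≡ n → c' ℕ.+ r' ≡ n → e ℕ.+ N ≡ r ℕ.+ r' →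
      (g ^ e) * ((A ^ c) * ((- 1#) ^ c') * (ai ^ c')) ≡ unit * ((x ^# r) * (y ^# r'))
    monomial c c' r r' e cr c'r' eN = sym (cong₂ (λ a b → (gi ^# N) * (a * b) * ((x ^# r) * (y ^# r'))) (cong (A ^#_) (sym cr) ∙ ^#-+ A c r) (cong (B ^#_) (sym c'r') ∙ ^#-+ B c' r') ∙ cong₂ (λ a b → (gi ^# N) * ((A ^# c) * (A ^# r) * ((B ^# c') * (B ^# r'))) * (a * b)) (*-^# g ai r) (*-^# g (- A) r') ∙ solve 9 (λ k a p b q u v w z → k :* (a :* p :* (b :* q)) :* (u :* v :* (w :* z)) := k :* (u :* w) :* (p :* v) :* (q :* z) :* (a :* b)) refl (gi ^# N) (A ^# c) (A ^# r) (B ^# c') (B ^# r') (g ^# r) (ai ^# r) (g ^# r') ((- A) ^# r') ∙ cong₂ (λ u v → (gi ^# N) * ((g ^# r) * (g ^# r')) * u * v * ((A ^# c) * (B ^# c'))) (inverse-^# A ai r Aai) (inverse-^# B (- A) r' (solve 2 (λ a A → :- a :* :- A := A :* a) refl ai A ∙ Aai)) ∙ cong (λ z → (gi ^# N) * z * 1# * 1# * ((A ^# c) * (B ^# c'))) (sym (^#-+ g r r') ∙ cong (g ^#_) (sym eN) ∙ ^#-+ g e N) ∙ solve 5 (λ k e q a b → k :* (e :* q) :* :1 :* :1 :* (a :* b) := (q :* k) :* (e :* (a :* b))) refl (gi ^# N) (g ^# e) (g ^# N) (A ^# c) (B ^# c') ∙ cong (_* ((g ^# e) * ((A ^# c) *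 (B ^# c')))) (inverse-^# g gi N ggi) ∙ *-identityˡ _ ∙ cong (λ z → (g ^# e) * ((A ^# c) * z)) (cong (_^# c') (solve 1 (λ a → :- a := :- :1 :* a) refl ai) ∙ (*-^# (- 1#) ai c')) ∙ cong ((g ^# e) *_) (sym (*-assoc (A ^# c) _ _)) ∙ sym (cong₂ _*_ (^≡^# g e) (cong₂ _*_ (cong₂ _*_ (^≡^# A c) (^≡^# (- 1#) c')) (^≡^# ai c'))))

    mapWeight-perms : ∀ s t → Invariants s t → transitiveᵇ s t ≡ true → mapWeight s t ≡ unit * ((x ^# ρ s) * (y ^# ρ t)) * embSum λ' s t
    mapWeight-perms s t inv h = cong (weightOf (cycles s) (cycles t)) (fromℕ-embeddings s t) ∙
      sym (*-assoc (g ^ (suc (suc N) ∸ (cycles s ℕ.+ cycles t))) ((A ^ cycles s) * ((- 1#) ^ cycles t) * (ai ^ cycles t)) (embSum λ' s t)) ∙ cong (_* embSum λ' s t) (monomial (cycles s) (cycles t) (ρ s) (ρ t) _ (compl s) (compl t)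
        (γ-exponent N (cycles s) (cycles t) (ρ s) (ρ t) (compl s) (compl t) (≤-pred (euler s t Fin.zero inv (transitive-Reach s t h)))))
      where
      compl : ∀ (s : PermV n) → cycles s ℕ.+ ρ s ≡ n
      compl s = ℕₚ.m+[n∸m]≡n (cycles-≤ s)

    -- Rooted maps become transitive pairs divided by N!, and embeddings become colourings of the
    -- edges by boxes. For a fixed colouring the sum over pairs is `connSum`, a function of the word
    -- of colours.
    Fn-words : Fn n A nz λ' ≡ - (1/! N * (unit * Σw Bx n connW))
    Fn-words = cong -_ (ΣL-cong (λ { (s , t) → refl }) (rootedMaps N) ∙ ΣL-cong (λ { (s , t) → refl }) (rootedMaps N) ∙ Σ-rootedMaps N mapWeight mapWeight-conj ∙ cong₂ _*_ (same1/! N) (ΣL-congAll (λ s invs → ΣL-congAll (λ t inv → term s t inv) invs) (permsOn-invariants (allFin n) (Uniqueₚ.allFin⁺ n)) ∙ ΣL-cong (λ s → ΣL-cong (λ t → ΣL-* unit _ (tuples n Bx)) P ∙ ΣL-* unit _ P) P ∙ ΣL-* unit _ P) ∙ cong (λ z → 1/! N * (unit * z)) (ΣL-cong (λ s → ΣL-swap _ P (tuples n Bx)) P ∙ ΣL-swap _ P (tuples n Bx)) ∙ cong (λ z → 1/! N * (unit * z)) (ΣL-cong (λ bs → connSum-connW (f₁ bs) (f₂ bs) Fin.zero (restFin N) (Uniqueₚ.allFin⁺ n) ∙ cong connW (colours bs)) (tuples n Bx)))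
      where
      same1/! : ∀ k → Connected.1/! ℚAlg 1# 1# k ≡ 1/! k
      same1/! zero = refl
      same1/! (suc k) = cong (ι (1/ℕ k) *_) (same1/! k)
      f₁ f₂ : Vec (ℕ × ℕ) n → Fin n → ℕ
      f₁ bs i = proj₁ (lookup bs i)
      f₂ bs i = proj₂ (lookup bs i)
      colours : ∀ {m} (bs : Vec (ℕ × ℕ) m) → map (λ i → proj₁ (lookup bs i) , proj₂ (lookup bs i)) (allFin m) ≡ Vec.toList bs
      colours [] = refl
      colours {suc m} (b ∷ bs) = cong (b ∷_) (cong (map _) (sym (Listₚ.map-tabulate id Fin.suc)) ∙ sym (Listₚ.map-∘ (allFin m)) ∙ colours bs)
      term : ∀ s t → Invariants s t → ind (transitiveᵇ s t) * mapWeight s t ≡ ΣL (λ bs → unit * (ind (connects Fin.zero (restFin N) s t) * weight₂ (f₁ bs) (f₂ bs) s t)) (tuples n Bx)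
      term s t inv = cases (transitiveᵇ s t) refl ∙ cong (λ b → ΣL (λ bs → unit * (ind b * weight₂ (f₁ bs) (f₂ bs) s t)) (tuples n Bx)) (sym (connects-transitive s t))
        where
        cases : ∀ b → transitiveᵇ s t ≡ b → ind b * mapWeight s t ≡ ΣL (λ bs → unit * (ind b * weight₂ (f₁ bs) (f₂ bs) s t)) (tuples n Bx)
        cases false _ = zeroˡ (mapWeight s t) ∙ sym (ΣL-cong (λ bs → solve 2 (λ u w → u :* (:0 :* w) := :0) refl unit (weight₂ (f₁ bs) (f₂ bs) s t)) (tuples n Bx) ∙ ΣL-0 (tuples n Bx))
        cases true h = *-identityˡ (mapWeight s t) ∙ mapWeight-perms s t inv h ∙ cong (unit * ((x ^# ρ s) * (y ^# ρ t)) *_) (embSum-boxes λ' s t) ∙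
          sym (ΣL-* (unit * ((x ^# ρ s) * (y ^# ρ t))) (λ bs → ind (compat (f₁ bs) s) * ind (compat (f₂ bs) t)) (tuples n Bx)) ∙ ΣL-cong (λ bs → solve 5 (λ u a b c d → u :* (a :* b) :* (c :* d) := u :* (:1 :* ((c :* a) :* (d :* b)))) refl unit (x ^# ρ s) (y ^# ρ t) (ind (compat (f₁ bs) s)) (ind (compat (f₂ bs) t))) (tuples n Bx)

    Fn-series : Fn n A nz λ' ≡ Recursion.f̂ (world cond (columns λ')) n
    Fn-series = Fn-words ∙ sym (f̂-words cond (columns λ') (columns-Nested λ') N ∙ (cong -_ (cong (λ z → g * (z * ŵ Bx N)) ((*-^# A (B * gi) n) ∙ cong ((A ^# n) *_) (*-^# B gi n)) ∙ solve 7 (λ g a b i p f s → g :* (a :* (b :* (i :* p)) :* (f :* s)) := (g :* i) :* (f :* (p :* (a :* b) :* s))) refl g (A ^# n) (B ^# n) gi (gi ^# N) (1/! N) (Σw Bx n connW) ∙ cong (_* (1/! N * (unit * Σw Bx n connW))) ggi ∙ *-identityˡ _)))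

-- Polynomials determined by their values

module Degree where
  open Ring ℚAlg

  -- Polynomials in k variables of total degree < d.
  data Deg : ∀ k → ℕ → (Vec ℚ k → ℚ) → Set where
    none : ∀ {k f} → (∀ v → f v ≡ 0ℚ) → Deg k zero f
    scalar : ∀ {d f} → Deg zero (suc d) f
    step : ∀ {k d f} (c : Vec ℚ k → ℚ) (f' : Vec ℚ (suc k) → ℚ) → Deg k (suc d) c → Deg (suc k) d f' →
      (∀ y ys → f (y ∷ ys) ≡ c ys + y * f' (y ∷ ys)) → Deg (suc k) (suc d) f

  deg-cong : ∀ k d {f h} → (∀ v → f v ≡ h v) → Deg k d h → Deg k d f
  deg-cong k zero e (none h) = none (λ v → e v ∙ h v)
  deg-cong zero (suc d) e h = scalar
  deg-cong (suc k) (suc d) e (step c f' hc hf eq) = step c f' hc hf (λ y ys → e (y ∷ ys) ∙ eq y ys)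

  deg-0 : ∀ k d → Deg k d (λ _ → 0ℚ)
  deg-0 k zero = none (λ _ → refl)
  deg-0 zero (suc d) = scalar
  deg-0 (suc k) (suc d) = step (λ _ → 0ℚ) (λ _ → 0ℚ) (deg-0 k (suc d)) (deg-0 (suc k) d) (λ y ys → solve 1 (λ y → :0 := :0 :+ y :* :0) refl y)

  deg-weaken : ∀ k d {f} → Deg k d f → Deg k (suc d) f
  deg-weaken k zero (none h) = deg-cong k 1 h (deg-0 k 1)
  deg-weaken zero (suc d) h = scalar
  deg-weaken (suc k) (suc d) (step c f' hc hf eq) = step c f' (deg-weaken k (suc d) hc) (deg-weaken (suc k) d hf) eq

  deg-mono : ∀ k {d e f} → d ℕ.≤ e → Deg k d f → Deg k e f
  deg-mono k {d} {e} {f} p h with m≤n⇒∃[o]m+o≡n p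
  ... | o , refl = subst (λ z → Deg k z f) (ℕₚ.+-comm o d) (go o)
    where
    go : ∀ o → Deg k (o ℕ.+ d) f
    go zero = h
    go (suc o) = deg-weaken k (o ℕ.+ d) (go o)

  deg-+ : ∀ k d {f h} → Deg k d f → Deg k d h → Deg k d (λ v → f v + h v)
  deg-+ k zero (none p) (none q) = none (λ v → cong₂ _+_ (p v) (q v) ∙ solve 0 (:0 :+ :0 := :0) refl)
  deg-+ zero (suc d) p q = scalar
  deg-+ (suc k) (suc d) (step c f hc hf e) (step c' f' hc' hf' e') =
    step _ _ (deg-+ k (suc d) hc hc') (deg-+ (suc k) d hf hf') (λ y ys → cong₂ _+_ (e y ys) (e' y ys) ∙
      solve 5 (λ a b c d y → (a :+ y :* b) :+ (c :+ y :* d) := (a :+ c) :+ y :* (b :+ d)) refl (c ys) (f (y ∷ ys)) (c' ys) (f' (y ∷ ys)) y)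

  deg-scale : ∀ k d q {f} → Deg k d f → Deg k d (λ v → q * f v)
  deg-scale k zero q (none p) = none (λ v → cong (q *_) (p v) ∙ zeroʳ q)
  deg-scale zero (suc d) q p = scalar
  deg-scale (suc k) (suc d) q (step c f hc hf e) = step _ _ (deg-scale k (suc d) q hc) (deg-scale (suc k) d q hf)
    (λ y ys → cong (q *_) (e y ys) ∙ solve 4 (λ q a y b → q :* (a :+ y :* b) := q :* a :+ y :* (q :* b)) refl q (c ys) y (f (y ∷ ys)))

  deg-const : ∀ k d q → Deg k (suc d) (λ _ → q)
  deg-const zero d q = scalar
  deg-const (suc k) d q = step (λ _ → q) (λ _ → 0ℚ) (deg-const k d q) (deg-0 (suc k) d) (λ y ys → solve 2 (λ q y → q := q :+ y :* :0) refl q y)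

  deg-lift : ∀ k d {c} → Deg k d c → Deg (suc k) d (λ v → c (Vec.tail v))
  deg-lift k zero (none h) = none (λ { (y ∷ ys) → h ys })
  deg-lift k (suc d) {c} h = step c (λ _ → 0ℚ) h (deg-0 (suc k) d) (λ y ys → solve 2 (λ q y → q := q :+ y :* :0) refl (c ys) y)

  deg-var : ∀ k d {f} → Deg (suc k) d f → Deg (suc k) (suc d) (λ v → Vec.head v * f v)
  deg-var k d {f} h = step (λ _ → 0ℚ) f (deg-0 k (suc d)) h (λ y ys → solve 2 (λ y f → y :* f := :0 :+ y :* f) refl y (f (y ∷ ys)))

  deg-pow : ∀ k d e {f} → Deg (suc k) d f → Deg (suc k) (e ℕ.+ d) (λ v → (Vec.head v ^# e) * f v)
  deg-pow k d zero {f} h = deg-cong (suc k) d (λ v → *-identityˡ (f v)) h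
  deg-pow k d (suc e) {f} h = deg-cong (suc k) (suc (e ℕ.+ d)) (λ v → *-assoc (Vec.head v) (Vec.head v ^# e) (f v)) (deg-var k (e ℕ.+ d) (deg-pow k d e h))

  -- Passes from the expansion at the node 0 to the expansion at a, as in Newton's form of
  -- interpolation.
  renode : ∀ k d a {f} → Deg (suc k) (suc d) f → Σ (Vec ℚ k → ℚ) λ c → Σ (Vec ℚ (suc k) → ℚ) λ f' →
    Deg k (suc d) c × Deg (suc k) d f' × (∀ y ys → f (y ∷ ys) ≡ c ys + (y + - a) * f' (y ∷ ys))
  renode k zero a {f} (step c f' hc (none hf) e) = c , f' , hc , none hf , λ y ys → e y ys ∙
    cong (λ z → c ys + y * z) (hf (y ∷ ys)) ∙ solve 3 (λ c y a → c :+ y :* :0 := c :+ (y :+ :- a) :* :0) refl (c ys) y a ∙ cong (λ z → c ys + (y + - a) * z) (sym (hf (y ∷ ys)))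
  renode k (suc d) a {f} (step c f' hc hf e) with renode k d a hf
  ... | c₁ , f₁ , hc₁ , hf₁ , e₁ = (λ ys → c ys + a * c₁ ys) , (λ v → f' v + a * f₁ v) ,
    deg-+ k (suc (suc d)) hc (deg-scale k (suc (suc d)) a (deg-weaken k (suc d) hc₁)) ,
    deg-+ (suc k) (suc d) hf (deg-scale (suc k) (suc d) a (deg-weaken (suc k) d hf₁)) ,
    λ y ys → e y ys ∙ solve 4 (λ c y a f → c :+ y :* f := c :+ (y :+ :- a) :* f :+ a :* f) refl (c ys) y a (f' (y ∷ ys)) ∙
      cong (λ z → c ys + (y + - a) * f' (y ∷ ys) + a * z) (e₁ y ys) ∙
        solve 6 (λ c y a f c' f' → c :+ (y :+ :- a) :* f :+ a :* (c' :+ (y :+ :- a) :* f') := (c :+ a :* c') :+ (y :+ :- a) :* (f :+ a :* f')) refl (c ys) y a (f' (y ∷ ys)) (c₁ ys) (f₁ (y ∷ ys))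

  *-cancelˡ : ∀ {a x : ℚ} → a ≢ 0ℚ → a * x ≡ 0ℚ → x ≡ 0ℚ
  *-cancelˡ {a} {x} a≢0 e = sym (*-identityˡ x) ∙ cong (_* x) (sym (ℚₚ.*-inverseˡ a {{ℚ.≢-nonZero a≢0}})) ∙ *-assoc (1/_ a {{ℚ.≢-nonZero a≢0}}) a x ∙ cong (1/_ a {{ℚ.≢-nonZero a≢0}} *_) e ∙ zeroʳ (1/_ a {{ℚ.≢-nonZero a≢0}})

  vsum : ∀ {k} → Vec ℕ k → ℕ
  vsum [] = 0
  vsum (i ∷ is) = i ℕ.+ vsum is

  points : ∀ {k} → Vec ℕ k → Vec ℚ k
  points = Vec.map (λ i → ratℕ (suc i))

  mutual
    -- Interpolation on a simplex of lattice points whose corner is (1, ..., 1). At the node a the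
    -- remainder depends on one variable fewer; the quotient by y - a has degree one less and
    -- inherits the nodes from a + 1 on.
    deg-zero : ∀ k d f → Deg k d f → (∀ is → vsum is ℕ.< d → f (points is) ≡ 0ℚ) → ∀ v → f v ≡ 0ℚ
    deg-zero k zero f (none h) z v = h v
    deg-zero zero (suc d) f h z [] = z [] (s≤s z≤n)
    deg-zero (suc k) (suc d) f h z v = deg-zero-from k (suc d) 1 f h (λ i is lt → z (i ∷ is) lt) v

    deg-zero-from : ∀ k d a f → Deg (suc k) d f → (∀ i is → i ℕ.+ vsum is ℕ.< d → f (ratℕ (a ℕ.+ i) ∷ points is) ≡ 0ℚ) → ∀ v → f v ≡ 0ℚ
    deg-zero-from k zero a f (none h) z v = h v
    deg-zero-from k (suc d) a f h z v with renode k d (ratℕ a) h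
    ... | c , f' , hc , hf , e = go v
      where
      c-zero : ∀ ys → c ys ≡ 0ℚ
      c-zero = deg-zero k (suc d) c hc (λ is lt → (solve 3 (λ c a f → c := c :+ (a :+ :- a) :* f) refl (c (points is)) (ratℕ a) (f' (ratℕ a ∷ points is)) ∙ sym (e (ratℕ a) (points is)) ∙ cong (λ b → f (ratℕ b ∷ points is)) (sym (ℕₚ.+-identityʳ a)) ∙ z 0 is lt))
      f'-zero : ∀ w → f' w ≡ 0ℚ
      f'-zero = deg-zero-from k d (suc a) f' hf (λ i is lt → *-cancelˡ (ratℕ-suc≢0 i) (solve 3 (λ s a f → s :* f := :0 :+ (a :+ s :+ :- a) :* f) refl (ratℕ (suc i)) (ratℕ a) (f' (ratℕ (suc a ℕ.+ i) ∷ points is)) ∙ cong₂ (λ p q → p + (q + - ratℕ a) * f' (ratℕ (suc a ℕ.+ i) ∷ points is)) (sym (c-zero (points is))) (sym (cong ratℕ (sym (ℕₚ.+-suc a i)) ∙ ratℕ-+ a (suc i))) ∙ sym (e (ratℕ (suc a ℕ.+ i)) (points is)) ∙ cong (λ b → f (ratℕ b ∷ points is)) (sym (ℕₚ.+-suc a i)) ∙ z (suc i) is (s≤s lt)))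
      go : ∀ w → f w ≡ 0ℚ
      go (y ∷ ys) = e y ys ∙ cong₂ (λ p q → p + (y + - ratℕ a) * q) (c-zero ys) (f'-zero (y ∷ ys)) ∙ solve 2 (λ y a → :0 :+ (y :+ :- a) :* :0 := :0) refl y (ratℕ a)

  -- For polynomials that vanish at all large integers the degree need only be finite, so the bound
  -- is not tracked.
  record IsPoly (f : ℚ → ℚ) : Set where
    constructor poly
    field
      bound : ℕ
      isDeg : Deg 1 bound (λ v → f (Vec.head v))

  poly-cong : ∀ {f h} → (∀ x → f x ≡ h x) → IsPoly h → IsPoly f
  poly-cong e (poly d p) = poly d (deg-cong 1 d (λ v → e (Vec.head v)) p)

  poly-const : ∀ q → IsPoly (λ _ → q)
  poly-const q = poly 1 (deg-const 1 0 q)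

  poly-+ : ∀ {f h} → IsPoly f → IsPoly h → IsPoly (λ x → f x + h x)
  poly-+ (poly d p) (poly e q) = poly (d ℕ.+ e) (deg-+ 1 (d ℕ.+ e) (deg-mono 1 (m≤m+n d e) p) (deg-mono 1 (m≤n+m e d) q))

  deg-* : ∀ d e {f h} → Deg 1 d f → Deg 1 e h → Deg 1 (d ℕ.+ e) (λ v → f v * h v)
  deg-* zero e {f} {h} (none p) q = deg-cong 1 e (λ v → cong (_* h v) (p v) ∙ zeroˡ (h v)) (deg-0 1 e)
  deg-* (suc d) e {f} {h} (step c f' hc hf eq) q = deg-cong 1 (suc (d ℕ.+ e))
    (λ { (y ∷ []) → cong (_* h (y ∷ [])) (eq y []) ∙ solve 4 (λ c y f h → (c :+ y :* f) :* h := c :* h :+ y :* (f :* h)) refl (c []) y (f' (y ∷ [])) (h (y ∷ [])) })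
    (deg-+ 1 (suc (d ℕ.+ e)) (deg-mono 1 (m≤n+m e (suc d)) (deg-scale 1 e (c []) q)) (deg-var 0 (d ℕ.+ e) (deg-* d e hf q)))

  poly-* : ∀ {f h} → IsPoly f → IsPoly h → IsPoly (λ x → f x * h x)
  poly-* (poly d p) (poly e q) = poly (d ℕ.+ e) (deg-* d e p q)

  poly-id : IsPoly (λ x → x)
  poly-id = poly 2 (deg-cong 1 2 (λ v → sym (*-identityʳ (Vec.head v))) (deg-var 0 1 (deg-const 1 0 1ℚ)))

  poly-^ : ∀ {f} n → IsPoly f → IsPoly (λ x → f x ^# n)
  poly-^ zero p = poly-const 1ℚ
  poly-^ (suc n) p = poly-* p (poly-^ n p)

  poly-zero : ∀ {f} a → IsPoly f → (∀ i → f (ratℕ (a ℕ.+ i)) ≡ 0ℚ) → ∀ x → f x ≡ 0ℚ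
  poly-zero {f} a (poly d p) z x = deg-zero-from 0 d a (λ v → f (Vec.head v)) p (λ { i [] _ → z i }) (x ∷ [])

  -- Laurent polynomials in A, as functions of A ≠ 0
  record Laurent (φ : (A : ℚ) → NonZero A → ℚ) : Set where
    constructor laurent
    field
      shift : ℕ
      P : ℚ → ℚ
      isPoly : IsPoly P
      scaled : ∀ A nz → (A ^# shift) * φ A nz ≡ P A

  laurent-cong : ∀ {φ ψ} → (∀ A nz → φ A nz ≡ ψ A nz) → Laurent ψ → Laurent φ
  laurent-cong e (laurent m P p h) = laurent m P p (λ A nz → cong ((A ^# m) *_) (e A nz) ∙ h A nz)

  laurent-const : ∀ q → Laurent (λ _ _ → q)
  laurent-const q = laurent 0 (λ _ → q) (poly-const q) (λ A nz → *-identityˡ q)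

  laurent-A : Laurent (λ A _ → A)
  laurent-A = laurent 0 (λ A → A) poly-id (λ A nz → *-identityˡ A)

  laurent-1/A : Laurent (λ A nz → 1/_ A {{nz}})
  laurent-1/A = laurent 1 (λ _ → 1ℚ) (poly-const 1ℚ) (λ A nz → cong (_* 1/_ A {{nz}}) (*-identityʳ A) ∙ ℚₚ.*-inverseʳ A {{nz}})

  laurent-+ : ∀ {φ ψ} → Laurent φ → Laurent ψ → Laurent (λ A nz → φ A nz + ψ A nz)
  laurent-+ {φ} {ψ} (laurent m P p h) (laurent m' P' p' h') = laurent (m ℕ.+ m') (λ A → (A ^# m') * P A + (A ^# m) * P' A)
    (poly-+ (poly-* (poly-^ m' poly-id) p) (poly-* (poly-^ m poly-id) p')) λ A nz → (cong (_* (φ A nz + ψ A nz)) (Sums.^#-+ ℚAlg A m m') ∙ solve 4 (λ a b x y → a :* b :* (x :+ y) := b :* (a :* x) :+ a :* (b :* y)) refl (A ^# m) (A ^# m') (φ A nz) (ψ A nz) ∙ cong₂ (λ a b → (A ^# m') * a + (A ^# m) * b) (h A nz) (h' A nz))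

  laurent-* : ∀ {φ ψ} → Laurent φ → Laurent ψ → Laurent (λ A nz → φ A nz * ψ A nz)
  laurent-* {φ} {ψ} (laurent m P p h) (laurent m' P' p' h') = laurent (m ℕ.+ m') (λ A → P A * P' A) (poly-* p p') λ A nz → (cong (_* (φ A nz * ψ A nz)) (Sums.^#-+ ℚAlg A m m') ∙ solve 4 (λ a b x y → a :* b :* (x :* y) := (a :* x) :* (b :* y)) refl (A ^# m) (A ^# m') (φ A nz) (ψ A nz) ∙ cong₂ _*_ (h A nz) (h' A nz))

  laurent-neg : ∀ {φ} → Laurent φ → Laurent (λ A nz → - φ A nz)
  laurent-neg {φ} p = laurent-cong (λ A nz → solve 1 (λ x → :- x := :- :1 :* x) refl (φ A nz)) (laurent-* (laurent-const (- 1ℚ)) p)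

  laurent-^ : ∀ {φ} n → Laurent φ → Laurent (λ A nz → φ A nz ^# n)
  laurent-^ zero p = laurent-const 1ℚ
  laurent-^ (suc n) p = laurent-* p (laurent-^ n p)

  laurent-γ : Laurent Defs.γ
  laurent-γ = laurent-+ (laurent-neg laurent-A) laurent-1/A

  -- -Aγ is A² - 1, which is a positive integer for an integer A ≥ 2.
  γ≢0-large : ∀ i (nz : NonZero (ratℕ (suc (suc i)))) → Defs.γ (ratℕ (suc (suc i))) nz ≢ 0ℚ
  γ≢0-large i nz e = ratℕ-suc≢0 (ℕ.pred (suc i ℕ.+ suc i ℕ.* suc (suc i))) (solve 1 (λ z → z := (:1 :+ z) :+ :- :1) refl (ratℕ (suc i ℕ.+ suc i ℕ.* suc (suc i))) ∙ cong (_+ - 1#) (sym (ratℕ-suc (suc i ℕ.+ suc i ℕ.* suc (suc i)))) ∙ cong (_+ - 1#) (ratℕ-* (suc (suc i)) (suc (suc i))) ∙ cong (λ z → A * A + - z) (sym (ℚₚ.*-inverseʳ A {{nz}})) ∙ solve 2 (λ A a → A :* A :+ :- (A :* a) := :- A :* (:- A :+ a)) refl A (1/_ A {{nz}}) ∙ cong (- A *_) e ∙ zeroʳ (- A))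
    where A = ratℕ (suc (suc i))

  -- The arguments 2, 3, ... avoid γ = 0 and already determine the polynomial obtained by clearing
  -- the powers of A.
  laurent-zero : ∀ {φ} → Laurent φ → (∀ A nz → Defs.γ A nz ≢ 0ℚ → φ A nz ≡ 0ℚ) → ∀ A nz → φ A nz ≡ 0ℚ
  laurent-zero {φ} (laurent m P p h) z A nz = sym (*-identityˡ (φ A nz)) ∙ cong (_* φ A nz) (sym (*-comm (a ^# m) (A ^# m) ∙ Powers.inverse-^# ℚAlg A a m (ℚₚ.*-inverseʳ A {{nz}}))) ∙ *-assoc (a ^# m) (A ^# m) (φ A nz) ∙ cong ((a ^# m) *_) (h A nz ∙ poly-zero 2 p P-zero A) ∙ zeroʳ (a ^# m)
    where
    a = 1/_ A {{nz}}
    P-zero : ∀ i → P (ratℕ (2 ℕ.+ i)) ≡ 0ℚ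
    P-zero i = sym (h _ nz') ∙ cong ((ratℕ (suc (suc i)) ^# m) *_) (z _ nz' (γ≢0-large i nz')) ∙ zeroʳ (ratℕ (suc (suc i)) ^# m)
      where nz' = ℚ.≢-nonZero (ratℕ-suc≢0 (suc i))

-- Permanents and polynomial functions on diagrams

sel : {X : Set} → List X → List (X × List X)
sel [] = []
sel (e ∷ es) = (e , es) ∷ map (λ (a , r) → a , e ∷ r) (sel es)

sel-length : ∀ {X : Set} (es : List X) → All (λ (e , r) → suc (length r) ≡ length es) (sel es)
sel-length [] = []
sel-length (e ∷ es) = refl ∷ Allₚ.map⁺ (All.map (cong suc) (sel-length es))

sel-sum : ∀ es → All (λ (e , r) → e ℕ.+ ListSum r ≡ ListSum es) (sel es)
sel-sum [] = []
sel-sum (e ∷ es) = refl ∷ Allₚ.map⁺ (All.map (λ {(a , r)} h → lem a e (ListSum r) ∙ cong (e ℕ.+_) h) (sel-sum es))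
  where
  lem : ∀ a e s → a ℕ.+ (e ℕ.+ s) ≡ e ℕ.+ (a ℕ.+ s)
  lem = solve-∀

-- Per φ es xs is the permanent of the matrix (φ e x).
module Permanent (R : Alg) {E X : Set} (φ : E → X → Alg.Carrier R) where
  open Ring R
  open Sums R
  open Series R using (nat-suc)

  Per : List E → List X → Carrier
  Per es [] = 1#
  Per es (x ∷ xs) = ΣL (λ (e , r) → φ e x * Per r xs) (sel es)

  Σsel-∷ : ∀ (F : E × List E → Carrier) e es → ΣL F (sel (e ∷ es)) ≡ F (e , es) + ΣL (λ (a , r) → F (a , e ∷ r)) (sel es)
  Σsel-∷ F e es = cong (F (e , es) +_) (ΣL-map F _ (sel es))

  Σsel-swap : ∀ (F : E → E → List E → Carrier) es →
    ΣL (λ (e , r) → ΣL (λ (e' , r') → F e e' r') (sel r)) (sel es) ≡ ΣL (λ (e , r) → ΣL (λ (e' , r') → F e' e r') (sel r)) (sel es)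
  Σsel-swap F [] = refl
  Σsel-swap F (a ∷ es) = expand F ∙ cong (λ z → ΣL (λ (e' , r') → F a e' r') (sel es) + (ΣL (λ (e , r) → F e a r) (sel es) + z)) (Σsel-swap (λ e e' r → F e e' (a ∷ r)) es) ∙ solve 3 (λ x y z → x :+ (y :+ z) := y :+ (x :+ z)) refl _ _ _ ∙ sym (expand (λ e e' → F e' e))
    where
    expand : ∀ (F : E → E → List E → Carrier) → ΣL (λ (e , r) → ΣL (λ (e' , r') → F e e' r') (sel r)) (sel (a ∷ es)) ≡
      ΣL (λ (e' , r') → F a e' r') (sel es) + (ΣL (λ (e , r) → F e a r) (sel es) + ΣL (λ (e , r) → ΣL (λ (e' , r') → F e e' (a ∷ r')) (sel r)) (sel es))
    expand F = Σsel-∷ _ a es ∙ cong (ΣL _ (sel es) +_)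
      (ΣL-cong (λ (e , r) → Σsel-∷ _ a r) (sel es) ∙ ΣL-+ _ _ (sel es))

  Per-↭ : ∀ es {xs ys} → xs ↭ ys → Per es xs ≡ Per es ys
  Per-↭ es ↭.refl = refl
  Per-↭ es (↭.prep x p) = ΣL-cong (λ (e , r) → cong (φ e x *_) (Per-↭ r p)) (sel es)
  Per-↭ es (↭.swap {xs} {ys} x y p) = expand x y xs ∙ Σsel-swap (λ e e' r' → φ e x * (φ e' y * Per r' xs)) es ∙ ΣL-cong (λ (e , r) → ΣL-cong (λ (e' , r') → cong (λ z → φ e' x * (φ e y * z)) (Per-↭ r' p) ∙ solve 3 (λ a b c → a :* (b :* c) := b :* (a :* c)) refl _ _ _) (sel r)) (sel es) ∙ sym (expand y x ys)
    where
    expand : ∀ x y xs → ΣL (λ (e , r) → φ e x * Per r (y ∷ xs)) (sel es) ≡ ΣL (λ (e , r) → ΣL (λ (e' , r') → φ e x * (φ e' y * Per r' xs)) (sel r)) (sel es)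
    expand x y xs = ΣL-cong (λ (e , r) → sym (ΣL-* (φ e x) _ (sel r))) (sel es)
  Per-↭ es (↭.trans p q) = Per-↭ es p ∙ Per-↭ es q

  Per-split : ∀ es {a b c} xs → (∀ e → φ e a ≡ φ e b + φ e c) → Per es (a ∷ xs) ≡ Per es (b ∷ xs) + Per es (c ∷ xs)
  Per-split es xs h = ΣL-cong (λ (e , r) → cong (_* Per r xs) (h e) ∙ distribʳ _ _ _) (sel es) ∙ ΣL-+ _ _ (sel es)

  Σsel-Π : ∀ (T : E → Carrier) es → ΣL (λ (e , r) → T e * Π# T r) (sel es) ≡ nat (length es) * Π# T es
  Σsel-Π T [] = sym (cong (_* 1#) (Series.nat-0 R) ∙ zeroˡ 1#)
  Σsel-Π T (e ∷ es) = Σsel-∷ _ e es ∙ cong (T e * Π# T es +_) (ΣL-cong (λ (a , r) → solve 3 (λ a b c → a :* (b :* c) := b :* (a :* c)) refl _ _ _) (sel es) ∙ ΣL-* (T e) _ (sel es) ∙ cong (T e *_) (Σsel-Π T es)) ∙ solve 3 (λ t p n → t :* p :+ t :* (n :* p) := (:1 :+ n) :* (t :* p)) refl _ _ _ ∙ cong (_* (T e * Π# T es)) (sym (nat-suc (length es)))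

  fact : ℕ → Carrier
  fact zero = 1#
  fact (suc k) = nat (suc k) * fact k

  -- Each of the k! terms of the permanent, summed over all tuples, gives the same product of power
  -- sums.
  Per-tuples : ∀ {Y : Set} k (xs : List Y) (c : Y → X) es → length es ≡ k →
    ΣL (λ bs → Per es (Vec.toList (Vec.map c bs))) (tuples k xs) ≡ fact k * Π# (λ e → ΣL (λ b → φ e (c b)) xs) es
  Per-tuples zero xs c [] _ = solve 0 (:1 :+ :0 := :1 :* :1) refl
  Per-tuples (suc k) xs c es h = ΣL-concatMap _ _ xs ∙ ΣL-cong (λ x → ΣL-map _ _ (tuples k xs)) xs ∙ ΣL-cong (λ x → ΣL-swap _ (tuples k xs) (sel es)) xs ∙ ΣL-swap _ xs (sel es) ∙ ΣL-congAll term (sel-length es) ∙ ΣL-* (fact k) _ (sel es) ∙ cong (fact k *_) (Σsel-Π T es) ∙ cong (λ l → fact k * (nat l * Π# T es)) h ∙ solve 3 (λ f n p → f :* (n :* p) := n :* f :* p) refl _ _ _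
    where
    T = λ e → ΣL (λ b → φ e (c b)) xs
    term : ∀ (p : E × List E) → suc (length (proj₂ p)) ≡ length es →
      ΣL (λ x → ΣL (λ bs → φ (proj₁ p) (c x) * Per (proj₂ p) (Vec.toList (Vec.map c bs))) (tuples k xs)) xs ≡ fact k * (T (proj₁ p) * Π# T (proj₂ p))
    term (e , r) l = ΣL-cong (λ x → ΣL-* (φ e (c x)) _ (tuples k xs) ∙ cong (φ e (c x) *_) (Per-tuples k xs c r (suc-injective (l ∙ h)))) xs ∙ ΣL-*ʳ _ _ xs ∙ solve 3 (λ t f p → t :* (f :* p) := f :* (t :* p)) refl _ _ _

-- the monomials occurring in the permanent of (x_j ^ e_i)
arrangements : ∀ k → List ℕ → List (Vec ℕ k)
arrangements zero es = [] ∷ []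
arrangements (suc k) es = concatMap (λ (e , r) → map (e ∷_) (arrangements k r)) (sel es)

arrangements-sum : ∀ k es → length es ≡ k → All (λ v → Vec.sum v ≡ ListSum es) (arrangements k es)
arrangements-sum zero [] _ = refl ∷ []
arrangements-sum (suc k) es h = Allₚ.concat⁺ (Allₚ.map⁺ (All.zipWith (λ {(e , r)} (l , s) →
  Allₚ.map⁺ (All.map (λ q → cong (e ℕ.+_) q ∙ s) (arrangements-sum k r (suc-injective (l ∙ h))))) (sel-length es , sel-sum es)))

power : ℕ → ℚ → ℚ
power e x = x ^ e

monomialValue : ∀ {k} → Vec ℚ k → Vec ℕ k → ℚ
monomialValue cs v = Vec.foldr (λ _ → ℚ) ℚ._*_ 1ℚ (Vec.zipWith _^_ cs v)

module _ where
  open Alg ℚAlg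
  open Sums ℚAlg
  open Permanent ℚAlg power

  Σ-arrangements : ∀ {k} es (cs : Vec ℚ k) → ΣL (monomialValue cs) (arrangements k es) ≡ Per es (Vec.toList cs)
  Σ-arrangements es [] = +-identityʳ 1ℚ
  Σ-arrangements {suc k} es (c ∷ cs) = ΣL-concatMap _ (λ (e , r) → map (e ∷_) (arrangements k r)) (sel es) ∙
    ΣL-cong (λ (e , r) → ΣL-map (monomialValue (c ∷ cs)) (e ∷_) (arrangements k r) ∙
      ΣL-* (c ^ e) (monomialValue cs) (arrangements k r) ∙ cong (c ^ e *_) (Σ-arrangements r cs)) (sel es)

toList-tabulate : ∀ {X : Set} {k} (f : Fin k → X) → Vec.toList (tabulate f) ≡ map f (allFin k)
toList-tabulate {k = zero} f = refl
toList-tabulate {k = suc k} f = cong (f Fin.zero ∷_) (toList-tabulate _ ∙ Listₚ.map-∘ (allFin k) ∙ cong (map f) (Listₚ.map-tabulate id Fin.suc))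

allFin-↭ : ∀ {k} (π : Permutation′ k) → map (π FinPerm.⟨$⟩ʳ_) (allFin k) ↭ allFin k
allFin-↭ {k} π = ∼bag⇒↭ (unique∧set⇒bag (Uniqueₚ.map⁺ (λ e → sym (FinPerm.inverseˡ π) ∙ cong (π FinPerm.⟨$⟩ˡ_) e ∙ FinPerm.inverseˡ π) (Uniqueₚ.allFin⁺ k)) (Uniqueₚ.allFin⁺ k)
  λ {i} → mk⇔ (λ _ → ∈ₚ.∈-allFin i) (λ _ → subst (_∈ map (π FinPerm.⟨$⟩ʳ_) (allFin k)) (FinPerm.inverseʳ π) (∈ₚ.∈-map⁺ (π FinPerm.⟨$⟩ʳ_) (∈ₚ.∈-allFin (π FinPerm.⟨$⟩ˡ i)))))

permuted-↭ : ∀ {X : Set} {k} (cs : Vec X k) (π : Permutation′ k) → Vec.toList (tabulate (λ i → lookup cs (π FinPerm.⟨$⟩ʳ i))) ↭ Vec.toList cs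
permuted-↭ {k = k} cs π = subst₂ _↭_
  (sym (Listₚ.map-∘ (allFin k)) ∙ sym (toList-tabulate _))
  (sym (toList-tabulate (lookup cs)) ∙ cong Vec.toList (Vecₚ.tabulate∘lookup cs))
  (↭ₚ.map⁺ (lookup cs) (allFin-↭ π))

double-half : ∀ n → 2 ℕ.* ⌊ n /2⌋ ℕ.≤ n
double-half n = ≤-trans (≤-reflexive (cong (⌊ n /2⌋ ℕ.+_) (ℕₚ.+-identityʳ ⌊ n /2⌋)))
  (≤-trans (ℕₚ.+-monoʳ-≤ ⌊ n /2⌋ (ℕₚ.⌊n/2⌋≤⌈n/2⌉ n)) (≤-reflexive (ℕₚ.⌊n/2⌋+⌈n/2⌉≡n n)))

half-double : ∀ k n → 2 ℕ.* k ℕ.≤ n → k ℕ.≤ ⌊ n /2⌋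
half-double k n h = subst (ℕ._≤ ⌊ n /2⌋) (cong (λ z → ⌊ k ℕ.+ z /2⌋) (ℕₚ.+-identityʳ k) ∙ sym (ℕₚ.n≡⌊n+n/2⌋ k)) (ℕₚ.⌊n/2⌋-mono h)

-- The label e of a factor stands for the power sum Σ c^e over the boxes, of degree e + 2.
boxDegree : Monomial ℕ → ℕ
boxDegree = degree (2 ℕ.+_)

weight-length : ∀ es → weight (2 ℕ.+_) es ≡ ListSum es ℕ.+ 2 ℕ.* length es
weight-length [] = refl
weight-length (e ∷ es) = cong (2 ℕ.+ e ℕ.+_) (weight-length es) ∙ lem e (ListSum es) (length es)
  where
  lem : ∀ e s l → 2 ℕ.+ e ℕ.+ (s ℕ.+ 2 ℕ.* l) ≡ e ℕ.+ s ℕ.+ 2 ℕ.* suc l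
  lem = solve-∀

boxDegree-length : ∀ m → boxDegree m ≡ gpow m ℕ.+ ListSum (fac m) ℕ.+ 2 ℕ.* length (fac m)
boxDegree-length m = cong (gpow m ℕ.+_) (weight-length (fac m)) ∙ sym (ℕₚ.+-assoc (gpow m) (ListSum (fac m)) (2 ℕ.* length (fac m)))

module _ where
  open Ring ℚAlg
  open Sums ℚAlg
  open Evaluation ℚAlg
  open Permanent ℚAlg power
  open Indicator ℚAlg

  contentPower : (A : ℚ) → NonZero A → YD → ℕ → ℚ
  contentPower A nz λ' e = ΣL (λ b → content A nz b ^ e) (boxes λ')

  value : List (Monomial ℕ) → LFun
  value U A nz λ' = evalP (Defs.γ A nz) (contentPower A nz λ') U

  value-++ : ∀ U V A nz λ' → value (U ++ V) A nz λ' ≡ value U A nz λ' + value V A nz λ'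
  value-++ U V A nz λ' = ΣL-++ (evalM (Defs.γ A nz) (contentPower A nz λ')) U V

  unordered : ∀ {k} → Mono k → Monomial ℕ
  unordered m = mono (coeff m) (gexp m) (Vec.toList (cexp m))

  Σ-monomialValue : ∀ {Y : Set} {k} (c : Y → ℚ) xs (v : Vec ℕ k) →
    ΣL (λ bs → monomialValue (Vec.map c bs) v) (tuples k xs) ≡ Π# (λ e → ΣL (λ b → c b ^ e) xs) (Vec.toList v)
  Σ-monomialValue c xs [] = +-identityʳ 1ℚ
  Σ-monomialValue {k = suc k} c xs (e ∷ v) = ΣL-concatMap (λ bs → monomialValue (Vec.map c bs) (e ∷ v)) (λ x → map (x ∷_) (tuples k xs)) xs ∙ ΣL-cong (λ x → ΣL-map (λ bs → monomialValue (Vec.map c bs) (e ∷ v)) (x ∷_) (tuples k xs) ∙ ΣL-* (c x ^ e) (λ bs → monomialValue (Vec.map c bs) v) (tuples k xs)) xs ∙ ΣL-*ʳ (ΣL (λ bs → monomialValue (Vec.map c bs) v) (tuples k xs)) (λ x → c x ^ e) xs ∙ cong (ΣL (λ x → c x ^ e) xs *_) (Σ-monomialValue c xs v)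

  Σ-evalPoly : ∀ {Y : Set} {k} g (c : Y → ℚ) xs (p : Poly k) →
    ΣL (λ bs → evalPoly p g (Vec.map c bs)) (tuples k xs) ≡ evalP g (λ e → ΣL (λ b → c b ^ e) xs) (map unordered p)
  Σ-evalPoly {k = k} g c xs p = ΣL-swap (λ bs m → evalMono g (Vec.map c bs) m) (tuples k xs) p ∙
    ΣL-cong term p ∙ sym (ΣL-map (evalM g (λ e → ΣL (λ b → c b ^ e) xs)) unordered p)
    where
    term : ∀ m → ΣL (λ bs → evalMono g (Vec.map c bs) m) (tuples k xs) ≡ evalM g (λ e → ΣL (λ b → c b ^ e) xs) (unordered m)
    term m = ΣL-* (coeff m * (g ^ gexp m)) (λ bs → monomialValue (Vec.map c bs) (cexp m)) (tuples k xs) ∙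
      cong₂ (λ a b → coeff m * a * b) (^≡^# g (gexp m)) (Σ-monomialValue c xs (cexp m)) ∙ *-assoc (coeff m) (g ^# gexp m) (Π# (λ e → ΣL (λ b → c b ^ e) xs) (Vec.toList (cexp m)))

  collected : ℕ → ((k : ℕ) → Poly k) → List (Monomial ℕ)
  collected d p = concatMap (λ k → map unordered (p k)) (upTo (suc ⌊ d /2⌋))

  value-collected : ∀ d p A nz λ' → polyFunValue d p A nz λ' ≡ value (collected d p) A nz λ'
  value-collected d p A nz λ' = sym (ΣL-concatMap (evalM g T) (λ k → map unordered (p k)) (upTo (suc ⌊ d /2⌋)) ∙
    ΣL-cong (λ k → sym (Σ-evalPoly g (content A nz) (boxes λ') (p k))) (upTo (suc ⌊ d /2⌋)))
    where
    g = Defs.γ A nz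
    T = contentPower A nz λ'

  upTo-≤ : ∀ d → All (ℕ._≤ d) (upTo (suc d))
  upTo-≤ d = All.tabulate (λ m → ≤-pred (∈ₚ.∈-upTo⁻ m))

  toList-sum : ∀ {k} (v : Vec ℕ k) → ListSum (Vec.toList v) ≡ Vec.sum v
  toList-sum [] = refl
  toList-sum (e ∷ v) = cong (e ℕ.+_) (toList-sum v)

  boxDegree-unordered : ∀ {k} (m : Mono k) → boxDegree (unordered m) ≡ degMono m ℕ.+ 2 ℕ.* k
  boxDegree-unordered m = boxDegree-length (unordered m) ∙ cong₂ (λ a b → gexp m ℕ.+ a ℕ.+ 2 ℕ.* b) (toList-sum (cexp m)) (Vecₚ.length-toList (cexp m))

  collected-degree : ∀ d p → Admissible d p → All (λ m → boxDegree m ℕ.≤ d) (collected d p)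
  collected-degree d p adm = Allₚ.concat⁺ (Allₚ.map⁺ (All.map (λ {k} k≤ → Allₚ.map⁺ (All.map (λ {m} h →
    subst (ℕ._≤ d) (sym (boxDegree-unordered m)) (subst (degMono m ℕ.+ 2 ℕ.* k ℕ.≤_) (m∸n+n≡m (≤-trans (ℕₚ.*-monoʳ-≤ 2 k≤) (double-half d))) (ℕₚ.+-monoˡ-≤ (2 ℕ.* k) h)))
    (proj₁ (adm k k≤)))) (upTo-≤ ⌊ d /2⌋)))

  1/fact : ℕ → ℚ
  1/fact zero = 1ℚ
  1/fact (suc k) = 1/ℕ k * 1/fact k

  1/fact-inverse : ∀ k → 1/fact k * fact k ≡ 1ℚ
  1/fact-inverse zero = *-identityˡ 1ℚ
  1/fact-inverse (suc k) = solve 4 (λ a b c d → a :* b :* (c :* d) := (a :* c) :* (b :* d)) refl (1/ℕ k) (1/fact k) (ratℕ (suc k)) (fact k) ∙ cong₂ _*_ (1/ℕ-inverse k) (1/fact-inverse k) ∙ *-identityˡ 1ℚ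

  -- A product of k power sums is the sum over k-tuples of boxes of a permanent divided by k!. The
  -- permanent supplies the symmetry demanded of p_k; the other numbers of factors belong to other
  -- p_k, hence the empty case.
  symmetrised : ∀ k → Monomial ℕ → Poly k
  symmetrised k m = if k ≡ᵇ length (fac m)
    then map (λ v → record { coeff = coef m * 1/fact k ; gexp = gpow m ; cexp = v }) (arrangements k (fac m))
    else []

  evalPoly-symmetrised : ∀ k m g (cs : Vec ℚ k) → evalPoly (symmetrised k m) g cs ≡ ind (k ≡ᵇ length (fac m)) * (coef m * 1/fact k * (g ^ gpow m) * Per (fac m) (Vec.toList cs))
  evalPoly-symmetrised k m g cs with k ≡ᵇ length (fac m)
  ... | false = sym (zeroˡ (coef m * 1/fact k * (g ^ gpow m) * Per (fac m) (Vec.toList cs)))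
  ... | true = ΣL-map (evalMono g cs) (λ v → record { coeff = coef m * 1/fact k ; gexp = gpow m ; cexp = v }) (arrangements k (fac m)) ∙
    ΣL-* (coef m * 1/fact k * (g ^ gpow m)) (monomialValue cs) (arrangements k (fac m)) ∙
      cong (coef m * 1/fact k * (g ^ gpow m) *_) (Σ-arrangements (fac m) cs) ∙ sym (*-identityˡ (coef m * 1/fact k * (g ^ gpow m) * Per (fac m) (Vec.toList cs)))

  evalPoly-concatMap : ∀ {k} (f : Monomial ℕ → Poly k) U g cs → evalPoly (concatMap f U) g cs ≡ ΣL (λ m → evalPoly (f m) g cs) U
  evalPoly-concatMap f U g cs = ΣL-concatMap (evalMono g cs) f U

  Σ-symmetrised : ∀ k m A nz λ' → ΣL (λ bs → evalPoly (symmetrised k m) (Defs.γ A nz) (Vec.map (content A nz) bs)) (tuples k (boxes λ'))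
    ≡ ind (k ≡ᵇ length (fac m)) * evalM (Defs.γ A nz) (contentPower A nz λ') m
  Σ-symmetrised k m A nz λ' = ΣL-cong (λ bs → evalPoly-symmetrised k m g (Vec.map (content A nz) bs)) (tuples k (boxes λ')) ∙ cases (k ≡ᵇ length (fac m)) refl
    where
    g = Defs.γ A nz
    T = contentPower A nz λ'
    cases : ∀ b → (k ≡ᵇ length (fac m)) ≡ b → ΣL (λ bs → ind b * (coef m * 1/fact k * (g ^ gpow m) * Per (fac m) (Vec.toList (Vec.map (content A nz) bs)))) (tuples k (boxes λ')) ≡ ind b * evalM g T m
    cases false _ = ΣL-cong (λ bs → zeroˡ (coef m * 1/fact k * (g ^ gpow m) * Per (fac m) (Vec.toList (Vec.map (content A nz) bs)))) (tuples k (boxes λ')) ∙ ΣL-0 (tuples k (boxes λ')) ∙ sym (zeroˡ (evalM g T m))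
    cases true e = ΣL-cong (λ bs → sym (*-assoc 1# (coef m * 1/fact k * (g ^ gpow m)) (Per (fac m) (Vec.toList (Vec.map (content A nz) bs))))) (tuples k (boxes λ')) ∙
      ΣL-* (1# * (coef m * 1/fact k * (g ^ gpow m))) (λ bs → Per (fac m) (Vec.toList (Vec.map (content A nz) bs))) (tuples k (boxes λ')) ∙
      cong₂ (λ a b → 1# * (coef m * 1/fact k * a) * b) (^≡^# g (gpow m)) (Per-tuples k (boxes λ') (content A nz) (fac m) (sym (≡ᵇ-sound e))) ∙
      solve 5 (λ c i g f p → :1 :* (c :* i :* g) :* (f :* p) := (i :* f) :* (:1 :* (c :* (g :* p)))) refl (coef m) (1/fact k) (g ^# gpow m) (fact k) (Π# T (fac m)) ∙
      cong (_* (1# * evalM g T m)) (1/fact-inverse k) ∙ *-identityˡ (1# * evalM g T m)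

  isPolyFun-value : ∀ d U → All (λ m → boxDegree m ℕ.≤ d) U → IsPolyFun d (value U)
  isPolyFun-value d U deg = p , adm , val
    where
    p : (k : ℕ) → Poly k
    p k = concatMap (symmetrised k) U
    symmetrised-degree : ∀ k m → boxDegree m ℕ.≤ d → DegLe (d ∸ 2 ℕ.* k) (symmetrised k m)
    symmetrised-degree k m h with k ≡ᵇ length (fac m) in e
    ... | false = []
    ... | true = Allₚ.map⁺ (All.map (λ {v} s → m+n≤o⇒m≤o∸n (gpow m ℕ.+ Vec.sum v) (subst (ℕ._≤ d)
        (boxDegree-length m ∙ cong₂ (λ a b → gpow m ℕ.+ a ℕ.+ 2 ℕ.* b) (sym s) (sym (≡ᵇ-sound {k} {length (fac m)} e))) h)) (arrangements-sum k (fac m) (sym (≡ᵇ-sound {k} {length (fac m)} e))))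
    adm : Admissible d p
    adm k _ = Allₚ.concat⁺ (Allₚ.map⁺ (All.map (λ {m} → symmetrised-degree k m) deg)) , λ π g cs →
      evalPoly-concatMap (symmetrised k) U g (tabulate (λ i → lookup cs (π FinPerm.⟨$⟩ʳ i))) ∙ ΣL-cong (λ m → evalPoly-symmetrised k m g (tabulate (λ i → lookup cs (π FinPerm.⟨$⟩ʳ i))) ∙
        cong (λ z → ind (k ≡ᵇ length (fac m)) * (coef m * 1/fact k * (g ^ gpow m) * z)) (Per-↭ (fac m) (permuted-↭ cs π)) ∙ sym (evalPoly-symmetrised k m g cs)) U ∙
        sym (evalPoly-concatMap (symmetrised k) U g cs)
    val : ∀ A nz λ' → value U A nz λ' ≡ polyFunValue d p A nz λ'
    val A nz λ' = sym (ΣL-cong (λ k → ΣL-cong (λ bs → evalPoly-concatMap (symmetrised k) U g (Vec.map c bs)) (tuples k bx) ∙ ΣL-swap (λ bs m → evalPoly (symmetrised k m) g (Vec.map c bs)) (tuples k bx) U) ks ∙ ΣL-cong (λ k → ΣL-cong (λ m → Σ-symmetrised k m A nz λ') U) ks ∙ ΣL-swap (λ k m → ind (k ≡ᵇ length (fac m)) * evalM g T m) ks U ∙ ΣL-congAll (λ m h → ΣL-*ʳ (evalM g T m) (λ k → ind (k ≡ᵇ length (fac m))) ks ∙ cong (_* evalM g T m) (TupleSums.pickℕ ℚAlg (length (fac m)) ks (Uniqueₚ.upTo⁺ (suc ⌊ d /2⌋)) (short m h)) ∙ *-identityˡ (evalM g T m)) deg)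
      where
      g = Defs.γ A nz
      c = content A nz
      bx = boxes λ'
      T = contentPower A nz λ'
      ks = upTo (suc ⌊ d /2⌋)
      short : ∀ m → boxDegree m ℕ.≤ d → length (fac m) ∈ ks
      short m h = ∈ₚ.∈-upTo⁺ (s≤s (half-double (length (fac m)) d (≤-trans (m≤n+m (2 ℕ.* length (fac m)) (gpow m ℕ.+ ListSum (fac m))) (subst (ℕ._≤ d) (boxDegree-length m) h))))

-- F_n as a polynomial function

module RowBoxes (R : Alg) (g A B : Alg.Carrier R) where
  open Ring R
  open Sums R
  open Series R using (nat-suc; nat-0)
  open Fubini R
  open RowForm R g A

  rowSum-suc : ∀ (h : ℕ → Carrier) x r → rowSum h (suc x) r ≡ rowSum (h ∘ suc) x r
  rowSum-suc h x zero = refl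
  rowSum-suc h x (suc r) = cong (h (suc x) +_) (rowSum-suc h (suc x) r)

  rowSum-upTo : ∀ (h : ℕ → Carrier) r → rowSum h 0 r ≡ ΣL h (upTo r)
  rowSum-upTo h zero = refl
  rowSum-upTo h (suc r) = cong (h 0 +_) (rowSum-suc h 0 r ∙ rowSum-upTo (h ∘ suc) r ∙
    sym (ΣL-map h suc (upTo r)) ∙ cong (ΣL h) (Listₚ.map-upTo suc r))

  height : Bool → Carrier
  height true = B
  height false = 0#

  chosen : List (Bool × ℕ) → List ℕ
  chosen [] = []
  chosen ((true , r) ∷ L) = r ∷ chosen L
  chosen ((false , r) ∷ L) = chosen L

  heightRows : List (Bool × ℕ) → List (Carrier × ℕ)
  heightRows = map (λ (b , r) → height b , r)

  -- The coordinates start at 1, so column x has index x - 1 and row y lies above total height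
  -- B(y-1). If A + B + g = 0, the constants cancel and the content is Ax + By.
  boxAt : ℕ × ℕ → Carrier × Carrier
  boxAt (x , y) = - (A * B) , A * nat x + B * nat y + - A + - B + - g

  -- A row of height 0 has boxes of weight 0 and does not raise the rows after it. It can thus be
  -- deleted from the diagram, and the following rows are renumbered.
  rowForm-boxesFrom : ∀ (φ : Carrier × Carrier → Carrier) → (∀ c → φ (- (A * 0#) , c) ≡ 0#) → ∀ y β → β + B ≡ B * nat y → ∀ L →
    rowForm φ β (heightRows L) ≡ ΣL (λ b → φ (boxAt b)) (boxesFrom y (chosen L))
  rowForm-boxesFrom φ z y β h [] = refl
  rowForm-boxesFrom φ z y β h ((false , r) ∷ L) = cong₂ _+_ (rowSum-upTo _ r ∙ ΣL-cong (λ k → z _) (upTo r) ∙ ΣL-0 (upTo r)) (cong (λ b → rowForm φ b (heightRows L)) (+-identityʳ β)) ∙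
    +-identityˡ _ ∙ rowForm-boxesFrom φ z y β h L
  rowForm-boxesFrom φ z y β h ((true , r) ∷ L) = cong₂ _+_ (rowSum-upTo _ r ∙ ΣL-cong (λ k → cong (λ c → φ (- (A * B) , c)) (place k)) (upTo r) ∙ sym (ΣL-map (λ x → φ (boxAt (x , y))) suc (upTo r)) ∙ sym (ΣL-map (λ b → φ (boxAt b)) (λ x → (x , y)) (range1 r))) (rowForm-boxesFrom φ z (suc y) (β + B) next L) ∙ sym (ΣL-++ _ (map (λ x → (x , y)) (range1 r)) _)
    where
    place : ∀ k → A * nat k + β + - g ≡ A * nat (suc k) + B * nat y + - A + - B + - g
    place k = solve 5 (λ A B k b g → A :* k :+ b :+ :- g := A :* (:1 :+ k) :+ (b :+ B) :+ :- A :+ :- B :+ :- g) refl A B (nat k) β g ∙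
      cong₂ (λ a b → A * a + b + - A + - B + - g) (sym (nat-suc k)) h
    next : β + B + B ≡ B * nat (suc y)
    next = cong (_+ B) h ∙ solve 2 (λ B y → B :* y :+ B := B :* (:1 :+ y)) refl B (nat y) ∙ cong (B *_) (sym (nat-suc y))

lead-map : ∀ {X Y : Set} (f : X → Y) L → lead (map (λ (y , r) → f y , r) L) ≡ map f (lead L)
lead-map f [] = refl
lead-map f ((y , zero) ∷ L) = refl
lead-map f ((y , suc r) ∷ L) = cong (f y ∷_) (lead-map f L)

colsOf-map : ∀ {X Y : Set} (f : X → Y) m x x' L → map proj₂ (colsOf m x' (map (λ (y , r) → f y , r) L)) ≡ map (λ cy → map f (proj₂ cy)) (colsOf m x L)
colsOf-map f zero x x' L = refl
colsOf-map f (suc m) x x' L = cong₂ _∷_ (lead-map f L) (cong (λ l → map proj₂ (colsOf m (suc x') l)) (sym (Listₚ.map-∘ L) ∙ Listₚ.map-∘ L) ∙ colsOf-map f m (suc x) (suc x') (strip L))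

Decreasing-map : ∀ {X Y : Set} (f : X → Y) {m L} → Decreasing m L → Decreasing m (map (λ (y , r) → f y , r) L)
Decreasing-map f [] = []
Decreasing-map f (p ∷ d) = p ∷ Decreasing-map f d

chosen-all : ∀ {R g A B} rs → RowBoxes.chosen R g A B (map (true ,_) rs) ≡ rs
chosen-all [] = refl
chosen-all {R} {g} {A} {B} (r ∷ rs) = cong (r ∷_) (chosen-all {R} {g} {A} {B} rs)

label-rows : ∀ {X : Set} (B : X) y rs → map (λ (_ , r) → B , r) (label y rs) ≡ map (B ,_) rs
label-rows B y [] = refl
label-rows B y (r ∷ rs) = cong ((B , r) ∷_) (label-rows B (suc y) rs)

-- At ω = 1 the power sums Σ ω^{m+1} c^e, for all m, become Σ c^e.
forget : Monomial (ℕ × ℕ) → Monomial ℕ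
forget m = mono (coef m) (gpow m) (map proj₁ (fac m))

seriesMonomials : ℕ → List (Monomial (ℕ × ℕ))
seriesMonomials n = proj₁ (Universal.rep-f̂ n)

mapsMonomials : ℕ → List (Monomial ℕ)
mapsMonomials n = map forget (seriesMonomials n)

module _ where
  open Ring ℚAlg
  open Sums ℚAlg
  open Evaluation ℚAlg
  open Degree
  open Powers ℚAlg

  content-boxAt : ∀ A nz b → RowBoxes.boxAt ℚAlg (Defs.γ A nz) A (- 1/_ A {{nz}}) b ≡ (- (A * - 1/_ A {{nz}}) , content A nz b)
  content-boxAt A nz (x , y) = cong (- (A * - 1/_ A {{nz}}) ,_) (solve 4 (λ A a x y → A :* x :+ :- a :* y :+ :- A :+ :- :- a :+ :- (:- A :+ a) := A :* x :+ :- (a :* y)) refl A (1/_ A {{nz}}) (ratℕ x) (ratℕ y) ∙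
    cong₂ (λ x y → A * x + - (1/_ A {{nz}} * y)) (ratℕ-def x) (ratℕ-def y))

  Π#-map : ∀ {X Y : Set} (f : Y → ℚ) (k : X → Y) xs → Π# f (map k xs) ≡ Π# (λ x → f (k x)) xs
  Π#-map f k [] = refl
  Π#-map f k (x ∷ xs) = cong (f (k x) *_) (Π#-map f k xs)

  Π#-cong : ∀ {X : Set} {f h : X → ℚ} → (∀ x → f x ≡ h x) → ∀ xs → Π# f xs ≡ Π# h xs
  Π#-cong e [] = refl
  Π#-cong e (x ∷ xs) = cong₂ _*_ (e x) (Π#-cong e xs)

  module _ (A : ℚ) (nz : NonZero A) (γ≢0 : Defs.γ A nz ≢ 0ℚ) (λ' : YD) where
    open MapsToSeries A nz γ≢0 using (B; g; Aai; world; cond; Fn-series)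
    open RowForm ℚAlg g A
    open RowBoxes ℚAlg g A B

    private
      L = map (λ (_ , r) → B , r) (labelYD λ')
      W = world cond (columns λ')

    world-bxs : Recursion.bxs W ≡ boxesB (colsB (width λ') L)
    world-bxs = boxesOf-boxesB W (World.cols W) ∙ cong boxesB (sym (colsOf-map (λ _ → B) (width λ') 1 0 (labelYD λ')))

    powerSum-content : ∀ e m → powerSum ℚAlg (Recursion.bxs W) (e , m) ≡ contentPower A nz λ' e
    powerSum-content e m = ΣL-cong {f = φ′} {h = φ} (λ { (ω , c) → refl }) (Recursion.bxs W) ∙ cong (ΣL φ) world-bxs ∙ ΣL-boxes-rows φ (width λ') L (Decreasing-map (λ _ → B) (labelYD-Decreasing λ')) ∙ cong (rowForm φ 0#) (label-rows B 1 (rows λ') ∙ Listₚ.map-∘ (rows λ')) ∙ rowForm-boxesFrom φ (λ c → cong (λ z → - z * ((- z) ^# m) * (c ^# e)) (zeroʳ A) ∙ solve 2 (λ x y → :- :0 :* x :* y := :0) refl ((- 0#) ^# m) (c ^# e)) 1 0# (+-identityˡ B ∙ sym (cong (B *_) (ratℕ-suc 0 ∙ cong (1# +_) ratℕ-0) ∙ solve 1 (λ b → b :* (:1 :+ :0) := b) refl B)) (map (true ,_) (rows λ')) ∙ cong (λ rs → ΣL (λ b → φ (boxAt b)) (boxesFrom 1 rs)) (chosen-all {ℚAlg} {g} {A} {B} (rows λ')) ∙ ΣL-cong (λ b → cong φ (content-boxAt A nz b) ∙ cong (λ w → (w ^# suc m) * (content A nz b ^# e)) unit ∙ cong (_* (content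 A nz b ^# e)) (one-^# (suc m)) ∙ *-identityˡ (content A nz b ^# e) ∙ sym (^≡^# (content A nz b) e)) (boxes λ')
      where
      φ φ′ : ℚ × ℚ → ℚ
      φ b = (proj₁ b ^# suc m) * (proj₂ b ^# e)
      φ′ = λ { (ω , c) → (ω ^# suc m) * (c ^# e) }
      unit : - (A * B) ≡ 1#
      unit = solve 2 (λ A a → :- (A :* :- a) := A :* a) refl A (1/_ A {{nz}}) ∙ Aai

    Fn-value-generic : ∀ N → Fn (suc N) A nz λ' ≡ value (mapsMonomials (suc N)) A nz λ'
    Fn-value-generic N = Fn-series N λ' ∙ proj₂ (proj₂ (Universal.rep-f̂ (suc N))) W ∙ ΣL-cong (λ m → cong (λ z → coef m * ((g ^# gpow m) * z)) (Π#-cong (λ (e , k) → powerSum-content e k) (fac m) ∙ sym (Π#-map (contentPower A nz λ') proj₁ (fac m)))) (seriesMonomials (suc N)) ∙ sym (ΣL-map (evalM g (contentPower A nz λ')) forget (seriesMonomials (suc N)))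

  laurent-Σ : ∀ {X : Set} {φ : X → (A : ℚ) → NonZero A → ℚ} xs → (∀ x → Laurent (φ x)) → Laurent (λ A nz → ΣL (λ x → φ x A nz) xs)
  laurent-Σ [] h = laurent-const 0ℚ
  laurent-Σ (x ∷ xs) h = laurent-+ (h x) (laurent-Σ xs h)

  laurent-Π : ∀ {X : Set} {φ : X → (A : ℚ) → NonZero A → ℚ} xs → (∀ x → Laurent (φ x)) → Laurent (λ A nz → Π# (λ x → φ x A nz) xs)
  laurent-Π [] h = laurent-const 1ℚ
  laurent-Π (x ∷ xs) h = laurent-* (h x) (laurent-Π xs h)

  laurent-^′ : ∀ {φ : (A : ℚ) → NonZero A → ℚ} n → Laurent φ → Laurent (λ A nz → φ A nz ^ n)
  laurent-^′ {φ} n h = laurent-cong (λ A nz → ^≡^# (φ A nz) n) (laurent-^ n h)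

  laurent-value : ∀ U λ' → Laurent (λ A nz → value U A nz λ')
  laurent-value U λ' = laurent-Σ U (λ m → laurent-* (laurent-const (coef m)) (laurent-* (laurent-^ (gpow m) laurent-γ)
    (laurent-Π (fac m) (λ e → laurent-Σ (boxes λ') (λ (x , y) → laurent-^′ e (laurent-+ (laurent-* laurent-A (laurent-const (fromℕ x))) (laurent-neg (laurent-* laurent-1/A (laurent-const (fromℕ y))))))))))

  laurent-Fn : ∀ n λ' → Laurent (λ A nz → Fn n A nz λ')
  laurent-Fn zero λ' = laurent-const 0ℚ
  laurent-Fn (suc N) λ' = laurent-neg (laurent-Σ (rootedMaps N) (λ { (s , t) → laurent-* (laurent-^′ (suc (suc N) ∸ (cycles s ℕ.+ cycles t)) laurent-γ)
    (laurent-* (laurent-* (laurent-* (laurent-^′ (cycles s) laurent-A) (laurent-const ((- 1#) ^ cycles t))) (laurent-^′ (cycles t) laurent-1/A)) (laurent-const (fromℕ (embeddings s t λ')))) }))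

  -- The series argument divides by γ. Both sides are Laurent polynomials in A, so the values with γ
  -- = 0 follow from the others.
  Fn-value : ∀ N A nz λ' → Fn (suc N) A nz λ' ≡ value (mapsMonomials (suc N)) A nz λ'
  Fn-value N A nz λ' = solve 2 (λ f v → f := (f :+ :- v) :+ v) refl F V ∙ cong (_+ V) (laurent-zero (laurent-+ (laurent-Fn (suc N) λ') (laurent-neg (laurent-value (mapsMonomials (suc N)) λ'))) (λ A nz γ≢0 → cong (_+ - value (mapsMonomials (suc N)) A nz λ') (Fn-value-generic A nz γ≢0 λ' N) ∙ ℚₚ.+-inverseʳ (value (mapsMonomials (suc N)) A nz λ')) A nz) ∙ +-identityˡ V
    where
    F = Fn (suc N) A nz λ'
    V = value (mapsMonomials (suc N)) A nz λ'

-- Deforming diagrams: rows that may be present or absent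

record Hom (R S : Alg) : Set where
  private
    module R = Alg R
    module S = Alg S
  field
    ⟦_⟧ : R.Carrier → S.Carrier
    hom-+ : ∀ a b → ⟦ a R.+ b ⟧ ≡ ⟦ a ⟧ S.+ ⟦ b ⟧
    hom-* : ∀ a b → ⟦ a R.* b ⟧ ≡ ⟦ a ⟧ S.* ⟦ b ⟧
    hom-neg : ∀ a → ⟦ R.- a ⟧ ≡ S.- ⟦ a ⟧
    hom-ι : ∀ q → ⟦ R.ι q ⟧ ≡ S.ι q
  hom-0 : ⟦ R.0# ⟧ ≡ S.0#
  hom-0 = cong ⟦_⟧ (sym R.ι-0) ∙ hom-ι 0ℚ ∙ S.ι-0
  hom-1 : ⟦ R.1# ⟧ ≡ S.1#
  hom-1 = cong ⟦_⟧ (sym R.ι-1) ∙ hom-ι 1ℚ ∙ S.ι-1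

-- Homogenisation to degree N: powers of ε make up the missing degree. At ε = 0, where 0⁰ = 1, the
-- monomials of degree N remain and those of lower degree disappear.
scaleM : ℚ → ℕ → Monomial ℕ → Monomial ℕ
scaleM ε N m = mono (coef m ℚ.* Alg._^#_ ℚAlg ε (N ∸ boxDegree m)) (gpow m) (fac m)

-- The row model with A = 1: a row of height B has boxes of weight -B.
module RowModel (R : Alg) (g : Alg.Carrier R) where
  open Alg R
  open Sums R
  open Evaluation R
  open RowForm R g 1#

  boxPower : ℕ → Carrier × Carrier → Carrier
  boxPower e b = proj₁ b * (proj₂ b ^# e)

  rowPower : List (Carrier × ℕ) → ℕ → Carrier
  rowPower L e = rowForm (boxPower e) 0# L

  model : ℚ → ℕ → List (Carrier × ℕ) → List (Monomial ℕ) → Carrier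
  model ε N L U = evalP g (rowPower L) (map (scaleM ε N) U)

module HomProperties {R S : Alg} (h : Hom R S) where
  open Hom h
  private
    module R = Alg R
    module S = Alg S
    module RS = Sums R
    module SS = Sums S
    module RF = Fubini R
    module SF = Fubini S

  hom-^# : ∀ a n → ⟦ a R.^# n ⟧ ≡ ⟦ a ⟧ S.^# n
  hom-^# a zero = hom-1
  hom-^# a (suc n) = hom-* _ _ ∙ cong (⟦ a ⟧ S.*_) (hom-^# a n)

  hom-ΣL : ∀ {X : Set} {f : X → R.Carrier} {f' : X → S.Carrier} → (∀ x → ⟦ f x ⟧ ≡ f' x) → ∀ xs → ⟦ RS.ΣL f xs ⟧ ≡ SS.ΣL f' xs
  hom-ΣL e [] = hom-0
  hom-ΣL e (x ∷ xs) = hom-+ _ _ ∙ cong₂ S._+_ (e x) (hom-ΣL e xs)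

  hom-Π : ∀ {X : Set} {f : X → R.Carrier} {f' : X → S.Carrier} → (∀ x → ⟦ f x ⟧ ≡ f' x) → ∀ xs → ⟦ RS.Π# f xs ⟧ ≡ SS.Π# f' xs
  hom-Π e [] = hom-1
  hom-Π e (x ∷ xs) = hom-* _ _ ∙ cong₂ S._*_ (e x) (hom-Π e xs)

  hom-evalP : ∀ {X : Set} {g g'} {T : X → R.Carrier} {T' : X → S.Carrier} → ⟦ g ⟧ ≡ g' → (∀ x → ⟦ T x ⟧ ≡ T' x) → ∀ U →
    ⟦ Evaluation.evalP R g T U ⟧ ≡ Evaluation.evalP S g' T' U
  hom-evalP {g = g} refl e = hom-ΣL (λ m → hom-* _ _ ∙ cong₂ S._*_ (hom-ι (coef m)) (hom-* _ _ ∙ cong₂ S._*_ (hom-^# g (gpow m)) (hom-Π e (fac m))))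

  hom-rowSum : ∀ {f : ℕ → R.Carrier} {f' : ℕ → S.Carrier} → (∀ x → ⟦ f x ⟧ ≡ f' x) → ∀ x r → ⟦ RF.rowSum f x r ⟧ ≡ SF.rowSum f' x r
  hom-rowSum e x zero = hom-0
  hom-rowSum e x (suc r) = hom-+ _ _ ∙ cong₂ S._+_ (e x) (hom-rowSum e (suc x) r)

  hom-rowForm : ∀ {g g'} e → ⟦ g ⟧ ≡ g' → ∀ β β' → ⟦ β ⟧ ≡ β' → ∀ L →
    ⟦ RowForm.rowForm R g R.1# (RowModel.boxPower R g e) β L ⟧ ≡ RowForm.rowForm S g' S.1# (RowModel.boxPower S g' e) β' (map (λ (B , r) → ⟦ B ⟧ , r) L)
  hom-rowForm e refl β β' refl [] = hom-0
  hom-rowForm {g = g} e refl β β' refl ((B , r) ∷ L) = hom-+ _ _ ∙ cong₂ S._+_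
    (hom-rowSum (λ k → hom-* _ _ ∙ cong₂ S._*_ (hom-neg _ ∙ cong S.-_ (hom-* _ _ ∙ cong (S._* ⟦ B ⟧) hom-1))
      (hom-^# _ e ∙ cong (S._^# e) (hom-+ _ _ ∙ cong₂ S._+_ (hom-+ _ _ ∙ cong (S._+ ⟦ β ⟧) (hom-* _ _ ∙ cong₂ S._*_ hom-1 (hom-ι _))) (hom-neg g)))) 0 r)
    (hom-rowForm e refl (β R.+ B) (⟦ β ⟧ S.+ ⟦ B ⟧) (hom-+ β B) L)

  hom-model : ∀ {g g'} ε N → ⟦ g ⟧ ≡ g' → ∀ L L' → map (λ (B , r) → ⟦ B ⟧ , r) L ≡ L' → ∀ U → ⟦ RowModel.model R g ε N L U ⟧ ≡ RowModel.model S g' ε N L' U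
  hom-model ε N e L L' refl U = hom-evalP e (λ x → hom-rowForm x e R.0# S.0# hom-0 L) (map (scaleM ε N) U)

-- A row is settled as present or absent, or it carries the variable of index i; assigning a value
-- to the variable 0 renumbers the others.
data Code : Set where
  fixed : Bool → Code
  free : ℕ → Code

assign : Bool → Code → Code
assign b (fixed b') = fixed b'
assign b (free zero) = fixed b
assign b (free (suc i)) = free i

gen : ∀ η k → ℕ → Alg.Carrier (Λ η k)
gen η zero i = 0ℚ
gen η (suc k) zero = Alg.0# (Λ η k) , Alg.1# (Λ η k)
gen η (suc k) (suc i) = gen η k i , Alg.0# (Λ η k)

codeHeight : ∀ η k → Code → Alg.Carrier (Λ η k)
codeHeight η k (fixed false) = Alg.0# (Λ η k)
codeHeight η k (fixed true) = Alg.-_ (Λ η k) (Alg.ι (Λ η k) η)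
codeHeight η k (free i) = Alg.-_ (Λ η k) (gen η k i)

codeRows : ∀ η k → List (Code × ℕ) → List (Alg.Carrier (Λ η k) × ℕ)
codeRows η k = map (λ (c , r) → codeHeight η k c , r)

module _ (R : Alg) (η : ℚ) where
  open Ring R
  open Dual R η

  -- w ↦ t is a ring homomorphism R[w]/(w² - ηw) → R when t² = ηt
  substitute : ∀ t → t ℚ.* t ≡ η ℚ.* t → Hom dual R
  substitute t h = record
    { ⟦_⟧ = λ (u , v) → u + ι t * v
    ; hom-+ = λ (a , b) (c , d) → solve 5 (λ t a b c d → a :+ c :+ t :* (b :+ d) := a :+ t :* b :+ (c :+ t :* d)) refl (ι t) a b c d
    ; hom-* = λ (a , b) (c , d) → solve 6 (λ t e a b c d → a :* c :+ t :* (a :* d :+ b :* c :+ e :* (b :* d)) := a :* c :+ t :* a :* d :+ t :* b :* c :+ (e :* t) :* b :* d) refl (ι t) (ι η) a b c d ∙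
        cong (λ z → a * c + ι t * a * d + ι t * b * c + z * b * d) (sym (ι-* η t) ∙ cong ι (sym h) ∙ ι-* t t) ∙
          solve 5 (λ t a b c d → a :* c :+ t :* a :* d :+ t :* b :* c :+ (t :* t) :* b :* d := (a :+ t :* b) :* (c :+ t :* d)) refl (ι t) a b c d
    ; hom-neg = λ (a , b) → solve 3 (λ t a b → :- a :+ t :* :- b := :- (a :+ t :* b)) refl (ι t) a b
    ; hom-ι = λ q → solve 2 (λ t a → a :+ t :* :0 := a) refl (ι t) (ι q) }

  branch : Bool → Hom dual R
  branch true = substitute η refl
  branch false = substitute 0ℚ (ℚₚ.*-zeroˡ 0ℚ ∙ sym (ℚₚ.*-zeroʳ η))

  -- The value at w = 0 is u, and the difference of the two values is ηv.
  dual-zero : η ≢ 0ℚ → ∀ x → (∀ b → Hom.⟦_⟧ (branch b) x ≡ 0#) → x ≡ (0# , 0#)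
  dual-zero η≢0 (u , v) h = cong₂ _,_ u-zero (solve 1 (λ v → v := :1 :* v) refl v ∙ cong (_* v) (sym (sym (ι-* i η) ∙ cong ι (ℚₚ.*-inverseˡ η {{nz}}) ∙ ι-1)) ∙ solve 3 (λ i e v → i :* e :* v := i :* (:0 :+ e :* v)) refl (ι i) (ι η) v ∙ cong (λ z → ι i * (z + ι η * v)) (sym u-zero) ∙ cong (ι i *_) (h true) ∙ zeroʳ (ι i))
    where
    nz = ℚ.≢-nonZero η≢0
    i = 1/_ η {{nz}}
    u-zero : u ≡ 0#
    u-zero = solve 2 (λ u v → u := u :+ :0 :* v) refl u v ∙ cong (λ z → u + z * v) (sym ι-0) ∙ h false

branch-height : ∀ η k b c → Hom.⟦_⟧ (branch (Λ η k) η b) (codeHeight η (suc k) c) ≡ codeHeight η k (assign b c)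
branch-height η k true (fixed true) = let open Ring (Λ η k) in solve 2 (λ a t → :- a :+ t :* :- :0 := :- a) refl (ι η) (ι η)
branch-height η k false (fixed true) = let open Ring (Λ η k) in solve 2 (λ a t → :- a :+ t :* :- :0 := :- a) refl (ι η) (ι 0ℚ)
branch-height η k true (fixed false) = let open Ring (Λ η k) in solve 1 (λ t → :0 :+ t :* :0 := :0) refl (ι η)
branch-height η k false (fixed false) = let open Ring (Λ η k) in solve 1 (λ t → :0 :+ t :* :0 := :0) refl (ι 0ℚ)
branch-height η k true (free zero) = let open Ring (Λ η k) in solve 1 (λ t → :- :0 :+ t :* :- :1 := :- t) refl (ι η)
branch-height η k false (free zero) = let open Ring (Λ η k) in cong (λ t → - 0# + t * - 1#) ι-0 ∙ solve 0 (:- :0 :+ :0 :* :- :1 := :0) refl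
branch-height η k true (free (suc i)) = let open Ring (Λ η k) in solve 2 (λ a t → :- a :+ t :* :- :0 := :- a) refl (gen η k i) (ι η)
branch-height η k false (free (suc i)) = let open Ring (Λ η k) in solve 2 (λ a t → :- a :+ t :* :- :0 := :- a) refl (gen η k i) (ι 0ℚ)

codeModel : ∀ η k → ℚ → ℚ → ℕ → List (Code × ℕ) → List (Monomial ℕ) → Alg.Carrier (Λ η k)
codeModel η k g ε N L U = RowModel.model (Λ η k) (Alg.ι (Λ η k) g) ε N (codeRows η k L) U

assignRows : (Code → Code) → List (Code × ℕ) → List (Code × ℕ)
assignRows f = map (λ (c , r) → f c , r)

-- Evaluating one variable after the other splits `Λ η k` into copies of ℚ, one for each set of rows
-- that are kept.
codeModel-zero : ∀ η → η ≢ 0ℚ → ∀ k g ε N L U → (∀ (f : Code → Bool) → codeModel η 0 g ε N (assignRows (fixed ∘ f) L) U ≡ 0ℚ) → codeModel η k g ε N L U ≡ Alg.0# (Λ η k)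
codeModel-zero η η≢0 zero g ε N L U h = cong (λ l → RowModel.model ℚAlg g ε N l U) (Listₚ.map-cong (λ (c , r) → cong (_, r) (resolve-height c)) L ∙ Listₚ.map-∘ L) ∙ h resolve
  where
  resolve : Code → Bool
  resolve (fixed b) = b
  resolve (free i) = false
  resolve-height : ∀ c → codeHeight η 0 c ≡ codeHeight η 0 (fixed (resolve c))
  resolve-height (fixed b) = refl
  resolve-height (free i) = refl
codeModel-zero η η≢0 (suc k) g ε N L U h = dual-zero (Λ η k) η η≢0 _ λ b → HomProperties.hom-model (branch (Λ η k) η b) ε N (Hom.hom-ι (branch (Λ η k) η b) g) (codeRows η (suc k) L) (codeRows η k (assignRows (assign b) L))
    (sym (Listₚ.map-∘ L) ∙ Listₚ.map-cong (λ (c , r) → cong (_, r) (branch-height η k b c)) L ∙ Listₚ.map-∘ L) U ∙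
  codeModel-zero η η≢0 k g ε N (assignRows (assign b) L) U (λ f → cong (λ l → codeModel η 0 g ε N l U) (sym (Listₚ.map-∘ L)) ∙ h (f ∘ assign b))

module _ where
  open Alg ℚAlg using () renaming (_^#_ to _^ℚ_)
  open Degree

  -- families in Λ (ε²) k with components polynomial in ε
  data PolyFam : ∀ k → ((ε : ℚ) → Alg.Carrier (Λ (ε ℚ.* ε) k)) → Set where
    base : ∀ {F} → IsPoly F → PolyFam zero F
    pair : ∀ {k F} → PolyFam k (λ ε → proj₁ (F ε)) → PolyFam k (λ ε → proj₂ (F ε)) → PolyFam (suc k) F

  private
    module D (k : ℕ) (ε : ℚ) = Alg (Λ (ε ℚ.* ε) k)

  fam-ι : ∀ k {q : ℚ → ℚ} → IsPoly q → PolyFam k (λ ε → D.ι k ε (q ε))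
  fam-0 : ∀ k → PolyFam k (λ ε → D.0# k ε)

  fam-0 zero = base (poly-const 0ℚ)
  fam-0 (suc k) = pair (fam-0 k) (fam-0 k)

  fam-ι zero p = base p
  fam-ι (suc k) p = pair (fam-ι k p) (fam-0 k)

  fam-1 : ∀ k → PolyFam k (λ ε → D.1# k ε)
  fam-1 zero = base (poly-const 1ℚ)
  fam-1 (suc k) = pair (fam-1 k) (fam-0 k)

  fam-+ : ∀ k {F G} → PolyFam k F → PolyFam k G → PolyFam k (λ ε → D._+_ k ε (F ε) (G ε))
  fam-+ zero (base p) (base q) = base (poly-+ p q)
  fam-+ (suc k) (pair p p') (pair q q') = pair (fam-+ k p q) (fam-+ k p' q')

  fam-neg : ∀ k {F} → PolyFam k F → PolyFam k (λ ε → D.-_ k ε (F ε))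
  fam-neg zero {F} (base p) = base (poly-cong (λ x → let open Ring ℚAlg in solve 1 (λ f → :- f := :- :1 :* f) refl (F x)) (poly-* (poly-const (ℚ.- 1ℚ)) p))
  fam-neg (suc k) (pair p p') = pair (fam-neg k p) (fam-neg k p')

  fam-* : ∀ k {F G} → PolyFam k F → PolyFam k G → PolyFam k (λ ε → D._*_ k ε (F ε) (G ε))
  fam-* zero (base p) (base q) = base (poly-* p q)
  fam-* (suc k) (pair p p') (pair q q') = pair (fam-* k p q)
    (fam-+ k (fam-+ k (fam-* k p q') (fam-* k p' q)) (fam-* k (fam-ι k (poly-* poly-id poly-id)) (fam-* k p' q')))

  fam-^ : ∀ k {F} n → PolyFam k F → PolyFam k (λ ε → D._^#_ k ε (F ε) n)
  fam-^ k zero p = fam-1 k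
  fam-^ k (suc n) p = fam-* k p (fam-^ k n p)

  fam-Σ : ∀ k {X : Set} {F : X → (ε : ℚ) → Alg.Carrier (Λ (ε ℚ.* ε) k)} xs → (∀ x → PolyFam k (F x)) → PolyFam k (λ ε → Sums.ΣL (Λ (ε ℚ.* ε) k) (λ x → F x ε) xs)
  fam-Σ k [] h = fam-0 k
  fam-Σ k (x ∷ xs) h = fam-+ k (h x) (fam-Σ k xs h)

  fam-Π : ∀ k {X : Set} {F : X → (ε : ℚ) → Alg.Carrier (Λ (ε ℚ.* ε) k)} xs → (∀ x → PolyFam k (F x)) → PolyFam k (λ ε → Sums.Π# (Λ (ε ℚ.* ε) k) (λ x → F x ε) xs)
  fam-Π k [] h = fam-1 k
  fam-Π k (x ∷ xs) h = fam-* k (h x) (fam-Π k xs h)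

  fam-rowSum : ∀ k {F : ℕ → (ε : ℚ) → Alg.Carrier (Λ (ε ℚ.* ε) k)} x r → (∀ x → PolyFam k (F x)) → PolyFam k (λ ε → Fubini.rowSum (Λ (ε ℚ.* ε) k) (λ x → F x ε) x r)
  fam-rowSum k x zero h = fam-0 k
  fam-rowSum k x (suc r) h = fam-+ k (h x) (fam-rowSum k (suc x) r h)

  fam-gen : ∀ k i → PolyFam k (λ ε → gen (ε ℚ.* ε) k i)
  fam-gen zero i = base (poly-const 0ℚ)
  fam-gen (suc k) zero = pair (fam-0 k) (fam-1 k)
  fam-gen (suc k) (suc i) = pair (fam-gen k i) (fam-0 k)

  fam-height : ∀ k c → PolyFam k (λ ε → codeHeight (ε ℚ.* ε) k c)
  fam-height k (fixed false) = fam-0 k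
  fam-height k (fixed true) = fam-neg k (fam-ι k (poly-* poly-id poly-id))
  fam-height k (free i) = fam-neg k (fam-gen k i)

  fam-rowForm : ∀ k (g β : (ε : ℚ) → Alg.Carrier (Λ (ε ℚ.* ε) k)) → PolyFam k g → PolyFam k β → ∀ e L →
    PolyFam k (λ ε → RowForm.rowForm (Λ (ε ℚ.* ε) k) (g ε) (D.1# k ε) (RowModel.boxPower (Λ (ε ℚ.* ε) k) (g ε) e) (β ε) (codeRows (ε ℚ.* ε) k L))
  fam-rowForm k g β pg pβ e [] = fam-0 k
  fam-rowForm k g β pg pβ e ((c , r) ∷ L) = fam-+ k
    (fam-rowSum k 0 r (λ x → fam-* k (fam-neg k (fam-* k (fam-1 k) (fam-height k c)))
      (fam-^ k e (fam-+ k (fam-+ k (fam-* k (fam-1 k) (fam-ι k (poly-const _))) pβ) (fam-neg k pg)))))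
    (fam-rowForm k g _ pg (fam-+ k pβ (fam-height k c)) e L)

  fam-model : ∀ k {g : ℚ → ℚ} → IsPoly g → ∀ N L U → PolyFam k (λ ε → codeModel (ε ℚ.* ε) k (g ε) ε N L U)
  fam-model k {g} pg N L U = subst-fam (fam-Σ k U (λ m → fam-* k (fam-ι k (poly-* (poly-const (coef m)) (poly-^ (N ∸ boxDegree m) poly-id)))
      (fam-* k (fam-^ k (gpow m) (fam-ι k pg)) (fam-Π k (fac m) (λ e → fam-rowForm k _ _ (fam-ι k pg) (fam-0 k) e L)))))
    where
    fam-cong : ∀ k {F G} → (∀ ε → F ε ≡ G ε) → PolyFam k F → PolyFam k G
    fam-cong zero e (base p) = base (poly-cong (λ ε → sym (e ε)) p)
    fam-cong (suc k) e (pair p q) = pair (fam-cong k (λ ε → cong proj₁ (e ε)) p) (fam-cong k (λ ε → cong proj₂ (e ε)) q)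
    subst-fam : PolyFam k _ → PolyFam k (λ ε → codeModel (ε ℚ.* ε) k (g ε) ε N L U)
    subst-fam = fam-cong k (λ ε → sym (Sums.ΣL-map (Λ _ k) _ _ U))

  fam-zero : ∀ k {F} → PolyFam k F → (∀ i → F (ratℕ (suc i)) ≡ D.0# k (ratℕ (suc i))) → ∀ ε → F ε ≡ D.0# k ε
  fam-zero zero (base p) h = poly-zero 1 p h
  fam-zero (suc k) (pair p q) h ε = cong₂ _,_ (fam-zero k p (λ i → cong proj₁ (h i)) ε) (fam-zero k q (λ i → cong proj₂ (h i)) ε)

-- The model at Λ (ε²) 0 with A = 1 and γ = ε² - 1 is the original at A = 1/ε, rescaled by ε.
module Rescaling (ε : ℚ) (ε≢0 : ε ≢ 0ℚ) where
  open Ring ℚAlg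
  open Sums ℚAlg
  open Evaluation ℚAlg
  open Powers ℚAlg

  nzε : NonZero ε
  nzε = ℚ.≢-nonZero ε≢0

  A : ℚ
  A = 1/_ ε {{nzε}}

  εA : ε * A ≡ 1#
  εA = ℚₚ.*-inverseʳ ε {{nzε}}

  nz : NonZero A
  nz = ℚ.≢-nonZero (λ A0 → 1≢0 (sym εA ∙ cong (ε *_) A0 ∙ zeroʳ ε))
    where
    1≢0 : 1ℚ ≢ 0ℚ
    1≢0 ()

  1/A : 1/_ A {{nz}} ≡ ε
  1/A = sym (*-identityˡ _) ∙ cong (_* 1/_ A {{nz}}) (sym εA) ∙ *-assoc ε A _ ∙ cong (ε *_) (ℚₚ.*-inverseʳ A {{nz}}) ∙ *-identityʳ ε

  g : ℚ
  g = - 1# + ε * ε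

  g-scaled : g ≡ ε * Defs.γ A nz
  g-scaled = cong (λ z → - z + ε * ε) (sym εA) ∙ solve 2 (λ e a → :- (e :* a) :+ e :* e := e :* (:- a :+ e)) refl ε A ∙ cong (λ z → ε * (- A + z)) (sym 1/A)

  open RowModel ℚAlg g
  open RowBoxes ℚAlg g 1# (- (ε * ε))

  private
    scaled-content : ∀ b → 1# * ratℕ (proj₁ b) + - (ε * ε) * ratℕ (proj₂ b) + - 1# + - - (ε * ε) + - g ≡ ε * content A nz b
    scaled-content (x , y) = solve 3 (λ e x y → :1 :* x :+ :- (e :* e) :* y :+ :- :1 :+ :- :- (e :* e) :+ :- (:- :1 :+ e :* e) := :1 :* x :+ :- (e :* (e :* y))) refl ε (ratℕ x) (ratℕ y) ∙ cong₂ (λ a b → a * ratℕ x + - (ε * (b * ratℕ y))) (sym εA) (sym 1/A) ∙ solve 5 (λ e a b x y → e :* a :* x :+ :- (e :* (b :* y)) := e :* (a :* x :+ :- (b :* y))) refl ε A (1/_ A {{nz}}) (ratℕ x) (ratℕ y) ∙ cong₂ (λ x y → ε * (A * x + - (1/_ A {{nz}} * y))) (ratℕ-def x) (ratℕ-def y)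

  rowPower-scaled : ∀ L λ' → rows λ' ≡ chosen L → ∀ e → rowPower (heightRows L) e ≡ (ε ^# (2 ℕ.+ e)) * contentPower A nz λ' e
  rowPower-scaled L λ' h e = rowForm-boxesFrom _ (λ c → solve 1 (λ x → :- (:1 :* :0) :* x := :0) refl (c ^# e)) 1 0# (+-identityˡ _ ∙ sym (cong (- (ε * ε) *_) (ratℕ-suc 0 ∙ cong (1# +_) ratℕ-0) ∙ solve 1 (λ b → b :* (:1 :+ :0) := b) refl (- (ε * ε)))) L ∙ cong (λ l → ΣL (λ b → boxPower e (boxAt b)) (boxesFrom 1 l)) (sym h) ∙ ΣL-cong (λ b → cong (λ c → - (1# * - (ε * ε)) * (c ^# e)) (scaled-content b) ∙ cong (- (1# * - (ε * ε)) *_) (*-^# ε (content A nz b) e) ∙ solve 3 (λ x p q → :- (:1 :* :- (x :* x)) :* (p :* q) := x :* (x :* p) :* q) refl ε (ε ^# e) (content A nz b ^# e) ∙ cong ((ε ^# (2 ℕ.+ e)) *_) (sym (^≡^# (content A nz b) e))) (boxes λ') ∙ ΣL-* (ε ^# (2 ℕ.+ e)) (λ b → content A nz b ^ e) (boxes λ')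

  Π-scaled : ∀ (T T' : ℕ → ℚ) → (∀ e → T e ≡ (ε ^# (2 ℕ.+ e)) * T' e) → ∀ es → Π# T es ≡ (ε ^# weight (2 ℕ.+_) es) * Π# T' es
  Π-scaled T T' h [] = sym (*-identityˡ 1#)
  Π-scaled T T' h (e ∷ es) = cong₂ _*_ (h e) (Π-scaled T T' h es) ∙
    solve 4 (λ a b c d → a :* b :* (c :* d) := a :* c :* (b :* d)) refl (ε ^# (2 ℕ.+ e)) (T' e) (ε ^# weight (2 ℕ.+_) es) (Π# T' es) ∙
      cong (_* (T' e * Π# T' es)) (sym (^#-+ ε (2 ℕ.+ e) (weight (2 ℕ.+_) es)))

  -- Multiplication by ε scales γ by ε and the power sum of exponent e by the power e + 2, in
  -- agreement with `boxDegree`; `scaleM` supplies the rest.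
  model-scaled : ∀ L λ' → rows λ' ≡ chosen L → ∀ N U → All (λ m → boxDegree m ℕ.≤ N) U → model ε N (heightRows L) U ≡ (ε ^# N) * value U A nz λ'
  model-scaled L λ' h N U deg = ΣL-map _ _ U ∙ ΣL-congAll term deg ∙ ΣL-* (ε ^# N) (evalM γ' T) U
    where
    γ' = Defs.γ A nz
    T̂ = rowPower (heightRows L)
    T = contentPower A nz λ'
    term : ∀ m → boxDegree m ℕ.≤ N → evalM g T̂ (scaleM ε N m) ≡ (ε ^# N) * evalM γ' T m
    term m d = cong₂ (λ a b → coef m * (ε ^# δ) * (a * b)) (cong (_^# gpow m) g-scaled ∙ (*-^# ε γ' (gpow m))) (Π-scaled T̂ T (rowPower-scaled L λ' h) (fac m)) ∙ solve 6 (λ c a b p d q → c :* a :* (b :* p :* (d :* q)) := a :* (b :* d) :* (c :* (p :* q))) refl (coef m) (ε ^# δ) (ε ^# gpow m) (γ' ^# gpow m) (ε ^# w) (Π# T (fac m)) ∙ cong (_* evalM γ' T m) (cong ((ε ^# δ) *_) (sym (^#-+ ε (gpow m) w)) ∙ sym (^#-+ ε δ _) ∙ cong (ε ^#_) (m∸n+n≡m d))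
      where
      δ = N ∸ boxDegree m
      w = weight (2 ℕ.+_) (fac m)

chosenRows : List (Bool × ℕ) → List ℕ
chosenRows [] = []
chosenRows ((true , r) ∷ L) = r ∷ chosenRows L
chosenRows ((false , r) ∷ L) = chosenRows L

chosen≡ : ∀ {R g A B} L → RowBoxes.chosen R g A B L ≡ chosenRows L
chosen≡ [] = refl
chosen≡ {R} {g} {A} {B} ((true , r) ∷ L) = cong (r ∷_) (chosen≡ {R} {g} {A} {B} L)
chosen≡ {R} {g} {A} {B} ((false , r) ∷ L) = chosen≡ {R} {g} {A} {B} L

weaken-head : ∀ {m r xs} → r ℕ.≤ m → Linked ℕ._≥_ (r ∷ xs) → Linked ℕ._≥_ (m ∷ xs)
weaken-head p [-] = [-]
weaken-head p (q ∷ l) = ≤-trans q p ∷ l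

chosenRows-linked : ∀ {m L} → Decreasing m L → Linked ℕ._≥_ (m ∷ chosenRows L)
chosenRows-linked [] = [-]
chosenRows-linked (_∷_ {y = true} p d) = p ∷ chosenRows-linked d
chosenRows-linked (_∷_ {y = false} p d) = weaken-head p (chosenRows-linked d)

rowTotal : {X : Set} → List (X × ℕ) → ℕ
rowTotal L = ListSum (map proj₂ L)

chosenRows-total : ∀ L → ListSum (chosenRows L) ℕ.≤ rowTotal L
chosenRows-total [] = z≤n
chosenRows-total ((true , r) ∷ L) = ℕₚ.+-monoʳ-≤ r (chosenRows-total L)
chosenRows-total ((false , r) ∷ L) = ≤-trans (chosenRows-total L) (m≤n+m _ r)

chosenRows-pos : ∀ L → All (λ p → 1 ℕ.≤ proj₂ p) L → All (1 ℕ.≤_) (chosenRows L)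
chosenRows-pos [] [] = []
chosenRows-pos ((true , r) ∷ L) (p ∷ ps) = p ∷ chosenRows-pos L ps
chosenRows-pos ((false , r) ∷ L) (p ∷ ps) = chosenRows-pos L ps

chosenYD : ∀ {m} L → Decreasing m L → All (λ p → 1 ℕ.≤ proj₂ p) L → YD
chosenYD L d p = record { rows = chosenRows L ; decr = Linked.tail (chosenRows-linked d) ; pos = chosenRows-pos L p }

-- For ε ≠ 0 every assignment deletes some rows and leaves, up to rescaling, a true diagram with
-- fewer than n boxes. All components of the model are polynomials in ε, so they also vanish at ε =
-- 0, where no diagram is left.
codeModel-vanishes : ∀ N U → All (λ m → boxDegree m ℕ.≤ N) U → ∀ n → (∀ A nz λ' → size λ' ℕ.< n → value U A nz λ' ≡ 0ℚ) →
  ∀ k {m} (L : List (Code × ℕ)) → Decreasing m L → All (λ p → 1 ℕ.≤ proj₂ p) L → rowTotal L ℕ.< n →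
  ∀ ε → codeModel (ε ℚ.* ε) k (ℚ.- 1ℚ ℚ.+ ε ℚ.* ε) ε N L U ≡ Alg.0# (Λ (ε ℚ.* ε) k)
codeModel-vanishes N U deg n vanish k L d ps lt = fam-zero k (fam-model k (Degree.poly-+ (Degree.poly-const (ℚ.- 1ℚ)) (Degree.poly-* Degree.poly-id Degree.poly-id)) N L U) λ i → nonzero _ (ratℕ-suc≢0 i)
  where
  nonzero : ∀ ε → ε ≢ 0ℚ → codeModel (ε ℚ.* ε) k (ℚ.- 1ℚ ℚ.+ ε ℚ.* ε) ε N L U ≡ Alg.0# (Λ (ε ℚ.* ε) k)
  nonzero ε ε≢0 = codeModel-zero _ (λ e → ε≢0 (Degree.*-cancelˡ ε≢0 e)) k _ ε N L U fixed-zero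
    where
    open Rescaling ε ε≢0
    open RowBoxes ℚAlg g 1ℚ (ℚ.- (ε ℚ.* ε)) using (heightRows; height)
    fixed-zero : ∀ (f : Code → Bool) → codeModel (ε ℚ.* ε) 0 g ε N (assignRows (fixed ∘ f) L) U ≡ 0ℚ
    fixed-zero f = cong (λ l → RowModel.model ℚAlg g ε N l U) (sym (Listₚ.map-∘ L) ∙ Listₚ.map-cong (λ (c , r) → cong (_, r) (same (f c))) L ∙ Listₚ.map-∘ L) ∙
      model-scaled ℓ λ' (sym (chosen≡ {ℚAlg} {g} {1ℚ} {ℚ.- (ε ℚ.* ε)} ℓ)) N U deg ∙ cong (Alg._^#_ ℚAlg ε N ℚ.*_) (vanish A nz λ' small) ∙ ℚₚ.*-zeroʳ (Alg._^#_ ℚAlg ε N)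
      where
      ℓ = map _ L
      λ' = chosenYD ℓ (Decreasing-map f d) (Allₚ.map⁺ ps)
      same : ∀ b → codeHeight (ε ℚ.* ε) 0 (fixed b) ≡ height b
      same true = refl
      same false = refl
      small : size λ' ℕ.< n
      small = ≤-<-trans (≤-trans (chosenRows-total ℓ) (≤-reflexive (cong ListSum (sym (Listₚ.map-∘ L))))) lt

-- The limit with heights of square zero

bump : Code → Code
bump (fixed b) = fixed b
bump (free i) = free (suc i)

freeRows : ∀ {k} → Vec ℕ k → List (Code × ℕ)
freeRows [] = []
freeRows (r ∷ rs) = (free 0 , r) ∷ map (λ (c , r) → bump c , r) (freeRows rs)

bump-height : ∀ η k c → codeHeight η (suc k) (bump c) ≡ (codeHeight η k c , Alg.0# (Λ η k))
bump-height η k (fixed false) = refl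
bump-height η k (fixed true) = let open Ring (Λ η k) in cong (- ι η ,_) (solve 0 (:- :0 := :0) refl)
bump-height η k (free i) = let open Ring (Λ η k) in cong (- gen η k i ,_) (solve 0 (:- :0 := :0) refl)

strip-freeRows : ∀ {k} (rs : Vec ℕ k) → strip (freeRows rs) ≡ freeRows (Vec.map ℕ.pred rs)
strip-freeRows [] = refl
strip-freeRows (r ∷ rs) = cong (_ ∷_) (sym (Listₚ.map-∘ (freeRows rs)) ∙ Listₚ.map-∘ (freeRows rs) ∙ cong (map _) (strip-freeRows rs))

strip-codeRows : ∀ η k L → strip (codeRows η k L) ≡ codeRows η k (strip L)
strip-codeRows η k L = sym (Listₚ.map-∘ L) ∙ Listₚ.map-∘ L

Λ₀ : ℕ → Alg
Λ₀ = Λ 0ℚ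

-- Bounded rs n x: the coefficient in x of the product of the variables in S vanishes when n exceeds Σ_{i∈S} r_i.
Bounded : ∀ {k} → Vec ℕ k → ℕ → Alg.Carrier (Λ₀ k) → Set
Bounded [] zero x = ⊤
Bounded [] (suc n) x = x ≡ 0ℚ
Bounded (r ∷ rs) n (u , v) = Bounded rs n u × Bounded rs (n ∸ r) v

private module D (k : ℕ) = Alg (Λ₀ k)

bounded-any : ∀ {k} (rs : Vec ℕ k) x → Bounded rs 0 x
bounded-any [] x = tt
bounded-any (r ∷ rs) (u , v) = bounded-any rs u , subst (λ n → Bounded rs n v) (sym (0∸n≡0 r)) (bounded-any rs v)

bounded-0 : ∀ {k} (rs : Vec ℕ k) n → Bounded rs n (D.0# k)
bounded-0 [] zero = tt
bounded-0 [] (suc n) = refl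
bounded-0 (r ∷ rs) n = bounded-0 rs n , bounded-0 rs (n ∸ r)

bounded-mono : ∀ {k} (rs : Vec ℕ k) {m n} → m ℕ.≤ n → ∀ x → Bounded rs n x → Bounded rs m x
bounded-mono [] {zero} p x h = tt
bounded-mono [] {suc m} (s≤s p) x h = h
bounded-mono (r ∷ rs) p (u , v) (h , h') = bounded-mono rs p u h , bounded-mono rs (∸-monoˡ-≤ r p) v h'

bounded-+ : ∀ {k} (rs : Vec ℕ k) n x y → Bounded rs n x → Bounded rs n y → Bounded rs n (D._+_ k x y)
bounded-+ [] zero x y p q = tt
bounded-+ [] (suc n) x y p q = cong₂ ℚ._+_ p q ∙ ℚₚ.+-identityˡ 0ℚ
bounded-+ (r ∷ rs) n (u , v) (u' , v') (p , p') (q , q') = bounded-+ rs n u u' p q , bounded-+ rs (n ∸ r) v v' p' q'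

bounded-neg : ∀ {k} (rs : Vec ℕ k) n x → Bounded rs n x → Bounded rs n (D.-_ k x)
bounded-neg [] zero x p = tt
bounded-neg [] (suc n) x p = cong ℚ.-_ p
bounded-neg (r ∷ rs) n (u , v) (p , p') = bounded-neg rs n u p , bounded-neg rs (n ∸ r) v p'

bounded-* : ∀ {k} (rs : Vec ℕ k) m n x y → Bounded rs m x → Bounded rs n y → Bounded rs (m ℕ.+ n) (D._*_ k x y)
bounded-* [] zero zero x y p q = tt
bounded-* [] zero (suc n) x y p q = cong (x ℚ.*_) q ∙ ℚₚ.*-zeroʳ x
bounded-* [] (suc m) n x y p q = cong (ℚ._* y) p ∙ ℚₚ.*-zeroˡ y
bounded-* {suc k} (r ∷ rs) m n (u , v) (u' , v') (p , p') (q , q') = bounded-* rs m n u u' p q ,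
  bounded-+ rs (m ℕ.+ n ∸ r) _ _ (bounded-+ rs (m ℕ.+ n ∸ r) _ _
      (bounded-mono rs (m≤n+o⇒m∸n≤o (m ℕ.+ n) r (shuffle m n)) _ (bounded-* rs m (n ∸ r) u v' p q'))
      (bounded-mono rs (m≤n+o⇒m∸n≤o (m ℕ.+ n) r (shuffle′ m n)) _ (bounded-* rs (m ∸ r) n v u' p' q)))
    (subst (Bounded rs (m ℕ.+ n ∸ r)) (sym (cong (λ z → D._*_ k z (D._*_ k v v')) (D.ι-0 k) ∙ D.zeroˡ k _)) (bounded-0 rs (m ℕ.+ n ∸ r)))
  where
  shuffle : ∀ m n → m ℕ.+ n ℕ.≤ r ℕ.+ (m ℕ.+ (n ∸ r))
  shuffle m n = ≤-trans (ℕₚ.+-monoʳ-≤ m (m≤n+m∸n n r)) (≤-reflexive (lem m r (n ∸ r)))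
    where
    lem : ∀ a b c → a ℕ.+ (b ℕ.+ c) ≡ b ℕ.+ (a ℕ.+ c)
    lem = solve-∀
  shuffle′ : ∀ m n → m ℕ.+ n ℕ.≤ r ℕ.+ (m ∸ r ℕ.+ n)
  shuffle′ m n = ≤-trans (ℕₚ.+-monoˡ-≤ n (m≤n+m∸n m r)) (≤-reflexive (ℕₚ.+-assoc r (m ∸ r) n))

bounded-pred : ∀ {k} (rs : Vec ℕ k) n x → Bounded (Vec.map ℕ.pred rs) n x → Bounded rs n x
bounded-pred [] n x h = h
bounded-pred (r ∷ rs) n (u , v) (h , h') = bounded-pred rs n u h , bounded-mono rs (ℕₚ.∸-monoʳ-≤ n (ℕₚ.pred[n]≤n {r})) v (bounded-pred rs (n ∸ ℕ.pred r) v h')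

-- Shortening every row by one lowers a positive sum of lengths by at least one, and a sum equal to
-- 0 lies below `suc n` anyway. The corresponding step from index 0 to 1 is false, hence the
-- successor.
bounded-pred-suc : ∀ {k} (rs : Vec ℕ k) n x → Bounded (Vec.map ℕ.pred rs) (suc n) x → Bounded rs (suc (suc n)) x
bounded-pred-suc [] n x h = h
bounded-pred-suc (zero ∷ rs) n (u , v) (h , h') = bounded-pred-suc rs n u h , bounded-pred-suc rs n v h'
bounded-pred-suc (suc r ∷ rs) n (u , v) (h , h') = bounded-pred-suc rs n u h , bounded-pred rs (suc n ∸ r) v h'

-- The coefficient of the product of all k variables.
leading : ∀ k → Alg.Carrier (Λ₀ k) → ℚ
leading zero x = x
leading (suc k) (u , v) = leading k v

leading-bounded : ∀ {k} (rs : Vec ℕ k) n x → Vec.sum rs ℕ.< n → Bounded rs n x → leading k x ≡ 0ℚ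
leading-bounded [] (suc n) x p h = h
leading-bounded (r ∷ rs) n (u , v) p (h , h') = leading-bounded rs (n ∸ r) v (m+n≤o⇒m≤o∸n (suc (Vec.sum rs)) (subst (ℕ._≤ n) (cong suc (ℕₚ.+-comm r (Vec.sum rs))) p)) h'

freeRows-bounded : ∀ {k} (rs : Vec ℕ k) → All (λ p → 1 ℕ.≤ proj₂ p → Bounded rs 1 (codeHeight 0ℚ k (proj₁ p))) (freeRows rs)
freeRows-bounded [] = []
freeRows-bounded {suc k} (r ∷ rs) = (λ { (s≤s {n = r'} _) → bounded-neg (r ∷ rs) 1 (D.0# k , D.1# k) (bounded-0 rs 1 , subst (λ z → Bounded rs z (D.1# k)) (sym (0∸n≡0 r')) (bounded-any rs (D.1# k))) })
  ∷ Allₚ.map⁺ (All.map (λ {(c , r')} h p → subst (Bounded (r ∷ rs) 1) (sym (bump-height 0ℚ k c)) (h p , bounded-0 rs (1 ∸ r))) (freeRows-bounded rs))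

freeRows-square : ∀ {k} (rs : Vec ℕ k) → All (λ p → D._*_ k (codeHeight 0ℚ k (proj₁ p)) (codeHeight 0ℚ k (proj₁ p)) ≡ D.0# k) (freeRows rs)
freeRows-square [] = []
freeRows-square {suc k} (r ∷ rs) = (let open Ring (Λ₀ k) in cong₂ _,_ (solve 0 (:- :0 :* :- :0 := :0) refl)
    (cong (λ z → - 0# * - 1# + - 1# * - 0# + z * (- 1# * - 1#)) ι-0 ∙ solve 0 (:- :0 :* :- :1 :+ :- :1 :* :- :0 :+ :0 :* (:- :1 :* :- :1) := :0) refl))
  ∷ Allₚ.map⁺ (All.map (λ {(c , r')} h → let open Ring (Λ₀ k) in cong (λ z → D._*_ (suc k) z z) (bump-height 0ℚ k c) ∙
      cong₂ _,_ h (solve 2 (λ a e → a :* :0 :+ :0 :* a :+ e :* (:0 :* :0) := :0) refl (codeHeight 0ℚ k c) (ι 0ℚ))) (freeRows-square rs))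

module LimitWorld (k : ℕ) where
  open Ring (Λ₀ k)
  open Series (Λ₀ k) using (nat-suc; nat-0)
  open RowForm (Λ₀ k) (ι (ℚ.- 1ℚ)) 1# using (colsB)

  g : Carrier
  g = ι (ℚ.- 1ℚ)

  g≡ : g ≡ - 1#
  g≡ = ι-neg 1ℚ ∙ (cong -_ ι-1)

  -- (1)^{(i)} / (i! γ^i) at γ = -1 vanishes for i ≥ 2
  α : ℕ → Carrier
  α 0 = 1#
  α 1 = - 1#
  α (suc (suc i)) = 0#

  α-suc : ∀ i → nat (suc i) * g * α (suc i) ≡ (1# + nat i * g) * α i
  α-suc 0 = cong₂ (λ a b → a * b * - 1#) (nat-suc 0 ∙ cong (1# +_) nat-0) g≡ ∙
    solve 1 (λ g → (:1 :+ :0) :* :- :1 :* :- :1 := (:1 :+ :0 :* g) :* :1) refl g ∙ cong (λ a → (1# + a * g) * 1#) (sym nat-0)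
  α-suc 1 = solve 1 (λ a → a :* :0 := (:1 :+ (:1 :+ :0) :* :- :1) :* :- :1) refl (nat 2 * g) ∙
    cong₂ (λ a b → (1# + a * b) * - 1#) (sym (nat-suc 0 ∙ cong (1# +_) nat-0)) (sym g≡)
  α-suc (suc (suc i)) = zeroʳ _ ∙ sym (zeroʳ _)

  varRows : Vec ℕ k → List (Carrier × ℕ)
  varRows rs = codeRows 0ℚ k (freeRows rs)

  varRows-square : ∀ rs → All (λ p → proj₁ p * proj₁ p ≡ 0#) (varRows rs)
  varRows-square rs = Allₚ.map⁺ (freeRows-square rs)

  strip-varRows : ∀ rs → strip (varRows rs) ≡ varRows (Vec.map ℕ.pred rs)
  strip-varRows rs = strip-codeRows 0ℚ k (freeRows rs) ∙ cong (codeRows 0ℚ k) (strip-freeRows rs)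

  lead-All : ∀ {P : Carrier → Set} L → All (λ p → 1 ℕ.≤ proj₂ p → P (proj₁ p)) L → All P (lead L)
  lead-All [] [] = []
  lead-All ((B , zero) ∷ L) (h ∷ hs) = []
  lead-All ((B , suc r) ∷ L) (h ∷ hs) = h (s≤s z≤n) ∷ lead-All L hs

  colsB-All : ∀ {P : Carrier → Set} m x L → All (λ p → P (proj₁ p)) L → All (All P) (map proj₂ (colsOf m x L))
  colsB-All zero x L h = []
  colsB-All (suc m) x L h = lead-All L (All.map (λ p _ → p) h) ∷ colsB-All m (suc x) (strip L) (Allₚ.map⁺ h)

  limitWorld : ℕ → Vec ℕ k → World
  limitWorld m rs = record { alg = Λ₀ k ; g = g ; A = 1# ; α = α ; α-zero = refl ; α-suc = α-suc ; cols = colsB m (varRows rs)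
    ; cond = All.map (All.map (λ {B} h → cong (λ z → B * (1# + B + z)) g≡ ∙ solve 1 (λ b → b :* (:1 :+ b :+ :- :1) := b :* b) refl B ∙ h))
        (colsB-All m 0 (varRows rs) (varRows-square rs)) }

  module _ (W₀ : ℕ × Vec ℕ k) where
    private W = limitWorld (proj₁ W₀) (proj₂ W₀)
    open Recursion W using (C; r; δ; dsum; dsum-last; dsum-cong; dsum-0; partition; f̂; Z; quot; conv; conv-cong; conv-comm; conv-δˡ; conv-cancel; f̂-Z; Z-zero; deriv)

    -- `α 0` = 1 and `α 1` = -1 are the only nonzero values of α, so the column operator becomes a
    -- two-term recursion.
    C-two : ∀ β (q : ℕ → Carrier) n → C β q (suc n) ≡ q (suc n) + (nat n + - β) * q n
    C-two β q n = dsum-last t n ∙ cong (_+ t (suc n) 0) (second n) ∙ solve 4 (λ p q b n → q :* ((b :+ n :* :- :1) :* :1 :* :- :1) :+ p :* (:1 :* :1) := p :+ (n :+ :- b) :* q) refl (q (suc n)) (q n) β (nat n) ∙ refl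
      where
      t : ℕ → ℕ → Carrier
      t j i = q j * (r β j i * α i)
      second : ∀ n → dsum (λ j i → t j (suc i)) n ≡ q n * ((β + nat n * - 1#) * 1# * - 1#)
      second zero = cong (λ z → q 0 * ((β + nat 0 * z) * 1# * - 1#)) g≡
      second (suc n) = dsum-last (λ j i → t j (suc i)) n ∙ cong₂ _+_
        (dsum-cong (λ j i → solve 2 (λ a b → a :* (b :* :0) := :0) refl (q j) (r β j (suc (suc i)))) n ∙ dsum-0 n)
        (cong (λ z → q (suc n) * ((β + nat (suc n) * z) * 1# * - 1#)) g≡) ∙ +-identityˡ _

    bounded-sum : ∀ (rs : Vec ℕ k) (Bs : List Carrier) → All (Bounded rs 1) Bs → Bounded rs 1 (sumL (Λ₀ k) Bs)
    bounded-sum rs [] [] = bounded-0 rs 1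
    bounded-sum rs (B ∷ Bs) (h ∷ hs) = bounded-+ rs 1 B _ h (bounded-sum rs Bs hs)

    -- Removing the first column shortens the rows by one. Of the three terms from `C-two`, the
    -- first keeps its index, the second gains one from the shorter rows, unless n = 0, when its
    -- factor n vanishes, and the third gains one from β, a combination of variables of rows of
    -- positive length.
    bounded-partition : ∀ m x (rs : Vec ℕ k) n → Bounded rs n (partition (map proj₂ (colsOf m x (varRows rs))) n)
    bounded-partition m x rs zero = bounded-any rs _
    bounded-partition zero x rs (suc n) = bounded-0 rs (suc n)
    bounded-partition (suc m) x rs (suc n) = subst (Bounded rs (suc n)) (sym (C-two β q n ∙ solve 4 (λ a n b c → a :+ (n :+ :- b) :* c := a :+ n :* c :+ :- b :* c) refl (q (suc n)) (nat n) β (q n)))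
      (bounded-+ rs (suc n) _ _ (bounded-+ rs (suc n) _ _ (bounded-pred rs (suc n) (q (suc n)) (IH (suc n))) (counted n (IH n)))
        (bounded-* rs 1 n (- β) (q n) (bounded-neg rs 1 β (bounded-sum rs (lead (varRows rs)) (lead-All {Bounded rs 1} (varRows rs) (Allₚ.map⁺ (freeRows-bounded rs))))) (bounded-pred rs n (q n) (IH n))))
      where
      β = sumL (Λ₀ k) (lead (varRows rs))
      q = partition (map proj₂ (colsOf m (suc x) (strip (varRows rs))))
      IH : ∀ n → Bounded (Vec.map ℕ.pred rs) n (q n)
      IH n = subst (λ L → Bounded (Vec.map ℕ.pred rs) n (partition (map proj₂ (colsOf m (suc x) L)) n)) (sym (strip-varRows rs)) (bounded-partition m (suc x) (Vec.map ℕ.pred rs) n)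
      counted : ∀ n → Bounded (Vec.map ℕ.pred rs) n (q n) → Bounded rs (suc n) (nat n * q n)
      counted zero h = subst (Bounded rs 1) (sym (cong (_* q 0) nat-0 ∙ zeroˡ _)) (bounded-0 rs 1)
      counted (suc n) h = bounded-* rs 0 (suc (suc n)) (nat (suc n)) (q (suc n)) (bounded-any rs _) (bounded-pred-suc rs n (q (suc n)) h)

    -- The bound is multiplicative and so survives long division; j counts the coefficients already
    -- split off.
    bounded-quot : ∀ (rs : Vec ℕ k) j n (P Y : ℕ → Carrier) → (∀ m → Bounded rs (m ℕ.+ j) (P m)) → (∀ m → Bounded rs m (Y m)) → Bounded rs (n ℕ.+ j) (quot P Y n)
    bounded-quot rs j zero P Y hP hY = hP 0
    bounded-quot rs j (suc n) P Y hP hY = subst (λ z → Bounded rs z (quot P′ Y n)) (ℕₚ.+-suc n j)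
      (bounded-quot rs (suc j) n P′ Y (λ m → bounded-+ rs (m ℕ.+ suc j) _ _ (subst (λ z → Bounded rs z (P (suc m))) (sym (ℕₚ.+-suc m j)) (hP (suc m)))
        (bounded-neg rs (m ℕ.+ suc j) _ (subst (λ z → Bounded rs z (P 0 * Y (suc m))) (ℕₚ.+-suc j m ∙ cong suc (ℕₚ.+-comm j m) ∙ sym (ℕₚ.+-suc m j)) (bounded-* rs j (suc m) (P 0) (Y (suc m)) (hP 0) (hY (suc m)))))) hY)
      where P′ = λ m → P (suc m) + - (P 0 * Y (suc m))

    bounded-f̂ : ∀ n → Bounded (proj₂ W₀) n (f̂ n)
    bounded-f̂ n = subst (λ z → Bounded rs z (f̂ n)) (ℕₚ.+-identityʳ n) (bounded-quot rs 0 n (λ m → - (g * deriv Z m)) Z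
      (λ m → bounded-neg rs (m ℕ.+ 0) _ (bounded-* rs 0 (m ℕ.+ 0) g _ (bounded-any rs g) (bounded-* rs 0 (m ℕ.+ 0) (nat m) (Z m) (bounded-any rs _) (subst (λ z → Bounded rs z (Z m)) (sym (ℕₚ.+-identityʳ m)) (hZ m))))) hZ)
      where
      rs = proj₂ W₀
      hZ : ∀ m → Bounded rs m (Z m)
      hZ = bounded-partition (proj₁ W₀) 0 rs

    leading-f̂ : ∀ n → Vec.sum (proj₂ W₀) ℕ.< n → leading k (f̂ n) ≡ 0ℚ
    leading-f̂ n p = leading-bounded (proj₂ W₀) n (f̂ n) p (bounded-f̂ n)

module _ (k : ℕ) where
  open Ring (Λ₀ k)
  open Sums (Λ₀ k)
  open Evaluation (Λ₀ k)
  open LimitWorld k using (g; g≡; varRows; varRows-square; limitWorld)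
  open RowModel (Λ₀ k) g
  open RowForm (Λ₀ k) g 1#
  open Fubini (Λ₀ k)

  private
    infixr 8 _^ℚ_
    _^ℚ_ : ℚ → ℕ → ℚ
    _^ℚ_ = Alg._^#_ ℚAlg

    excess : List (ℕ × ℕ) → ℕ
    excess = weight (λ (e , m) → 2 ℕ.* m)

    weight-excess : ∀ es → weight powerWeight es ≡ weight (2 ℕ.+_) (map proj₁ es) ℕ.+ excess es
    weight-excess [] = refl
    weight-excess ((e , m) ∷ es) = cong (e ℕ.+ 2 ℕ.* suc m ℕ.+_) (weight-excess es) ∙ lem e m (weight (2 ℕ.+_) (map proj₁ es)) (excess es)
      where
      lem : ∀ e m a b → e ℕ.+ 2 ℕ.* suc m ℕ.+ (a ℕ.+ b) ≡ 2 ℕ.+ e ℕ.+ a ℕ.+ (2 ℕ.* m ℕ.+ b)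
      lem = solve-∀

    boxPowers : ℕ × ℕ → Carrier × Carrier → Carrier
    boxPowers (e , m) b = (proj₁ b ^# suc m) * (proj₂ b ^# e)

    -- ω² = 0 in the limit, so the power sums with m ≥ 1 vanish. The power 2m of 0 records this and
    -- is 1 for m = 0; its exponent is the excess in degree over the power sum without the
    -- additional factors ω.
    rowForm-excess : ∀ e m β L → All (λ p → proj₁ p * proj₁ p ≡ 0#) L → rowForm (boxPowers (e , m)) β L ≡ ι (0ℚ ^ℚ (2 ℕ.* m)) * rowForm (boxPower e) β L
    rowForm-excess e m β [] [] = sym (zeroʳ _)
    rowForm-excess e m β ((B , r) ∷ L) (h ∷ hs) = cong₂ _+_ (sums m 0 r) (rowForm-excess e m (β + B) L hs) ∙ sym (distribˡ _ _ _)
      where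
      term : ∀ m x → boxPowers (e , m) (box x (B , β)) ≡ ι (0ℚ ^ℚ (2 ℕ.* m)) * boxPower e (box x (B , β))
      term zero x = solve 2 (λ w c → w :* :1 :* c := :1 :* (w :* c)) refl (- (1# * B)) _ ∙ cong (_* boxPower e (box x (B , β))) (sym ι-1)
      term (suc m) x = solve 3 (λ b p c → :- (:1 :* b) :* (:- (:1 :* b) :* p) :* c := b :* b :* (p :* c)) refl B ((- (1# * B)) ^# m) _ ∙
        cong (_* (((- (1# * B)) ^# m) * (proj₂ (box x (B , β)) ^# e))) h ∙ zeroˡ _ ∙ sym (cong (_* boxPower e (box x (B , β))) (cong ι (ℚₚ.*-zeroˡ (0ℚ ^ℚ (m ℕ.+ suc (m ℕ.+ 0)))) ∙ ι-0) ∙ zeroˡ _)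
      sums : ∀ m x r → rowSum (λ k → boxPowers (e , m) (box k (B , β))) x r ≡ ι (0ℚ ^ℚ (2 ℕ.* m)) * rowSum (λ k → boxPower e (box k (B , β))) x r
      sums m x zero = sym (zeroʳ _)
      sums m x (suc r) = cong₂ _+_ (term m x) (sums m (suc x) r) ∙ sym (distribˡ _ _ _)

    Π-excess : ∀ (P : ℕ × ℕ → Carrier) (T : ℕ → Carrier) → (∀ e m → P (e , m) ≡ ι (0ℚ ^ℚ (2 ℕ.* m)) * T e) → ∀ es → Π# P es ≡ ι (0ℚ ^ℚ excess es) * Π# T (map proj₁ es)
    Π-excess P T h [] = sym (*-identityˡ 1#) ∙ cong (_* 1#) (sym ι-1)
    Π-excess P T h ((e , m) ∷ es) = cong₂ _*_ (h e m) (Π-excess P T h es) ∙ solve 4 (λ a b c d → a :* b :* (c :* d) := a :* c :* (b :* d)) refl _ _ _ _ ∙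
      cong (_* (T e * Π# T (map proj₁ es))) (sym (ι-* _ _) ∙ cong ι (sym (Sums.^#-+ ℚAlg 0ℚ (2 ℕ.* m) (excess es))))

  -- At ε = 0 the factor ε^{n+1-deg} discards the monomials in which some ω occurs squared, which are zero in the limit world as well.
  limit-model : ∀ m rs → Decreasing m (freeRows rs) → ∀ n → codeModel 0ℚ k (ℚ.- 1ℚ) 0ℚ (suc n) (freeRows rs) (mapsMonomials n) ≡ Recursion.f̂ (limitWorld m rs) n
  limit-model m rs d n = sym (proj₂ (proj₂ (Universal.rep-f̂ n)) W ∙ ΣL-congAll term (proj₁ (proj₂ (Universal.rep-f̂ n))) ∙ sym (ΣL-map (evalM g T) (scaleM 0ℚ (suc n)) (mapsMonomials n) ∙ ΣL-map (λ μ → evalM g T (scaleM 0ℚ (suc n) μ)) forget (seriesMonomials n)))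
    where
    W = limitWorld m rs
    P = powerSum (Λ₀ k) (Recursion.bxs W)
    T = rowPower (varRows rs)
    P-T : ∀ e j → P (e , j) ≡ ι (0ℚ ^ℚ (2 ℕ.* j)) * T e
    P-T e j = ΣL-cong {h = boxPowers (e , j)} (λ { (ω , c) → refl }) (Recursion.bxs W) ∙ cong (ΣL (boxPowers (e , j))) (boxesOf-boxesB W (World.cols W)) ∙
      ΣL-boxes-rows (boxPowers (e , j)) m (varRows rs) (Decreasing-map (codeHeight 0ℚ k) d) ∙ rowForm-excess e j 0# (varRows rs) (varRows-square rs)
    term : ∀ μ → degree powerWeight μ ℕ.+ 0 ≡ suc n → evalM g P μ ≡ evalM g T (scaleM 0ℚ (suc n) (forget μ))
    term μ e = cong (λ z → ι (coef μ) * ((g ^# gpow μ) * z)) (Π-excess P T P-T (fac μ)) ∙ solve 4 (λ a b c d → a :* (b :* (c :* d)) := (a :* c) :* (b :* d)) refl _ _ _ _ ∙ cong (_* ((g ^# gpow μ) * Π# T (map proj₁ (fac μ)))) (sym (ι-* _ _) ∙ cong (λ z → ι (coef μ ℚ.* (0ℚ ^ℚ z))) (sym δ))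
      where
      δ : suc n ∸ boxDegree (forget μ) ≡ excess (fac μ)
      δ = cong (_∸ boxDegree (forget μ)) (sym e ∙ ℕₚ.+-identityʳ _ ∙ cong (gpow μ ℕ.+_) (weight-excess (fac μ)) ∙ sym (ℕₚ.+-assoc (gpow μ) _ _)) ∙
        m+n∸m≡n (boxDegree (forget μ)) (excess (fac μ))

  mapsModel-vanishes : ∀ m rs → Decreasing m (freeRows rs) → ∀ n → Vec.sum rs ℕ.< n → leading k (codeModel 0ℚ k (ℚ.- 1ℚ) 0ℚ (suc n) (freeRows rs) (mapsMonomials n)) ≡ 0ℚ
  mapsModel-vanishes m rs d n p = cong (leading k) (limit-model m rs d n) ∙ LimitWorld.leading-f̂ k (m , rs) n p

mapsMonomials-degree : ∀ n → All (λ m → boxDegree m ℕ.≤ suc n) (mapsMonomials n)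
mapsMonomials-degree n = Allₚ.map⁺ (All.map (λ {μ} e → ≤-trans (ℕₚ.+-monoʳ-≤ (gpow μ) (light (fac μ))) (≤-reflexive (sym (ℕₚ.+-identityʳ _) ∙ e))) (proj₁ (proj₂ (Universal.rep-f̂ n))))
  where
  light : ∀ es → weight (2 ℕ.+_) (map proj₁ es) ℕ.≤ weight powerWeight es
  light [] = z≤n
  light ((e , m) ∷ es) = ℕₚ.+-mono-≤ (≤-trans (≤-reflexive (ℕₚ.+-comm 2 e)) (ℕₚ.+-monoʳ-≤ e (ℕₚ.*-monoʳ-≤ 2 (s≤s z≤n)))) (light es)

-- The limit of F_n on a single row of n boxes

module SingleRow (N : ℕ) where
  open LimitWorld 1
  open Permanent ℚAlg power using (fact)
  open Series ℚAlg using (δ)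
  private
    module R = Alg (Λ₀ 1)
    module Q = Ring ℚAlg
    open Q using (solve; _:=_; _:+_; _:*_; :-_; :0; :1)
    n = suc N
    W₀ : ℕ × Vec ℕ 1
    W₀ = n , (n ∷ [])
    W = limitWorld n (n ∷ [])
    open Recursion W using (partition; C; Z; Z-zero; f̂; f̂-Z; conv; conv-cong; conv-comm; conv-δˡ; conv-cancel; deriv; dsum-cong)
    module S = Series (Λ₀ 1)

    B : R.Carrier
    B = R.- (0ℚ , 1ℚ)

    z : ℕ → ℕ → R.Carrier
    z r = partition (List.replicate r (B ∷ []))

    singleCols : ∀ x r → map proj₂ (colsOf r x (varRows (r ∷ []))) ≡ List.replicate r (B ∷ [])
    singleCols x zero = refl
    singleCols x (suc r) = cong ((B ∷ []) ∷_) (singleCols (suc x) r)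

    -- The coefficient of w in Z for one row of r boxes; in closed form (m-1)! times the binomial
    -- coefficient of r over m, for m ≥ 1.
    coefficient : ℕ → ℕ → ℚ
    coefficient zero m = 0ℚ
    coefficient (suc r) zero = 0ℚ
    coefficient (suc r) (suc m) = coefficient r (suc m) ℚ.+ (ratℕ m ℚ.* coefficient r m ℚ.+ δ m)

    z-coefficient : ∀ r m → z r m ≡ (δ m , coefficient r m)
    z-coefficient zero zero = refl
    z-coefficient zero (suc m) = refl
    z-coefficient (suc r) zero = cong (λ a → a R.* (R.1# R.* R.1#)) (z-coefficient r 0) ∙ cong₂ _,_ (solve 0 (:1 :* (:1 :* :1) := :1) refl) (zeroth r)
      where
      zeroth : ∀ r → 1ℚ ℚ.* (1ℚ ℚ.* 0ℚ ℚ.+ 0ℚ ℚ.* 1ℚ ℚ.+ 0ℚ ℚ.* (0ℚ ℚ.* 0ℚ)) ℚ.+ coefficient r 0 ℚ.* (1ℚ ℚ.* 1ℚ) ℚ.+ 0ℚ ℚ.* (coefficient r 0 ℚ.* (1ℚ ℚ.* 0ℚ ℚ.+ 0ℚ ℚ.* 1ℚ ℚ.+ 0ℚ ℚ.* (0ℚ ℚ.* 0ℚ))) ≡ 0ℚ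
      zeroth zero = refl
      zeroth (suc r) = refl
    z-coefficient (suc r) (suc m) = C-two W₀ (B R.+ R.0#) (z r) m ∙ cong₂ (λ a b → a R.+ (R.nat m R.+ R.- (B R.+ R.0#)) R.* b) (z-coefficient r (suc m)) (z-coefficient r m) ∙
      cong₂ _,_ (solve 2 (λ n d → :0 :+ (n :+ :- (:- :0 :+ :0)) :* d := n :* d) refl (ratℕ m) (δ m) ∙ vanish m)
        (solve 4 (λ p n d q → p :+ ((n :+ :- (:- :0 :+ :0)) :* q :+ (:0 :+ :- (:- :1 :+ :0)) :* d :+ :0 :* ((:0 :+ :- (:- :1 :+ :0)) :* q)) := p :+ (n :* q :+ d)) refl (coefficient r (suc m)) (ratℕ m) (δ m) (coefficient r m))
      where
      vanish : ∀ m → ratℕ m ℚ.* δ m ≡ 0ℚ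
      vanish zero = cong (ℚ._* 1ℚ) ratℕ-0 ∙ ℚₚ.*-zeroˡ 1ℚ
      vanish (suc m) = ℚₚ.*-zeroʳ (ratℕ (suc m))

    coefficient-high : ∀ r m → r ℕ.< m → coefficient r m ≡ 0ℚ
    coefficient-high zero m p = refl
    coefficient-high (suc r) (suc (suc m)) (s≤s p) = cong₂ (λ a b → a ℚ.+ (ratℕ (suc m) ℚ.* b ℚ.+ 0ℚ)) (coefficient-high r (suc (suc m)) (m≤n⇒m≤1+n p)) (coefficient-high r (suc m) p) ∙
      solve 1 (λ n → :0 :+ (n :* :0 :+ :0) := :0) refl (ratℕ (suc m))

    coefficient-top : ∀ r → coefficient (suc r) (suc r) ≡ fact r
    coefficient-top zero = cong (λ c → 0ℚ ℚ.+ (c ℚ.* 0ℚ ℚ.+ 1ℚ)) ratℕ-0 ∙ refl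
    coefficient-top (suc r) = cong₂ (λ a b → a ℚ.+ (ratℕ (suc r) ℚ.* b ℚ.+ 0ℚ)) (coefficient-high (suc r) (suc (suc r)) ≤-refl) (coefficient-top r) ∙
      solve 1 (λ x → :0 :+ (x :+ :0) := x) refl (ratℕ (suc r) ℚ.* fact r)

    F : ℕ → R.Carrier
    F m = 0ℚ , ratℕ m ℚ.* coefficient n m

    f̂-F : ∀ m → f̂ m ≡ F m
    f̂-F = conv-cancel f̂ F Z Z-zero λ m → f̂-Z m ∙ lhs m ∙ sym (dsum-cong absorb m ∙ conv-comm F S.δ m ∙ conv-δˡ F m)
      where
      Z-value : ∀ m → Z m ≡ (δ m , coefficient n m)
      Z-value m = cong (λ cs → partition cs m) (singleCols 0 n) ∙ z-coefficient n m
      -- w² = 0, so a multiple of w sees only the part of Z free of w, which is δ.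
      absorb : ∀ i j → F i R.* Z j ≡ F i R.* S.δ j
      absorb i j = cong (F i R.*_) (Z-value j) ∙ cong₂ _,_ refl (solve 3 (λ f d c → :0 :* c :+ f :* d :+ :0 :* (f :* c) := :0 :* :0 :+ f :* d :+ :0 :* (f :* :0)) refl (ratℕ i ℚ.* coefficient n i) (δ j) (coefficient n j)) ∙ cong (F i R.*_) (sym (δ-pair j))
        where
        δ-pair : ∀ j → S.δ j ≡ (δ j , 0ℚ)
        δ-pair zero = refl
        δ-pair (suc j) = refl
      lhs : ∀ m → R.- (g R.* deriv Z m) ≡ F m
      lhs m = cong₂ (λ a b → R.- (a R.* (R.nat m R.* b))) g≡ (Z-value m) ∙ cong₂ _,_
        (solve 2 (λ n d → :- (:- :1 :* (n :* d)) := n :* d) refl (ratℕ m) (δ m) ∙ vanish m)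
        (solve 3 (λ n c d → :- (:- :1 :* (n :* c :+ :0 :* d :+ :0 :* (:0 :* c)) :+ :- :0 :* (n :* d) :+ :0 :* (:- :0 :* (n :* c :+ :0 :* d :+ :0 :* (:0 :* c)))) := n :* c) refl (ratℕ m) (coefficient n m) (δ m))
        where
        vanish : ∀ m → ratℕ m ℚ.* δ m ≡ 0ℚ
        vanish zero = cong (ℚ._* 1ℚ) ratℕ-0 ∙ ℚₚ.*-zeroˡ 1ℚ
        vanish (suc m) = ℚₚ.*-zeroʳ (ratℕ (suc m))

  -- The coefficient of w in Z is (n-1)! at index n, and the logarithmic derivative multiplies it by
  -- n. This supplies the point that the vanishing argument misses for monomials with one factor.
  singleRow-leading : leading 1 (codeModel 0ℚ 1 (ℚ.- 1ℚ) 0ℚ (suc n) (freeRows (n ∷ [])) (mapsMonomials n)) ≡ fact n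
  singleRow-leading = cong (leading 1) (limit-model 1 n (n ∷ []) (≤-refl ∷ []) n) ∙ cong (leading 1) (f̂-F n) ∙ cong (ratℕ n ℚ.*_) (coefficient-top N)

-- The coefficient of w₁⋯w_k as a permanent

first : ∀ k → Hom (Λ₀ (suc k)) (Λ₀ k)
first k = record { ⟦_⟧ = proj₁ ; hom-+ = λ _ _ → refl ; hom-* = λ _ _ → refl ; hom-neg = λ _ → refl ; hom-ι = λ _ → refl }

constant : ∀ k → Hom (Λ₀ k) ℚAlg
constant zero = record { ⟦_⟧ = id ; hom-+ = λ _ _ → refl ; hom-* = λ _ _ → refl ; hom-neg = λ _ → refl ; hom-ι = λ _ → refl }
constant (suc k) = record { ⟦_⟧ = λ x → ⟦ proj₁ x ⟧ ; hom-+ = λ x y → hom-+ _ _ ; hom-* = λ x y → hom-* _ _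
  ; hom-neg = λ x → hom-neg _ ; hom-ι = hom-ι }
  where open Hom (constant k)

leading-+ : ∀ k x y → leading k (Alg._+_ (Λ₀ k) x y) ≡ leading k x ℚ.+ leading k y
leading-+ zero x y = refl
leading-+ (suc k) x y = leading-+ k _ _

leading-0 : ∀ k → leading k (Alg.0# (Λ₀ k)) ≡ 0ℚ
leading-0 zero = refl
leading-0 (suc k) = leading-0 k

leading-Σ : ∀ k {X : Set} (f : X → Alg.Carrier (Λ₀ k)) xs → leading k (Sums.ΣL (Λ₀ k) f xs) ≡ Sums.ΣL ℚAlg (λ x → leading k (f x)) xs
leading-Σ k f [] = leading-0 k
leading-Σ k f (x ∷ xs) = leading-+ k (f x) _ ∙ cong (leading k (f x) ℚ.+_) (leading-Σ k f xs)

powerTotal : ℕ → ℕ → ℚ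
powerTotal e zero = 0ℚ
powerTotal e (suc r) = powerTotal e r ℚ.+ ratℕ (suc r) ^ e

module _ (R : Alg) where
  open Ring R
  open Sums R
  open Dual R 0ℚ

  -- Leibniz's rule: the coefficient of w in a product takes the w-part of one factor and the
  -- constant parts of the others.
  dual-Π : ∀ {E : Set} (T : E → DC) es → Sums.Π# dual T es ≡ (Π# (λ e → proj₁ (T e)) es , ΣL (λ (e , r) → proj₂ (T e) * Π# (λ e → proj₁ (T e)) r) (sel es))
  dual-Π T [] = refl
  dual-Π T (e ∷ es) = cong (T e *ᵈ_) (dual-Π T es) ∙ cong (u e * Π# u es ,_) (cong (λ z → u e * S + v e * Π# u es + z * (v e * S)) ι-0 ∙ solve 3 (λ a b c → a :+ b :+ :0 :* c := b :+ a) refl (u e * S) (v e * Π# u es) (v e * S) ∙ cong (v e * Π# u es +_) (sym (ΣL-* (u e) _ (sel es)) ∙ ΣL-cong (λ (a , r) → solve 3 (λ x y z → x :* (y :* z) := y :* (x :* z)) refl (u e) (v a) (Π# u r)) (sel es)) ∙ sym (Permanent.Σsel-∷ R {X = ⊤} (λ _ _ → 0#) _ e es))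
    where
    u = λ e → proj₁ (T e)
    v = λ e → proj₂ (T e)
    S = ΣL (λ (a , r) → v a * Π# u r) (sel es)

limitPower : ∀ {k} → Vec ℕ k → ℕ → Alg.Carrier (Λ₀ k)
limitPower {k} rs = RowModel.rowPower (Λ₀ k) (LimitWorld.g k) (LimitWorld.varRows k rs)

module _ (k : ℕ) where
  open Ring (Λ₀ k)
  open RowModel (Λ₀ k) (LimitWorld.g k)
  open RowForm (Λ₀ k) (LimitWorld.g k) 1#
  open Fubini (Λ₀ k)
  private
    module Dₛ = Alg (Λ₀ (suc k))
    c = Hom.⟦_⟧ (constant k)
    module C = Hom (constant k)

  -- Setting the first variable to 0 gives its row the height 0, and such a row contributes nothing.
  limitPower-first : ∀ r (rs : Vec ℕ k) e → proj₁ (limitPower (r ∷ rs) e) ≡ limitPower rs e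
  limitPower-first r rs e = HomProperties.hom-rowForm (first k) e refl Dₛ.0# 0# refl (LimitWorld.varRows (suc k) (r ∷ rs)) ∙
    cong₂ _+_ (empty 0 r) (cong₂ (rowForm _) (solve 0 (:0 :+ :- :0 := :0) refl) shifted) ∙ +-identityˡ _
    where
    empty : ∀ x r → rowSum (λ k → boxPower e (box k (- 0# , 0#))) x r ≡ 0#
    empty x zero = refl
    empty x (suc r) = cong₂ _+_ (solve 1 (λ c → :- (:1 :* :- :0) :* c := :0) refl (proj₂ (box x (- 0# , 0#)) ^# e)) (empty (suc x) r) ∙ +-identityˡ 0#
    shifted : map (λ (B , r) → proj₁ B , r) (map (λ (c , r) → codeHeight 0ℚ (suc k) c , r) (map (λ (c , r) → bump c , r) (freeRows rs))) ≡ LimitWorld.varRows k rs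
    shifted = sym (Listₚ.map-∘ _) ∙ sym (Listₚ.map-∘ _) ∙ Listₚ.map-cong (λ (c , r) → cong (λ z → proj₁ z , r) (bump-height 0ℚ k c)) _

constant-height : ∀ {k} (rs : Vec ℕ k) → All (λ p → Hom.⟦_⟧ (constant k) (codeHeight 0ℚ k (proj₁ p)) ≡ 0ℚ) (freeRows rs)
constant-height [] = []
constant-height {suc k} (r ∷ rs) = hom-neg 0# ∙ cong ℚ.-_ hom-0
  ∷ Allₚ.map⁺ (All.map (λ {(c , r')} h → cong (λ z → ⟦ proj₁ z ⟧) (bump-height 0ℚ k c) ∙ h) (constant-height rs))
  where
  open Hom (constant k)
  open Alg (Λ₀ k) using (0#)

module _ (k : ℕ) where
  open Alg (Λ₀ (suc k))
  open RowModel (Λ₀ (suc k)) (LimitWorld.g (suc k))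
  open RowForm (Λ₀ (suc k)) (LimitWorld.g (suc k)) 1#
  open Fubini (Λ₀ (suc k))
  open Hom (constant k)
  private
    module R = Alg (Λ₀ k)
    module Q = Ring ℚAlg
    module Cₛ = Hom (constant (suc k))

    slope : Carrier → ℚ
    slope x = ⟦ proj₂ x ⟧

    slope-* : ∀ x y → slope (x * y) ≡ ⟦ proj₁ x ⟧ ℚ.* slope y ℚ.+ slope x ℚ.* ⟦ proj₁ y ⟧
    slope-* (u , v) (u' , v') = hom-+ _ _ ∙ cong₂ ℚ._+_ (hom-+ _ _ ∙ cong₂ ℚ._+_ (hom-* u v') (hom-* v u'))
      (hom-* _ _ ∙ cong (ℚ._* ⟦ v R.* v' ⟧) (hom-ι 0ℚ) ∙ ℚₚ.*-zeroˡ ⟦ v R.* v' ⟧) ∙ ℚₚ.+-identityʳ _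

    slope-rowSum : ∀ h x r → slope (rowSum h x r) ≡ Fubini.rowSum ℚAlg (λ k → slope (h k)) x r
    slope-rowSum h x zero = hom-0
    slope-rowSum h x (suc r) = hom-+ _ _ ∙ cong (slope (h x) ℚ.+_) (slope-rowSum h (suc x) r)

    flat : Carrier → Set
    flat B = ⟦ proj₁ B ⟧ ≡ 0ℚ × slope B ≡ 0ℚ

    slope-flat : ∀ B y → flat B → slope (- (1# * B) * y) ≡ 0ℚ
    slope-flat B y (p , q) = slope-* _ y ∙ cong₂ (λ a b → a ℚ.* slope y ℚ.+ b ℚ.* ⟦ proj₁ y ⟧)
        (hom-neg _ ∙ cong ℚ.-_ (hom-* R.1# _ ∙ cong (⟦ R.1# ⟧ ℚ.*_) p ∙ ℚₚ.*-zeroʳ ⟦ R.1# ⟧))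
        (hom-neg _ ∙ cong ℚ.-_ (slope-* 1# B ∙ cong₂ (λ a b → ⟦ R.1# ⟧ ℚ.* a ℚ.+ ⟦ R.0# ⟧ ℚ.* b) q p ∙ Q.solve 2 (λ a b → a Q.:* Q.:0 Q.:+ b Q.:* Q.:0 Q.:= Q.:0) refl ⟦ R.1# ⟧ ⟦ R.0# ⟧)) ∙
      Q.solve 2 (λ a b → Q.:- Q.:0 Q.:* a Q.:+ Q.:- Q.:0 Q.:* b Q.:= Q.:0) refl (slope y) ⟦ proj₁ y ⟧

    slope-rowForm : ∀ e β L → All (λ p → flat (proj₁ p)) L → slope (rowForm (boxPower e) β L) ≡ 0ℚ
    slope-rowForm e β [] [] = hom-0
    slope-rowForm e β ((B , r) ∷ L) (h ∷ hs) = hom-+ _ _ ∙ cong₂ ℚ._+_ (slope-rowSum _ 0 r ∙ sums 0 r) (slope-rowForm e (β + B) L hs) ∙ ℚₚ.+-identityˡ 0ℚ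
      where
      sums : ∀ x r → Fubini.rowSum ℚAlg (λ k → slope (boxPower e (box k (B , β)))) x r ≡ 0ℚ
      sums x zero = refl
      sums x (suc r) = cong₂ ℚ._+_ (slope-flat B _ h) (sums (suc x) r) ∙ ℚₚ.+-identityˡ 0ℚ

    rowSum-last : ∀ (h : ℕ → ℚ) x r → Fubini.rowSum ℚAlg h x (suc r) ≡ Fubini.rowSum ℚAlg h x r ℚ.+ h (x ℕ.+ r)
    rowSum-last h x zero = ℚₚ.+-comm (h x) 0ℚ ∙ cong (λ z → 0ℚ ℚ.+ h z) (sym (ℕₚ.+-identityʳ x))
    rowSum-last h x (suc r) = cong (h x ℚ.+_) (rowSum-last h (suc x) r) ∙ sym (ℚₚ.+-assoc (h x) _ (h _)) ∙ cong (λ z → h x ℚ.+ Fubini.rowSum ℚAlg h (suc x) r ℚ.+ h z) (sym (ℕₚ.+-suc x r))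

  -- To first order in the first variable, and modulo the others, the boxes of the first row have
  -- weight w and contents 1, ..., r; every box of a later row has another variable as a factor.
  limitPower-slope : ∀ r (rs : Vec ℕ k) e → Hom.⟦_⟧ (constant k) (proj₂ (limitPower (r ∷ rs) e)) ≡ powerTotal e r
  limitPower-slope r rs e = hom-+ _ _ ∙ cong₂ ℚ._+_ (slope-rowSum h 0 r ∙ go r) (slope-rowForm e (0# + w) L flats) ∙ ℚₚ.+-identityʳ _
    where
    w : Carrier
    w = - (R.0# , R.1#)
    h = λ k → boxPower e (box k (w , 0#))
    L = map (λ (c , r) → codeHeight 0ℚ (suc k) c , r) _
    flats : All (λ p → flat (proj₁ p)) L
    flats = Allₚ.map⁺ (Allₚ.map⁺ (All.map (λ {(c , r')} p → cong (λ z → ⟦ proj₁ z ⟧) (bump-height 0ℚ k c) ∙ p , cong slope (bump-height 0ℚ k c) ∙ hom-0) (constant-height rs)))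
    value-h : ∀ x → slope (h x) ≡ ratℕ (suc x) ^ e
    value-h x = slope-* _ (y ^# e) ∙ cong₂ (λ a b → ⟦ a ⟧ ℚ.* slope (y ^# e) ℚ.+ ⟦ b ⟧ ℚ.* ⟦ proj₁ (y ^# e) ⟧) (Rk.solve 0 (Rk.:- (Rk.:1 Rk.:* Rk.:- Rk.:0) Rk.:= Rk.:0) refl) (Rk.solve 1 (λ z → Rk.:- (Rk.:1 Rk.:* Rk.:- Rk.:1 Rk.:+ Rk.:0 Rk.:* Rk.:- Rk.:0 Rk.:+ z Rk.:* (Rk.:0 Rk.:* Rk.:- Rk.:1)) Rk.:= Rk.:1) refl (R.ι 0ℚ)) ∙ cong₂ (λ a b → a ℚ.* slope (y ^# e) ℚ.+ b ℚ.* ⟦ proj₁ (y ^# e) ⟧) hom-0 hom-1 ∙ Q.solve 2 (λ a b → Q.:0 Q.:* a Q.:+ Q.:1 Q.:* b Q.:= b) refl (slope (y ^# e)) ⟦ proj₁ (y ^# e) ⟧ ∙ HomProperties.hom-^# (constant (suc k)) y e ∙ cong (Q._^# e) yc ∙ sym (^≡^# _ e)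
      where
      module Rk = Ring (Λ₀ k)
      y = proj₂ (box x (w , 0#))
      yc : Cₛ.⟦_⟧ y ≡ ratℕ (suc x)
      yc = Cₛ.hom-+ (1# * nat x + 0#) (- LimitWorld.g (suc k)) ∙ cong₂ ℚ._+_ (Cₛ.hom-+ (1# * nat x) 0# ∙ cong₂ ℚ._+_ (Cₛ.hom-* 1# (nat x) ∙ cong₂ ℚ._*_ Cₛ.hom-1 (Cₛ.hom-ι (ratℕ x))) Cₛ.hom-0) (Cₛ.hom-neg (LimitWorld.g (suc k)) ∙ cong ℚ.-_ (Cₛ.hom-ι (ℚ.- 1ℚ))) ∙
        Q.solve 1 (λ n → Q.:1 Q.:* n Q.:+ Q.:0 Q.:+ Q.:- Q.:- Q.:1 Q.:= Q.:1 Q.:+ n) refl (ratℕ x) ∙ sym (ratℕ-suc x)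
    go : ∀ r → Fubini.rowSum ℚAlg (λ k → slope (h k)) 0 r ≡ powerTotal e r
    go zero = refl
    go (suc r) = rowSum-last _ 0 r ∙ cong₂ ℚ._+_ (go r) (value-h r)

module RowPermanent = Permanent ℚAlg powerTotal

-- The k factors have no constant term, so the product of all k variables is reached only if each
-- factor supplies a different variable, to first order. The ways of distributing the variables make
-- up the permanent, and z enters by its constant term.
leading-Π : ∀ {k} (rs : Vec ℕ k) z es → length es ≡ k →
  leading k (Alg._*_ (Λ₀ k) z (Sums.Π# (Λ₀ k) (limitPower rs) es)) ≡ Hom.⟦_⟧ (constant k) z ℚ.* RowPermanent.Per es (Vec.toList rs)
-- Every factor lies in the ideal generated by the k variables, whose power k + 1 is zero.
leading-long : ∀ {k} (rs : Vec ℕ k) z es → k ℕ.< length es → leading k (Alg._*_ (Λ₀ k) z (Sums.Π# (Λ₀ k) (limitPower rs) es)) ≡ 0ℚ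

module _ (k : ℕ) where
  open Alg (Λ₀ k)
  open Sums (Λ₀ k)

  leading-step : ∀ r (rs : Vec ℕ k) (z : Alg.Carrier (Λ₀ (suc k))) es → leading (suc k) (Alg._*_ (Λ₀ (suc k)) z (Sums.Π# (Λ₀ (suc k)) (limitPower (r ∷ rs)) es)) ≡
    Sums.ΣL ℚAlg (λ (e , es') → leading k (proj₁ z * proj₂ (limitPower (r ∷ rs) e) * Π# (limitPower rs) es')) (sel es) ℚ.+ leading k (proj₂ z * Π# (limitPower rs) es)
  leading-step r rs (z₀ , z₁) es = cong (λ p → leading (suc k) (Alg._*_ (Λ₀ (suc k)) (z₀ , z₁) p)) (dual-Π (Λ₀ k) (limitPower (r ∷ rs)) es) ∙ cong (λ y → leading k (z₀ * S + z₁ * Π# u es + y)) (cong (_* (z₁ * S)) ι-0 ∙ zeroˡ _) ∙ cong (leading k) (+-identityʳ _) ∙ leading-+ k _ _ ∙ cong₂ ℚ._+_ (cong (leading k) (sym (ΣL-* z₀ _ (sel es))) ∙ leading-Σ k _ (sel es) ∙ Sums.ΣL-cong ℚAlg (λ (e , r') → cong (leading k) (sym (*-assoc z₀ (v e) _) ∙ cong (z₀ * v e *_) (Π-u r'))) (sel es)) (cong (λ p → leading k (z₁ * p)) (Π-u es))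
    where
    u = λ e → proj₁ (limitPower (r ∷ rs) e)
    v = λ e → proj₂ (limitPower (r ∷ rs) e)
    S = ΣL (λ (e , r') → v e * Π# u r') (sel es)
    Π-u : ∀ es → Π# u es ≡ Π# (limitPower rs) es
    Π-u [] = refl
    Π-u (e ∷ es) = cong₂ _*_ (limitPower-first k r rs e) (Π-u es)

leading-long [] z (e ∷ es) p = cong (z ℚ.*_) (ℚₚ.*-zeroˡ (Sums.Π# ℚAlg _ es)) ∙ ℚₚ.*-zeroʳ z
leading-long {suc k} (r ∷ rs) z es p = leading-step k r rs z es ∙ cong₂ ℚ._+_
    (Sums.ΣL-congAll ℚAlg (λ (e , es') l → leading-long rs _ es' (≤-pred (subst (suc k ℕ.<_) (sym l) p))) (sel-length es) ∙ Sums.ΣL-0 ℚAlg (sel es))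
    (leading-long rs _ es (<-trans (n<1+n k) p)) ∙ ℚₚ.+-identityˡ 0ℚ

leading-Π [] z [] _ = refl
leading-Π {suc k} (r ∷ rs) z es l = leading-step k r rs z es ∙ cong₂ ℚ._+_
    (Sums.ΣL-congAll ℚAlg {h = λ (e , es') → c₀ ℚ.* (powerTotal e r ℚ.* RowPermanent.Per es' (Vec.toList rs))} term (sel-length es) ∙ Sums.ΣL-* ℚAlg c₀ _ (sel es))
    (leading-long rs _ es (≤-reflexive (sym l))) ∙ ℚₚ.+-identityʳ _
  where
  open Hom (constant k)
  c₀ = ⟦ proj₁ z ⟧
  term : ∀ (p : ℕ × List ℕ) → suc (length (proj₂ p)) ≡ length es →
    leading k (Alg._*_ (Λ₀ k) (Alg._*_ (Λ₀ k) (proj₁ z) (proj₂ (limitPower (r ∷ rs) (proj₁ p)))) (Sums.Π# (Λ₀ k) (limitPower rs) (proj₂ p))) ≡ c₀ ℚ.* (powerTotal (proj₁ p) r ℚ.* RowPermanent.Per (proj₂ p) (Vec.toList rs))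
  term (e , es') l' = leading-Π rs _ es' (suc-injective (l' ∙ l)) ∙ cong (ℚ._* RowPermanent.Per es' (Vec.toList rs)) (hom-* _ _ ∙ cong (c₀ ℚ.*_) (limitPower-slope k r rs e)) ∙
    ℚₚ.*-assoc c₀ (powerTotal e r) (RowPermanent.Per es' (Vec.toList rs))

-- Monomials of top degree and their vanishing on rows

isTop : ℕ → ℕ → Monomial ℕ → Bool
isTop N k m = (boxDegree m ≡ᵇ N) ∧ (length (fac m) ≡ᵇ k)

tops : ℕ → ℕ → List (Monomial ℕ) → List (Monomial ℕ)
tops N k = filterᵇ (isTop N k)

≡ᵇ-false : ∀ m n → (m ≡ᵇ n) ≡ false → m ≢ n
≡ᵇ-false m n e refl with sym (≡ᵇ-refl m) ∙ e
... | ()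

module _ where
  open Ring ℚAlg
  open Sums ℚAlg
  open Indicator ℚAlg
  open Rooted ℚAlg using (ΣL-filterᵇ)

  -- Each product of power sums is replaced by a permanent in arbitrary values φ. For `powerTotal`
  -- this is what the limit computes; for `power` it is, up to k!, the symmetric polynomial in the
  -- contents.
  topSum : ∀ {X : Set} → ℚ → (ℕ → X → ℚ) → List (Monomial ℕ) → List X → ℚ
  topSum g φ H xs = ΣL (λ m → coef m * ((g ^# gpow m) * Permanent.Per ℚAlg φ (fac m) xs)) H

  topSum-++ : ∀ {X : Set} g (φ : ℕ → X → ℚ) H H' xs → topSum g φ (H ++ H') xs ≡ topSum g φ H xs + topSum g φ H' xs
  topSum-++ g φ H H' xs = ΣL-++ (λ m → coef m * ((g ^# gpow m) * Permanent.Per ℚAlg φ (fac m) xs)) H H'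

  -- Below degree N the coefficient carries a positive power of 0, and more than k factors cannot
  -- reach the product of the variables. Fewer factors could, through terms of higher order, and are
  -- excluded by hypothesis; for k = 1 fewer means none, and a scalar has no w-part.
  leading-monomial : ∀ {k} (rs : Vec ℕ k) N m → boxDegree m ℕ.≤ N → (boxDegree m ≡ N → k ℕ.≤ length (fac m) ⊎ k ≡ 1) →
    leading k (Evaluation.evalM (Λ₀ k) (LimitWorld.g k) (limitPower rs) (scaleM 0ℚ N m)) ≡
    ind (isTop N k m) * (coef m * (((- 1#) ^# gpow m) * RowPermanent.Per (fac m) (Vec.toList rs)))
  leading-monomial {k} rs N m d ok = cases (boxDegree m ≡ᵇ N) (length (fac m) ≡ᵇ k) refl refl
    where
    module R = Ring (Λ₀ k)
    open Hom (constant k) using (⟦_⟧; hom-*; hom-ι)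
    g = LimitWorld.g k
    Π = Sums.Π# (Λ₀ k) (limitPower rs) (fac m)
    P = RowPermanent.Per (fac m) (Vec.toList rs)
    x = leading k (Evaluation.evalM (Λ₀ k) g (limitPower rs) (scaleM 0ℚ N m))
    G = R.ι (coef m) R.* (g R.^# gpow m)
    top-value : boxDegree m ≡ N → x ≡ leading k (G R.* Π)
    top-value e = cong (leading k) (cong (λ q → R.ι q R.* ((g R.^# gpow m) R.* Π)) (cong (λ z → coef m * (0ℚ ^# z)) (cong (N ∸_) e ∙ n∸n≡0 N) ∙ *-identityʳ (coef m)) ∙ sym (R.*-assoc _ _ _))
    low-value : boxDegree m ≢ N → x ≡ 0ℚ
    low-value ne = cong (leading k) (cong (λ q → R.ι q R.* ((g R.^# gpow m) R.* Π)) (zero-power (ℕₚ.m<n⇒0<n∸m (≤∧≢⇒< d ne))) ∙ cong (R._* ((g R.^# gpow m) R.* Π)) R.ι-0 ∙ R.zeroˡ _) ∙ leading-0 k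
      where
      zero-power : ∀ {j} → 0 ℕ.< j → coef m * (0ℚ ^# j) ≡ 0ℚ
      zero-power {suc j} _ = cong (coef m *_) (zeroˡ (0ℚ ^# j)) ∙ zeroʳ (coef m)
    short : ∀ {k} (rs : Vec ℕ k) q p es → length es ℕ.< k → k ≡ 1 →
      leading k (Alg._*_ (Λ₀ k) (Alg._*_ (Λ₀ k) (Alg.ι (Λ₀ k) q) (Alg._^#_ (Λ₀ k) (LimitWorld.g k) p)) (Sums.Π# (Λ₀ k) (limitPower rs) es)) ≡ 0ℚ
    short rs q p [] _ refl = cong (leading 1) (cong (λ z → S.ι q S.* z S.* S.1#) (sym (scalar p)) ∙ S.*-identityʳ _ ∙ sym (S.ι-* q ((- 1#) ^# p)))
      where
      module S = Alg (Λ₀ 1)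
      scalar : ∀ p → S.ι ((- 1#) ^# p) ≡ LimitWorld.g 1 S.^# p
      scalar zero = refl
      scalar (suc p) = S.ι-* (- 1#) ((- 1#) ^# p) ∙ cong (LimitWorld.g 1 S.*_) (scalar p)
    short rs q p (e ∷ es) (s≤s ()) refl
    cases : ∀ b b' → (boxDegree m ≡ᵇ N) ≡ b → (length (fac m) ≡ᵇ k) ≡ b' → x ≡ ind (b ∧ b') * (coef m * (((- 1#) ^# gpow m) * P))
    cases false b' e _ = low-value (≡ᵇ-false _ _ e) ∙ sym (zeroˡ (coef m * (((- 1#) ^# gpow m) * P)))
    cases true true e e' = top-value (≡ᵇ-sound {boxDegree m} {N} e) ∙ leading-Π rs G (fac m) (≡ᵇ-sound {length (fac m)} {k} e') ∙
      cong (_* P) (hom-* _ _ ∙ cong₂ _*_ (hom-ι (coef m)) (HomProperties.hom-^# (constant k) g (gpow m) ∙ cong (_^# gpow m) (hom-ι (- 1#)))) ∙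
        *-assoc (coef m) ((- 1#) ^# gpow m) P ∙ sym (*-identityˡ (coef m * (((- 1#) ^# gpow m) * P)))
    cases true false e e' = top-value (≡ᵇ-sound {boxDegree m} {N} e) ∙ unmatched ∙ sym (zeroˡ (coef m * (((- 1#) ^# gpow m) * P)))
      where
      len≢k = ≡ᵇ-false (length (fac m)) k e'
      unmatched : leading k (G R.* Π) ≡ 0ℚ
      unmatched with ok (≡ᵇ-sound {boxDegree m} {N} e)
      ... | inj₁ k≤ = leading-long rs G (fac m) (≤∧≢⇒< k≤ (λ q → len≢k (sym q)))
      ... | inj₂ k≡1 with ≤-total (length (fac m)) k
      ...   | inj₁ l≤ = short rs (coef m) (gpow m) (fac m) (≤∧≢⇒< l≤ len≢k) k≡1
      ...   | inj₂ k≤ = leading-long rs G (fac m) (≤∧≢⇒< k≤ (λ q → len≢k (sym q)))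

  limitModel : ∀ {k} → Vec ℕ k → ℕ → List (Monomial ℕ) → Alg.Carrier (Λ₀ k)
  limitModel {k} rs N U = codeModel 0ℚ k (- 1#) 0ℚ N (freeRows rs) U

  HighTops : ℕ → ℕ → List (Monomial ℕ) → Set
  HighTops N k U = All (λ m → boxDegree m ≡ N → k ℕ.≤ length (fac m) ⊎ k ≡ 1) U

  leading-limitModel : ∀ {k} (rs : Vec ℕ k) N U → All (λ m → boxDegree m ℕ.≤ N) U → HighTops N k U →
    leading k (limitModel rs N U) ≡ topSum (- 1#) powerTotal (tops N k U) (Vec.toList rs)
  leading-limitModel {k} rs N U deg high = cong (leading k) (Sums.ΣL-map (Λ₀ k) (Evaluation.evalM (Λ₀ k) (LimitWorld.g k) (limitPower rs)) (scaleM 0ℚ N) U) ∙ leading-Σ k _ U ∙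
    ΣL-congAll (λ m (d , h) → leading-monomial rs N m d h) (All.zip (deg , high)) ∙
      sym (ΣL-filterᵇ (isTop N k) (λ m → coef m * (((- 1#) ^# gpow m) * RowPermanent.Per (fac m) (Vec.toList rs))) U)

  limitModel-++ : ∀ {k} (rs : Vec ℕ k) N U V → leading k (limitModel rs N (U ++ V)) ≡ leading k (limitModel rs N U) + leading k (limitModel rs N V)
  limitModel-++ {k} rs N U V = cong (leading k) (cong (Evaluation.evalP (Λ₀ k) (LimitWorld.g k) (limitPower rs)) (Listₚ.map-++ (scaleM 0ℚ N) U V) ∙ Sums.ΣL-++ (Λ₀ k) _ (map (scaleM 0ℚ N) U) (map (scaleM 0ℚ N) V)) ∙ leading-+ k _ _

  -- a top sum with k factors, evaluated on rows r₁ ≥ … ≥ r_k ≥ 1 with fewer than n boxes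
  VanishesOnRows : ℕ → ℕ → (List ℕ → ℚ) → Set
  VanishesOnRows n k Φ = ∀ ys → length ys ≡ k → Linked ℕ._≥_ ys → All (1 ℕ.≤_) ys → ListSum ys ℕ.< n → Φ ys ≡ 0ℚ

  freeRows-Decreasing : ∀ {k} m (rs : Vec ℕ k) → Linked ℕ._≥_ (m ∷ Vec.toList rs) → Decreasing m (freeRows rs)
  freeRows-Decreasing m [] _ = []
  freeRows-Decreasing m (r ∷ rs) (p ∷ l) = p ∷ Decreasing-map bump (freeRows-Decreasing r rs l)

  freeRows-pos : ∀ {k} (rs : Vec ℕ k) → All (1 ℕ.≤_) (Vec.toList rs) → All (λ p → 1 ℕ.≤ proj₂ p) (freeRows rs)
  freeRows-pos [] [] = []
  freeRows-pos (r ∷ rs) (p ∷ ps) = p ∷ Allₚ.map⁺ (freeRows-pos rs ps)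

  freeRows-total : ∀ {k} (rs : Vec ℕ k) → rowTotal (freeRows rs) ≡ ListSum (Vec.toList rs)
  freeRows-total [] = refl
  freeRows-total (r ∷ rs) = cong (r ℕ.+_) (cong ListSum (sym (Listₚ.map-∘ (freeRows rs))) ∙ freeRows-total rs)

  bounded-head : ∀ {ys} → Linked ℕ._≥_ ys → ∃ λ m → Linked ℕ._≥_ (m ∷ ys)
  bounded-head [] = 0 , [-]
  bounded-head {y ∷ _} [-] = y , ≤-refl ∷ [-]
  bounded-head {y ∷ _} (p ∷ l) = y , ≤-refl ∷ p ∷ l

  topSum-rows : ∀ n k U → All (λ m → boxDegree m ℕ.≤ suc n) U → HighTops (suc n) k U →
    (∀ (rs : Vec ℕ k) → All (1 ℕ.≤_) (Vec.toList rs) → ListSum (Vec.toList rs) ℕ.< n → ∀ m → Linked ℕ._≥_ (m ∷ Vec.toList rs) → leading k (limitModel rs (suc n) U) ≡ 0ℚ) →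
    VanishesOnRows n k (topSum (- 1#) powerTotal (tops (suc n) k U))
  topSum-rows n .(length ys) U deg high h ys refl l ps lt = cong (topSum (- 1#) powerTotal (tops (suc n) (length ys) U)) (sym (Vecₚ.toList∘fromList ys)) ∙
    sym (leading-limitModel rs (suc n) U deg high) ∙ h rs (subst (All (1 ℕ.≤_)) (sym (Vecₚ.toList∘fromList ys)) ps) (subst (λ z → ListSum z ℕ.< n) (sym (Vecₚ.toList∘fromList ys)) lt)
      (proj₁ (bounded-head l)) (subst (λ z → Linked ℕ._≥_ (proj₁ (bounded-head l) ∷ z)) (sym (Vecₚ.toList∘fromList ys)) (proj₂ (bounded-head l)))
    where
    rs = Vec.fromList ys

  limitModel-vanishes : ∀ n k U → All (λ m → boxDegree m ℕ.≤ suc n) U → (∀ A nz λ' → size λ' ℕ.< n → value U A nz λ' ≡ 0ℚ) →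
    ∀ (rs : Vec ℕ k) → All (1 ℕ.≤_) (Vec.toList rs) → ListSum (Vec.toList rs) ℕ.< n → ∀ m → Linked ℕ._≥_ (m ∷ Vec.toList rs) → leading k (limitModel rs (suc n) U) ≡ 0ℚ
  limitModel-vanishes n k U deg h rs ps lt m l = cong (leading k) (codeModel-vanishes (suc n) U deg n h k (freeRows rs) (freeRows-Decreasing m rs l) (freeRows-pos rs ps) (subst (ℕ._< n) (sym (freeRows-total rs)) lt) 0ℚ) ∙ leading-0 k

  limitModel-maps : ∀ n k (rs : Vec ℕ k) → ListSum (Vec.toList rs) ℕ.< n → ∀ m → Linked ℕ._≥_ (m ∷ Vec.toList rs) → leading k (limitModel rs (suc n) (mapsMonomials n)) ≡ 0ℚ
  limitModel-maps n k rs lt m l = mapsModel-vanishes k m rs (freeRows-Decreasing m rs l) n (subst (ℕ._< n) (toList-sum rs) lt)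

  module DescendingSort = Data.List.Sort (Flip.decTotalOrder ℕₚ.≤-decTotalOrder)

  topSum-↭ : ∀ {X : Set} g (φ : ℕ → X → ℚ) H {xs ys} → xs ↭ ys → topSum g φ H xs ≡ topSum g φ H ys
  topSum-↭ g φ H p = ΣL-cong (λ m → cong (λ z → coef m * ((g ^# gpow m) * z)) (Permanent.Per-↭ ℚAlg φ (fac m) p)) H

  -- (true , r) is evaluated by the power total up to r, (false , r) by the power of r.
  mixedPower : ℕ → Bool × ℕ → ℚ
  mixedPower e (true , r) = powerTotal e r
  mixedPower e (false , r) = ratℕ r ^ e

  topSum-mixed : ∀ {Y : Set} g (ψ : ℕ → Y → ℚ) (f : Y → Bool × ℕ) → (∀ e y → mixedPower e (f y) ≡ ψ e y) → ∀ H ys → topSum g mixedPower H (map f ys) ≡ topSum g ψ H ys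
  topSum-mixed g ψ f h H ys = ΣL-cong (λ m → cong (λ z → coef m * ((g ^# gpow m) * z)) (same (fac m) ys)) H
    where
    same : ∀ es ys → Permanent.Per ℚAlg mixedPower es (map f ys) ≡ Permanent.Per ℚAlg ψ es ys
    same es [] = refl
    same es (y ∷ ys) = ΣL-cong (λ (e , r) → cong₂ _*_ (h e y) (same r ys)) (sel es)

  module _ (n k : ℕ) (H : List (Monomial ℕ)) (vanish : VanishesOnRows n k (topSum (- 1#) powerTotal H)) where

    private
      G : List (Bool × ℕ) → ℚ
      G = topSum (- 1#) mixedPower H

      -- Permanents are symmetric, so the lengths may be sorted into a diagram.
      G-rows : ∀ ys → length ys ≡ k → All (1 ℕ.≤_) ys → ListSum ys ℕ.< n → G (map (true ,_) ys) ≡ 0ℚ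
      G-rows ys l ps lt = topSum-mixed (- 1#) powerTotal (true ,_) (λ e y → refl) H ys ∙ topSum-↭ (- 1#) powerTotal H (↭.↭-sym p) ∙
        vanish (sort ys) (↭ₚ.↭-length p ∙ l) (sort-↗ ys) (↭ₚ.All-resp-↭ (↭.↭-sym p) ps) (subst (ℕ._< n) (sum-↭ (↭.↭-sym p)) lt)
        where
        open DescendingSort using (sort; sort-↭; sort-↗)
        p = sort-↭ ys

      G-split : ∀ i zs → G ((true , suc i) ∷ zs) ≡ G ((true , i) ∷ zs) + G ((false , suc i) ∷ zs)
      G-split i zs = ΣL-cong (λ m → cong (λ z → coef m * (((- 1#) ^# gpow m) * z)) (Permanent.Per-split ℚAlg mixedPower (fac m) {true , suc i} {true , i} {false , suc i} zs (λ e → refl)) ∙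
          solve 4 (λ c g x y → c :* (g :* (x :+ y)) := c :* (g :* x) :+ c :* (g :* y)) refl (coef m) ((- 1#) ^# gpow m) (Permanent.Per ℚAlg mixedPower (fac m) ((true , i) ∷ zs)) (Permanent.Per ℚAlg mixedPower (fac m) ((false , suc i) ∷ zs))) H ∙
        ΣL-+ (λ m → coef m * (((- 1#) ^# gpow m) * Permanent.Per ℚAlg mixedPower (fac m) ((true , i) ∷ zs))) (λ m → coef m * (((- 1#) ^# gpow m) * Permanent.Per ℚAlg mixedPower (fac m) ((false , suc i) ∷ zs))) H

      G-zero : ∀ zs → G ((true , 0) ∷ zs) ≡ 0ℚ
      G-zero zs = ΣL-cong (λ m → cong (λ z → coef m * (((- 1#) ^# gpow m) * z)) (ΣL-cong (λ (e , r) → zeroˡ (Permanent.Per ℚAlg mixedPower r zs)) (sel (fac m)) ∙ ΣL-0 (sel (fac m))) ∙ solve 2 (λ a b → a :* (b :* :0) := :0) refl (coef m) ((- 1#) ^# gpow m)) H ∙ ΣL-0 H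

      -- The power of i + 1 is the difference of the power totals up to i + 1 and up to i. Each
      -- power entry is thus exchanged for two row entries, neither of which raises the total
      -- length.
      G-mixed : ∀ xs ys → length xs ℕ.+ length ys ≡ k → All (1 ℕ.≤_) ys → ListSum (map suc xs) ℕ.+ ListSum ys ℕ.< n → G (map (λ i → false , suc i) xs ++ map (true ,_) ys) ≡ 0ℚ
      G-mixed [] ys l ps lt = G-rows ys l ps lt
      G-mixed (i ∷ xs) ys l ps lt = solve 2 (λ a c → c := (a :+ c) :+ :- a) refl a c ∙ cong₂ (λ p q → p + - q) (sym (G-split i zs) ∙ whole) (previous i lt) ∙ solve 0 (:0 :+ :- :0 := :0) refl
        where
        zs = map (λ i → false , suc i) xs ++ map (true ,_) ys
        a = G ((true , i) ∷ zs)
        c = G ((false , suc i) ∷ zs)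
        move : ∀ j → G ((true , j) ∷ zs) ≡ G (map (λ i → false , suc i) xs ++ map (true ,_) (j ∷ ys))
        move j = topSum-↭ (- 1#) mixedPower H (↭.↭-sym (↭ₚ.shift (true , j) (map (λ i → false , suc i) xs) (map (true ,_) ys)))
        len : length xs ℕ.+ suc (length ys) ≡ k
        len = ℕₚ.+-suc (length xs) (length ys) ∙ l
        total : ∀ a b c → a ℕ.+ (b ℕ.+ c) ≡ b ℕ.+ a ℕ.+ c
        total = solve-∀
        whole : G ((true , suc i) ∷ zs) ≡ 0ℚ
        whole = move (suc i) ∙ G-mixed xs (suc i ∷ ys) len (s≤s z≤n ∷ ps) (subst (ℕ._< n) (sym (total (ListSum (map suc xs)) (suc i) (ListSum ys))) lt)
        previous : ∀ i → suc i ℕ.+ ListSum (map suc xs) ℕ.+ ListSum ys ℕ.< n → G ((true , i) ∷ zs) ≡ 0ℚ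
        previous zero _ = G-zero zs
        previous (suc j) lt' = move (suc j) ∙ G-mixed xs (suc j ∷ ys) len (s≤s z≤n ∷ ps)
          (subst (ℕ._< n) (sym (total (ListSum (map suc xs)) (suc j) (ListSum ys))) (<-trans (n<1+n _) lt'))

    -- The length i + 1 may equal n here: only the preceding length i has to lie within the range of
    -- vanishing.
    topSum-single : k ≡ 1 → ∀ i → i ℕ.< n → topSum (- 1#) powerTotal H (suc i ∷ []) ≡ topSum (- 1#) power H (ratℕ (suc i) ∷ [])
    topSum-single k≡1 i lt = sym (topSum-mixed (- 1#) powerTotal (true ,_) (λ e y → refl) H (suc i ∷ [])) ∙ G-split i [] ∙ cong (_+ G ((false , suc i) ∷ [])) (previous i lt) ∙ +-identityˡ (G ((false , suc i) ∷ []))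
      where
      previous : ∀ i → i ℕ.< n → G ((true , i) ∷ []) ≡ 0ℚ
      previous zero _ = G-zero []
      previous (suc j) lt = G-rows (suc j ∷ []) (sym k≡1) (s≤s z≤n ∷ []) (subst (ℕ._< n) (sym (ℕₚ.+-identityʳ (suc j))) lt)

    topSum-points : ∀ (is : Vec ℕ k) → Degree.vsum is ℕ.+ k ℕ.< n → topSum (- 1#) power H (Vec.toList (Degree.points is)) ≡ 0ℚ
    topSum-points is lt = cong (topSum (- 1#) power H) (Vecₚ.toList-map (λ i → ratℕ (suc i)) is ∙ refl) ∙ sym (Per-power (Vec.toList is)) ∙
      cong G (sym (Listₚ.++-identityʳ (map (λ i → false , suc i) (Vec.toList is)))) ∙ G-mixed (Vec.toList is) [] (ℕₚ.+-identityʳ _ ∙ Vecₚ.length-toList is) [] (subst (ℕ._< n) (sym (ℕₚ.+-identityʳ _ ∙ total is)) lt)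
      where
      total : ∀ {k} (is : Vec ℕ k) → ListSum (map suc (Vec.toList is)) ≡ Degree.vsum is ℕ.+ k
      total [] = refl
      total {suc k} (i ∷ is) = cong (suc i ℕ.+_) (total is) ∙ lem i (Degree.vsum is) k
        where
        lem : ∀ a b c → suc a ℕ.+ (b ℕ.+ c) ≡ a ℕ.+ b ℕ.+ suc c
        lem = solve-∀
      Per-power : ∀ js → G (map (λ i → false , suc i) js) ≡ topSum (- 1#) power H (map (λ i → ratℕ (suc i)) js)
      Per-power js = topSum-mixed (- 1#) (λ e i → ratℕ (suc i) ^ e) (λ i → false , suc i) (λ e i → refl) H js ∙ ΣL-cong (λ m → cong (λ z → coef m * (((- 1#) ^# gpow m) * z)) (same (fac m) js)) H
        where
        same : ∀ es js → Permanent.Per ℚAlg (λ e i → ratℕ (suc i) ^ e) es js ≡ Permanent.Per ℚAlg power es (map (λ i → ratℕ (suc i)) js)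
        same es [] = refl
        same es (j ∷ js) = ΣL-cong (λ (e , r) → cong (ratℕ (suc j) ^ e *_) (same r js)) (sel es)

-- Removing the monomials of top degree

<∸⇒+< : ∀ a b c → a ℕ.< b ∸ c → a ℕ.+ c ℕ.< b
<∸⇒+< a b c lt = ℕₚ.≰⇒> λ b≤ → <⇒≱ lt (m≤n+o⇒m∸n≤o b c (subst (b ℕ.≤_) (ℕₚ.+-comm a c) b≤))

module _ where
  open Ring ℚAlg
  open Sums ℚAlg
  open Indicator ℚAlg
  open Rooted ℚAlg using (ΣL-filterᵇ)
  open Permanent ℚAlg power using (Per; Per-tuples; fact)
  open Degree
  open Powers ℚAlg

  deg-Σ : ∀ k d {X : Set} (f : X → Vec ℚ k → ℚ) {xs} → All (λ x → Deg k d (f x)) xs → Deg k d (λ v → ΣL (λ x → f x v) xs)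
  deg-Σ k d f [] = deg-0 k d
  deg-Σ k d f (h ∷ hs) = deg-+ k d h (deg-Σ k d f hs)

  deg-Per : ∀ k es → length es ≡ k → Deg k (suc (ListSum es)) (λ v → Per es (Vec.toList v))
  deg-Per zero es _ = scalar
  deg-Per (suc k) es l = deg-cong (suc k) (suc _) (λ { (y ∷ ys) → refl })
    (deg-Σ (suc k) (suc _) (λ (e , r) v → power e _ * Per r (Vec.toList (Vec.tail v))) (All.zipWith (λ {(e , r)} (q , s) → term e r q s) (sel-length es , sel-sum es)))
    where
    term : ∀ e r → suc (length r) ≡ length es → e ℕ.+ ListSum r ≡ ListSum es → Deg (suc k) (suc (ListSum es)) (λ v → power e (Vec.head v) * Per r (Vec.toList (Vec.tail v)))
    term e r q s = deg-cong (suc k) _ (λ v → cong (_* Per r (Vec.toList (Vec.tail v))) (^≡^# _ e))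
      (subst (λ d → Deg (suc k) d (λ v → (Vec.head v ^# e) * Per r (Vec.toList (Vec.tail v)))) (ℕₚ.+-suc e _ ∙ cong suc s)
        (deg-pow k _ e (deg-lift k _ (deg-Per k r (suc-injective (q ∙ l))))))

  IsTop : ℕ → ℕ → Monomial ℕ → Set
  IsTop N k m = boxDegree m ≡ N × length (fac m) ≡ k

  isTop-sound : ∀ N k m → isTop N k m ≡ true → IsTop N k m
  isTop-sound N k m h with boxDegree m ≡ᵇ N in e
  ... | true = ≡ᵇ-sound {boxDegree m} {N} e , ≡ᵇ-sound {length (fac m)} {k} h

  isTop-complete : ∀ N k m → IsTop N k m → isTop N k m ≡ true
  isTop-complete N k m (refl , refl) rewrite ≡ᵇ-refl (boxDegree m) = ≡ᵇ-refl (length (fac m))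

  tops-IsTop : ∀ N k U → All (IsTop N k) (tops N k U)
  tops-IsTop N k U = All.map (λ {m} → isTop-sound N k m) (filterᵇ-All _ U)

  top-degree : ∀ N k m → IsTop N k m → gpow m ℕ.+ ListSum (fac m) ℕ.+ 2 ℕ.* k ≡ N
  top-degree N k m (d , refl) = sym (boxDegree-length m) ∙ d

  deg-topSum : ∀ g N k {H} → All (IsTop N k) H → Deg k (suc N ∸ 2 ℕ.* k) (λ v → topSum g power H (Vec.toList v))
  deg-topSum g N k {H} h = deg-Σ k _ _ (All.map (λ {m} t → deg-scale k _ (coef m) (deg-scale k _ (g ^# gpow m)
    (deg-mono k (m+n≤o⇒m≤o∸n _ (s≤s (≤-trans (ℕₚ.+-monoˡ-≤ _ (m≤n+m _ (gpow m))) (≤-reflexive (top-degree N k m t))))) (deg-Per k (fac m) (proj₂ t))))) h)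

  Per-homogeneous : ∀ s es cs → length es ≡ length cs → Per es (map (s *_) cs) ≡ (s ^# ListSum es) * Per es cs
  Per-homogeneous s [] [] _ = sym (*-identityˡ 1#)
  Per-homogeneous s es (c ∷ cs) l = ΣL-congAll term (All.zip (sel-length es , sel-sum es)) ∙ ΣL-* (s ^# ListSum es) (λ (e , r) → power e c * Per r cs) (sel es)
    where
    term : ∀ (p : ℕ × List ℕ) → suc (length (proj₂ p)) ≡ length es × proj₁ p ℕ.+ ListSum (proj₂ p) ≡ ListSum es →
      power (proj₁ p) (s * c) * Per (proj₂ p) (map (s *_) cs) ≡ (s ^# ListSum es) * (power (proj₁ p) c * Per (proj₂ p) cs)
    term (e , r) (q , t) = cong₂ _*_ (^≡^# (s * c) e ∙ (*-^# s c e) ∙ cong ((s ^# e) *_) (sym (^≡^# c e))) (Per-homogeneous s r cs (suc-injective (q ∙ l))) ∙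
      solve 4 (λ a b c d → a :* b :* (c :* d) := a :* c :* (b :* d)) refl (s ^# e) (power e c) (s ^# ListSum r) (Per r cs) ∙
        cong (_* _) (sym (^#-+ s e _) ∙ cong (s ^#_) t)

  module _ (N k : ℕ) (H : List (Monomial ℕ)) (top : All (IsTop N k) H) where

    -- In a top monomial the exponents of γ and of the contents have the fixed sum N - 2k. By
    -- homogeneity the value γ = -1 of the limit decides all γ ≠ 0.
    topSum-rescaled : ∀ g s → - g * s ≡ 1# → ∀ cs → length cs ≡ k → topSum g power H cs ≡ ((- g) ^# (N ∸ 2 ℕ.* k)) * topSum (- 1#) power H (map (s *_) cs)
    topSum-rescaled g s gs cs l = ΣL-congAll term top ∙ ΣL-* ((- g) ^# (N ∸ 2 ℕ.* k)) (λ m → coef m * (((- 1#) ^# gpow m) * Per (fac m) (map (s *_) cs))) H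
      where
      term : ∀ m → IsTop N k m → coef m * ((g ^# gpow m) * Per (fac m) cs) ≡ ((- g) ^# (N ∸ 2 ℕ.* k)) * (coef m * (((- 1#) ^# gpow m) * Per (fac m) (map (s *_) cs)))
      term m t = sym (cong₂ (λ d z → ((- g) ^# d) * (coef m * (((- 1#) ^# p) * z))) (cong (_∸ 2 ℕ.* k) (sym (top-degree N k m t)) ∙ ℕₚ.m+n∸n≡m (p ℕ.+ e) (2 ℕ.* k)) (Per-homogeneous s (fac m) cs (proj₂ t ∙ sym l)) ∙ cong (_* (coef m * (((- 1#) ^# p) * ((s ^# e) * P)))) (^#-+ (- g) p e) ∙ solve 6 (λ a b c u v w → a :* b :* (c :* (u :* (v :* w))) := c :* ((a :* u) :* ((b :* v) :* w))) refl ((- g) ^# p) ((- g) ^# e) (coef m) ((- 1#) ^# p) (s ^# e) P ∙ cong₂ (λ a b → coef m * (a * (b * P))) (sym (*-^# (- g) (- 1#) p) ∙ cong (_^# p) (solve 1 (λ g → :- g :* :- :1 := g) refl g)) (inverse-^# (- g) s e gs) ∙ cong (λ z → coef m * ((g ^# p) * z)) (*-identityˡ P))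
        where
        p = gpow m
        e = ListSum (fac m)
        P = Per (fac m) cs

    -- For γ ≠ 0 the value is, up to k!, a sum of permanents over tuples of boxes, each zero after
    -- rescaling to γ = -1; the remaining A follow because the value is a Laurent polynomial.
    value-tops-zero : (∀ (v : Vec ℚ k) → topSum (- 1#) power H (Vec.toList v) ≡ 0ℚ) → ∀ A nz λ' → value H A nz λ' ≡ 0ℚ
    value-tops-zero zeros A nz λ' = laurent-zero (laurent-value H λ') generic A nz
      where
      generic : ∀ A nz → Defs.γ A nz ≢ 0ℚ → value H A nz λ' ≡ 0ℚ
      generic A nz γ≢0 = sym (*-identityˡ _) ∙ cong (_* value H A nz λ') (sym (1/fact-inverse k)) ∙ *-assoc (1/fact k) (fact k) (value H A nz λ') ∙ cong (1/fact k *_) (sym averaged ∙ ΣL-cong vanishes (tuples k _) ∙ ΣL-0 (tuples k _)) ∙ zeroʳ (1/fact k)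
        where
        g = Defs.γ A nz
        i = 1/_ g {{ℚ.≢-nonZero γ≢0}}
        contents : Vec (ℕ × ℕ) k → Vec ℚ k
        contents = Vec.map (content A nz)
        averaged : ΣL (λ bs → topSum g power H (Vec.toList (contents bs))) (tuples k (boxes λ')) ≡ fact k * value H A nz λ'
        averaged = ΣL-swap (λ bs m → coef m * _) (tuples k _) H ∙
          ΣL-congAll (λ m t → ΣL-* (coef m) (λ bs → (g ^# gpow m) * Per (fac m) (Vec.toList (contents bs))) (tuples k _) ∙
              cong (coef m *_) (ΣL-* (g ^# gpow m) (λ bs → Per (fac m) (Vec.toList (contents bs))) (tuples k _) ∙ cong ((g ^# gpow m) *_) (Per-tuples k (boxes λ') (content A nz) (fac m) (proj₂ t))) ∙
                solve 4 (λ c g f p → c :* (g :* (f :* p)) := f :* (c :* (g :* p))) refl (coef m) (g ^# gpow m) (fact k) (Π# (contentPower A nz λ') (fac m))) top ∙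
            ΣL-* (fact k) _ H
        vanishes : ∀ bs → topSum g power H (Vec.toList (contents bs)) ≡ 0ℚ
        vanishes bs = topSum-rescaled g (- i) (solve 2 (λ g i → :- g :* :- i := g :* i) refl g i ∙ ℚₚ.*-inverseʳ g {{ℚ.≢-nonZero γ≢0}}) (Vec.toList (contents bs)) (Vecₚ.length-toList (contents bs)) ∙
          cong (((- g) ^# (N ∸ 2 ℕ.* k)) *_) (cong (topSum (- 1#) power H) (sym (Vecₚ.toList-map (- i *_) (contents bs))) ∙ zeros (Vec.map (- i *_) (contents bs))) ∙ zeroʳ ((- g) ^# (N ∸ 2 ℕ.* k))

  -- The degree is at most n + 1 - 2k, so points with coordinate sum up to n + 1 - 2k must be
  -- tested, while vanishing is known up to n - 1 - k. For k ≥ 2 this is enough, and for k = 0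
  -- because n ≥ 1; for k = 1 the last point is missing.
  topSum-zero : ∀ n k {H} → k ≢ 1 → 1 ℕ.≤ n → All (IsTop (suc n) k) H → VanishesOnRows n k (topSum (- 1#) powerTotal H) → ∀ (v : Vec ℚ k) → topSum (- 1#) power H (Vec.toList v) ≡ 0ℚ
  topSum-zero n k {H} k≢1 n≥1 top vanish = deg-zero k _ _ (deg-topSum (- 1#) (suc n) k top)
    λ is lt → topSum-points n k H vanish is (small k k≢1 is (<∸⇒+< _ _ _ lt))
    where
    small : ∀ k → k ≢ 1 → (is : Vec ℕ k) → vsum is ℕ.+ 2 ℕ.* k ℕ.< suc (suc n) → vsum is ℕ.+ k ℕ.< n
    small zero _ [] _ = n≥1
    small (suc zero) k≢1 _ _ = ⊥-elim (k≢1 refl)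
    small (suc (suc j)) _ is lt = ≤-trans (s≤s (≤-trans (m≤m+n _ j) (≤-reflexive refl))) (≤-pred (≤-pred (≤-trans (≤-reflexive (lem _ j)) lt)))
      where
      lem : ∀ a j → suc (suc (suc (a ℕ.+ suc (suc j) ℕ.+ j))) ≡ suc (a ℕ.+ 2 ℕ.* suc (suc j))
      lem = solve-∀

  remove : ℕ → ℕ → List (Monomial ℕ) → List (Monomial ℕ)
  remove N k = filterᵇ (λ m → not (isTop N k m))

  value-remove : ∀ N k U A nz λ' → value (tops N k U) A nz λ' ≡ 0ℚ → value (remove N k U) A nz λ' ≡ value U A nz λ'
  value-remove N k U A nz λ' h = sym (ΣL-cong (λ m → split (isTop N k m) (e m)) U ∙ ΣL-+ _ _ U ∙ cong₂ _+_ (sym (ΣL-filterᵇ _ e U) ∙ h) (sym (ΣL-filterᵇ _ e U)) ∙ +-identityˡ _)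
    where
    e : Monomial ℕ → ℚ
    e = Evaluation.evalM ℚAlg _ _
    split : ∀ b x → x ≡ ind b * x + ind (not b) * x
    split true x = solve 1 (λ x → x := :1 :* x :+ :0 :* x) refl x
    split false x = solve 1 (λ x → x := :0 :* x :+ :1 :* x) refl x

  remove-All : ∀ {P : Monomial ℕ → Set} N k {U} → All P U → All P (remove N k U)
  remove-All N k [] = []
  remove-All N k {m ∷ U} (p ∷ ps) with isTop N k m
  ... | true = remove-All N k ps
  ... | false = p ∷ remove-All N k ps

  remove-length : ∀ N k U → All (λ m → boxDegree m ≡ N → length (fac m) ≢ k) (remove N k U)
  remove-length N k U = All.map (λ {m} h d l → contra m h (isTop-complete N k m (d , l))) (filterᵇ-All _ U)
    where
    contra : ∀ m → not (isTop N k m) ≡ true → isTop N k m ≡ true → ⊥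
    contra m h h' with sym h ∙ cong not h'
    ... | ()

  module Removal (n : ℕ) (n≥1 : 1 ℕ.≤ n) where

    N = suc n

    -- `Small` concerns U together with F_n. On small diagrams it is Ch_n that vanishes, the sum of
    -- F_n and the difference under study; F_n contributes nothing to the limit by
    -- `limitModel-maps`, so the top degree of U can still be isolated.
    Bounded≤ Small : List (Monomial ℕ) → Set
    Bounded≤ U = All (λ m → boxDegree m ℕ.≤ N) U
    Small U = ∀ A nz λ' → size λ' ℕ.< n → value (U ++ mapsMonomials n) A nz λ' ≡ 0ℚ

    tops-vanish : ∀ k U → Bounded≤ U → Small U → HighTops N k U → VanishesOnRows n k (topSum (- 1#) powerTotal (tops N k U))
    tops-vanish k U deg small high = topSum-rows n k U deg high λ rs ps lt m l → (solve 2 (λ a b → a := (a :+ b) :+ :- b) refl (leading k _) (leading k _) ∙ cong₂ (λ a b → a + - b) (sym (limitModel-++ rs N U _) ∙ limitModel-vanishes n k _ (Allₚ.++⁺ deg (mapsMonomials-degree n)) small rs ps lt m l) (limitModel-maps n k rs lt m l) ∙ solve 0 (:0 :+ :- :0 := :0) refl)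

    SameValue : List (Monomial ℕ) → List (Monomial ℕ) → Set
    SameValue U V = ∀ A nz λ' → value U A nz λ' ≡ value V A nz λ'

    small-resp : ∀ U V → SameValue U V → Small V → Small U
    small-resp U V e small A nz λ' lt = value-++ U (mapsMonomials n) A nz λ' ∙ cong (_+ value (mapsMonomials n) A nz λ') (e A nz λ') ∙ sym (value-++ V (mapsMonomials n) A nz λ') ∙ small A nz λ' lt

    remove-step : ∀ k U → k ≢ 1 → Bounded≤ U → Small U → HighTops N k U → SameValue (remove N k U) U
    remove-step k U k≢1 deg small high A nz λ' = value-remove N k U A nz λ'
      (value-tops-zero N k _ (tops-IsTop N k U) (topSum-zero n k k≢1 n≥1 (tops-IsTop N k U) (tops-vanish k U deg small high)) A nz λ')

    Long : ℕ → List (Monomial ℕ) → Set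
    Long k U = All (λ m → boxDegree m ≡ N → k ℕ.≤ length (fac m)) U

    remove-long : ∀ k U → Long k U → Long (suc k) (remove N k U)
    remove-long k U long = All.zipWith (λ (l , ne) d → ≤∧≢⇒< (l d) (λ e → ne d (sym e))) (remove-All N k long , remove-length N k U)

module _ where
  open Ring ℚAlg
  open Sums ℚAlg
  open Indicator ℚAlg
  open Rooted ℚAlg using (ΣL-filterᵇ)
  open Permanent ℚAlg power using (Per; fact)
  open Degree

  module RemoveAll (n : ℕ) (n≥1 : 1 ℕ.≤ n) where
    open Removal n n≥1 public

    -- In increasing number of factors: the coefficient of w₁⋯w_k isolates the top monomials with k
    -- factors once no shorter ones are left.
    remove-from : ∀ j k U → Bounded≤ U → Small U → Long (2 ℕ.+ k) U → Σ (List (Monomial ℕ)) λ V → SameValue V U × Bounded≤ V × Long (j ℕ.+ (2 ℕ.+ k)) V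
    remove-from zero k U deg small long = U , (λ _ _ _ → refl) , deg , long
    remove-from (suc j) k U deg small long =
      let same = remove-step (2 ℕ.+ k) U (λ ()) deg small (All.map (λ l d → inj₁ (l d)) long)
          V , same′ , deg′ , long′ = remove-from j (suc k) (remove N (2 ℕ.+ k) U) (remove-All N (2 ℕ.+ k) deg) (small-resp (remove N (2 ℕ.+ k) U) U same small) (remove-long (2 ℕ.+ k) U long)
      in V , (λ A nz λ' → same′ A nz λ' ∙ same A nz λ') , deg′ , subst (λ z → Long z V) (ℕₚ.+-suc j (2 ℕ.+ k)) long′

    lower-degree : ∀ U → Bounded≤ U → Small U → (∀ A nz λ' → value (tops N 1 U) A nz λ' ≡ 0ℚ) →
      Σ (List (Monomial ℕ)) λ V → SameValue V U × All (λ m → boxDegree m ℕ.≤ n) V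
    lower-degree U deg small single = V , (λ A nz λ' → same A nz λ' ∙ same₀ A nz λ' ∙ same₁ A nz λ') , All.zipWith (λ {m} (d , l) → ≤-pred (≤∧≢⇒< d (λ e → impossible m e (l e)))) (degV , longV)
      where
      U₁ = remove N 1 U
      same₁ : SameValue U₁ U
      same₁ A nz λ' = value-remove N 1 U A nz λ' (single A nz λ')
      small₁ = small-resp U₁ U same₁ small
      U₀ = remove N 0 U₁
      same₀ : SameValue U₀ U₁
      same₀ = remove-step 0 U₁ (λ ()) (remove-All N 1 deg) small₁ (All.universal (λ m _ → inj₁ z≤n) U₁)
      long : Long 2 U₀
      long = All.zipWith (λ (a , b) d → two (a d) (b d)) (remove-All N 0 (remove-length N 1 U) , remove-length N 0 U₁)
        where
        two : ∀ {l} → l ≢ 1 → l ≢ 0 → 2 ℕ.≤ l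
        two {zero} _ h = ⊥-elim (h refl)
        two {suc zero} h _ = ⊥-elim (h refl)
        two {suc (suc l)} _ _ = s≤s (s≤s z≤n)
      -- N rounds suffice: a remaining monomial of degree N would have at least N + 2 factors, each
      -- of degree at least 2.
      result = remove-from N 0 U₀ (remove-All N 0 (remove-All N 1 deg)) (small-resp U₀ U₁ same₀ small₁) long
      V = proj₁ result
      same = proj₁ (proj₂ result)
      degV = proj₁ (proj₂ (proj₂ result))
      longV = proj₂ (proj₂ (proj₂ result))
      impossible : ∀ m → boxDegree m ≡ N → N ℕ.+ 2 ℕ.≤ length (fac m) → ⊥
      impossible m e l = <⇒≱ (≤-trans (≤-reflexive (ℕₚ.+-comm 1 N)) (ℕₚ.+-monoʳ-≤ N (s≤s z≤n)))
        (≤-trans l (≤-trans (m≤m+n (length (fac m)) (length (fac m) ℕ.+ 0)) (≤-trans (m≤n+m (2 ℕ.* length (fac m)) (gpow m ℕ.+ ListSum (fac m))) (≤-reflexive (sym (boxDegree-length m) ∙ e)))))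

  -- The monomials with a single factor

  descending : ℕ → ℚ → ℚ
  descending zero x = 1#
  descending (suc j) x = descending j x * (x + - ratℕ (suc j))

  descending-zero : ∀ j i → i ℕ.< j → descending j (ratℕ (suc i)) ≡ 0ℚ
  descending-zero (suc j) i lt with i ℕ.≟ j
  ... | yes refl = cong (descending j (ratℕ (suc j)) *_) (ℚₚ.+-inverseʳ (ratℕ (suc j))) ∙ zeroʳ (descending j (ratℕ (suc j)))
  ... | no i≢j = cong (_* (ratℕ (suc i) + - ratℕ (suc j))) (descending-zero j i (≤∧≢⇒< (≤-pred lt) i≢j)) ∙ zeroˡ (ratℕ (suc i) + - ratℕ (suc j))

  descending-fact : ∀ j c → descending j (ratℕ (suc (j ℕ.+ c))) * fact c ≡ fact (j ℕ.+ c)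
  descending-fact zero c = *-identityˡ (fact c)
  descending-fact (suc j) c = cong₂ (λ a b → descending j (ratℕ a) * b * fact c) (cong suc (sym (ℕₚ.+-suc j c))) difference ∙ *-assoc (descending j (ratℕ (suc (j ℕ.+ suc c)))) (ratℕ (suc c)) (fact c) ∙ descending-fact j (suc c) ∙ cong fact (ℕₚ.+-suc j c)
    where
    difference : ratℕ (suc (suc j ℕ.+ c)) + - ratℕ (suc j) ≡ ratℕ (suc c)
    difference = cong (_+ - ratℕ (suc j)) (cong ratℕ (sym (ℕₚ.+-suc (suc j) c)) ∙ ratℕ-+ (suc j) (suc c)) ∙ solve 2 (λ a b → a :+ b :+ :- a := b) refl (ratℕ (suc j)) (ratℕ (suc c))

  -- monic of degree j up to lower terms
  LeadingTerm : ℚ → ℕ → (ℚ → ℚ) → Set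
  LeadingTerm q j f = Σ (Vec ℚ 1 → ℚ) λ r → Deg 1 j r × (∀ v → f (Vec.head v) ≡ q * (Vec.head v ^# j) + r v)

  descending-monic : ∀ j → LeadingTerm 1# j (descending j)
  descending-monic zero = (λ _ → 0ℚ) , deg-0 1 0 , λ v → solve 0 (:1 := :1 :* :1 :+ :0) refl
  descending-monic (suc j) with descending-monic j
  ... | r , d , e = (λ v → Vec.head v * r v + - ratℕ (suc j) * ((Vec.head v ^# j) + r v)) ,
    deg-+ 1 (suc j) (deg-var 0 j d) (deg-scale 1 (suc j) (- ratℕ (suc j)) (deg-+ 1 (suc j) monomial (deg-weaken 1 j d))) ,
    λ v → cong (_* (Vec.head v + - ratℕ (suc j))) (e v) ∙ solve 4 (λ x p r c → (:1 :* p :+ r) :* (x :+ :- c) := :1 :* (x :* p) :+ (x :* r :+ :- c :* (p :+ r))) refl (Vec.head v) (Vec.head v ^# j) (r v) (ratℕ (suc j))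
    where
    monomial : Deg 1 (suc j) (λ v → Vec.head v ^# j)
    monomial = deg-cong 1 (suc j) (λ v → sym (*-identityʳ (Vec.head v ^# j))) (subst (λ d → Deg 1 d (λ v → (Vec.head v ^# j) * 1#)) (ℕₚ.+-comm j 1) (deg-pow 0 1 j (deg-const 1 0 1#)))

  -- The comparison polynomial is j + 1 times (x-1)⋯(x-j). The difference has degree below j and
  -- vanishes at 1, ..., j, so f takes the value (j+1) · j! at j + 1.
  monic-value : ∀ j f → LeadingTerm (ratℕ (suc j)) j f → (∀ i → i ℕ.< j → f (ratℕ (suc i)) ≡ 0ℚ) → f (ratℕ (suc j)) ≡ fact (suc j)
  monic-value j f (r , d , e) z with descending-monic j
  ... | r' , d' , e' = solve 2 (λ a b → a := (a :+ :- b) :+ b) refl (f x) (q * descending j x) ∙ cong₂ _+_ (same (x ∷ []) ∙ h-zero (x ∷ [])) (cong (q *_) top) ∙ +-identityˡ (q * fact j)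
    where
    q = ratℕ (suc j)
    x = ratℕ (suc j)
    h : Vec ℚ 1 → ℚ
    h v = r v + - q * r' v
    same : ∀ v → f (Vec.head v) + - (q * descending j (Vec.head v)) ≡ h v
    same v = cong₂ (λ a b → a + - (q * b)) (e v) (e' v) ∙ solve 4 (λ q p r s → q :* p :+ r :+ :- (q :* (:1 :* p :+ s)) := r :+ :- q :* s) refl q (Vec.head v ^# j) (r v) (r' v)
    h-zero : ∀ v → h v ≡ 0ℚ
    h-zero = deg-zero 1 j h (deg-+ 1 j d (deg-scale 1 j (- q) d')) λ { (i ∷ []) lt → let i<j = subst (ℕ._< j) (ℕₚ.+-identityʳ i) lt in
      sym (same (ratℕ (suc i) ∷ [])) ∙ cong₂ (λ a b → a + - (q * b)) (z i i<j) (descending-zero j i i<j) ∙ solve 1 (λ q → :0 :+ :- (q :* :0) := :0) refl q }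
    top : descending j x ≡ fact j
    top = sym (*-identityʳ (descending j x)) ∙ cong (λ k → descending j (ratℕ (suc k)) * 1#) (sym (ℕₚ.+-identityʳ j)) ∙ descending-fact j 0 ∙ cong fact (ℕₚ.+-identityʳ j)

  hasExponent : ℕ → Monomial ℕ → Bool
  hasExponent j m = only (fac m)
    where
    only : List ℕ → Bool
    only (e ∷ []) = e ≡ᵇ j
    only _ = false

  leadingCoefficient : ℕ → List (Monomial ℕ) → ℚ
  leadingCoefficient j H = ΣL (λ m → ind (hasExponent j m) * coef m) H

  -- In a top monomial with one factor the exponents of γ and of c add up to j; those with a
  -- positive power of γ therefore fall into the remainder.
  topSum-leadingTerm : ∀ j {H} → All (IsTop (suc (suc j)) 1) H → LeadingTerm (leadingCoefficient j H) j (λ x → topSum (- 1#) power H (x ∷ []))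
  topSum-leadingTerm j [] = (λ _ → 0ℚ) , deg-0 1 j , λ v → solve 1 (λ p → :0 := :0 :* p :+ :0) refl (Vec.head v ^# j)
  topSum-leadingTerm j {m ∷ H} (t ∷ ts) with topSum-leadingTerm j ts | term m t
    where
    term : ∀ m → IsTop (suc (suc j)) 1 m → LeadingTerm (ind (hasExponent j m) * coef m) j (λ x → coef m * (((- 1#) ^# gpow m) * Per (fac m) (x ∷ [])))
    term (mono c g (e ∷ [])) (d , refl) = cases (e ≡ᵇ j) refl
      where
      g+e : g ℕ.+ e ≡ j
      g+e = suc-injective (suc-injective (lem g e ∙ d))
        where
        lem : ∀ g e → suc (suc (g ℕ.+ e)) ≡ g ℕ.+ (2 ℕ.+ e ℕ.+ 0)
        lem = solve-∀
      Q : ℚ → ℚ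
      Q x = c * (((- 1#) ^# g) * (x ^ e * 1# + 0#))
      cases : ∀ b → (e ≡ᵇ j) ≡ b → LeadingTerm (ind b * c) j Q
      cases true h = (λ _ → 0ℚ) , deg-0 1 j , λ v → cong₂ (λ a p → c * (((- 1#) ^# a) * (p * 1# + 0#))) g≡0 (cong (Vec.head v ^_) (≡ᵇ-sound {e} {j} h) ∙ ^≡^# (Vec.head v) j) ∙
          solve 2 (λ c p → c :* (:1 :* (p :* :1 :+ :0)) := :1 :* c :* p :+ :0) refl c (Vec.head v ^# j)
        where
        g≡0 : g ≡ 0
        g≡0 = ℕₚ.+-cancelʳ-≡ e g 0 (g+e ∙ sym (≡ᵇ-sound {e} {j} h))
      cases false h = (λ v → Q (Vec.head v)) , deg-cong 1 j (λ v → cong (λ p → c * (((- 1#) ^# g) * (p * 1# + 0#))) (^≡^# (Vec.head v) e) ∙ solve 3 (λ c s p → c :* (s :* (p :* :1 :+ :0)) := c :* s :* (p :* :1)) refl c ((- 1#) ^# g) (Vec.head v ^# e))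
          (deg-scale 1 j (c * ((- 1#) ^# g)) (deg-mono 1 (subst (ℕ._≤ j) (ℕₚ.+-comm 1 e) (≤∧≢⇒< (subst (e ℕ.≤_) g+e (m≤n+m e g)) (≡ᵇ-false e j h))) (deg-pow 0 1 e (deg-const 1 0 1#)))) ,
        λ v → solve 3 (λ c p q → q := :0 :* c :* p :+ q) refl c (Vec.head v ^# j) (Q (Vec.head v))
  ... | r , d , e | r' , d' , e' = (λ v → r' v + r v) , deg-+ 1 j d' d , λ v → cong₂ _+_ (e' v) (e v) ∙
    solve 5 (λ a b p x y → (a :* p :+ x) :+ (b :* p :+ y) := (a :+ b) :* p :+ (x :+ y)) refl (ind (hasExponent j m) * coef m) (leadingCoefficient j H) (Vec.head v ^# j) (r' v) (r v)

  negated : List (Monomial ℕ) → List (Monomial ℕ)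
  negated = map (λ m → mono (- coef m) (gpow m) (fac m))

  value-negated : ∀ U A nz λ' → value (negated U) A nz λ' ≡ - value U A nz λ'
  value-negated U A nz λ' = ΣL-map e (λ m → mono (- coef m) (gpow m) (fac m)) U ∙ ΣL-cong (λ m → solve 2 (λ c x → :- c :* x := :- :1 :* (c :* x)) refl (coef m) (((Defs.γ A nz) ^# gpow m) * Π# (contentPower A nz λ') (fac m))) U ∙
    ΣL-* (- 1#) e U ∙ solve 1 (λ v → :- :1 :* v := :- v) refl (value U A nz λ')
    where
    e : Monomial ℕ → ℚ
    e = Evaluation.evalM ℚAlg (Defs.γ A nz) (contentPower A nz λ')

  tops-++ : ∀ N k U V → tops N k (U ++ V) ≡ tops N k U ++ tops N k V
  tops-++ N k U V = Listₚ.filter-++ _ U V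

  topSum-negated : ∀ N k U xs → topSum (- 1#) power (tops N k (negated U)) xs ≡ - topSum (- 1#) power (tops N k U) xs
  topSum-negated N k U xs = ΣL-filterᵇ (isTop N k) e (negated U) ∙ ΣL-map (λ m → ind (isTop N k m) * e m) (λ m → mono (- coef m) (gpow m) (fac m)) U ∙
    ΣL-cong (λ m → solve 3 (λ i c x → i :* (:- c :* x) := :- :1 :* (i :* (c :* x))) refl (ind (isTop N k m)) (coef m) (((- 1#) ^# gpow m) * Per (fac m) xs)) U ∙
      ΣL-* (- 1#) (λ m → ind (isTop N k m) * e m) U ∙ cong (- 1# *_) (sym (ΣL-filterᵇ (isTop N k) e U)) ∙ solve 1 (λ v → :- :1 :* v := :- v) refl (topSum (- 1#) power (tops N k U) xs)
    where
    e : Monomial ℕ → ℚ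
    e m = coef m * (((- 1#) ^# gpow m) * Per (fac m) xs)

  single-tops : ∀ j U → All (λ m → boxDegree m ℕ.≤ suc (suc j)) U → HighTops (suc (suc j)) 1 U
  single-tops j U _ = All.universal (λ m _ → inj₂ refl) U

  -- The value at the last point comes from the explicit limit on one row, the zeros before it from
  -- the termination of Z.
  maps-single : ∀ j i → topSum (- 1#) power (tops (suc (suc j)) 1 (mapsMonomials (suc j))) (ratℕ (suc j) ∷ []) ≡ fact (suc j) × (i ℕ.< j → topSum (- 1#) power (tops (suc (suc j)) 1 (mapsMonomials (suc j))) (ratℕ (suc i) ∷ []) ≡ 0ℚ)
  maps-single j i = sym (topSum-single n 1 H vanish refl j ≤-refl) ∙ sym (leading-limitModel (n ∷ []) (suc n) U deg (single-tops j U deg)) ∙ SingleRow.singleRow-leading j ,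
    λ lt → topSum-points n 1 H vanish (i ∷ []) (≤-trans (≤-reflexive (lem i)) (s≤s lt))
    where
    n = suc j
    U = mapsMonomials n
    H = tops (suc n) 1 U
    deg = mapsMonomials-degree n
    vanish = topSum-rows n 1 U deg (single-tops j U deg) (λ rs ps lt m l → limitModel-maps n 1 rs lt m l)
    lem : ∀ i → suc (i ℕ.+ 0 ℕ.+ 1) ≡ suc (suc i)
    lem = solve-∀

-- Comparison of Ch_n with F_n

module JackCharacter (j : ℕ) (Ch : LFun) (p : (k : ℕ) → Poly k) (adm : Admissible (suc (suc j)) p)
  (Ch-p : ∀ A nz λ' → Ch A nz λ' ≡ polyFunValue (suc (suc j)) p A nz λ')
  (normalised : ∀ g → coeffC1 (p 1) j g ≡ fromℕ (suc j))
  (vanish : ∀ A nz λ' → size λ' ℕ.< suc j → Ch A nz λ' ≡ 0ℚ) where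

  open Ring ℚAlg
  open Sums ℚAlg
  open Indicator ℚAlg
  open Rooted ℚAlg using (ΣL-filterᵇ)
  open Permanent ℚAlg power using (Per; fact)
  open Powers ℚAlg using (one-^#)
  open Degree
  private
    n = suc j
    N = suc n
    UF = mapsMonomials n
    UC = collected N p
  open RemoveAll n (s≤s z≤n) hiding (N)

  UC-degree : Bounded≤ UC
  UC-degree = collected-degree N p adm

  Ch-value : ∀ A nz λ' → Ch A nz λ' ≡ value UC A nz λ'
  Ch-value A nz λ' = Ch-p A nz λ' ∙ value-collected N p A nz λ'

  private
    inner : ℕ → ℚ
    inner k = ΣL (λ m → ind (isTop N 1 m) * (ind (hasExponent j m) * coef m)) (map unordered (p k))

    inner-1 : inner 1 ≡ ratℕ n
    -- The degree bound on p₁ leaves no room for γ beside the power j of c₁, so the prescribed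
    -- coefficient may be read off at γ = 1.
    inner-1 = ΣL-map (λ m → ind (isTop N 1 m) * (ind (hasExponent j m) * coef m)) unordered (p 1) ∙ ΣL-congAll term (proj₁ (adm 1 (s≤s z≤n))) ∙ sym (ΣL-filterᵇ (λ m → lookup (cexp m) Fin.zero ≡ᵇ j) (λ m → coeff m * (1ℚ ^ gexp m)) (p 1)) ∙ normalised 1ℚ ∙ sym (ratℕ-def n)
      where
      term : ∀ (m : Mono 1) → degMono m ℕ.≤ N ∸ 2 →
        ind (isTop N 1 (unordered m)) * (ind (hasExponent j (unordered m)) * coeff m) ≡ ind (lookup (cexp m) Fin.zero ≡ᵇ j) * (coeff m * (1ℚ ^ gexp m))
      term record { coeff = c ; gexp = g ; cexp = e ∷ [] } d = cases (e ≡ᵇ j) refl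
        where
        m = mono c g (e ∷ [])
        cases : ∀ b → (e ≡ᵇ j) ≡ b → ind (isTop N 1 m) * (ind b * c) ≡ ind b * (c * (1ℚ ^ g))
        cases false _ = solve 3 (λ t c g → t :* (:0 :* c) := :0 :* (c :* g)) refl (ind (isTop N 1 m)) c (1ℚ ^ g)
        cases true h = cong (λ b → ind b * (1# * c)) (isTop-complete N 1 m (full , refl)) ∙ solve 1 (λ c → :1 :* (:1 :* c) := :1 :* (c :* :1)) refl c ∙ cong (λ z → 1# * (c * z)) (sym (^≡^# 1ℚ g ∙ one-^# g))
          where
          e≡j = ≡ᵇ-sound {e} {j} h
          g≡0 : g ≡ 0
          g≡0 = ℕₚ.n≤0⇒n≡0 (ℕₚ.+-cancelʳ-≤ j g 0 (subst (λ z → g ℕ.+ z ℕ.≤ j) (ℕₚ.+-identityʳ e ∙ e≡j) d))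
          full : boxDegree m ≡ N
          full = cong₂ (λ a b → a ℕ.+ (2 ℕ.+ b ℕ.+ 0)) g≡0 e≡j ∙ ℕₚ.+-identityʳ N

    inner-other : ∀ k → inner k ≡ ind (k ≡ᵇ 1) * inner 1
    inner-other (suc zero) = sym (*-identityˡ (inner 1))
    inner-other zero = ΣL-map (λ m → ind (isTop N 1 m) * (ind (hasExponent j m) * coef m)) unordered (p 0) ∙ ΣL-cong (λ { record { coeff = c ; gexp = g ; cexp = [] } → solve 2 (λ t c → t :* (:0 :* c) := :0) refl (ind (isTop N 1 (mono c g []))) c }) (p 0) ∙ ΣL-0 (p 0) ∙ sym (zeroˡ (inner 1))
    inner-other (suc (suc k)) = ΣL-map (λ m → ind (isTop N 1 m) * (ind (hasExponent j m) * coef m)) unordered (p (suc (suc k))) ∙ ΣL-cong (λ { record { coeff = c ; gexp = g ; cexp = e ∷ e' ∷ v } →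
      solve 2 (λ t c → t :* (:0 :* c) := :0) refl (ind (isTop N 1 (mono c g (e ∷ e' ∷ Vec.toList v)))) c }) (p (suc (suc k))) ∙ ΣL-0 (p (suc (suc k))) ∙ sym (zeroˡ (inner 1))

  UC-leadingCoefficient : leadingCoefficient j (tops N 1 UC) ≡ ratℕ n
  UC-leadingCoefficient = ΣL-filterᵇ (isTop N 1) (λ m → ind (hasExponent j m) * coef m) UC ∙ ΣL-concatMap (λ m → ind (isTop N 1 m) * (ind (hasExponent j m) * coef m)) (λ k → map unordered (p k)) (upTo (suc ⌊ N /2⌋)) ∙ ΣL-cong inner-other (upTo (suc ⌊ N /2⌋)) ∙ ΣL-*ʳ (inner 1) (λ k → ind (k ≡ᵇ 1)) (upTo (suc ⌊ N /2⌋)) ∙ cong (_* inner 1) (TupleSums.pickℕ ℚAlg 1 (upTo (suc ⌊ N /2⌋)) (Uniqueₚ.upTo⁺ (suc ⌊ N /2⌋)) (∈ₚ.∈-upTo⁺ (s≤s (s≤s z≤n)))) ∙ *-identityˡ (inner 1) ∙ inner-1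

  private
    fC fF : Vec ℚ 1 → ℚ
    fC v = topSum (- 1#) power (tops N 1 UC) (Vec.toList v)
    fF v = topSum (- 1#) power (tops N 1 UF) (Vec.toList v)

    fC-low : ∀ i → i ℕ.< j → fC (ratℕ (suc i) ∷ []) ≡ 0ℚ
    fC-low i lt = topSum-points n 1 (tops N 1 UC)
      (topSum-rows n 1 UC UC-degree (single-tops j UC UC-degree) (limitModel-vanishes n 1 UC UC-degree (λ A nz λ' s → sym (Ch-value A nz λ') ∙ vanish A nz λ' s)))
      (i ∷ []) (≤-trans (≤-reflexive (lem i)) (s≤s lt))
      where
      lem : ∀ i → suc (i ℕ.+ 0 ℕ.+ 1) ≡ suc (suc i)
      lem = solve-∀

    -- n · (n-1)!, from the prescribed leading coefficient n and the zeros 1, ..., n - 1.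
    fC-top : fC (ratℕ n ∷ []) ≡ fact n
    fC-top = monic-value j (λ x → topSum (- 1#) power (tops N 1 UC) (x ∷ []))
      (subst (λ q → LeadingTerm q j (λ x → topSum (- 1#) power (tops N 1 UC) (x ∷ []))) UC-leadingCoefficient (topSum-leadingTerm j (tops-IsTop N 1 UC))) fC-low

  D : List (Monomial ℕ)
  D = UC ++ negated UF

  D-degree : Bounded≤ D
  D-degree = Allₚ.++⁺ UC-degree (Allₚ.map⁺ (mapsMonomials-degree n))

  D-value : ∀ A nz λ' → value D A nz λ' ≡ value UC A nz λ' + - value UF A nz λ'
  D-value A nz λ' = value-++ UC (negated UF) A nz λ' ∙ cong (value UC A nz λ' +_) (value-negated UF A nz λ')

  D-small : Small D
  D-small A nz λ' lt = value-++ D UF A nz λ' ∙ cong (_+ value UF A nz λ') (D-value A nz λ') ∙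
    solve 2 (λ a b → a :+ :- b :+ b := a) refl (value UC A nz λ') (value UF A nz λ') ∙ sym (Ch-value A nz λ') ∙ vanish A nz λ' lt

  -- The polynomial has degree below n and the n zeros 1, ..., n: at the last of them both Ch_n and
  -- F_n contribute n!, the one by its normalisation, the other by the computation on a single row.
  D-single : ∀ A nz λ' → value (tops N 1 D) A nz λ' ≡ 0ℚ
  D-single = value-tops-zero N 1 (tops N 1 D) (tops-IsTop N 1 D) (deg-zero 1 n (λ v → topSum (- 1#) power (tops N 1 D) (Vec.toList v))
      (deg-topSum (- 1#) N 1 (tops-IsTop N 1 D)) λ { (i ∷ []) lt → difference (ratℕ (suc i) ∷ []) ∙ at-point i (subst (ℕ._< n) (ℕₚ.+-identityʳ i) lt) })
    where
    difference : ∀ v → topSum (- 1#) power (tops N 1 D) (Vec.toList v) ≡ fC v + - fF v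
    difference v = cong (λ H → topSum (- 1#) power H (Vec.toList v)) (tops-++ N 1 UC (negated UF)) ∙
      topSum-++ (- 1#) power (tops N 1 UC) (tops N 1 (negated UF)) (Vec.toList v) ∙ cong (fC v +_) (topSum-negated N 1 UF (Vec.toList v))
    at-point : ∀ i → i ℕ.< n → fC (ratℕ (suc i) ∷ []) + - fF (ratℕ (suc i) ∷ []) ≡ 0ℚ
    at-point i lt with i ℕ.≟ j
    ... | yes refl = cong₂ (λ a b → a + - b) fC-top (proj₁ (maps-single j i)) ∙ ℚₚ.+-inverseʳ (fact n)
    ... | no i≢j = let i<j = ≤∧≢⇒< (≤-pred lt) i≢j in
      cong₂ (λ a b → a + - b) (fC-low i i<j) (proj₂ (maps-single j i) i<j) ∙ solve 0 (:0 :+ :- :0 := :0) refl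

  difference-IsPolyFun : IsPolyFun n (λ A nz λ' → Ch A nz λ' - Fn n A nz λ')
  difference-IsPolyFun =
    let V , same , degV = lower-degree D D-degree D-small D-single
        q , admq , val = isPolyFun-value n V degV
    in q , admq , λ A nz λ' → cong₂ (λ a b → a + - b) (Ch-value A nz λ') (Fn-value j A nz λ') ∙ sym (D-value A nz λ') ∙ sym (same A nz λ') ∙ val A nz λ'

theorem4p1 : (n : ℕ) → 1 ≤ n → (Ch : LFun) → IsJackChar n Ch →
  IsPolyFun n (λ A nz λ' → Ch A nz λ' - Fn n A nz λ')
theorem4p1 (suc j) _ Ch (p , adm , Ch-p , normalised , vanish) = JackCharacter.difference-IsPolyFun j Ch p adm Ch-p normalised vanish
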